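{- There is an absolute constant $c > 0$ with the following property. If $n$ and $N$ are positive integers with $N$ prime and $n \leq cN$, then $M_3(n,N) = M_3(n) = \lceil n^2/2\rceil$. Furthermore, the only subsets of $\mathbb{Z}/N\mathbb{Z}$ with cardinality $n$ and $T_3(A) = M_3(n,N)$ are affine images (images under maps $x \mapsto ax+b$ with $a \in (\mathbb{Z}/N\mathbb{Z})^*$, $b \in \mathbb{Z}/N\mathbb{Z}$) of the sets $E(k,m)$, $F(k,m)$ ($k,m \in \mathbb{N}\cup\{0\}$), considered as subsets of $\mathbb{Z}/N\mathbb{Z}$ via reduction mod $N$.
   Context: For a set $A$ in an abelian group $G$, $T_3(A)$ denotes the number of pairs $(x,d) \in G \times G$ with $x, x+d, x+2d \in A$. $M_3(n)$ is the maximum of $T_3(A)$ over sets $A \subseteq \mathbb{Z}$ with $|A| = n$, and $M_3(n,N)$ is the maximum of $T_3(A)$ over sets $A \subseteq \mathbb{Z}/N\mathbb{Z}$ with $|A| = n$. For $k,m \in \mathbb{N}\cup\{0\}$, $E(k,m)$ is the set of integers consisting of all integers in $[-k,k]$ together with $\pm(k+2j)$ for $1 \le j \le m$; and $F(k,m)$ is the set consisting of all integers in $[-k,k]$ together with $k+2j$ for $1 \le j \le m$ and $-(k+2j)$ for $1 \le j \le m-1$. Thus $|E(k,m)| = 2k+2m+1$ and $|F(k,m)| = 2k+2m$. -}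

module Defs where

open import Data.Nat as ℕ using (ℕ; NonZero; suc; _≤_)
import Data.Nat.DivMod as ℕD
open import Data.Integer as ℤ using (ℤ; +_; -_; _%ℕ_)
open import Data.Integer.Properties using () renaming (_≟_ to _≟ℤ_)
open import Data.Fin using (Fin; toℕ)
open import Data.Fin.Subset using (Subset; _∈_)
open import Data.Fin.Subset.Properties using (_∈?_)
open import Data.List using (List; length; filter; allFin; cartesianProduct; concatMap; map)
open import Data.List.Membership.DecPropositional _≟ℤ_ using () renaming (_∈?_ to _∈ℤ?_)
open import Data.Product using (Σ; _×_; _,_)
open import Data.Sum using (_⊎_)
open import Relation.Nullary.Decidable using (_×-dec_)
open import Relation.Binary.PropositionalEquality using (_≡_)
open import Function.Bundles using (_⇔_)

red : (N : ℕ) .{{_ : NonZero N}} → ℤ → Fin N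
red N z = ℕD._mod_ (z %ℕ N) N

toℤ : {N : ℕ} → Fin N → ℤ
toℤ x = + toℕ x

T3N : (N : ℕ) .{{_ : NonZero N}} → Subset N → ℕ
T3N N A = length (filter P? (cartesianProduct (allFin N) (allFin N)))
  where
  P? : (p : Fin N × Fin N) → _
  P? (x , d) =
    (x ∈? A) ×-dec
    ((red N (toℤ x ℤ.+ toℤ d) ∈? A) ×-dec
     (red N (toℤ x ℤ.+ (+ 2) ℤ.* toℤ d) ∈? A))

-- T₃ in Z, for a finite set A ⊆ Z given as a duplicate-free list.
-- Any pair (x , d) with x ∈ A and x + d ∈ A has the form (x , y - x) with
-- x , y ∈ A, and distinct (x , y) give distinct (x , d); so we enumerate
-- exactly these candidate pairs and keep those with x, x+d, x+2d ∈ A.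

T3Z : List ℤ → ℕ
T3Z A = length (filter P? (concatMap (λ x → map (λ y → (x , y ℤ.- x)) A) A))
  where
  P? : (p : ℤ × ℤ) → _
  P? (x , d) =
    (x ∈ℤ? A) ×-dec
    (((x ℤ.+ d) ∈ℤ? A) ×-dec
     ((x ℤ.+ (+ 2) ℤ.* d) ∈ℤ? A))

InInterval : ℕ → ℤ → Set
InInterval k x = (- (+ k) ℤ.≤ x) × (x ℤ.≤ + k)

InE : ℕ → ℕ → ℤ → Set
InE k m x =
  InInterval k x ⊎
  Σ ℕ (λ j → (1 ≤ j) × (j ≤ m) × ((x ≡ + (k ℕ.+ 2 ℕ.* j)) ⊎ (x ≡ - (+ (k ℕ.+ 2 ℕ.* j)))))

InF : ℕ → ℕ → ℤ → Set
InF k m x =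
  InInterval k x ⊎
  (Σ ℕ (λ j → (1 ≤ j) × (j ≤ m) × (x ≡ + (k ℕ.+ 2 ℕ.* j))) ⊎
   Σ ℕ (λ j → (1 ≤ j) × (j ℕ.+ 1 ≤ m) × (x ≡ - (+ (k ℕ.+ 2 ℕ.* j)))))

IsUnit : (N : ℕ) .{{_ : NonZero N}} → Fin N → Set
IsUnit N a = Σ (Fin N) (λ a' → red N (toℤ a ℤ.* toℤ a') ≡ red N (+ 1))

IsAffineImage : (N : ℕ) .{{_ : NonZero N}} → Subset N → (ℤ → Set) → Set
IsAffineImage N A S =
  Σ (Fin N) λ a → IsUnit N a × Σ (Fin N) λ b →
    (∀ y → (y ∈ A) ⇔ Σ ℤ (λ x → S x × (y ≡ red N (toℤ a ℤ.* x ℤ.+ toℤ b))))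

AffineImageOfEF : (N : ℕ) .{{_ : NonZero N}} → Subset N → Set
AffineImageOfEF N A =
  Σ ℕ λ k → Σ ℕ λ m → IsAffineImage N A (InE k m) ⊎ IsAffineImage N A (InF k m)

M3ZIs : ℕ → ℕ → Set
M3ZIs n v =
  (Σ (List ℤ) λ A → Unique A × length A ≡ n × T3Z A ≡ v) ×
  (∀ (A : List ℤ) → Unique A → length A ≡ n → T3Z A ≤ v)
  where open import Data.List.Relation.Unary.Unique.Propositional using (Unique)

M3NIs : (N : ℕ) .{{_ : NonZero N}} → ℕ → ℕ → Set
M3NIs N n v =
  (Σ (Subset N) λ A → Data.Fin.Subset.∣ A ∣ ≡ n × T3N N A ≡ v) ×
  (∀ (A : Subset N) → Data.Fin.Subset.∣ A ∣ ≡ n → T3N N A ≤ v)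
  where import Data.Fin.Subset

{-# OPTIONS --safe #-}
module Submission where

-- Work in G = Z/p and write T(A) for the number of pairs (x , y) in A with 2y - x ∈ A. By strong induction on |A| the
-- bound 2T ≤ |A|² + 1 holds for all smaller sets, so when 2T(A) ≥ |A|² every partition A = A₁ ∪ A₂ is crossed by about
-- |A₁||A₂| progressions. The Balog–Szemerédi–Gowers argument yields a dense Y ⊆ A with small difference set, and the
-- popular differences S of Y have bounded iterated sumsets; by Ruzsa covering these grow polynomially, so some set B of
-- density at most a small constant is almost invariant under S. A second-moment count over all dilations ξ and arcs
-- replaces Fourier analysis: for some ξ ≠ 0 the profile of ξB is almost invariant under ξS and under small shifts, which
-- forces a bounded multiple of ξ to send most of S into a short arc. Hence a dilate of A has a positive proportion in a
-- short arc, and since the core of A cannot be cut off from the rest, repeated dilations (Dirichlet) move all of A into a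
-- short arc. There A behaves like a set of integers: a midpoint y with L elements below and R above has at most
-- 1 + 2 min(L , R) progressions, which sums to ⌈n²/2⌉, and equality at the two middle elements already forces the sets
-- E(k , m) and F(k , m).

open import Defs
open import Data.Nat using (ℕ; NonZero; _≤_; _*_; _+_; _/_)
open import Data.Nat.Primality using (Prime)
open import Data.Fin.Subset using (Subset; ∣_∣)
open import Data.Product using (Σ; _×_)
open import Relation.Binary.PropositionalEquality using (_≡_)
open import Algebra.Bundles using (CommutativeRing; CommutativeSemiring)
import Algebra.Solver.Ring
import Algebra.Solver.Ring.AlmostCommutativeRing as ACR
open import Data.Bool using (Bool; true; false; _∧_; _∨_; not; if_then_else_)
open import Data.Nat using (zero; suc; _∸_; _^_; _<_; z≤n; s≤s; _≤?_; _%_; _!; _⊓_; >-nonZero)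
import Data.Nat.DivMod as DM
open import Data.Nat.Tactic.RingSolver using (solve-∀)
import Data.Nat.Coprimality as Cop
import Data.Nat.GCD as GCD
open import Data.Nat.Divisibility using (divides; ∣-trans; m∣m*n; m≤n⇒m!∣n!)
import Data.Integer as ℤ
open ℤ using (ℤ) renaming (+_ to pos; ∣_∣ to ⌊_⌋)
import Data.Integer.Properties as ℤP
import Data.Integer.DivMod as ℤD
import Data.Integer.Tactic.RingSolver as ℤR
open import Data.Fin using (Fin; toℕ; fromℕ<; zero; suc)
open import Data.Fin.Properties using (toℕ-injective; toℕ-fromℕ<; toℕ<n; pigeonhole; all?; any?) renaming (_≟_ to _≟F_)
open import Data.List using (List; []; _∷_; length; map; _++_; allFin; downFrom; filter; concatMap; cartesianProduct)
open import Data.List.Properties using (map-tabulate; length-tabulate; length-++; length-map; length-downFrom)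
open import Data.List.Membership.Propositional using (_∈_)
open import Data.List.Membership.Propositional.Properties using (∈-allFin; ∈-++⁻; ∈-++⁺ˡ; ∈-++⁺ʳ; ∈-map⁺; ∈-map⁻; ∈-downFrom⁺; ∈-downFrom⁻; ∈-filter⁺; ∈-filter⁻)
open import Data.List.Relation.Unary.Any using (here; there)
open import Data.List.Relation.Unary.All using (All; []; _∷_)
import Data.List.Relation.Unary.All as All
open import Data.List.Relation.Unary.AllPairs using ([]; _∷_)
open import Data.List.Relation.Unary.Unique.Propositional using (Unique)
open import Data.List.Relation.Unary.Unique.Propositional.Properties using (allFin⁺) renaming (map⁺ to map⁺!; filter⁺ to filter⁺!)
open import Data.Bool.Properties using () renaming (_≟_ to _≟B_)
import Data.Fin.Subset as FS
open import Data.Fin.Subset.Properties using () renaming (_∈?_ to _∈S?_)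
import Data.Vec as Vec
open import Data.Vec.Properties using (lookup∘tabulate; []=⇒lookup; lookup⇒[]=)
open import Data.Nat.Induction using (<-rec)
open import Function.Bundles using (mk⇔)
open import Data.Maybe using (Maybe; just; nothing)
open import Data.Product using (∃; _,_; proj₁; proj₂)
open import Data.Sum using (_⊎_; inj₁; inj₂)
open import Data.Empty using (⊥; ⊥-elim)
open import Relation.Nullary using (¬_; Dec; yes; no; does)
open import Relation.Nullary.Decidable using (toWitness; dec-true; dec-false)
open import Relation.Binary.Definitions using (DecidableEquality; Tri; tri<; tri≈; tri>)
open import Data.List.Membership.DecPropositional ℤP._≟_ using () renaming (_∈?_ to _∈ℤ?_)
open import Relation.Binary.PropositionalEquality hiding (setoid; J; _≡_)
open import Function using (_∘_; id)

-- Finite sums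

-- The additive part yields only a positive proportion of A, while the count must be exact. The
-- passage is possible because the density condition is inherited by subsets: p stays fixed in the
-- induction, and the bound with error 1 applies to every piece of A. An obstacle without
-- counterpart over the integers is that 2 is invertible: a point near p/2 can be the midpoint of
-- two points near 0. Such points are counted separately and dealt with by a dilation by 2. A
-- frequency ξ alone cannot place ξs near 0, since the profile may also have a period close to ap/k;
-- the bounded multiple K! removes these denominators. The final arc has radius p/16 because a
-- relation 2y = x + z modulo p between integers of this size holds over the integers. All
-- inequalities are cleared of denominators: to lie within p/q of 0 reads q‖x‖ ≤ p.

module Summation {c} (R : CommutativeSemiring c c) where
  open CommutativeSemiring R
    using (Carrier; _≈_; 0#; 1#; setoid; +-cong; *-cong; +-congˡ; +-congʳ; zeroˡ; zeroʳ; distribˡ; distribʳ; *-identityˡ; +-identityˡ; +-identityʳ)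
    renaming (_+_ to _⊹_; _*_ to _⋆_; refl to ≈-refl; sym to ≈-sym; trans to ≈-trans; +-assoc to ⊹-assoc; +-comm to ⊹-comm; *-comm to ⋆-comm)
  open import Relation.Binary.Reasoning.Setoid setoid

  module _ {a} {X : Set a} where

    ∑ : List X → (X → Carrier) → Carrier
    ∑ []       f = 0#
    ∑ (x ∷ xs) f = f x ⊹ ∑ xs f

    ∑-cong : ∀ xs {f g : X → Carrier} → (∀ x → f x ≈ g x) → ∑ xs f ≈ ∑ xs g
    ∑-cong []       e = ≈-refl
    ∑-cong (x ∷ xs) e = +-cong (e x) (∑-cong xs e)

    ∑-zero : ∀ xs → ∑ xs (λ _ → 0#) ≈ 0#
    ∑-zero []       = ≈-refl
    ∑-zero (x ∷ xs) = ≈-trans (+-identityˡ _) (∑-zero xs)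

    interchange : ∀ u v w z → (u ⊹ v) ⊹ (w ⊹ z) ≈ (u ⊹ w) ⊹ (v ⊹ z)
    interchange u v w z = begin
      (u ⊹ v) ⊹ (w ⊹ z) ≈⟨ ⊹-assoc u v _ ⟩
      u ⊹ (v ⊹ (w ⊹ z)) ≈⟨ +-congˡ (≈-sym (⊹-assoc v w z)) ⟩
      u ⊹ ((v ⊹ w) ⊹ z) ≈⟨ +-congˡ (+-congʳ (⊹-comm v w)) ⟩
      u ⊹ ((w ⊹ v) ⊹ z) ≈⟨ +-congˡ (⊹-assoc w v z) ⟩
      u ⊹ (w ⊹ (v ⊹ z)) ≈⟨ ≈-sym (⊹-assoc u w _) ⟩
      (u ⊹ w) ⊹ (v ⊹ z) ∎

    ∑-+ : ∀ xs (f g : X → Carrier) → ∑ xs (λ x → f x ⊹ g x) ≈ ∑ xs f ⊹ ∑ xs g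
    ∑-+ []       f g = ≈-sym (+-identityˡ 0#)
    ∑-+ (x ∷ xs) f g = ≈-trans (+-congˡ (∑-+ xs f g)) (interchange _ _ _ _)

    ∑-*ˡ : ∀ xs k (f : X → Carrier) → ∑ xs (λ x → k ⋆ f x) ≈ k ⋆ ∑ xs f
    ∑-*ˡ []       k f = ≈-sym (zeroʳ k)
    ∑-*ˡ (x ∷ xs) k f = ≈-trans (+-congˡ (∑-*ˡ xs k f)) (≈-sym (distribˡ k _ _))

    ∑-*ʳ : ∀ xs k (f : X → Carrier) → ∑ xs (λ x → f x ⋆ k) ≈ ∑ xs f ⋆ k
    ∑-*ʳ xs k f = ≈-trans (∑-cong xs (λ x → ⋆-comm (f x) k)) (≈-trans (∑-*ˡ xs k f) (⋆-comm k _))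

  ∑-swap : ∀ {a b} {X : Set a} {Y : Set b} xs ys (f : X → Y → Carrier) →
           ∑ xs (λ x → ∑ ys (f x)) ≈ ∑ ys (λ y → ∑ xs (λ x → f x y))
  ∑-swap []       ys f = ≈-sym (∑-zero ys)
  ∑-swap (x ∷ xs) ys f = ≈-trans (+-congˡ (∑-swap xs ys f)) (≈-sym (∑-+ ys _ _))

  ⟦_⟧ : Bool → Carrier
  ⟦ true ⟧  = 1#
  ⟦ false ⟧ = 0#

  module Delta {a} {X : Set a} (_≟_ : DecidableEquality X) where

    ∑-miss : ∀ a xs (f : X → Carrier) → All (λ y → ¬ a ≡ y) xs → ∑ xs (λ y → ⟦ does (a ≟ y) ⟧ ⋆ f y) ≈ 0#
    ∑-miss a []       f []       = ≈-refl
    ∑-miss a (x ∷ xs) f (n ∷ ns) with a ≟ x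
    ... | yes e = ⊥-elim (n e)
    ... | no _  = ≈-trans (+-cong (zeroˡ _) (∑-miss a xs f ns)) (+-identityˡ 0#)

    ∑-δ : ∀ {xs} → Unique xs → ∀ {a} → a ∈ xs → (f : X → Carrier) → ∑ xs (λ y → ⟦ does (a ≟ y) ⟧ ⋆ f y) ≈ f a
    ∑-δ {x ∷ xs} (u ∷ us) {a} m f with a ≟ x
    ... | yes refl = ≈-trans (+-cong (*-identityˡ _) (∑-miss a xs f u)) (+-identityʳ _)
    ∑-δ {x ∷ xs} (u ∷ us) {a} (here e) f | no ne = ⊥-elim (ne e)
    ∑-δ {x ∷ xs} (u ∷ us) {a} (there m) f | no ne = ≈-trans (+-cong (zeroˡ _) (∑-δ us m f)) (+-identityˡ _)

    does-cong : ∀ {p q} {P : Set p} {Q : Set q} (d : Dec P) (e : Dec Q) → (P → Q) → (Q → P) → does d ≡ does e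
    does-cong (yes x) (yes y) f g = refl
    does-cong (yes x) (no y)  f g = ⊥-elim (y (f x))
    does-cong (no x)  (yes y) f g = ⊥-elim (x (g y))
    does-cong (no x)  (no y)  f g = refl

    -- Both sides are double sums over a Kronecker delta: `φ x ≡ y` and `ψ y ≡ x` are the same
    -- condition, so an exchange of summations takes the place of a permutation of the list.
    ∑-bij : ∀ {xs} → Unique xs → (∀ x → x ∈ xs) → (φ ψ : X → X) → (∀ x → φ (ψ x) ≡ x) → (∀ x → ψ (φ x) ≡ x) →
            (f : X → Carrier) → ∑ xs (λ x → f (φ x)) ≈ ∑ xs f
    ∑-bij {xs} u m φ ψ φψ ψφ f = begin
      ∑ xs (λ x → f (φ x))  ≈⟨ ∑-cong xs (λ x → ≈-sym (∑-δ u (m (φ x)) f)) ⟩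
      ∑ xs (λ x → ∑ xs (λ y → ⟦ does (φ x ≟ y) ⟧ ⋆ f y))  ≈⟨ ∑-swap xs xs _ ⟩
      ∑ xs (λ y → ∑ xs (λ x → ⟦ does (φ x ≟ y) ⟧ ⋆ f y))  ≈⟨ ∑-cong xs (λ y → ∑-cong xs (λ x → δ-flip x y)) ⟩
      ∑ xs (λ y → ∑ xs (λ x → ⟦ does (ψ y ≟ x) ⟧ ⋆ f y))  ≈⟨ ∑-cong xs (λ y → ∑-δ u (m (ψ y)) (λ _ → f y)) ⟩
      ∑ xs f  ∎
      where
      δ-flip : ∀ x y → ⟦ does (φ x ≟ y) ⟧ ⋆ f y ≈ ⟦ does (ψ y ≟ x) ⟧ ⋆ f y
      δ-flip x y rewrite does-cong (φ x ≟ y) (ψ y ≟ x) (λ { refl → ψφ x }) (λ { refl → φψ y }) = ≈-refl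

open import Data.Nat.Properties

module Σℕ = Summation +-*-commutativeSemiring
module Σℤ = Summation ℤP.+-*-commutativeSemiring

open Σℕ public using (∑; ⟦_⟧)

module _ {a} {X : Set a} (xs : List X) where

  ∑-cong : {f g : X → ℕ} → (∀ x → f x ≡ g x) → ∑ xs f ≡ ∑ xs g
  ∑-cong = Σℕ.∑-cong xs

  ∑-zero : ∑ xs (λ _ → 0) ≡ 0
  ∑-zero = Σℕ.∑-zero xs

  ∑-+ : (f g : X → ℕ) → ∑ xs (λ x → f x + g x) ≡ ∑ xs f + ∑ xs g
  ∑-+ = Σℕ.∑-+ xs

  ∑-*ˡ : ∀ k (f : X → ℕ) → ∑ xs (λ x → k * f x) ≡ k * ∑ xs f
  ∑-*ˡ = Σℕ.∑-*ˡ xs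

  ∑-*ʳ : ∀ k (f : X → ℕ) → ∑ xs (λ x → f x * k) ≡ ∑ xs f * k
  ∑-*ʳ = Σℕ.∑-*ʳ xs

  ∑-swap : ∀ {b} {Y : Set b} (ys : List Y) (f : X → Y → ℕ) → ∑ xs (λ x → ∑ ys (f x)) ≡ ∑ ys (λ y → ∑ xs (λ x → f x y))
  ∑-swap = Σℕ.∑-swap xs

module _ {a} {X : Set a} where

  ∑-mono : ∀ xs {f g : X → ℕ} → (∀ x → f x ≤ g x) → ∑ xs f ≤ ∑ xs g
  ∑-mono []       h = z≤n
  ∑-mono (x ∷ xs) h = +-mono-≤ (h x) (∑-mono xs h)

  ∑-mono-∈ : ∀ xs {f g : X → ℕ} → (∀ x → x ∈ xs → f x ≤ g x) → ∑ xs f ≤ ∑ xs g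
  ∑-mono-∈ []       h = z≤n
  ∑-mono-∈ (x ∷ xs) h = +-mono-≤ (h x (here refl)) (∑-mono-∈ xs (λ y m → h y (there m)))

  ∑-cong-∈ : ∀ xs {f g : X → ℕ} → (∀ x → x ∈ xs → f x ≡ g x) → ∑ xs f ≡ ∑ xs g
  ∑-cong-∈ []       h = refl
  ∑-cong-∈ (x ∷ xs) h = cong₂ _+_ (h x (here refl)) (∑-cong-∈ xs (λ y m → h y (there m)))

  ∑-const : ∀ xs k → ∑ {X = X} xs (λ _ → k) ≡ length xs * k
  ∑-const []       k = refl
  ∑-const (x ∷ xs) k = cong (k +_) (∑-const xs k)

  ∑-term : ∀ {xs x} → x ∈ xs → (f : X → ℕ) → f x ≤ ∑ xs f
  ∑-term (here refl) f = m≤m+n _ _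
  ∑-term (there {x = y} m) f = ≤-trans (∑-term m f) (m≤n+m _ (f y))

  -- The source of the equality statements for integer sets: that every rank occurs, that every
  -- midpoint of an extremal set has its maximal count, and that every reflection on the shorter
  -- side stays in the set.
  ∑-mono-eq : ∀ xs {f g : X → ℕ} → (∀ x → x ∈ xs → f x ≤ g x) → ∑ xs g ≤ ∑ xs f → ∀ {x} → x ∈ xs → f x ≡ g x
  ∑-mono-eq (y ∷ xs) {f} {g} h le (here refl) = ≤-antisym (h y (here refl))
    (+-cancelʳ-≤ (∑ xs f) (g y) (f y) (≤-trans (+-monoʳ-≤ (g y) (∑-mono-∈ xs (λ x m → h x (there m)))) le))
  ∑-mono-eq (y ∷ xs) {f} {g} h le (there m) = ∑-mono-eq xs (λ x m → h x (there m))
    (+-cancelˡ-≤ (f y) _ _ (≤-trans (+-monoˡ-≤ _ (h y (here refl))) le)) m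

  ∑-≤-pick : ∀ xs (S : X → Bool) {f g : X → ℕ} → 1 ≤ ∑ xs (λ x → ⟦ S x ⟧) →
             ∑ xs (λ x → ⟦ S x ⟧ * f x) ≤ ∑ xs (λ x → ⟦ S x ⟧ * g x) →
             ∃ λ x → S x ≡ true × f x ≤ g x
  ∑-≤-pick xs S {f} {g} ne le = go xs ne le
    where
    go : ∀ xs → 1 ≤ ∑ xs (λ x → ⟦ S x ⟧) → ∑ xs (λ x → ⟦ S x ⟧ * f x) ≤ ∑ xs (λ x → ⟦ S x ⟧ * g x) → ∃ λ x → S x ≡ true × f x ≤ g x
    -- Once an element of `S` with g x < f x has been discarded, the remaining inequality is strict,
    -- and strictness alone guarantees that the search succeeds before the list ends.
    none : ∀ xs → ∑ xs (λ x → ⟦ S x ⟧ * f x) < ∑ xs (λ x → ⟦ S x ⟧ * g x) → ∃ λ x → S x ≡ true × f x ≤ g x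
    none (x ∷ xs) lt with S x in e
    ... | false = none xs lt
    ... | true with f x ≤? g x
    ...   | yes q = x , e , q
    ...   | no q = none xs (+-cancelˡ-< (1 * g x) _ _ (≤-<-trans (+-monoˡ-≤ _ (*-monoʳ-≤ 1 (<⇒≤ (≰⇒> q)))) lt))
    go (x ∷ xs) ne le with S x in e
    ... | false = go xs ne le
    ... | true with f x ≤? g x
    ...   | yes q = x , e , q
    ...   | no q = none xs (+-cancelˡ-< (1 * g x) _ _ (<-≤-trans (+-monoˡ-< _ (*-monoʳ-< 1 (≰⇒> q))) le))

  ∑-<-pick : ∀ xs {f g : X → ℕ} → ∑ xs f < ∑ xs g → ∃ λ x → x ∈ xs × f x < g x
  ∑-<-pick (x ∷ xs) {f} {g} lt with f x <? g x
  ... | yes q = x , here refl , q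
  ... | no q with ∑-<-pick xs (+-cancelˡ-< (f x) _ _ (<-≤-trans lt (+-monoˡ-≤ _ (≮⇒≥ q))))
  ...   | y , m , r = y , there m , r

⟦∧⟧ : ∀ a b → ⟦ a ∧ b ⟧ ≡ ⟦ a ⟧ * ⟦ b ⟧
⟦∧⟧ true true = refl
⟦∧⟧ true false = refl
⟦∧⟧ false b = refl

⟦⟧*≤ : ∀ a k → ⟦ a ⟧ * k ≤ k
⟦⟧*≤ true k = ≤-reflexive (*-identityˡ k)
⟦⟧*≤ false k = z≤n

*⟦⟧≤ : ∀ k a → k * ⟦ a ⟧ ≤ k
*⟦⟧≤ k a = ≤-trans (≤-reflexive (*-comm k ⟦ a ⟧)) (⟦⟧*≤ a k)

⟦⟧-mono : ∀ {a b} → (a ≡ true → b ≡ true) → ⟦ a ⟧ ≤ ⟦ b ⟧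
⟦⟧-mono {true} h rewrite h refl = ≤-refl
⟦⟧-mono {false} h = z≤n

⟦⟧-guard : ∀ a {k l} → (a ≡ true → k ≤ l) → ⟦ a ⟧ * k ≤ ⟦ a ⟧ * l
⟦⟧-guard true h = *-monoʳ-≤ 1 (h refl)
⟦⟧-guard false h = z≤n

⟦⟧-guard₀ : ∀ a {k l} → (a ≡ true → k ≤ l) → ⟦ a ⟧ * k ≤ l
⟦⟧-guard₀ a h = ≤-trans (⟦⟧-guard a h) (⟦⟧*≤ a _)

∧-true : ∀ {a b} → a ∧ b ≡ true → a ≡ true × b ≡ true
∧-true {true} {true} _ = refl , refl

∧-intro : ∀ {a b} → a ≡ true → b ≡ true → a ∧ b ≡ true
∧-intro refl refl = refl

does⇒ : ∀ {p} {P : Set p} (d : Dec P) → does d ≡ true → P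
does⇒ (yes x) _ = x

⇒does : ∀ {p} {P : Set p} (d : Dec P) → P → does d ≡ true
⇒does d x = dec-true d x

does⇏ : ∀ {p} {P : Set p} (d : Dec P) → does d ≡ false → ¬ P
does⇏ (no x) _ = x

true≢false : ∀ {b} {ℓ} {W : Set ℓ} → b ≡ true → b ≡ false → W
true≢false refl ()

opaque
  -- A Boolean test, so that sets cut out by inequalities are Boolean functions and can be counted;
  -- opaque, so that tests against numerals stay symbolic.
  _≤ᵈ_ : ℕ → ℕ → Bool
  m ≤ᵈ n = does (m ≤? n)

  ≤ᵈ-elim : ∀ {m n} → m ≤ᵈ n ≡ true → m ≤ n
  ≤ᵈ-elim {m} {n} = does⇒ (m ≤? n)

  ≤ᵈ-intro : ∀ {m n} → m ≤ n → m ≤ᵈ n ≡ true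
  ≤ᵈ-intro {m} {n} = ⇒does (m ≤? n)

  ≤ᵈ-false : ∀ {m n} → m ≤ᵈ n ≡ false → n < m
  ≤ᵈ-false {m} {n} e = ≰⇒> (does⇏ (m ≤? n) e)

not-true : ∀ {b} → not b ≡ true → b ≡ false
not-true {false} _ = refl

2ab≤a²+b² : ∀ a b → 2 * (a * b) ≤ a * a + b * b
2ab≤a²+b² a b with ≤-total a b
... | inj₁ h = go a b h
  where
  expand : ∀ a k → 2 * (a * (a + k)) + k * k ≡ a * a + (a + k) * (a + k)
  expand = solve-∀
  go : ∀ a b → a ≤ b → 2 * (a * b) ≤ a * a + b * b
  go a b h = subst (λ b → 2 * (a * b) ≤ a * a + b * b) (m+[n∸m]≡n h) (m+n≤o⇒m≤o _ (≤-reflexive (expand a (b ∸ a))))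
... | inj₂ h = subst₂ _≤_ (cong (2 *_) (*-comm b a)) (+-comm (b * b) (a * a)) (go b a h)
  where
  expand : ∀ a k → 2 * (a * (a + k)) + k * k ≡ a * a + (a + k) * (a + k)
  expand = solve-∀
  go : ∀ a b → a ≤ b → 2 * (a * b) ≤ a * a + b * b
  go a b h = subst (λ b → 2 * (a * b) ≤ a * a + b * b) (m+[n∸m]≡n h) (m+n≤o⇒m≤o _ (≤-reflexive (expand a (b ∸ a))))

cancel-sq : ∀ {y z} → y * y ≤ y * z → y ≤ z
cancel-sq {zero} h = z≤n
cancel-sq {suc y} {z} h = *-cancelˡ-≤ (suc y) h

-- Numerical estimates

module ExponentialGrowth where

  n<2^n : ∀ n → n < 2 ^ n
  n<2^n zero = s≤s z≤n
  n<2^n (suc n) = begin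
    2 + n  ≡⟨ +-comm 2 n ⟩
    n + 2  ≡⟨ sym (+-assoc n 1 1) ⟩
    n + 1 + 1  ≤⟨ +-mono-≤ (≤-trans (≤-reflexive (+-comm n 1)) (n<2^n n)) (≤-trans (s≤s z≤n) (n<2^n n)) ⟩
    2 ^ n + 2 ^ n  ≡⟨ cong (2 ^ n +_) (sym (+-identityʳ _)) ⟩
    2 ^ suc n  ∎
    where open ≤-Reasoning

  -- Bernoulli's inequality for (1 + 1/e)^k, cleared of denominators.
  bernoulli : ∀ e k → (e + k) * e ^ k ≤ e * (e + 1) ^ k
  bernoulli e zero = ≤-reflexive (cong (_* 1) (+-identityʳ e))
  bernoulli e (suc k) = begin
    (e + suc k) * (e * e ^ k)  ≤⟨ m≤m+n _ (k * e ^ k) ⟩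
    (e + suc k) * (e * e ^ k) + k * e ^ k  ≡⟨ lem e k (e ^ k) ⟩
    (e + 1) * ((e + k) * e ^ k)  ≤⟨ *-monoʳ-≤ (e + 1) (bernoulli e k) ⟩
    (e + 1) * (e * (e + 1) ^ k)  ≡⟨ lem' e ((e + 1) ^ k) ⟩
    e * ((e + 1) * (e + 1) ^ k)  ∎
    where
    open ≤-Reasoning
    lem : ∀ e k q → (e + suc k) * (e * q) + k * q ≡ (e + 1) * ((e + k) * q)
    lem e k q = trans (cong (λ z → z * (e * q) + k * q) (+-suc e k)) (lem₀ e k q)
      where
      lem₀ : ∀ e k q → (1 + (e + k)) * (e * q) + k * q ≡ (e + 1) * ((e + k) * q)
      lem₀ = solve-∀
    lem' : ∀ e q → (e + 1) * (e * q) ≡ e * ((e + 1) * q)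
    lem' = solve-∀

  doubling : ∀ e → 1 ≤ e → 2 * e ^ e ≤ (e + 1) ^ e
  doubling e h = *-cancelˡ-≤ e {{>-nonZero h}} (≤-trans (≤-reflexive (lem e (e ^ e))) (bernoulli e e))
    where
    lem : ∀ e q → e * (2 * q) ≡ (e + e) * q
    lem = solve-∀

  -- With i = 2t the right side is a square, and t < 2^t suffices for t = cd + 2d.
  squares : ∀ c d → ∃ λ i → (c + i) * d < 2 ^ i
  squares c d = t + t , (begin-strict
    (c + (t + t)) * d  ≡⟨ lem₁ c t d ⟩
    c * d + t * (2 * d)  ≤⟨ +-monoˡ-≤ _ cd≤ ⟩
    t * (c * d) + t * (2 * d) ≡⟨ sym (*-distribˡ-+ t _ _) ⟩
    t * t  <⟨ *-mono-< (n<2^n t) (n<2^n t) ⟩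
    2 ^ t * 2 ^ t  ≡⟨ sym (^-distribˡ-+-* 2 t t) ⟩
    2 ^ (t + t)  ∎)
    where
    open ≤-Reasoning
    t = c * d + 2 * d
    lem₁ : ∀ c t d → (c + (t + t)) * d ≡ c * d + t * (2 * d)
    lem₁ = solve-∀
    dup : ∀ m u → m ≤ u → m ≤ u * m
    dup zero u h = z≤n
    dup (suc m) (suc u) h = m≤m+n _ _
    cd≤ : c * d ≤ t * (c * d)
    cd≤ = dup (c * d) t (m≤m+n _ _)

  -- Take k = ej with j = 2^i. By `doubling`, (1 + 1/e)^k is at least 2^j, while k + 1 ≤ 2^(e+i)
  -- keeps the polynomial factor below 2^((e+i)d); `squares` chooses i with (e+i)d < j.
  exponential-beats-polynomial : ∀ e d → 1 ≤ e → ∃ λ k → e ^ k * (k + 1) ^ d < (e + 1) ^ k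
  exponential-beats-polynomial e d h with squares e d
  ... | i , lt = e * j , (begin-strict
    e ^ (e * j) * (e * j + 1) ^ d  ≤⟨ *-monoʳ-≤ (e ^ (e * j)) (^-monoˡ-≤ d base) ⟩
    e ^ (e * j) * (2 ^ (e + i)) ^ d  ≡⟨ cong (e ^ (e * j) *_) (^-*-assoc 2 (e + i) d) ⟩
    e ^ (e * j) * 2 ^ ((e + i) * d)  <⟨ *-monoʳ-< (e ^ (e * j)) {{m^n≢0 e (e * j) {{>-nonZero h}}}} (^-monoʳ-< 2 (s≤s (s≤s z≤n)) lt) ⟩
    e ^ (e * j) * 2 ^ j  ≡⟨ cong (_* 2 ^ j) (sym (^-*-assoc e e j)) ⟩
    (e ^ e) ^ j * 2 ^ j  ≡⟨ *-comm ((e ^ e) ^ j) (2 ^ j) ⟩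
    2 ^ j * (e ^ e) ^ j  ≡⟨ sym (distr 2 (e ^ e) j) ⟩
    (2 * e ^ e) ^ j  ≤⟨ ^-monoˡ-≤ j (doubling e h) ⟩
    ((e + 1) ^ e) ^ j  ≡⟨ ^-*-assoc (e + 1) e j ⟩
    (e + 1) ^ (e * j)  ∎)
    where
    open ≤-Reasoning
    j = 2 ^ i
    distr : ∀ a b j → (a * b) ^ j ≡ a ^ j * b ^ j
    distr a b zero = refl
    distr a b (suc j) = trans (cong (a * b *_) (distr a b j)) (lem a b (a ^ j) (b ^ j))
      where
      lem : ∀ a b c d → a * b * (c * d) ≡ a * c * (b * d)
      lem = solve-∀
    base : e * j + 1 ≤ 2 ^ (e + i)
    base = begin
      e * j + 1  ≤⟨ +-monoʳ-≤ (e * j) (≤-trans (s≤s z≤n) (n<2^n i)) ⟩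
      e * j + j  ≡⟨ +-comm (e * j) j ⟩
      suc e * j  ≤⟨ *-monoˡ-≤ j (n<2^n e) ⟩
      2 ^ e * j  ≡⟨ sym (^-distribˡ-+-* 2 e i) ⟩
      2 ^ (e + i)  ∎

-- If each of the first k steps multiplied f by more than 1 + 1/e, the factors would accumulate. For
-- f of polynomial growth this is impossible for large k, and the slow step is an almost invariant
-- set.
slow-step : ∀ e (f : ℕ → ℕ) k → (∃ λ j → j < k × e * f (suc j) ≤ (e + 1) * f j) ⊎ (e + 1) ^ k * f 0 ≤ e ^ k * f k
slow-step e f zero = inj₂ ≤-refl
slow-step e f (suc k) with slow-step e f k
... | inj₁ (j , lt , h) = inj₁ (j , m<n⇒m<1+n lt , h)
... | inj₂ h with e * f (suc k) ≤? (e + 1) * f k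
...   | yes q = inj₁ (k , ≤-refl , q)
...   | no q = inj₂ (begin
    (e + 1) * (e + 1) ^ k * f 0  ≡⟨ *-assoc (e + 1) _ _ ⟩
    (e + 1) * ((e + 1) ^ k * f 0)  ≤⟨ *-monoʳ-≤ (e + 1) h ⟩
    (e + 1) * (e ^ k * f k)  ≡⟨ lem (e + 1) (e ^ k) (f k) ⟩
    e ^ k * ((e + 1) * f k)  ≤⟨ *-monoʳ-≤ (e ^ k) (<⇒≤ (≰⇒> q)) ⟩
    e ^ k * (e * f (suc k))  ≡⟨ lem' (e ^ k) e (f (suc k)) ⟩
    e * e ^ k * f (suc k)  ∎)
  where
  open ≤-Reasoning
  lem : ∀ a b c → a * (b * c) ≡ b * (a * c)
  lem = solve-∀
  lem' : ∀ a b c → a * (b * c) ≡ b * a * c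
  lem' = solve-∀

-- Bounds the number of translates of 2S that cover 3S: |4S| is at most (72K²)⁴Kn, while |S| is at
-- least n/72.
følner-rank : ℕ → ℕ
følner-rank K = 72 * ((72 * K * K) ^ 4 * K)

-- The first factor bounds the number of translates in a box of side k, the second is the bound for
-- |2S|/n.
følner-size : ∀ K e → 1 ≤ e → ℕ
følner-size K e e≥1 = (k + 1) ^ følner-rank K * ((72 * K * K) ^ 2 * K)
  where k = proj₁ (ExponentialGrowth.exponential-beats-polynomial e (følner-rank K) e≥1)

sq : ℤ → ℕ
sq z = ⌊ z ⌋ * ⌊ z ⌋

sq-pos : ∀ z → pos (sq z) ≡ z ℤ.* z
sq-pos (pos n) = ℤP.pos-* n n
sq-pos ℤ.-[1+ n ] = refl

sq-0 : ∀ {z} → z ≡ pos 0 → sq z ≡ 0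
sq-0 refl = refl

sq-neg : ∀ z → sq (ℤ.- z) ≡ sq z
sq-neg z = cong₂ _*_ (ℤP.∣-i∣≡∣i∣ z) (ℤP.∣-i∣≡∣i∣ z)

sq-+ : ∀ a b → sq (a ℤ.+ b) ≤ 2 * sq a + 2 * sq b
sq-+ a b = begin
  sq (a ℤ.+ b)  ≤⟨ *-mono-≤ (ℤP.∣i+j∣≤∣i∣+∣j∣ a b) (ℤP.∣i+j∣≤∣i∣+∣j∣ a b) ⟩
  (⌊ a ⌋ + ⌊ b ⌋) * (⌊ a ⌋ + ⌊ b ⌋)  ≡⟨ e₁ ⌊ a ⌋ ⌊ b ⌋ ⟩
  sq a + sq b + 2 * (⌊ a ⌋ * ⌊ b ⌋)  ≤⟨ +-monoʳ-≤ (sq a + sq b) (2ab≤a²+b² ⌊ a ⌋ ⌊ b ⌋) ⟩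
  sq a + sq b + (sq a + sq b)  ≡⟨ e₂ (sq a) (sq b) ⟩
  2 * sq a + 2 * sq b  ∎
  where
  open ≤-Reasoning
  e₁ : ∀ x y → (x + y) * (x + y) ≡ x * x + y * y + 2 * (x * y)
  e₁ = solve-∀
  e₂ : ∀ x y → x + y + (x + y) ≡ 2 * x + 2 * y
  e₂ = solve-∀

-- Bounds the exponent jg + k of 4 that occurs in `periods-near`, where j < 2K, g ≤ qK! and k ≤ K:
-- each repetition of a shift costs a factor of at most 4.
period-exponent : ℕ → ℕ → ℕ
period-exponent K q = 2 * K * (q * K !) + K

period-constant : ℕ → ℕ → ℕ
period-constant K q = 8 * 4 ^ period-exponent K q

-- The accuracy with which B must be invariant under translation by S.
invariance : ℕ → ℕ → ℕ
invariance K q = 16 * (2 * period-constant K q)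

divides-factorial : ∀ {k K} → 1 ≤ k → k ≤ K → ∃ λ f → f * k ≡ K ! × f ≤ K !
divides-factorial {suc k} {K} _ h with ∣-trans (m∣m*n {suc k} (k !)) (m≤n⇒m!∣n! h)
... | divides f e = f , sym e , ≤-trans (m≤m*n f (suc k)) (≤-reflexive (sym e))

invariance-pos : ∀ K q → 1 ≤ invariance K q
invariance-pos K q = *-mono-≤ {1} {16} (s≤s z≤n) (*-mono-≤ {1} {2} (s≤s z≤n) (*-mono-≤ {1} {8} (s≤s z≤n) (m^n>0 4 (period-exponent K q))))

-- The factor 8 keeps the almost invariant set below an eighth of the group, so that the frequency ξ
-- = 0 carries at most an eighth of the total variation.
cluster-density : ℕ → ℕ → ℕ → ℕ
cluster-density C K q = 8 * følner-size C (invariance K q) (invariance-pos K q)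

-- The bounds for the two pieces turn few crossing progressions into 2cmE ≤ 2E + 14n². If 40m > n,
-- then n² ≤ 144 · 40 · cm, so that 14n² ≤ 80640cm ≤ Ecm. This leaves cm ≤ 2, against n > 80640.
-- Hence the constant 80640 = 14 · 144 · 40.
merge-arithmetic : ∀ {n c m T Tc Tm R} E → 80640 ≤ E → E < n → n ≡ c + m → n * n ≤ 2 * T → E * T ≤ E * (Tc + Tm) + R → R ≤ 7 * (n * n) →
  2 * Tc ≤ c * c + 1 → 2 * Tm ≤ m * m + 1 → n ≤ 144 * c → 40 * m ≤ n
merge-arithmetic {n} {c} {m} {T} {Tc} {Tm} {R} E E≥ E<n refl T≥ split R≤ Tc≤ Tm≤ c-large = ≮⇒≥ λ lt → <-irrefl refl (begin-strict
    80640  ≤⟨ E≥ ⟩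
    E  <⟨ E<n ⟩
    n  ≤⟨ m≤m*n n n {{>-nonZero (≤-trans (s≤s z≤n) E<n)}} ⟩
    n * n  ≤⟨ *-mono-≤ c-large (<⇒≤ lt) ⟩
    144 * c * (40 * m)  ≡⟨ l₁ c m ⟩
    5760 * (c * m)  ≤⟨ *-monoʳ-≤ 5760 (cm≤2 lt) ⟩
    11520  ≤⟨ ≤ᵇ⇒≤ 11520 80640 _ ⟩
    80640  ∎)
  where
  open ≤-Reasoning
  l₁ : ∀ c m → 144 * c * (40 * m) ≡ 5760 * (c * m)
  l₁ c m = l₀ 144 c 40 m
    where
    l₀ : ∀ a c b m → a * c * (b * m) ≡ a * b * (c * m)
    l₀ = solve-∀
  l₂ : ∀ E c m → E * (c * c + m * m) + E * (2 * (c * m)) ≡ E * ((c + m) * (c + m))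
  l₂ = solve-∀
  l₃ : ∀ E T → E * (2 * T) ≡ 2 * (E * T)
  l₃ = solve-∀
  l₄ : ∀ E a b R → 2 * (E * (a + b) + R) ≡ E * (2 * a + 2 * b) + 2 * R
  l₄ = solve-∀
  l₅ : ∀ E c m N → E * (c * c + 1 + (m * m + 1)) + 2 * (7 * N) ≡ E * (c * c + m * m) + (E * 2 + 14 * N)
  l₅ = solve-∀
  l₆ : ∀ E q → E * (2 * q) ≡ E * q + E * q
  l₆ = solve-∀
  l₇ : ∀ c m → 14 * (144 * c * (40 * m)) ≡ 80640 * (c * m)
  l₇ c m = trans (cong (14 *_) (l₁ c m)) (sym (*-assoc 14 5760 (c * m)))
  cross : E * (2 * (c * m)) ≤ E * 2 + 14 * (n * n)
  cross = +-cancelˡ-≤ (E * (c * c + m * m)) _ _ (begin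
    E * (c * c + m * m) + E * (2 * (c * m))  ≡⟨ l₂ E c m ⟩
    E * (n * n)  ≤⟨ *-monoʳ-≤ E T≥ ⟩
    E * (2 * T)  ≡⟨ l₃ E T ⟩
    2 * (E * T)  ≤⟨ *-monoʳ-≤ 2 split ⟩
    2 * (E * (Tc + Tm) + R)  ≡⟨ l₄ E Tc Tm R ⟩
    E * (2 * Tc + 2 * Tm) + 2 * R  ≤⟨ +-mono-≤ (*-monoʳ-≤ E (+-mono-≤ Tc≤ Tm≤)) (*-monoʳ-≤ 2 R≤) ⟩
    E * (c * c + 1 + (m * m + 1)) + 2 * (7 * (n * n))  ≡⟨ l₅ E c m (n * n) ⟩
    E * (c * c + m * m) + (E * 2 + 14 * (n * n))  ∎)
  cm≤2 : n < 40 * m → c * m ≤ 2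
  cm≤2 lt = *-cancelˡ-≤ E {{>-nonZero (≤-trans (s≤s z≤n) E≥)}} (+-cancelʳ-≤ (E * (c * m)) _ _ (begin
    E * (c * m) + E * (c * m)  ≡⟨ sym (l₆ E (c * m)) ⟩
    E * (2 * (c * m))  ≤⟨ cross ⟩
    E * 2 + 14 * (n * n)  ≤⟨ +-monoʳ-≤ (E * 2) (*-monoʳ-≤ 14 (*-mono-≤ c-large (<⇒≤ lt))) ⟩
    E * 2 + 14 * (144 * c * (40 * m))  ≡⟨ cong (E * 2 +_) (l₇ c m) ⟩
    E * 2 + 80640 * (c * m)  ≤⟨ +-monoʳ-≤ (E * 2) (*-monoˡ-≤ (c * m) E≥) ⟩
    E * 2 + E * (c * m)  ∎))

-- Comparing quadratic terms gives 2af ≤ 2 + 12fg. With f ≤ g ≤ n/40 and a = n - f, multiplication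
-- by 40 turns this into 66nf ≤ 80, impossible for f ≥ 1 because then n ≥ 40.
endgame-arithmetic : ∀ {n a f g T Ta Tf} → n ≡ a + f → f ≤ g → 40 * g ≤ n → n * n ≤ 2 * T → T ≤ Ta + Tf + 6 * (f * g) →
  2 * Ta ≤ a * a + 1 → 2 * Tf ≤ f * f + 1 → f ≡ 0
endgame-arithmetic {n} {a} {zero} refl f≤g g≤ T≥ split Ta≤ Tf≤ = refl
endgame-arithmetic {n} {a} {f@(suc f')} {g} {T} {Ta} {Tf} refl f≤g g≤ T≥ split Ta≤ Tf≤ = ⊥-elim (<-irrefl refl (begin-strict
    66 * 40  ≤⟨ *-monoʳ-≤ 66 (≤-trans (≤-trans (*-monoʳ-≤ 40 (≤-trans (s≤s z≤n) f≤g)) g≤) (m≤m*n n f)) ⟩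
    66 * (n * f)  ≤⟨ +-cancelˡ-≤ (14 * (n * f)) _ _ main ⟩
    80  <⟨ ≤ᵇ⇒≤ 81 2640 _ ⟩
    66 * 40  ∎))
  where
  open ≤-Reasoning
  l₁ : ∀ a f → (a * a + f * f) + 2 * (a * f) ≡ (a + f) * (a + f)
  l₁ = solve-∀
  l₂ : ∀ a b q → 2 * (a + b + 6 * q) ≡ 2 * a + 2 * b + 12 * q
  l₂ = solve-∀
  l₃ : ∀ a f q → a * a + 1 + (f * f + 1) + 12 * q ≡ a * a + f * f + (2 + 12 * q)
  l₃ = solve-∀
  l₄ : ∀ a f → 14 * ((a + f) * f) + 66 * ((a + f) * f) ≡ 40 * (2 * (a * f)) + 2 * (40 * f * f)
  l₄ = solve-∀
  l₅ : ∀ f g → 40 * (2 + 12 * (f * g)) ≡ 80 + 12 * (40 * g * f)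
  l₅ = solve-∀
  l₆ : ∀ q → 80 + 12 * q + 2 * q ≡ 14 * q + 80
  l₆ = solve-∀
  cross : 2 * (a * f) ≤ 2 + 12 * (f * g)
  cross = +-cancelˡ-≤ (a * a + f * f) _ _ (begin
    a * a + f * f + 2 * (a * f)  ≡⟨ l₁ a f ⟩
    n * n  ≤⟨ T≥ ⟩
    2 * T  ≤⟨ *-monoʳ-≤ 2 split ⟩
    2 * (Ta + Tf + 6 * (f * g))  ≡⟨ l₂ Ta Tf (f * g) ⟩
    2 * Ta + 2 * Tf + 12 * (f * g)  ≤⟨ +-monoˡ-≤ (12 * (f * g)) (+-mono-≤ Ta≤ Tf≤) ⟩
    a * a + 1 + (f * f + 1) + 12 * (f * g)  ≡⟨ l₃ a f (f * g) ⟩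
    a * a + f * f + (2 + 12 * (f * g))  ∎)
  main : 14 * (n * f) + 66 * (n * f) ≤ 14 * (n * f) + 80
  main = begin
    14 * (n * f) + 66 * (n * f)  ≡⟨ l₄ a f ⟩
    40 * (2 * (a * f)) + 2 * (40 * f * f)  ≤⟨ +-mono-≤ (*-monoʳ-≤ 40 cross) (*-monoʳ-≤ 2 (*-monoˡ-≤ f (≤-trans (*-monoʳ-≤ 40 f≤g) g≤))) ⟩
    40 * (2 + 12 * (f * g)) + 2 * (n * f)  ≡⟨ cong (_+ 2 * (n * f)) (l₅ f g) ⟩
    80 + 12 * (40 * g * f) + 2 * (n * f)  ≤⟨ +-monoˡ-≤ (2 * (n * f)) (+-monoʳ-≤ 80 (*-monoʳ-≤ 12 (*-monoˡ-≤ f g≤))) ⟩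
    80 + 12 * (n * f) + 2 * (n * f)  ≡⟨ l₆ (n * f) ⟩
    14 * (n * f) + 80  ∎

guard₃ : ∀ a b c {k} → (a ≡ true → b ≡ true → c ≡ true → 1 ≤ k) → ⟦ b ⟧ * (⟦ a ⟧ * ⟦ c ⟧) ≤ k
guard₃ true true true h = h refl refl refl
guard₃ true true false h = z≤n
guard₃ false true c h = z≤n
guard₃ a false c h = z≤n

-- The sharpness of the core required when f more dilations may follow: with Q = `scale q f` and R =
-- 2Q², a dilation that enlarges the core turns an arc of radius p/(6R) into one of radius p/Q.
scale : ℕ → ℕ → ℕ
scale q zero = q
scale q (suc f) = 6 * (2 * (scale q f * scale q f))

scale-step : ∀ q → 1 ≤ q → q ≤ 6 * (2 * (q * q))
scale-step q h = ≤-trans (m≤m*n q q {{>-nonZero h}}) (≤-trans (m≤n*m (q * q) 2) (m≤n*m (2 * (q * q)) 6))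

scale-≥ : ∀ q f → 1 ≤ q → q ≤ scale q f
scale-≥ q zero h = ≤-refl
scale-≥ q (suc f) h = ≤-trans (scale-≥ q f h) (scale-step (scale q f) (≤-trans h (scale-≥ q f h)))

-- Sealed, because with-abstraction would normalise these huge numbers wherever they occur in the context.
opaque
  rectification-density : ℕ → ℕ → ℕ → ℕ
  rectification-density C K E = cluster-density C K (scale 96 E) + (2 * scale 96 E + K)

  cluster-density-≤ : ∀ C K E → cluster-density C K (scale 96 E) ≤ rectification-density C K E
  cluster-density-≤ C K E = m≤m+n _ (2 * scale 96 E + K)

  scale-≤-density : ∀ C K E → 2 * scale 96 E + K ≤ rectification-density C K E
  scale-≤-density C K E = m≤n+m (2 * scale 96 E + K) (cluster-density C K (scale 96 E))

-- Three-term progressions in finite sets of integers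

half-square : ℕ → ℕ
half-square zero = 0
half-square (suc zero) = 1
half-square (suc (suc n)) = half-square n + (2 * n + 2)

half-square-double : ∀ n → 2 * half-square n ≡ n * n ⊎ 2 * half-square n ≡ n * n + 1
half-square-double zero = inj₁ refl
half-square-double (suc zero) = inj₂ refl
half-square-double (suc (suc n)) with half-square-double n
... | inj₁ e = inj₁ (trans (*-distribˡ-+ 2 (half-square n) _) (trans (cong (_+ 2 * (2 * n + 2)) e) (lem n)))
  where
  lem : ∀ n → n * n + 2 * (2 * n + 2) ≡ (2 + n) * (2 + n)
  lem = solve-∀
... | inj₂ e = inj₂ (trans (*-distribˡ-+ 2 (half-square n) _) (trans (cong (_+ 2 * (2 * n + 2)) e) (lem n)))
  where
  lem : ∀ n → n * n + 1 + 2 * (2 * n + 2) ≡ (2 + n) * (2 + n) + 1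
  lem = solve-∀

half-square-≤ : ∀ n → 2 * half-square n ≤ n * n + 1
half-square-≤ n with half-square-double n
... | inj₁ e = ≤-trans (≤-reflexive e) (m≤m+n _ 1)
... | inj₂ e = ≤-reflexive e

half-square-≥ : ∀ n → n * n ≤ 2 * half-square n
half-square-≥ n with half-square-double n
... | inj₁ e = ≤-reflexive (sym e)
... | inj₂ e = ≤-trans (m≤m+n _ 1) (≤-reflexive (sym e))

half-square-/ : ∀ n → (n * n + 1) / 2 ≡ half-square n
half-square-/ n = ≤-antisym
  (≤-pred (DM.m<n*o⇒m/o<n {n * n + 1} {suc (half-square n)} {2} (≤-trans (s≤s (+-monoˡ-≤ 1 (half-square-≥ n))) (≤-reflexive (lem (half-square n))))))
  (≤-trans (≤-reflexive (sym (DM.m*n/n≡m (half-square n) 2))) (DM./-monoˡ-≤ 2 (≤-trans (≤-reflexive (*-comm (half-square n) 2)) (half-square-≤ n))))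
  where
  lem : ∀ h → suc (2 * h + 1) ≡ suc h * 2
  lem = solve-∀

≤half-square : ∀ n T → 2 * T ≤ n * n + 1 → T ≤ half-square n
≤half-square n T h = ≮⇒≥ λ lt → <-irrefl refl (begin-strict
    n * n + 1  <⟨ +-monoʳ-< (n * n) (≤-refl {2}) ⟩
    n * n + 2  ≤⟨ +-monoˡ-≤ 2 (half-square-≥ n) ⟩
    2 * half-square n + 2  ≡⟨ lem (half-square n) ⟩
    2 * suc (half-square n)  ≤⟨ *-monoʳ-≤ 2 lt ⟩
    2 * T  ≤⟨ h ⟩
    n * n + 1  ∎)
  where
  open ≤-Reasoning
  lem : ∀ h → 2 * h + 2 ≡ 2 * suc h
  lem = solve-∀

-- Bound for the progressions whose midpoint has rank i: the constant one, and two for each pair of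
-- elements exchanged by reflection in the midpoint.
peak : ℕ → ℕ → ℕ
peak n i = 1 + 2 * (i ⊓ (n ∸ suc i))

∑-downFrom-suc : ∀ n (f : ℕ → ℕ) → ∑ (downFrom (suc n)) f ≡ f 0 + ∑ (downFrom n) (λ i → f (suc i))
∑-downFrom-suc zero f = refl
∑-downFrom-suc (suc n) f = trans (cong (f (suc n) +_) (∑-downFrom-suc n f)) (lem (f (suc n)) (f 0) (∑ (downFrom n) (λ i → f (suc i))))
  where
  lem : ∀ a b c → a + (b + c) ≡ b + (a + c)
  lem = solve-∀

-- The two outermost ranks contribute 1 each, and without them every remaining value drops by
-- exactly 2. This is why `half-square` recurses in steps of two.
∑-peak : ∀ n → ∑ (downFrom n) (peak n) ≡ half-square n
∑-peak zero = refl
∑-peak (suc zero) = refl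
∑-peak (suc (suc n)) = begin
  peak (2 + n) (suc n) + ∑ (downFrom (suc n)) (peak (2 + n))  ≡⟨ cong₂ _+_ last (∑-downFrom-suc n (peak (2 + n))) ⟩
  1 + (1 + ∑ (downFrom n) (λ i → peak (2 + n) (suc i)))  ≡⟨ cong (λ s → 1 + (1 + s)) (∑-cong-∈ (downFrom n) (λ i m → inner i (∈-downFrom⁻ m))) ⟩
  1 + (1 + ∑ (downFrom n) (λ i → peak n i + 2))  ≡⟨ cong (λ s → 1 + (1 + s)) (trans (∑-+ (downFrom n) (peak n) (λ _ → 2)) (cong₂ _+_ (∑-peak n) (trans (∑-const (downFrom n) 2) (cong (_* 2) (length-downFrom n))))) ⟩
  1 + (1 + (half-square n + n * 2))  ≡⟨ lem (half-square n) n ⟩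
  half-square n + (2 * n + 2)  ∎
  where
  open ≡-Reasoning
  lem : ∀ h n → 1 + (1 + (h + n * 2)) ≡ h + (2 * n + 2)
  lem = solve-∀
  last : peak (2 + n) (suc n) ≡ 1
  last = cong (λ k → 1 + 2 * k) (trans (cong (suc n ⊓_) (n∸n≡0 n)) (⊓-zeroʳ (suc n)))
  inner : ∀ i → i < n → peak (2 + n) (suc i) ≡ peak n i + 2
  inner i lt = trans (cong (λ k → 1 + 2 * (suc i ⊓ k)) (∸-suc' lt)) (lem' (i ⊓ (n ∸ suc i)))
    where
    ∸-suc' : ∀ {n i} → i < n → n ∸ i ≡ suc (n ∸ suc i)
    ∸-suc' {suc n} {zero} _ = refl
    ∸-suc' {suc n} {suc i} (s≤s h) = ∸-suc' h
    lem' : ∀ k → 1 + 2 * suc k ≡ 1 + 2 * k + 2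
    lem' = solve-∀

module _ {X : Set} where
  ∑-at-most-one : ∀ {xs : List X} → Unique xs → (b : X → Bool) → (∀ {x y} → x ∈ xs → y ∈ xs → b x ≡ true → b y ≡ true → x ≡ y) → ∑ xs (λ x → ⟦ b x ⟧) ≤ 1
  ∑-at-most-one [] b h = z≤n
  ∑-at-most-one {x ∷ xs} (u ∷ us) b h with b x in e
  ... | false = ∑-at-most-one us b (λ mx my → h (there mx) (there my))
  ... | true = s≤s (≤-reflexive (trans (∑-cong-∈ xs (λ y m → none y m (b y) refl)) (∑-zero xs)))
    where
    none : ∀ y → y ∈ xs → ∀ c → b y ≡ c → ⟦ b y ⟧ ≡ 0
    none y m false eq = cong ⟦_⟧ eq
    none y m true eq = ⊥-elim (All.lookup u m (h (here refl) (there m) e eq))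

  length-filter-∑ : ∀ {q} {Q : X → Set q} (Q? : ∀ x → Dec (Q x)) xs → length (filter Q? xs) ≡ ∑ xs (λ x → ⟦ does (Q? x) ⟧)
  length-filter-∑ Q? [] = refl
  length-filter-∑ Q? (x ∷ xs) with does (Q? x)
  ... | true = cong suc (length-filter-∑ Q? xs)
  ... | false = length-filter-∑ Q? xs

  ∑-++ : ∀ xs ys (f : X → ℕ) → ∑ (xs ++ ys) f ≡ ∑ xs f + ∑ ys f
  ∑-++ [] ys f = refl
  ∑-++ (x ∷ xs) ys f = trans (cong (f x +_) (∑-++ xs ys f)) (sym (+-assoc (f x) _ _))

∑-map : ∀ {X Y : Set} (g : X → Y) xs (f : Y → ℕ) → ∑ (map g xs) f ≡ ∑ xs (λ x → f (g x))
∑-map g [] f = refl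
∑-map g (x ∷ xs) f = cong (f (g x) +_) (∑-map g xs f)

∑-concatMap : ∀ {X Y : Set} (g : X → List Y) xs (f : Y → ℕ) → ∑ (concatMap g xs) f ≡ ∑ xs (λ x → ∑ (g x) f)
∑-concatMap g [] f = refl
∑-concatMap g (x ∷ xs) f = trans (∑-++ (g x) (concatMap g xs) f) (cong (∑ (g x) f +_) (∑-concatMap g xs f))

downFrom! : ∀ n → Unique (downFrom n)
downFrom! zero = []
downFrom! (suc n) = All.tabulate (λ m e → <⇒≢ (∈-downFrom⁻ m) (sym e)) ∷ downFrom! n

module Line (A : List ℤ) (A! : Unique A) where
  module Δ = Σℕ.Delta ℤP._≟_

  mem : ℤ → Bool
  mem z = does (z ∈ℤ? A)

  mem-∈ : ∀ {z} → mem z ≡ true → z ∈ A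
  mem-∈ {z} = does⇒ (z ∈ℤ? A)

  ∈-mem : ∀ {z} → z ∈ A → mem z ≡ true
  ∈-mem {z} = ⇒does (z ∈ℤ? A)

  mirror : ℤ → ℤ → ℤ
  mirror y x = pos 2 ℤ.* y ℤ.- x

  mirror-invol : ∀ y x → mirror y (mirror y x) ≡ x
  mirror-invol = lem
    where
    lem : ∀ y x → pos 2 ℤ.* y ℤ.- (pos 2 ℤ.* y ℤ.- x) ≡ x
    lem = ℤR.solve-∀

  mirror-< : ∀ {y x} → x ℤ.< y → y ℤ.< mirror y x
  mirror-< {y} {x} h = subst₂ ℤ._<_ (l₁ y x) (l₂ y x) (ℤP.+-monoˡ-< (y ℤ.- x) h)
    where
    l₁ : ∀ y x → x ℤ.+ (y ℤ.- x) ≡ y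
    l₁ = ℤR.solve-∀
    l₂ : ∀ y x → y ℤ.+ (y ℤ.- x) ≡ pos 2 ℤ.* y ℤ.- x
    l₂ = ℤR.solve-∀

  mirror-> : ∀ {y x} → y ℤ.< x → mirror y x ℤ.< y
  mirror-> {y} {x} h = subst₂ ℤ._<_ (l₂ y x) (l₁ y x) (ℤP.+-monoˡ-< (y ℤ.- x) h)
    where
    l₁ : ∀ y x → x ℤ.+ (y ℤ.- x) ≡ y
    l₁ = ℤR.solve-∀
    l₂ : ∀ y x → y ℤ.+ (y ℤ.- x) ≡ pos 2 ℤ.* y ℤ.- x
    l₂ = ℤR.solve-∀

  lt gt : ℤ → ℤ → Bool
  lt y x = does (x ℤP.<? y)
  gt y x = does (y ℤP.<? x)

  n : ℕ
  n = length A

  -- On `A` the count `L` is the rank of y. `l` and `r` count only those elements on their side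
  -- whose reflection in y stays in `A`; `c` counts ordered progressions with midpoint y, the
  -- constant one included.
  c L R l r : ℤ → ℕ
  c y = ∑ A (λ x → ⟦ mem (mirror y x) ⟧)
  L y = ∑ A (λ x → ⟦ lt y x ⟧)
  R y = ∑ A (λ x → ⟦ gt y x ⟧)
  l y = ∑ A (λ x → ⟦ lt y x ⟧ * ⟦ mem (mirror y x) ⟧)
  r y = ∑ A (λ x → ⟦ gt y x ⟧ * ⟦ mem (mirror y x) ⟧)

  T : ℕ
  T = ∑ A c

  -- The candidate pair made from x and y has d = y - x, so x + 2d is the reflection of x in y, and
  -- grouping by y counts by midpoints.
  T3Z≡T : T3Z A ≡ T
  T3Z≡T = trans (length-filter-∑ _ (concatMap (λ x → map (λ y → (x , y ℤ.- x)) A) A))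
    (trans (∑-concatMap (λ x → map (λ y → (x , y ℤ.- x)) A) A _)
    (trans (∑-cong A (λ x → ∑-map (λ y → (x , y ℤ.- x)) A _))
    (trans (∑-cong-∈ A (λ x mx → ∑-cong-∈ A (λ y my → cong ⟦_⟧ (test mx my))))
    (∑-swap A A (λ x y → ⟦ mem (mirror y x) ⟧)))))
    where
    l₁ : ∀ x y → x ℤ.+ (y ℤ.- x) ≡ y
    l₁ = ℤR.solve-∀
    l₂ : ∀ x y → x ℤ.+ pos 2 ℤ.* (y ℤ.- x) ≡ pos 2 ℤ.* y ℤ.- x
    l₂ = ℤR.solve-∀
    test : ∀ {x y} → x ∈ A → y ∈ A → mem x ∧ (mem (x ℤ.+ (y ℤ.- x)) ∧ mem (x ℤ.+ pos 2 ℤ.* (y ℤ.- x))) ≡ mem (mirror y x)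
    test {x} {y} mx my = trans (cong₂ (λ a b → a ∧ (b ∧ mem (x ℤ.+ pos 2 ℤ.* (y ℤ.- x)))) (∈-mem mx) (trans (cong mem (l₁ x y)) (∈-mem my))) (cong mem (l₂ x y))

  trichotomy : ∀ y x → 1 ≡ ⟦ lt y x ⟧ + ⟦ does (y ℤP.≟ x) ⟧ + ⟦ gt y x ⟧
  trichotomy y x with ℤP.<-cmp x y
  ... | tri< a b c = sym (cong₂ _+_ (cong₂ (λ u v → ⟦ u ⟧ + ⟦ v ⟧) (dec-true (x ℤP.<? y) a) (dec-false (y ℤP.≟ x) (λ e → b (sym e)))) (cong ⟦_⟧ (dec-false (y ℤP.<? x) c)))
  ... | tri≈ a b c = sym (cong₂ _+_ (cong₂ (λ u v → ⟦ u ⟧ + ⟦ v ⟧) (dec-false (x ℤP.<? y) a) (dec-true (y ℤP.≟ x) (sym b))) (cong ⟦_⟧ (dec-false (y ℤP.<? x) c)))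
  ... | tri> a b c = sym (cong₂ _+_ (cong₂ (λ u v → ⟦ u ⟧ + ⟦ v ⟧) (dec-false (x ℤP.<? y) a) (dec-false (y ℤP.≟ x) (λ e → b (sym e)))) (cong ⟦_⟧ (dec-true (y ℤP.<? x) c)))

  ∑-trichotomy : ∀ {y} → y ∈ A → (f : ℤ → ℕ) → ∑ A f ≡ ∑ A (λ x → ⟦ lt y x ⟧ * f x) + f y + ∑ A (λ x → ⟦ gt y x ⟧ * f x)
  ∑-trichotomy {y} my f = begin
    ∑ A f
      ≡⟨ ∑-cong A (λ x → trans (sym (*-identityˡ (f x))) (trans (cong (_* f x) (trichotomy y x)) (trans (*-distribʳ-+ (f x) (⟦ lt y x ⟧ + ⟦ does (y ℤP.≟ x) ⟧) ⟦ gt y x ⟧) (cong (_+ ⟦ gt y x ⟧ * f x) (*-distribʳ-+ (f x) ⟦ lt y x ⟧ ⟦ does (y ℤP.≟ x) ⟧))))) ⟩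
    ∑ A (λ x → ⟦ lt y x ⟧ * f x + ⟦ does (y ℤP.≟ x) ⟧ * f x + ⟦ gt y x ⟧ * f x)
      ≡⟨ trans (∑-+ A (λ x → ⟦ lt y x ⟧ * f x + ⟦ does (y ℤP.≟ x) ⟧ * f x) (λ x → ⟦ gt y x ⟧ * f x)) (cong (_+ ∑ A (λ x → ⟦ gt y x ⟧ * f x)) (∑-+ A (λ x → ⟦ lt y x ⟧ * f x) (λ x → ⟦ does (y ℤP.≟ x) ⟧ * f x))) ⟩
    ∑ A (λ x → ⟦ lt y x ⟧ * f x) + ∑ A (λ x → ⟦ does (y ℤP.≟ x) ⟧ * f x) + ∑ A (λ x → ⟦ gt y x ⟧ * f x)
      ≡⟨ cong (λ s → ∑ A (λ x → ⟦ lt y x ⟧ * f x) + s + ∑ A (λ x → ⟦ gt y x ⟧ * f x)) (Δ.∑-δ A! my f) ⟩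
    ∑ A (λ x → ⟦ lt y x ⟧ * f x) + f y + ∑ A (λ x → ⟦ gt y x ⟧ * f x) ∎
    where open ≡-Reasoning

  n≡L+R : ∀ {y} → y ∈ A → n ≡ L y + 1 + R y
  n≡L+R {y} my = trans (sym (trans (∑-const A 1) (*-identityʳ n))) (trans (∑-trichotomy my (λ _ → 1))
    (cong₂ (λ a b → a + 1 + b) (∑-cong A (λ x → *-identityʳ ⟦ lt y x ⟧)) (∑-cong A (λ x → *-identityʳ ⟦ gt y x ⟧))))

  mem-∑ : ∀ w → ⟦ mem w ⟧ ≡ ∑ A (λ z → ⟦ does (w ℤP.≟ z) ⟧)
  mem-∑ w with w ∈ℤ? A
  ... | yes m = sym (trans (∑-cong A (λ z → sym (*-identityʳ ⟦ does (w ℤP.≟ z) ⟧))) (Δ.∑-δ A! m (λ _ → 1)))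
  ... | no m = sym (trans (∑-cong-∈ A (λ z mz → cong ⟦_⟧ (dec-false (w ℤP.≟ z) (λ { refl → m mz })))) (∑-zero A))

  -- Reflection in y exchanges the contributions from the two sides of y.
  l≡r : ∀ y → l y ≡ r y
  l≡r y = begin
    ∑ A (λ x → ⟦ lt y x ⟧ * ⟦ mem (mirror y x) ⟧)  ≡⟨ ∑-cong A (λ x → trans (cong (⟦ lt y x ⟧ *_) (mem-∑ (mirror y x))) (sym (∑-*ˡ A ⟦ lt y x ⟧ _))) ⟩
    ∑ A (λ x → ∑ A (λ z → ⟦ lt y x ⟧ * ⟦ does (mirror y x ℤP.≟ z) ⟧))  ≡⟨ ∑-swap A A _ ⟩
    ∑ A (λ z → ∑ A (λ x → ⟦ lt y x ⟧ * ⟦ does (mirror y x ℤP.≟ z) ⟧))  ≡⟨ ∑-cong A (λ z → ∑-cong A (λ x → pt z x)) ⟩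
    ∑ A (λ z → ∑ A (λ x → ⟦ gt y z ⟧ * ⟦ does (mirror y z ℤP.≟ x) ⟧))  ≡⟨ ∑-cong A (λ z → trans (∑-*ˡ A ⟦ gt y z ⟧ _) (cong (⟦ gt y z ⟧ *_) (sym (mem-∑ (mirror y z))))) ⟩
    r y  ∎
    where
    open ≡-Reasoning
    pt : ∀ z x → ⟦ lt y x ⟧ * ⟦ does (mirror y x ℤP.≟ z) ⟧ ≡ ⟦ gt y z ⟧ * ⟦ does (mirror y z ℤP.≟ x) ⟧
    pt z x with mirror y x ℤP.≟ z
    ... | yes refl = cong₂ (λ a b → ⟦ a ⟧ * ⟦ b ⟧)
            (Δ.does-cong (x ℤP.<? y) (y ℤP.<? mirror y x) mirror-< (λ h → subst (ℤ._< y) (mirror-invol y x) (mirror-> h)))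
            (sym (⇒does (mirror y (mirror y x) ℤP.≟ x) (mirror-invol y x)))
    ... | no ne = trans (*-zeroʳ ⟦ lt y x ⟧) (sym (trans (cong (λ b → ⟦ gt y z ⟧ * ⟦ b ⟧) (dec-false (mirror y z ℤP.≟ x) (λ { refl → ne (mirror-invol y z) }))) (*-zeroʳ ⟦ gt y z ⟧)))

  c≡ : ∀ {y} → y ∈ A → c y ≡ 1 + 2 * l y
  c≡ {y} my = trans (∑-trichotomy my (λ x → ⟦ mem (mirror y x) ⟧)) (trans (cong₂ (λ a b → l y + ⟦ a ⟧ + b) (trans (cong mem (lem y)) (∈-mem my)) (sym (l≡r y))) (lem' (l y)))
    where
    lem : ∀ y → pos 2 ℤ.* y ℤ.- y ≡ y
    lem = ℤR.solve-∀
    lem' : ∀ l → l + 1 + l ≡ 1 + 2 * l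
    lem' = solve-∀

  l≤L : ∀ y → l y ≤ L y
  l≤L y = ∑-mono A (λ x → *⟦⟧≤ ⟦ lt y x ⟧ (mem (mirror y x)))

  r≤R : ∀ y → r y ≤ R y
  r≤R y = ∑-mono A (λ x → *⟦⟧≤ ⟦ gt y x ⟧ (mem (mirror y x)))

  R≡ : ∀ {y} → y ∈ A → R y ≡ n ∸ suc (L y)
  R≡ {y} my = sym (trans (cong (_∸ suc (L y)) (trans (n≡L+R my) (cong (_+ R y) (+-comm (L y) 1)))) (m+n∸m≡n (suc (L y)) (R y)))

  -- `l` and `r` agree and are bounded by `L` and `R`, hence by the smaller of the two.
  c≤ : ∀ {y} → y ∈ A → c y ≤ peak n (L y)
  c≤ {y} my = ≤-trans (≤-reflexive (c≡ my)) (s≤s (*-monoʳ-≤ 2 (⊓-glb (l≤L y) (≤-trans (≤-reflexive (l≡r y)) (≤-trans (r≤R y) (≤-reflexive (R≡ my)))))))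

  lt-true : ∀ {y x} → x ℤ.< y → lt y x ≡ true
  lt-true {y} {x} = ⇒does (x ℤP.<? y)

  lt⁻ : ∀ {y x} → lt y x ≡ true → x ℤ.< y
  lt⁻ {y} {x} = does⇒ (x ℤP.<? y)

  gt-true : ∀ {y x} → y ℤ.< x → gt y x ≡ true
  gt-true {y} {x} = ⇒does (y ℤP.<? x)

  L-mono : ∀ {y y'} → y ∈ A → y ℤ.< y' → L y < L y'
  L-mono {y} {y'} my h = ≤-trans (≤-reflexive (+-comm 1 (L y))) (≤-trans (≤-reflexive (sym (trans (∑-+ A (λ x → ⟦ lt y x ⟧) (λ x → ⟦ does (y ℤP.≟ x) ⟧ * 1)) (cong (L y +_) (Δ.∑-δ A! my (λ _ → 1)))))) (∑-mono A pt))
    where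
    pt : ∀ x → ⟦ lt y x ⟧ + ⟦ does (y ℤP.≟ x) ⟧ * 1 ≤ ⟦ lt y' x ⟧
    pt x with y ℤP.≟ x
    ... | yes refl = ≤-reflexive (trans (cong (λ b → ⟦ b ⟧ + 1) (dec-false (y ℤP.<? y) (ℤP.<-irrefl refl))) (sym (cong ⟦_⟧ (lt-true h))))
    ... | no _ = ≤-trans (≤-reflexive (+-identityʳ _)) (⟦⟧-mono {lt y x} {lt y' x} (λ e → lt-true {y'} {x} (ℤP.<-trans (lt⁻ {y} {x} e) h)))

  L-inj : ∀ {y y'} → y ∈ A → y' ∈ A → L y ≡ L y' → y ≡ y'
  L-inj {y} {y'} my my' e with ℤP.<-cmp y y'
  ... | tri< a _ _ = ⊥-elim (<⇒≢ (L-mono my a) e)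
  ... | tri≈ _ b _ = b
  ... | tri> _ _ a = ⊥-elim (<⇒≢ (L-mono my' a) (sym e))

  L<n : ∀ {y} → y ∈ A → L y < n
  L<n {y} my = ≤-trans (≤-reflexive (+-comm 1 (L y))) (≤-trans (m≤m+n _ (R y)) (≤-reflexive (sym (n≡L+R my))))

  module Δn = Σℕ.Delta _≟_

  expand-rank : ∀ (φ : ℕ → ℕ) {y} → y ∈ A → φ (L y) ≡ ∑ (downFrom n) (λ i → ⟦ does (L y ≟ i) ⟧ * φ i)
  expand-rank φ my = sym (Δn.∑-δ (downFrom! n) (∈-downFrom⁺ (L<n my)) φ)

  rank-count : ℕ → ℕ
  rank-count i = ∑ A (λ y → ⟦ does (L y ≟ i) ⟧)

  rank-≤1 : ∀ i → rank-count i ≤ 1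
  rank-≤1 i = ∑-at-most-one A! (λ y → does (L y ≟ i)) (λ {x} {y} mx my ex ey → L-inj mx my (trans (does⇒ (L x ≟ i) ex) (sym (does⇒ (L y ≟ i) ey))))

  rank-total : ∑ (downFrom n) rank-count ≡ n
  rank-total = trans (∑-swap (downFrom n) A _) (trans (∑-cong-∈ A (λ y my → trans (∑-cong (downFrom n) (λ i → sym (*-identityʳ ⟦ does (L y ≟ i) ⟧))) (sym (expand-rank (λ _ → 1) my)))) (trans (∑-const A 1) (*-identityʳ n)))

  -- No rank is taken twice, and the n counts add up to n.
  rank-1 : ∀ {i} → i < n → rank-count i ≡ 1
  rank-1 lt = ∑-mono-eq (downFrom n) {rank-count} {λ _ → 1} (λ i _ → rank-≤1 i) (≤-reflexive (trans (∑-const (downFrom n) 1) (trans (*-identityʳ _) (trans (length-downFrom n) (sym rank-total))))) (∈-downFrom⁺ lt)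

  ∑-rank : ∀ (φ : ℕ → ℕ) → ∑ A (λ y → φ (L y)) ≡ ∑ (downFrom n) φ
  ∑-rank φ = begin
    ∑ A (λ y → φ (L y))  ≡⟨ ∑-cong-∈ A (λ y my → expand-rank φ my) ⟩
    ∑ A (λ y → ∑ (downFrom n) (λ i → ⟦ does (L y ≟ i) ⟧ * φ i))  ≡⟨ ∑-swap A (downFrom n) _ ⟩
    ∑ (downFrom n) (λ i → ∑ A (λ y → ⟦ does (L y ≟ i) ⟧ * φ i))  ≡⟨ ∑-cong-∈ (downFrom n) (λ i m → trans (∑-*ʳ A (φ i) _) (trans (cong (_* φ i) (rank-1 (∈-downFrom⁻ m))) (*-identityˡ (φ i)))) ⟩
    ∑ (downFrom n) φ  ∎
    where open ≡-Reasoning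

  at-rank : ∀ {i} → i < n → ∃ λ y → y ∈ A × L y ≡ i
  at-rank {i} h with ∑-<-pick A {λ _ → 0} {λ y → ⟦ does (L y ≟ i) ⟧} (≤-trans (s≤s (≤-reflexive (∑-zero A))) (≤-reflexive (sym (rank-1 h))))
  ... | y , my , q = y , my , does⇒ (L y ≟ i) (pos⇒true q)
    where
    pos⇒true : ∀ {b} → 1 ≤ ⟦ b ⟧ → b ≡ true
    pos⇒true {true} _ = refl

  T≤ : T ≤ half-square n
  T≤ = ≤-trans (∑-mono-∈ A (λ y my → c≤ my)) (≤-reflexive (trans (∑-rank (peak n)) (∑-peak n)))

  module Extremal (T≡ : half-square n ≤ T) where

    l≡min : ∀ {y} → y ∈ A → l y ≡ L y ⊓ R y
    l≡min {y} my = trans (*-cancelˡ-≡ (l y) (L y ⊓ (n ∸ suc (L y))) 2 (suc-injective (trans (sym (c≡ my))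
      (∑-mono-eq A {c} {λ y → peak n (L y)} (λ y my → c≤ my) (≤-trans (≤-reflexive (trans (∑-rank (peak n)) (∑-peak n))) T≡) my)))) (cong (L y ⊓_) (sym (R≡ my)))

    -- In an extremal set `l` equals the size of the shorter side of y, so no element of that side
    -- fails to reflect.
    reflect-left : ∀ {y} → y ∈ A → L y ≤ R y → ∀ {x} → x ∈ A → x ℤ.< y → mirror y x ∈ A
    reflect-left {y} my h {x} mx lt' = mem-∈ (get (∑-mono-eq A {λ x → ⟦ lt y x ⟧ * ⟦ mem (mirror y x) ⟧} {λ x → ⟦ lt y x ⟧} (λ x _ → *⟦⟧≤ ⟦ lt y x ⟧ (mem (mirror y x))) (≤-reflexive (sym (trans (l≡min my) (m≤n⇒m⊓n≡m h)))) mx) (lt-true lt'))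
      where
      get : ∀ {a b} → ⟦ a ⟧ * ⟦ b ⟧ ≡ ⟦ a ⟧ → a ≡ true → b ≡ true
      get {true} {true} e _ = refl

    reflect-right : ∀ {y} → y ∈ A → R y ≤ L y → ∀ {x} → x ∈ A → y ℤ.< x → mirror y x ∈ A
    reflect-right {y} my h {x} mx lt' = mem-∈ (get (∑-mono-eq A {λ x → ⟦ gt y x ⟧ * ⟦ mem (mirror y x) ⟧} {λ x → ⟦ gt y x ⟧} (λ x _ → *⟦⟧≤ ⟦ gt y x ⟧ (mem (mirror y x))) (≤-reflexive (sym (trans (sym (l≡r y)) (trans (l≡min my) (m≥n⇒m⊓n≡n h))))) mx) (gt-true lt'))
      where
      get : ∀ {a b} → ⟦ a ⟧ * ⟦ b ⟧ ≡ ⟦ a ⟧ → a ≡ true → b ≡ true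
      get {true} {true} e _ = refl

    r-even : ∀ {y} → y ∈ A → R y ≡ suc (L y) → R y ≡ suc (r y)
    r-even {y} my e = trans e (cong suc (sym (trans (sym (l≡r y)) (trans (l≡min my) (m≤n⇒m⊓n≡m (≤-trans (n≤1+n _) (≤-reflexive (sym e))))))))

-- The sets E and F as runs in two parity classes

Chains : ℕ → ℕ → ℕ → Set
Chains U V j = (∃ λ i → i < U × j ≡ 2 * i) ⊎ (∃ λ i → i < V × j ≡ suc (2 * i))

-- The absolute values of the elements of E(k , m).
Ends : ℕ → ℕ → ℕ → Set
Ends k m j = j ≤ k ⊎ (∃ λ t → 1 ≤ t × t ≤ m × j ≡ k + 2 * t)

parity : ∀ j → ∃ λ i → j ≡ 2 * i ⊎ j ≡ suc (2 * i)
parity zero = 0 , inj₁ refl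
parity (suc j) with parity j
... | i , inj₁ e = i , inj₂ (cong suc e)
... | i , inj₂ e = suc i , inj₁ (trans (cong suc e) (sym (*-suc 2 i)))

2*-cancel-≤ : ∀ {i u} → 2 * i ≤ suc (2 * u) → i ≤ u
2*-cancel-≤ {i} {u} h = ≮⇒≥ λ lt → <-irrefl refl (≤-trans (≤-trans (≤-reflexive (sym (*-suc 2 u))) (*-monoʳ-≤ 2 lt)) h)

-- For odd k all the numbers k + 2t are odd, so the ends prolong only the odd run: the interval
-- takes u + 1 terms of each parity, and m odd ones follow.
Ends-odd : ∀ u m j → (Ends (suc (2 * u)) m j → Chains (suc u) (suc u + m) j) × (Chains (suc u) (suc u + m) j → Ends (suc (2 * u)) m j)
Ends-odd u m j = to , from
  where
  to : Ends (suc (2 * u)) m j → Chains (suc u) (suc u + m) j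
  to (inj₁ h) with parity j
  ... | i , inj₁ refl = inj₁ (i , s≤s (2*-cancel-≤ h) , refl)
  ... | i , inj₂ refl = inj₂ (i , ≤-trans (s≤s (*-cancelˡ-≤ 2 (≤-pred h))) (m≤m+n (suc u) m) , refl)
  to (inj₂ (t , t≥1 , t≤m , refl)) = inj₂ (u + t , s≤s (+-monoʳ-≤ u t≤m) , cong suc (sym (*-distribˡ-+ 2 u t)))
  from : Chains (suc u) (suc u + m) j → Ends (suc (2 * u)) m j
  from (inj₁ (i , lt , refl)) = inj₁ (≤-trans (*-monoʳ-≤ 2 (≤-pred lt)) (n≤1+n _))
  from (inj₂ (i , lt , refl)) with i ≤? u
  ... | yes h = inj₁ (s≤s (*-monoʳ-≤ 2 h))
  ... | no h = inj₂ (i ∸ u , m<n⇒0<n∸m (≰⇒> h) , ≤-trans (∸-monoˡ-≤ u (≤-pred lt)) (≤-reflexive (m+n∸m≡n u m)) ,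
      cong suc (trans (cong (2 *_) (sym (m+[n∸m]≡n (<⇒≤ (≰⇒> h))))) (*-distribˡ-+ 2 u (i ∸ u))))

Ends-even : ∀ v m j → (Ends (2 * v) m j → Chains (suc v + m) v j) × (Chains (suc v + m) v j → Ends (2 * v) m j)
Ends-even v m j = to , from
  where
  to : Ends (2 * v) m j → Chains (suc v + m) v j
  to (inj₁ h) with parity j
  ... | i , inj₁ refl = inj₁ (i , ≤-trans (s≤s (*-cancelˡ-≤ 2 h)) (m≤m+n (suc v) m) , refl)
  ... | i , inj₂ refl = inj₂ (i , *-cancelˡ-< 2 i v h , refl)
  to (inj₂ (t , t≥1 , t≤m , refl)) = inj₁ (v + t , s≤s (+-monoʳ-≤ v t≤m) , sym (*-distribˡ-+ 2 v t))
  from : Chains (suc v + m) v j → Ends (2 * v) m j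
  from (inj₁ (i , lt , refl)) with i ≤? v
  ... | yes h = inj₁ (*-monoʳ-≤ 2 h)
  ... | no h = inj₂ (i ∸ v , m<n⇒0<n∸m (≰⇒> h) , ≤-trans (∸-monoˡ-≤ v (≤-pred lt)) (≤-reflexive (m+n∸m≡n v m)) ,
      trans (cong (2 *_) (sym (m+[n∸m]≡n (<⇒≤ (≰⇒> h))))) (*-distribˡ-+ 2 v (i ∸ v)))
  from (inj₂ (i , lt , refl)) = inj₁ (≤-trans (n≤1+n _) (≤-trans (≤-reflexive (sym (*-suc 2 i))) (*-monoʳ-≤ 2 lt)))

Chains-equal : ∀ U j → (Chains U U j → j < 2 * U) × (j < 2 * U → Chains U U j)
Chains-equal U j = to , from
  where
  to : Chains U U j → j < 2 * U
  to (inj₁ (i , lt , refl)) = *-monoʳ-< 2 lt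
  to (inj₂ (i , lt , refl)) = ≤-trans (≤-reflexive (sym (*-suc 2 i))) (*-monoʳ-≤ 2 lt)
  from : j < 2 * U → Chains U U j
  from h with parity j
  ... | i , inj₁ refl = inj₁ (i , *-cancelˡ-< 2 i U h , refl)
  ... | i , inj₂ refl = inj₂ (i , *-cancelˡ-≤ 2 (≤-trans (≤-reflexive (*-suc 2 i)) h) , refl)

Chains-succ : ∀ V j → (Chains (suc V) V j → j < suc (2 * V)) × (j < suc (2 * V) → Chains (suc V) V j)
Chains-succ V j = to , from
  where
  to : Chains (suc V) V j → j < suc (2 * V)
  to (inj₁ (i , lt , refl)) = s≤s (*-monoʳ-≤ 2 (≤-pred lt))
  to (inj₂ (i , lt , refl)) = m≤n⇒m≤1+n (≤-trans (≤-reflexive (sym (*-suc 2 i))) (*-monoʳ-≤ 2 lt))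
  from : j < suc (2 * V) → Chains (suc V) V j
  from h with parity j
  ... | i , inj₁ refl = inj₁ (i , s≤s (*-cancelˡ-≤ 2 (≤-pred h)) , refl)
  ... | i , inj₂ refl = inj₂ (i , *-cancelˡ-< 2 i V (≤-pred h) , refl)

InInterval-pos : ∀ {k j} → j ≤ k → InInterval k (pos j) × InInterval k (ℤ.- pos j)
InInterval-pos {k} {j} h = (ℤP.≤-trans (ℤP.neg-mono-≤ (ℤ.+≤+ (z≤n {k}))) (ℤ.+≤+ z≤n) , ℤ.+≤+ h) , (ℤP.neg-mono-≤ (ℤ.+≤+ h) , ℤP.≤-trans (ℤP.neg-mono-≤ (ℤ.+≤+ (z≤n {j}))) (ℤ.+≤+ z≤n))

InInterval-elim : ∀ {k x} → InInterval k x → ∃ λ j → j ≤ k × (x ≡ pos j ⊎ x ≡ ℤ.- pos j)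
InInterval-elim {k} {pos j} (_ , h) = j , ℤP.drop‿+≤+ h , inj₁ refl
InInterval-elim {k} {ℤ.-[1+ j ]} (h , _) = suc j , ℤP.drop‿+≤+ (ℤP.≤-trans (ℤP.neg-mono-≤ h) (ℤP.≤-reflexive (ℤP.neg-involutive (pos k)))) , inj₂ refl

InE-intro : ∀ {k m j} → Ends k m j → InE k m (pos j) × InE k m (ℤ.- pos j)
InE-intro (inj₁ h) = inj₁ (proj₁ (InInterval-pos h)) , inj₁ (proj₂ (InInterval-pos h))
InE-intro (inj₂ (t , a , b , refl)) = inj₂ (t , a , b , inj₁ refl) , inj₂ (t , a , b , inj₂ refl)

InE-elim : ∀ {k m x} → InE k m x → ∃ λ j → Ends k m j × (x ≡ pos j ⊎ x ≡ ℤ.- pos j)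
InE-elim (inj₁ h) with InInterval-elim h
... | j , le , e = j , inj₁ le , e
InE-elim {k} (inj₂ (t , a , b , e)) = k + 2 * t , inj₂ (t , a , b , refl) , e

InF-intro⁺ : ∀ {k m j} → Ends k m j → InF k m (pos j)
InF-intro⁺ (inj₁ h) = inj₁ (proj₁ (InInterval-pos h))
InF-intro⁺ (inj₂ (t , a , b , refl)) = inj₂ (inj₁ (t , a , b , refl))

-- The negative side of F(k , m + 1) is one element shorter than the positive one, so its absolute
-- values are those of E(k , m).
InF-intro⁻ : ∀ {k m j} → Ends k m j → InF k (suc m) (ℤ.- pos j)
InF-intro⁻ (inj₁ h) = inj₁ (proj₂ (InInterval-pos h))
InF-intro⁻ (inj₂ (t , a , b , refl)) = inj₂ (inj₂ (t , a , ≤-trans (≤-reflexive (+-comm t 1)) (s≤s b) , refl))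

InF-elim : ∀ {k m x} → InF k (suc m) x → ∃ λ j → (Ends k (suc m) j × x ≡ pos j) ⊎ (Ends k m j × x ≡ ℤ.- pos j)
InF-elim (inj₁ h) with InInterval-elim h
... | j , le , inj₁ e = j , inj₁ (inj₁ le , e)
... | j , le , inj₂ e = j , inj₂ (inj₁ le , e)
InF-elim {k} (inj₂ (inj₁ (t , a , b , e))) = k + 2 * t , inj₁ (inj₂ (t , a , b , refl) , e)
InF-elim {k} (inj₂ (inj₂ (t , a , b , e))) = k + 2 * t , inj₂ (inj₂ (t , a , ≤-pred (≤-trans (≤-reflexive (+-comm 1 t)) b) , refl) , e)

threshold : (P : ℕ → Bool) → (∀ i → P (suc i) ≡ true → P i ≡ true) → ∀ N → P N ≡ false → ∃ λ u → (∀ i → P i ≡ true → i < u) × (∀ i → i < u → P i ≡ true)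
threshold P down zero e = 0 , (λ i h → true≢false (lower i h) e) , λ i ()
  where
  lower : ∀ i → P i ≡ true → P 0 ≡ true
  lower zero h = h
  lower (suc i) h = lower i (down i h)
threshold P down (suc N) e with P N in eN
... | false = threshold P down N eN
... | true = suc N , (λ i h → s≤s (≮⇒≥ λ lt → true≢false (lower i lt h) e)) , (λ i lt → raise N eN i (≤-pred lt))
  where
  lower : ∀ i {j} → j ≤ i → P i ≡ true → P j ≡ true
  lower i {j} le h with m≤n⇒m<n∨m≡n le
  ... | inj₂ refl = h
  lower (suc i) le h | inj₁ lt = lower i (≤-pred lt) (down i h)
  raise : ∀ N → P N ≡ true → ∀ i → i ≤ N → P i ≡ true
  raise N h i le = lower N le h

module Classification (A : List ℤ) (A! : Unique A) where
  open Line A A!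

  private
    l-at : ∀ y h j → y ℤ.+ (pos 1 ℤ.+ j) ℤ.* h ≡ (y ℤ.+ h) ℤ.+ j ℤ.* h
    l-at = ℤR.solve-∀

  at : ℤ → ℤ → ℕ → ℤ
  at y h j = y ℤ.+ pos j ℤ.* h

  -- The general form of an extremal set seen from its middle element y, with h the gap to the next
  -- one: on each side the even and the odd multiples of h form unbroken runs starting next to y,
  -- with lengths that may differ.
  record Description (y h : ℤ) (U V U' V' : ℕ) : Set where
    field
      to⁺ : ∀ {j} → Chains U V j → at y h j ∈ A
      to⁻ : ∀ {j} → Chains U' V' j → at y (ℤ.- h) j ∈ A
      from : ∀ {z} → z ∈ A → ∃ λ j → (Chains U V j × z ≡ at y h j) ⊎ (Chains U' V' j × z ≡ at y (ℤ.- h) j)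

  -- Records why h will be invertible modulo p: reduction is injective on `A`, so a difference of
  -- two distinct elements of `A` does not reduce to 0.
  Scale : ℤ → Set
  Scale h = h ≡ pos 1 ⊎ (∃ λ a → ∃ λ b → a ∈ A × b ∈ A × a ≢ b × h ≡ a ℤ.- b)

  -- A is the image of S under x ↦ y + (h / s) x.
  record AffineImage (S : ℤ → Set) : Set where
    field
      y h : ℤ
      s : ℕ
      s≡ : s ≡ 1 ⊎ s ≡ 2
      scale-h : Scale h
      into : ∀ {z} → z ∈ A → ∃ λ x → S x × pos s ℤ.* z ≡ pos s ℤ.* y ℤ.+ h ℤ.* x
      onto : ∀ {x} → S x → ∃ λ z → z ∈ A × pos s ℤ.* z ≡ pos s ℤ.* y ℤ.+ h ℤ.* x

  -- Exchange the roles of the two middle elements y and y + h.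
  flip : ∀ {y h U V U' V'} → Description y h (suc U) (suc V) (suc U') V' → Description (y ℤ.+ h) (ℤ.- h) (suc V') (suc U') (suc V) U
  flip {y} {h} {U} {V} {U'} {V'} D = record { to⁺ = to⁺' ; to⁻ = to⁻' ; from = from' }
    where
    open Description D
    2+ : ∀ i → 2 * suc i ≡ suc (suc (2 * i))
    2+ i = *-suc 2 i
    l₀ : ∀ y h → y ℤ.+ h ≡ y ℤ.+ h ℤ.+ pos 0 ℤ.* (ℤ.- h)
    l₀ = ℤR.solve-∀
    l₁ : ∀ y h → y ℤ.+ pos 1 ℤ.* h ≡ y ℤ.+ h
    l₁ = ℤR.solve-∀
    neg-shift : ∀ j → at y (ℤ.- h) j ≡ at (y ℤ.+ h) (ℤ.- h) (suc j)
    neg-shift j = lem y h (pos j)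
      where
      lem : ∀ y h j → y ℤ.+ j ℤ.* (ℤ.- h) ≡ y ℤ.+ h ℤ.+ (pos 1 ℤ.+ j) ℤ.* (ℤ.- h)
      lem = ℤR.solve-∀
    pos-shift : ∀ j → at y h (suc j) ≡ at (y ℤ.+ h) (ℤ.- (ℤ.- h)) j
    pos-shift j = trans (l-at y h (pos j)) (cong (λ w → (y ℤ.+ h) ℤ.+ pos j ℤ.* w) (sym (ℤP.neg-involutive h)))
    to⁺' : ∀ {j} → Chains (suc V') (suc U') j → at (y ℤ.+ h) (ℤ.- h) j ∈ A
    to⁺' (inj₁ (zero , _ , refl)) = subst (_∈ A) (trans (l₁ y h) (l₀ y h)) (to⁺ (inj₂ (0 , s≤s z≤n , refl)))
    to⁺' (inj₁ (suc i , lt , refl)) = subst (_∈ A) (trans (neg-shift (suc (2 * i))) (cong (at (y ℤ.+ h) (ℤ.- h)) (sym (2+ i)))) (to⁻ (inj₂ (i , ≤-pred lt , refl)))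
    to⁺' (inj₂ (i , lt , refl)) = subst (_∈ A) (neg-shift (2 * i)) (to⁻ (inj₁ (i , lt , refl)))
    to⁻' : ∀ {j} → Chains (suc V) U j → at (y ℤ.+ h) (ℤ.- (ℤ.- h)) j ∈ A
    to⁻' (inj₁ (i , lt , refl)) = subst (_∈ A) (pos-shift (2 * i)) (to⁺ (inj₂ (i , lt , refl)))
    to⁻' (inj₂ (i , lt , refl)) = subst (_∈ A) (pos-shift (suc (2 * i))) (to⁺ (inj₁ (suc i , s≤s lt , sym (2+ i))))
    from' : ∀ {z} → z ∈ A → ∃ λ j → (Chains (suc V') (suc U') j × z ≡ at (y ℤ.+ h) (ℤ.- h) j) ⊎ (Chains (suc V) U j × z ≡ at (y ℤ.+ h) (ℤ.- (ℤ.- h)) j)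
    from' m with from m
    ... | _ , inj₁ (inj₁ (zero , lt , refl) , e) = 1 , inj₁ (inj₂ (0 , s≤s z≤n , refl) , trans e (trans (lem y h) (neg-shift 0)))
      where
      lem : ∀ y h → y ℤ.+ pos 0 ℤ.* h ≡ y ℤ.+ pos 0 ℤ.* (ℤ.- h)
      lem = ℤR.solve-∀
    ... | _ , inj₁ (inj₁ (suc i , lt , refl) , e) = suc (2 * i) , inj₂ (inj₂ (i , ≤-pred lt , refl) , trans e (trans (cong (at y h) (2+ i)) (pos-shift (suc (2 * i)))))
    ... | _ , inj₁ (inj₂ (i , lt , refl) , e) = 2 * i , inj₂ (inj₁ (i , lt , refl) , trans e (pos-shift (2 * i)))
    ... | _ , inj₂ (inj₁ (i , lt , refl) , e) = suc (2 * i) , inj₁ (inj₂ (i , lt , refl) , trans e (neg-shift (2 * i)))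
    ... | _ , inj₂ (inj₂ (i , lt , refl) , e) = 2 * suc i , inj₁ (inj₁ (suc i , s≤s lt , refl) , trans e (trans (neg-shift (suc (2 * i))) (cong (at (y ℤ.+ h) (ℤ.- h)) (sym (2+ i)))))

  private
    one⁺ : ∀ y h j → pos 1 ℤ.* (y ℤ.+ j ℤ.* h) ≡ pos 1 ℤ.* y ℤ.+ h ℤ.* j
    one⁺ = ℤR.solve-∀
    one⁻' : ∀ y h j → pos 1 ℤ.* (y ℤ.+ j ℤ.* (ℤ.- h)) ≡ pos 1 ℤ.* y ℤ.+ h ℤ.* (ℤ.- j)
    one⁻' = ℤR.solve-∀
    two⁺ : ∀ y h j → pos 2 ℤ.* (y ℤ.+ j ℤ.* h) ≡ pos 2 ℤ.* y ℤ.+ h ℤ.* (pos 2 ℤ.* j)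
    two⁺ = ℤR.solve-∀
    two⁻ : ∀ y h j → pos 2 ℤ.* (y ℤ.+ j ℤ.* (ℤ.- h)) ≡ pos 2 ℤ.* y ℤ.+ h ℤ.* (ℤ.- (pos 2 ℤ.* j))
    two⁻ = ℤR.solve-∀

  symmetric⇒E : ∀ {y h U V k m} → Scale h → Description y h U V U V → (∀ j → (Ends k m j → Chains U V j) × (Chains U V j → Ends k m j)) → AffineImage (InE k m)
  symmetric⇒E {y} {h} {U} {V} {k} {m} sc D eq = record { y = y ; h = h ; s = 1 ; s≡ = inj₁ refl ; scale-h = sc ; into = into ; onto = onto }
    where
    open Description D
    into : ∀ {z} → z ∈ A → ∃ λ x → InE k m x × pos 1 ℤ.* z ≡ pos 1 ℤ.* y ℤ.+ h ℤ.* x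
    into mz with from mz
    ... | j , inj₁ (ch , refl) = pos j , proj₁ (InE-intro (proj₂ (eq j) ch)) , one⁺ y h (pos j)
    ... | j , inj₂ (ch , refl) = ℤ.- pos j , proj₂ (InE-intro (proj₂ (eq j) ch)) , one⁻' y h (pos j)
    onto : ∀ {x} → InE k m x → ∃ λ z → z ∈ A × pos 1 ℤ.* z ≡ pos 1 ℤ.* y ℤ.+ h ℤ.* x
    onto sx with InE-elim sx
    ... | j , en , inj₁ refl = at y h j , to⁺ (proj₁ (eq j) en) , one⁺ y h (pos j)
    ... | j , en , inj₂ refl = at y (ℤ.- h) j , to⁻ (proj₁ (eq j) en) , one⁻' y h (pos j)

  asymmetric⇒F : ∀ {y h U V U' V' k m} → Scale h → Description y h U V U' V' → (∀ j → (Ends k (suc m) j → Chains U V j) × (Chains U V j → Ends k (suc m) j)) →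
    (∀ j → (Ends k m j → Chains U' V' j) × (Chains U' V' j → Ends k m j)) → AffineImage (InF k (suc m))
  asymmetric⇒F {y} {h} {U} {V} {U'} {V'} {k} {m} sc D eq eq' = record { y = y ; h = h ; s = 1 ; s≡ = inj₁ refl ; scale-h = sc ; into = into ; onto = onto }
    where
    open Description D
    into : ∀ {z} → z ∈ A → ∃ λ x → InF k (suc m) x × pos 1 ℤ.* z ≡ pos 1 ℤ.* y ℤ.+ h ℤ.* x
    into mz with from mz
    ... | j , inj₁ (ch , refl) = pos j , InF-intro⁺ (proj₂ (eq j) ch) , one⁺ y h (pos j)
    ... | j , inj₂ (ch , refl) = ℤ.- pos j , InF-intro⁻ (proj₂ (eq' j) ch) , one⁻' y h (pos j)
    onto : ∀ {x} → InF k (suc m) x → ∃ λ z → z ∈ A × pos 1 ℤ.* z ≡ pos 1 ℤ.* y ℤ.+ h ℤ.* x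
    onto sx with InF-elim sx
    ... | j , inj₁ (en , refl) = at y h j , to⁺ (proj₁ (eq j) en) , one⁺ y h (pos j)
    ... | j , inj₂ (en , refl) = at y (ℤ.- h) j , to⁻ (proj₁ (eq' j) en) , one⁻' y h (pos j)

  -- An arithmetic progression of even length is F(0 , m) scaled by one half.
  progression⇒F : ∀ {y h U V U' V' m} → Scale h → Description y h U V U' V' → (∀ j → (Chains U V j → j < suc (suc m)) × (j < suc (suc m) → Chains U V j)) →
    (∀ j → (Chains U' V' j → j < suc m) × (j < suc m → Chains U' V' j)) → AffineImage (InF 0 (suc m))
  progression⇒F {y} {h} {U} {V} {U'} {V'} {m} sc D eq eq' = record { y = y ; h = h ; s = 2 ; s≡ = inj₂ refl ; scale-h = sc ; into = into ; onto = onto }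
    where
    open Description D
    ends : ∀ {j M} → j ≤ M → Ends 0 M (2 * j)
    ends {zero} le = inj₁ z≤n
    ends {suc j} le = inj₂ (suc j , s≤s z≤n , le , refl)
    unends : ∀ {i M} → Ends 0 M i → ∃ λ j → j ≤ M × i ≡ 2 * j
    unends (inj₁ z≤n) = 0 , z≤n , refl
    unends (inj₂ (t , _ , le , e)) = t , le , e
    two⁺' : ∀ j → pos 2 ℤ.* at y h j ≡ pos 2 ℤ.* y ℤ.+ h ℤ.* pos (2 * j)
    two⁺' j = trans (two⁺ y h (pos j)) (cong (λ w → pos 2 ℤ.* y ℤ.+ h ℤ.* w) (sym (ℤP.pos-* 2 j)))
    two⁻' : ∀ j → pos 2 ℤ.* at y (ℤ.- h) j ≡ pos 2 ℤ.* y ℤ.+ h ℤ.* (ℤ.- pos (2 * j))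
    two⁻' j = trans (two⁻ y h (pos j)) (cong (λ w → pos 2 ℤ.* y ℤ.+ h ℤ.* (ℤ.- w)) (sym (ℤP.pos-* 2 j)))
    into : ∀ {z} → z ∈ A → ∃ λ x → InF 0 (suc m) x × pos 2 ℤ.* z ≡ pos 2 ℤ.* y ℤ.+ h ℤ.* x
    into mz with from mz
    ... | j , inj₁ (ch , refl) = pos (2 * j) , InF-intro⁺ (ends (≤-pred (proj₁ (eq j) ch))) , two⁺' j
    ... | j , inj₂ (ch , refl) = ℤ.- pos (2 * j) , InF-intro⁻ (ends (≤-pred (proj₁ (eq' j) ch))) , two⁻' j
    onto : ∀ {x} → InF 0 (suc m) x → ∃ λ z → z ∈ A × pos 2 ℤ.* z ≡ pos 2 ℤ.* y ℤ.+ h ℤ.* x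
    onto sx with InF-elim sx
    ... | i , inj₁ (en , refl) with unends en
    ...   | j , le , refl = at y h j , to⁺ (proj₂ (eq j) (s≤s le)) , two⁺' j
    onto sx | i , inj₂ (en , refl) with unends en
    ...   | j , le , refl = at y (ℤ.- h) j , to⁻ (proj₂ (eq' j) (s≤s le)) , two⁻' j

  Classified : Set
  Classified = ∃ λ k → ∃ λ m → AffineImage (InE k m) ⊎ AffineImage (InF k m)

  Scale-neg : ∀ {a b} → a ∈ A → b ∈ A → a ≢ b → Scale (ℤ.- (a ℤ.- b))
  Scale-neg {a} {b} ma mb ne = inj₂ (b , a , mb , ma , (λ e → ne (sym e)) , lem a b)
    where
    lem : ∀ a b → ℤ.- (a ℤ.- b) ≡ b ℤ.- a
    lem = ℤR.solve-∀

  -- The longer parity class provides the ends and fixes the parity of k; the shorter one determines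
  -- where the interval stops.
  classify-E : ∀ {y h} U V → Scale h → Description y h (suc U) V (suc U) V → Classified
  classify-E U V sc D with V ≤? U
  ... | yes le = 2 * V , U ∸ V , inj₁ (symmetric⇒E sc D (subst (λ u → ∀ j → (Ends (2 * V) (U ∸ V) j → Chains (suc u) V j) × (Chains (suc u) V j → Ends (2 * V) (U ∸ V) j)) (m+[n∸m]≡n le) (Ends-even V (U ∸ V))))
  ... | no gt = suc (2 * U) , V ∸ suc U , inj₁ (symmetric⇒E sc D (subst (λ v → ∀ j → (Ends (suc (2 * U)) (V ∸ suc U) j → Chains (suc U) v j) × (Chains (suc U) v j → Ends (suc (2 * U)) (V ∸ suc U) j)) (m+[n∸m]≡n (≰⇒> gt)) (Ends-odd U (V ∸ suc U))))

  odd-long : ∀ {y h} U d → Scale h → Description y h (suc U) (suc (suc U + d)) (suc U) (suc U + d) → Classified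
  odd-long U d sc D = suc (2 * U) , suc d , inj₂ (asymmetric⇒F sc D (subst (λ v → ∀ j → (Ends (suc (2 * U)) (suc d) j → Chains (suc U) v j) × (Chains (suc U) v j → Ends (suc (2 * U)) (suc d) j)) (+-suc (suc U) d) (Ends-odd U (suc d))) (Ends-odd U d))

  even-long : ∀ {y h} V d → Scale h → Description y h (suc (suc V + d)) V (suc V + d) V → Classified
  even-long V d sc D = 2 * V , suc d , inj₂ (asymmetric⇒F sc D (subst (λ u → ∀ j → (Ends (2 * V) (suc d) j → Chains u V j) × (Chains u V j → Ends (2 * V) (suc d) j)) (+-suc (suc V) d) (Ends-even V (suc d))) (Ends-even V d))

  -- The unmatched element sits at an odd position. If the odd class is the longer one, this is F
  -- about y; if the classes end together, a progression of even length. Otherwise the two classes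
  -- change places when seen from the other middle element.
  classify-odd : ∀ {y h} U V → Scale h → Scale (ℤ.- h) → Description y h (suc U) (suc V) (suc U) V → Classified
  classify-odd U V sc sc' D with <-cmp U V
  ... | tri< lt _ _ = odd-long U (V ∸ suc U) sc (subst (λ v → Description _ _ (suc U) (suc v) (suc U) v) (sym (m+[n∸m]≡n lt)) D)
  ... | tri≈ _ refl _ = 0 , suc (2 * U) , inj₂ (progression⇒F sc D (λ j → (λ c → ≤-trans (proj₁ (Chains-equal (suc U) j) c) (≤-reflexive (*-suc 2 U))) , (λ c → proj₂ (Chains-equal (suc U) j) (≤-trans c (≤-reflexive (sym (*-suc 2 U)))))) (Chains-succ U))
  ... | tri> _ _ gt = odd-long V (U ∸ suc V) sc' (subst (λ u → Description _ _ (suc V) (suc u) (suc V) u) (sym (m+[n∸m]≡n gt)) (flip D))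

  classify-even : ∀ {y h} U V → Scale h → Scale (ℤ.- h) → Description y h (suc (suc U)) (suc V) (suc U) (suc V) → Classified
  classify-even U V sc sc' D with <-cmp V U
  ... | tri< lt _ _ = even-long (suc V) (U ∸ suc V) sc (subst (λ u → Description _ _ (suc (suc u)) (suc V) (suc u) (suc V)) (sym (m+[n∸m]≡n lt)) D)
  ... | tri≈ _ refl _ = 0 , suc (suc (2 * U)) , inj₂ (progression⇒F sc D (λ j → (λ c → ≤-trans (proj₁ (Chains-succ (suc U) j) c) (≤-reflexive (cong suc (*-suc 2 U)))) , (λ c → proj₂ (Chains-succ (suc U) j) (≤-trans c (≤-reflexive (cong suc (sym (*-suc 2 U)))))))
        (λ j → (λ c → ≤-trans (proj₁ (Chains-equal (suc U) j) c) (≤-reflexive (*-suc 2 U))) , (λ c → proj₂ (Chains-equal (suc U) j) (≤-trans c (≤-reflexive (sym (*-suc 2 U)))))))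
  ... | tri> _ _ gt = even-long (suc U) (V ∸ suc U) sc' (subst (λ v → Description _ _ (suc (suc v)) (suc U) (suc v) (suc U)) (sym (m+[n∸m]≡n gt)) (flip D))

∑-two : ∀ {X : Set} {xs : List X} (b : X → Bool) {x y} → x ∈ xs → y ∈ xs → x ≢ y → b x ≡ true → b y ≡ true → 2 ≤ ∑ xs (λ x → ⟦ b x ⟧)
∑-two b (here refl) (here refl) ne ex ey = ⊥-elim (ne refl)
∑-two b (here refl) (there my) ne ex ey rewrite ex = s≤s (≤-trans (≤-reflexive (sym (cong ⟦_⟧ ey))) (∑-term my (λ x → ⟦ b x ⟧)))
∑-two b (there mx) (here refl) ne ex ey rewrite ey = s≤s (≤-trans (≤-reflexive (sym (cong ⟦_⟧ ex))) (∑-term mx (λ x → ⟦ b x ⟧)))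
∑-two b {x} {y} (there {x = w} mx) (there my) ne ex ey = ≤-trans (∑-two b mx my ne ex ey) (m≤n+m _ ⟦ b w ⟧)

double≢odd : ∀ {i j} → 2 * i ≢ suc (2 * j)
double≢odd {i} {j} e = <⇒≱ lt (≤-trans (2*-cancel-≤ {i} {j} (≤-reflexive e)) ≤-refl)
  where
  lt : j < i
  lt = *-cancelˡ-< 2 j i (≤-reflexive (sym e))

positive : ∀ {y z} → y ℤ.< z → ∃ λ k → z ≡ y ℤ.+ pos (suc k)
positive {y} {z} lt = go (z ℤ.- y) refl (subst (ℤ._< z ℤ.- y) (ℤP.+-inverseʳ y) (ℤP.+-monoˡ-< (ℤ.- y) lt))
  where
  l : ∀ y z → z ≡ y ℤ.+ (z ℤ.- y)
  l = ℤR.solve-∀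
  go : ∀ d → z ℤ.- y ≡ d → pos 0 ℤ.< d → ∃ λ k → z ≡ y ℤ.+ pos (suc k)
  go (pos (suc k)) e _ = k , trans (l y z) (cong (λ w → y ℤ.+ w) e)
  go (pos zero) e (ℤ.+<+ ())
  go ℤ.-[1+ k ] e ()

module Extremizers (A : List ℤ) (A! : Unique A) (extremal : half-square (length A) ≤ Line.T A A!) where
  open Line A A!
  open Extremal extremal
  open Classification A A!

  adjacent-< : ∀ {y z} → y ∈ A → z ∈ A → L y < L z → y ℤ.< z
  adjacent-< {y} {z} my mz lt' with ℤP.<-cmp y z
  ... | tri< a _ _ = a
  ... | tri≈ _ refl _ = ⊥-elim (<-irrefl refl lt')
  ... | tri> _ _ a = ⊥-elim (<-asym lt' (L-mono mz a))

  -- For neighbours y₀ < y₁ chosen in this way, everything below y₀ reflects in y₀ and everything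
  -- above y₁ reflects in y₁. The two reflections together translate by 2h, which forces the runs.
  module Middle (y₀ y₁ : ℤ) (m₀ : y₀ ∈ A) (m₁ : y₁ ∈ A) (next : L y₁ ≡ suc (L y₀)) (left : L y₀ ≤ R y₀) (right : R y₁ ≤ L y₁) where

    y₀<y₁ : y₀ ℤ.< y₁
    y₀<y₁ = adjacent-< m₀ m₁ (≤-reflexive (sym next))

    k : ℕ
    k = proj₁ (positive y₀<y₁)

    y₁≡ : y₁ ≡ y₀ ℤ.+ pos (suc k)
    y₁≡ = proj₂ (positive y₀<y₁)

    h : ℤ
    h = pos (suc k)

    gap : ∀ {w} → w ∈ A → w ℤ.< y₁ → w ℤ.≤ y₀
    gap {w} mw w<y₁ = ℤP.≮⇒≥ λ y₀<w → <-irrefl refl (≤-trans (s≤s (L-mono m₀ y₀<w)) (≤-trans (L-mono mw w<y₁) (≤-reflexive next)))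

    pt : ℕ → ℤ
    pt = at y₀ h

    pt-≡ : ∀ j → pt j ≡ y₀ ℤ.+ pos (j * suc k)
    pt-≡ j = cong (λ w → y₀ ℤ.+ w) (sym (ℤP.pos-* j (suc k)))

    pt-0 : pt 0 ≡ y₀
    pt-0 = trans (pt-≡ 0) (ℤP.+-identityʳ y₀)

    pt-1 : pt 1 ≡ y₁
    pt-1 = trans (pt-≡ 1) (trans (cong (λ w → y₀ ℤ.+ pos w) (*-identityˡ (suc k))) (sym y₁≡))

    pt-mono : ∀ {i j} → i < j → pt i ℤ.< pt j
    pt-mono {i} {j} lt' = subst₂ ℤ._<_ (sym (pt-≡ i)) (sym (pt-≡ j)) (ℤP.+-monoʳ-< y₀ (ℤ.+<+ (*-monoˡ-< (suc k) {{_}} {i} {j} lt')))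

    pt-inj : ∀ {i j} → pt i ≡ pt j → i ≡ j
    pt-inj {i} {j} e with <-cmp i j
    ... | tri< a _ _ = ⊥-elim (ℤP.<-irrefl e (pt-mono a))
    ... | tri≈ _ b _ = b
    ... | tri> _ _ a = ⊥-elim (ℤP.<-irrefl (sym e) (pt-mono a))

    pt-above : ∀ j → y₀ ℤ.< pt (suc j)
    pt-above j = subst (ℤ._< pt (suc j)) pt-0 (pt-mono {0} {suc j} (s≤s z≤n))

    mirror-pt : ∀ j → mirror y₀ (pt j) ≡ at y₀ (ℤ.- h) j
    mirror-pt j = lem y₀ h (pos j)
      where
      lem : ∀ y h j → pos 2 ℤ.* y ℤ.- (y ℤ.+ j ℤ.* h) ≡ y ℤ.+ j ℤ.* (ℤ.- h)
      lem = ℤR.solve-∀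

    reflect : ∀ {x} → x ∈ A → x ℤ.< y₀ → mirror y₀ x ∈ A
    reflect = reflect-left m₀ left

    -- Reflect in y₁ and then in y₀.
    lower : ∀ {z} → z ∈ A → y₁ ℤ.< z → (z ℤ.- pos 2 ℤ.* h) ∈ A × y₀ ℤ.≤ z ℤ.- pos 2 ℤ.* h
    lower {z} mz lt' = subst (λ u → u ∈ A × y₀ ℤ.≤ u) eq (both (ℤP.<-cmp w y₀))
      where
      w = mirror y₁ z
      mw : w ∈ A
      mw = reflect-right m₁ right mz lt'
      w≤ : w ℤ.≤ y₀
      w≤ = gap mw (mirror-> lt')
      lem : ∀ y h z → pos 2 ℤ.* y ℤ.- (pos 2 ℤ.* (y ℤ.+ h) ℤ.- z) ≡ z ℤ.- pos 2 ℤ.* h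
      lem = ℤR.solve-∀
      lem' : ∀ y → pos 2 ℤ.* y ℤ.- y ≡ y
      lem' = ℤR.solve-∀
      eq : mirror y₀ w ≡ z ℤ.- pos 2 ℤ.* h
      eq = trans (cong (λ y → mirror y₀ (mirror y z)) y₁≡) (lem y₀ h z)
      both : Tri (w ℤ.< y₀) (w ≡ y₀) (y₀ ℤ.< w) → mirror y₀ w ∈ A × y₀ ℤ.≤ mirror y₀ w
      both (tri< a _ _) = reflect mw a , ℤP.<⇒≤ (mirror-< a)
      both (tri≈ _ b _) = subst (_∈ A) (sym e) m₀ , ℤP.≤-reflexive (sym e)
        where
        e : mirror y₀ w ≡ y₀
        e = trans (cong (mirror y₀) b) (lem' y₀)
      both (tri> _ _ c) = ⊥-elim (ℤP.<⇒≱ c w≤)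

    descend : ∀ j {z} → z ℤ.- pos 2 ℤ.* h ≡ pt j → z ≡ pt (suc (suc j))
    descend j {z} e = trans (lem z h) (trans (cong (λ w → w ℤ.+ pos 2 ℤ.* h) e) (lem' y₀ h (pos j)))
      where
      lem : ∀ z h → z ≡ z ℤ.- pos 2 ℤ.* h ℤ.+ pos 2 ℤ.* h
      lem = ℤR.solve-∀
      lem' : ∀ y h j → y ℤ.+ j ℤ.* h ℤ.+ pos 2 ℤ.* h ≡ y ℤ.+ (pos 1 ℤ.+ (pos 1 ℤ.+ j)) ℤ.* h
      lem' = ℤR.solve-∀

    chain : ∀ j → pt (suc (suc j)) ∈ A → pt j ∈ A
    chain j m = subst (_∈ A) (lem y₀ h (pos j)) (proj₁ (lower m (subst (ℤ._< pt (suc (suc j))) pt-1 (pt-mono {1} {suc (suc j)} (s≤s (s≤s z≤n))))))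
      where
      lem : ∀ y h j → y ℤ.+ (pos 1 ℤ.+ (pos 1 ℤ.+ j)) ℤ.* h ℤ.- pos 2 ℤ.* h ≡ y ℤ.+ j ℤ.* h
      lem = ℤR.solve-∀

    -- Descending by 2h stays in `A` and never passes below y₀; as `A` has no element between y₀ and
    -- y₁, the descent ends at one of these two. The number f is fuel: it bounds the height above
    -- y₀.
    on-grid : ∀ f {z} → z ∈ A → y₀ ℤ.< z → z ℤ.≤ y₀ ℤ.+ pos f → ∃ λ j → z ≡ pt (suc j)
    on-grid zero mz lt' le = ⊥-elim (ℤP.<⇒≱ lt' (ℤP.≤-trans le (ℤP.≤-reflexive (ℤP.+-identityʳ y₀))))
    on-grid (suc f) {z} mz lt' le with ℤP.<-cmp z y₁
    ... | tri< a _ _ = ⊥-elim (ℤP.<⇒≱ lt' (gap mz a))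
    ... | tri≈ _ refl _ = 0 , sym pt-1
    ... | tri> _ _ c with ℤP.<-cmp y₀ (z ℤ.- pos 2 ℤ.* h)
    ...   | tri> _ _ c' = ⊥-elim (ℤP.<⇒≱ c' (proj₂ (lower mz c)))
    ...   | tri≈ _ b _ = 1 , descend 0 (trans (sym b) (sym pt-0))
    ...   | tri< a _ _ = let (j , e) = on-grid f (proj₁ (lower mz c)) a small in suc (suc j) , descend (suc j) e
      where
      lem : ∀ z h → z ℤ.- pos 2 ℤ.* h ℤ.+ (pos 2 ℤ.* h) ≡ z
      lem = ℤR.solve-∀
      less : z ℤ.- pos 2 ℤ.* h ℤ.< z
      less = subst (z ℤ.- pos 2 ℤ.* h ℤ.<_) (lem z h) (subst (ℤ._< z ℤ.- pos 2 ℤ.* h ℤ.+ pos 2 ℤ.* h) (ℤP.+-identityʳ _) (ℤP.+-monoʳ-< (z ℤ.- pos 2 ℤ.* h) (ℤ.+<+ (s≤s z≤n))))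
      lem' : ∀ y f → ℤ.-1ℤ ℤ.+ (y ℤ.+ (pos 1 ℤ.+ f)) ≡ y ℤ.+ f
      lem' = ℤR.solve-∀
      small : z ℤ.- pos 2 ℤ.* h ℤ.≤ y₀ ℤ.+ pos f
      small = ℤP.≤-trans (ℤP.i<j⇒i≤pred[j] (ℤP.<-≤-trans less le)) (ℤP.≤-reflexive (lem' y₀ (pos f)))

    -- Any common bound for the distances to y₀ would serve; the sum spares a maximum over the list.
    bound : ℕ
    bound = ∑ A (λ z → ⌊ z ℤ.- y₀ ⌋)

    i≤∣i∣ : ∀ i → i ℤ.≤ pos ⌊ i ⌋
    i≤∣i∣ (pos n) = ℤP.≤-refl
    i≤∣i∣ ℤ.-[1+ n ] = ℤ.-≤+

    bounded : ∀ {z} → z ∈ A → z ℤ.≤ y₀ ℤ.+ pos bound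
    bounded {z} mz = ℤP.≤-trans (ℤP.≤-reflexive (lem y₀ z)) (ℤP.+-monoʳ-≤ y₀ (ℤP.≤-trans (i≤∣i∣ (z ℤ.- y₀)) (ℤ.+≤+ (∑-term mz (λ z → ⌊ z ℤ.- y₀ ⌋)))))
      where
      lem : ∀ y z → z ≡ y ℤ.+ (z ℤ.- y)
      lem = ℤR.solve-∀

    far-out : ∀ j → bound < j → mem (pt j) ≡ false
    far-out j lt' = dec-false (pt j ∈ℤ? A) (λ m → <⇒≱ (<-≤-trans lt' (m≤m*n j (suc k))) (ℤP.drop‿+≤+ (cancel (ℤP.≤-trans (ℤP.≤-reflexive (sym (pt-≡ j))) (bounded m)))))
      where
      cancel : ∀ {a b} → y₀ ℤ.+ a ℤ.≤ y₀ ℤ.+ b → a ℤ.≤ b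
      cancel {a} {b} le = subst₂ ℤ._≤_ (lem y₀ a) (lem y₀ b) (ℤP.+-monoʳ-≤ (ℤ.- y₀) le)
        where
        lem : ∀ y a → ℤ.- y ℤ.+ (y ℤ.+ a) ≡ a
        lem = ℤR.solve-∀

    evens odds : ℕ → Bool
    evens i = mem (pt (2 * i))
    odds i = mem (pt (suc (2 * i)))

    even-threshold : ∃ λ u → (∀ i → evens i ≡ true → i < u) × (∀ i → i < u → evens i ≡ true)
    even-threshold = threshold evens (λ i e → ∈-mem (chain (2 * i) (subst (λ w → pt w ∈ A) (*-suc 2 i) (mem-∈ e)))) (suc bound) (far-out (2 * suc bound) (m≤n*m (suc bound) 2))

    odd-threshold : ∃ λ v → (∀ i → odds i ≡ true → i < v) × (∀ i → i < v → odds i ≡ true)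
    odd-threshold = threshold odds (λ i e → ∈-mem (chain (suc (2 * i)) (subst (λ w → pt (suc w) ∈ A) (*-suc 2 i) (mem-∈ e)))) (suc bound) (far-out (suc (2 * suc bound)) (m≤n⇒m≤1+n (m≤n*m (suc bound) 2)))

    module Thresholds (U V : ℕ) (U⁺ : ∀ i → evens i ≡ true → i < U) (U⁻ : ∀ i → i < U → evens i ≡ true)
                      (V⁺ : ∀ i → odds i ≡ true → i < V) (V⁻ : ∀ i → i < V → odds i ≡ true) where

      in-A : ∀ {j} → Chains U V j → pt j ∈ A
      in-A (inj₁ (i , lt' , refl)) = mem-∈ (U⁻ i lt')
      in-A (inj₂ (i , lt' , refl)) = mem-∈ (V⁻ i lt')

      in-chains : ∀ {j} → pt j ∈ A → Chains U V j
      in-chains {j} m with parity j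
      ... | i , inj₁ refl = inj₁ (i , U⁺ i (∈-mem m) , refl)
      ... | i , inj₂ refl = inj₂ (i , V⁺ i (∈-mem m) , refl)

      U≥1 : 0 < U
      U≥1 = U⁺ 0 (∈-mem (subst (_∈ A) (sym pt-0) m₀))

      V≥1 : 0 < V
      V≥1 = V⁺ 0 (∈-mem (subst (_∈ A) (sym pt-1) m₁))

      above : ∀ {z} → z ∈ A → y₀ ℤ.≤ z → ∃ λ j → Chains U V j × z ≡ pt j
      above {z} mz le with ℤP.<-cmp y₀ z
      ... | tri< a _ _ = let (j , e) = on-grid bound mz a (bounded mz) in suc j , in-chains (subst (_∈ A) e mz) , e
      ... | tri≈ _ refl _ = 0 , in-chains (subst (_∈ A) (sym pt-0) m₀) , sym pt-0
      ... | tri> _ _ c = ⊥-elim (ℤP.<⇒≱ c le)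

      build : ∀ U' V' → (∀ {j} → Chains U' V' j → mirror y₀ (pt j) ∈ A) → (∀ {j} → Chains U V j → mirror y₀ (pt j) ∈ A → Chains U' V' j) → Description y₀ h U V U' V'
      build U' V' to back = record { to⁺ = in-A ; to⁻ = λ {j} c → subst (_∈ A) (mirror-pt j) (to c) ; from = from }
        where
        from : ∀ {z} → z ∈ A → ∃ λ j → (Chains U V j × z ≡ at y₀ h j) ⊎ (Chains U' V' j × z ≡ at y₀ (ℤ.- h) j)
        from {z} mz with y₀ ℤP.≤? z
        ... | yes le = let (j , c , e) = above mz le in j , inj₁ (c , e)
        ... | no gt' = let (j , c , e) = above (reflect mz z<y₀) (ℤP.<⇒≤ (mirror-< z<y₀))
                           z≡ = trans (sym (mirror-invol y₀ z)) (cong (mirror y₀) e)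
                       in j , inj₂ (back c (subst (_∈ A) z≡ mz) , trans z≡ (mirror-pt j))
          where
          z<y₀ = ℤP.≰⇒> gt'

      mirror-y₀ : mirror y₀ (pt 0) ∈ A
      mirror-y₀ = subst (_∈ A) (sym (trans (cong (mirror y₀) pt-0) (lem y₀))) m₀
        where
        lem : ∀ y → pos 2 ℤ.* y ℤ.- y ≡ y
        lem = ℤR.solve-∀

    scale-h : Scale h
    scale-h = inj₂ (y₁ , y₀ , m₁ , m₀ , (λ e → ℤP.<-irrefl (sym e) y₀<y₁) , sym (trans (cong (ℤ._- y₀) y₁≡) (lem y₀ h)))
      where
      lem : ∀ y h → y ℤ.+ h ℤ.- y ≡ h
      lem = ℤR.solve-∀

    scale--h : Scale (ℤ.- h)
    scale--h = subst Scale (cong ℤ.-_ (trans (cong (ℤ._- y₀) y₁≡) (lem y₀ h))) (Scale-neg m₁ m₀ (λ e → ℤP.<-irrefl (sym e) y₀<y₁))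
      where
      lem : ∀ y h → y ℤ.+ h ℤ.- y ≡ h
      lem = ℤR.solve-∀

    -- Both inequalities hold at y₀, so `A` is symmetric about y₀ and is determined by the two runs
    -- of its right half.
    symmetric-case : R y₀ ≤ L y₀ → Classified
    symmetric-case balanced = go even-threshold odd-threshold
      where
      go : (∃ λ u → (∀ i → evens i ≡ true → i < u) × (∀ i → i < u → evens i ≡ true)) → (∃ λ v → (∀ i → odds i ≡ true → i < v) × (∀ i → i < v → odds i ≡ true)) → Classified
      go (U , U⁺ , U⁻) (V , V⁺ , V⁻) = finish U refl
        where
        open Thresholds U V U⁺ U⁻ V⁺ V⁻
        to : ∀ {j} → Chains U V j → mirror y₀ (pt j) ∈ A
        to {zero} c = mirror-y₀
        to {suc j} c = reflect-right m₀ balanced (in-A c) (pt-above j)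
        finish : ∀ u → U ≡ u → Classified
        finish zero refl = ⊥-elim (n≮0 U≥1)
        finish (suc u) refl = classify-E u V scale-h (build U V to (λ c _ → c))

    -- Exactly one element above y₀ has no mirror image, and it is the top of its parity class.
    asymmetric-case : R y₀ ≡ suc (L y₀) → Classified
    asymmetric-case unbalanced = go even-threshold odd-threshold
      where
      missing : ℤ → Bool
      missing x = gt y₀ x ∧ not (mem (mirror y₀ x))

      missing-intro : ∀ {x} → y₀ ℤ.< x → mem (mirror y₀ x) ≡ false → missing x ≡ true
      missing-intro {x} lt' e = ∧-intro (gt-true {y₀} {x} lt') (cong not e)

      one-missing : ∑ A (λ x → ⟦ missing x ⟧) ≡ 1
      one-missing = +-cancelˡ-≡ (r y₀) _ _ (trans (trans (sym (∑-+ A (λ x → ⟦ gt y₀ x ⟧ * ⟦ mem (mirror y₀ x) ⟧) (λ x → ⟦ missing x ⟧))) (∑-cong A (λ x → split (gt y₀ x) (mem (mirror y₀ x))))) (trans (r-even m₀ unbalanced) (+-comm 1 (r y₀))))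
        where
        split : ∀ a b → ⟦ a ⟧ * ⟦ b ⟧ + ⟦ a ∧ not b ⟧ ≡ ⟦ a ⟧
        split true true = refl
        split true false = refl
        split false b = refl

      go : (∃ λ u → (∀ i → evens i ≡ true → i < u) × (∀ i → i < u → evens i ≡ true)) → (∃ λ v → (∀ i → odds i ≡ true → i < v) × (∀ i → i < v → odds i ≡ true)) → Classified
      go (U , U⁺ , U⁻) (V , V⁺ , V⁻) = exceptional (∑-<-pick A {λ _ → 0} {λ x → ⟦ missing x ⟧} (≤-trans (s≤s (≤-reflexive (∑-zero A))) (≤-reflexive (sym one-missing))))
        where
        open Thresholds U V U⁺ U⁻ V⁺ V⁻
        exceptional : (∃ λ x → x ∈ A × 0 < ⟦ missing x ⟧) → Classified
        exceptional (e , me , q) = locate (above me (ℤP.<⇒≤ y₀<e))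
          where
          pos⇒true : ∀ {b} → 1 ≤ ⟦ b ⟧ → b ≡ true
          pos⇒true {true} _ = refl
          missing-e : missing e ≡ true
          missing-e = pos⇒true q
          y₀<e : y₀ ℤ.< e
          y₀<e = does⇒ (y₀ ℤP.<? e) (proj₁ (∧-true {gt y₀ e} missing-e))
          e∉ : ¬ mirror y₀ e ∈ A
          e∉ m = true≢false (∈-mem m) (not-true (proj₂ (∧-true {gt y₀ e} missing-e)))
          only : ∀ {x} → x ∈ A → y₀ ℤ.< x → x ≢ e → mirror y₀ x ∈ A
          only {x} mx lt' ne = pick (mem (mirror y₀ x)) refl
            where
            pick : ∀ b → mem (mirror y₀ x) ≡ b → mirror y₀ x ∈ A
            pick true eq = mem-∈ eq
            pick false eq = ⊥-elim (<⇒≱ (∑-two missing mx me ne (missing-intro lt' eq) missing-e) (≤-reflexive one-missing))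
          to : ∀ {j₀} → e ≡ pt j₀ → ∀ {j} → Chains U V j → j ≢ j₀ → mirror y₀ (pt j) ∈ A
          to e≡ {zero} c ne = mirror-y₀
          to e≡ {suc j} c ne = only (in-A c) (pt-above j) (λ eq → ne (pt-inj (trans eq e≡)))
          -- The reflection of position j₀ + 2 in y₁ is the reflection of position j₀ in y₀, which
          -- is exactly the missing point.
          top : ∀ {j₀} → e ≡ pt j₀ → ¬ pt (suc (suc j₀)) ∈ A
          top {j₀} refl m = e∉ (subst (_∈ A) (trans (cong (λ y → mirror y (pt (suc (suc j₀)))) y₁≡) (lem y₀ h (pos j₀))) (reflect-right m₁ right m (subst (ℤ._< pt (suc (suc j₀))) pt-1 (pt-mono {1} {suc (suc j₀)} (s≤s (s≤s z≤n))))))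
            where
            lem : ∀ y h j → pos 2 ℤ.* (y ℤ.+ h) ℤ.- (y ℤ.+ (pos 1 ℤ.+ (pos 1 ℤ.+ j)) ℤ.* h) ≡ pos 2 ℤ.* y ℤ.- (y ℤ.+ j ℤ.* h)
            lem = ℤR.solve-∀
          locate : (∃ λ j → Chains U V j × e ≡ pt j) → Classified
          locate (_ , inj₁ (zero , lt' , refl) , e≡) = ⊥-elim (ℤP.<-irrefl (sym (trans e≡ pt-0)) y₀<e)
          locate (_ , inj₁ (suc a , lt' , refl) , e≡) = finish U V refl refl (≤-antisym top-U lt') V≥1
            where
            top-U : U ≤ suc (suc a)
            top-U = ≮⇒≥ λ more → top {2 * suc a} e≡ (subst (λ w → pt w ∈ A) (*-suc 2 (suc a)) (in-A (inj₁ (suc (suc a) , more , refl))))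
            finish : ∀ u v → U ≡ u → V ≡ v → u ≡ suc (suc a) → 0 < v → Classified
            finish _ (suc v) refl refl refl _ = classify-even a v scale-h scale--h (build (suc a) (suc v) to' back)
              where
              to' : ∀ {j} → Chains (suc a) (suc v) j → mirror y₀ (pt j) ∈ A
              to' (inj₁ (i , lt , refl)) = to e≡ (inj₁ (i , m<n⇒m<1+n lt , refl)) (λ eq → <⇒≢ lt (*-cancelˡ-≡ i (suc a) 2 eq))
              to' (inj₂ (i , lt , refl)) = to e≡ (inj₂ (i , lt , refl)) (λ eq → double≢odd {suc a} {i} (sym eq))
              back : ∀ {j} → Chains (suc (suc a)) (suc v) j → mirror y₀ (pt j) ∈ A → Chains (suc a) (suc v) j
              back (inj₁ (i , lt , refl)) m = inj₁ (i , ≤∧≢⇒< (≤-pred lt) (λ { refl → e∉ (subst (λ w → mirror y₀ w ∈ A) (sym e≡) m) }) , refl)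
              back (inj₂ c) m = inj₂ c
          locate (_ , inj₂ (a , lt' , refl) , e≡) = finish U V refl refl (≤-antisym top-V lt') U≥1
            where
            top-V : V ≤ suc a
            top-V = ≮⇒≥ λ more → top {suc (2 * a)} e≡ (subst (λ w → pt (suc w) ∈ A) (*-suc 2 a) (in-A (inj₂ (suc a , more , refl))))
            finish : ∀ u v → U ≡ u → V ≡ v → v ≡ suc a → 0 < u → Classified
            finish (suc u) _ refl refl refl _ = classify-odd u a scale-h scale--h (build (suc u) a to' back)
              where
              to' : ∀ {j} → Chains (suc u) a j → mirror y₀ (pt j) ∈ A
              to' (inj₁ (i , lt , refl)) = to e≡ (inj₁ (i , lt , refl)) (double≢odd {i} {a})
              to' (inj₂ (i , lt , refl)) = to e≡ (inj₂ (i , m<n⇒m<1+n lt , refl)) (λ eq → <⇒≢ lt (*-cancelˡ-≡ i a 2 (suc-injective eq)))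
              back : ∀ {j} → Chains (suc u) (suc a) j → mirror y₀ (pt j) ∈ A → Chains (suc u) a j
              back (inj₁ c) m = inj₁ c
              back (inj₂ (i , lt , refl)) m = inj₂ (i , ≤∧≢⇒< (≤-pred lt) (λ { refl → e∉ (subst (λ w → mirror y₀ w ∈ A) (sym e≡) m) }) , refl)

  R-at : ∀ {y i} → y ∈ A → L y ≡ i → R y ≡ n ∸ suc i
  R-at my refl = R≡ my

  classified : 1 ≤ n → Classified
  classified n≥1 = go n (parity n) refl n≥1
    where
    -- A single element has no neighbour to define a gap, so h is taken to be 1.
    singleton : n ≡ 1 → Classified
    singleton e = from-point (at-rank (≤-reflexive (sym e)))
      where
      from-point : (∃ λ y → y ∈ A × L y ≡ 0) → Classified
      from-point (y , my , ly) = classify-E {y} {pos 1} 0 0 (inj₁ refl) (record { to⁺ = to {pos 1} ; to⁻ = to {ℤ.- pos 1} ; from = from })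
        where
        to : ∀ {h j} → Chains 1 0 j → at y h j ∈ A
        to {h} (inj₁ (zero , _ , refl)) = subst (_∈ A) (lem y h) my
          where
          lem : ∀ y h → y ≡ y ℤ.+ pos 0 ℤ.* h
          lem = ℤR.solve-∀
        to (inj₁ (suc i , s≤s () , _))
        from : ∀ {z} → z ∈ A → ∃ λ j → (Chains 1 0 j × z ≡ at y (pos 1) j) ⊎ (Chains 1 0 j × z ≡ at y (ℤ.- pos 1) j)
        from {z} mz = 0 , inj₁ (inj₁ (0 , s≤s z≤n , refl) , trans (L-inj mz my (trans (n<1⇒n≡0 (≤-trans (L<n mz) (≤-reflexive e))) (sym ly))) (sym (ℤP.+-identityʳ y)))
    go : ∀ m → (∃ λ i → m ≡ 2 * i ⊎ m ≡ suc (2 * i)) → n ≡ m → 1 ≤ m → Classified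
    go _ (zero , inj₁ refl) e ()
    go _ (zero , inj₂ refl) e _ = singleton e
    -- n = 2i + 2: the middle elements have ranks i and i + 1, and y₀ has one element more above it
    -- than below.
    go _ (suc i , inj₁ refl) e _ = from-points (at-rank {i} (≤-trans (m≤n*m (suc i) 2) (≤-reflexive (sym e)))) (at-rank {suc i} (≤-trans (two≤ i) (≤-reflexive (sym e))))
      where
      two≤ : ∀ i → suc (suc i) ≤ 2 * suc i
      two≤ i = ≤-trans (s≤s (s≤s (m≤m+n i (i + 0)))) (≤-reflexive (lem i))
        where
        lem : ∀ i → 2 + (i + (i + 0)) ≡ 2 * (1 + i)
        lem = solve-∀
      count : ∀ i → 2 * suc i ∸ suc i ≡ suc i
      count i = trans (cong (λ w → suc i + w ∸ suc i) (+-identityʳ (suc i))) (m+n∸m≡n (suc i) (suc i))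
      from-points : (∃ λ y → y ∈ A × L y ≡ i) → (∃ λ y → y ∈ A × L y ≡ suc i) → Classified
      from-points (y₀ , m₀ , l₀) (y₁ , m₁ , l₁) = Middle.asymmetric-case y₀ y₁ m₀ m₁ (trans l₁ (cong suc (sym l₀))) (≤-trans (≤-reflexive l₀) (≤-trans (n≤1+n i) (≤-reflexive (sym r₀)))) (≤-trans (≤-reflexive r₁) (≤-trans (≤-trans (m∸n≤m (2 * suc i ∸ suc i) 1) (≤-reflexive (count i))) (≤-reflexive (sym l₁)))) (trans r₀ (cong suc (sym l₀)))
        where
        r₀ : R y₀ ≡ suc i
        r₀ = trans (R-at m₀ l₀) (trans (cong (_∸ suc i) e) (count i))
        r₁ : R y₁ ≡ 2 * suc i ∸ suc i ∸ 1
        r₁ = trans (R-at m₁ l₁) (trans (cong (_∸ suc (suc i)) e) (sym (trans (∸-+-assoc (2 * suc i) (suc i) 1) (cong (2 * suc i ∸_) (+-comm (suc i) 1)))))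
    -- n = 2i + 3: y₀ is the centre, of rank i + 1; its right neighbour supplies the gap and the
    -- second reflection.
    go _ (suc i , inj₂ refl) e _ = from-points (at-rank {suc i} (≤-trans (s≤s (m≤n*m (suc i) 2)) (≤-reflexive (sym e)))) (at-rank {suc (suc i)} (≤-trans (s≤s (two≤ i)) (≤-reflexive (sym e))))
      where
      two≤ : ∀ i → suc (suc i) ≤ 2 * suc i
      two≤ i = ≤-trans (s≤s (s≤s (m≤m+n i (i + 0)))) (≤-reflexive (lem i))
        where
        lem : ∀ i → 2 + (i + (i + 0)) ≡ 2 * (1 + i)
        lem = solve-∀
      count : ∀ i → 2 * suc i ∸ suc i ≡ suc i
      count i = trans (cong (λ w → suc i + w ∸ suc i) (+-identityʳ (suc i))) (m+n∸m≡n (suc i) (suc i))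
      from-points : (∃ λ y → y ∈ A × L y ≡ suc i) → (∃ λ y → y ∈ A × L y ≡ suc (suc i)) → Classified
      from-points (y₀ , m₀ , l₀) (y₁ , m₁ , l₁) = Middle.symmetric-case y₀ y₁ m₀ m₁ (trans l₁ (cong suc (sym l₀))) (≤-reflexive (trans l₀ (sym r₀))) (≤-trans (≤-reflexive r₁) (≤-trans (≤-trans (m∸n≤m (2 * suc i ∸ suc i) 1) (≤-reflexive (count i))) (≤-trans (n≤1+n (suc i)) (≤-reflexive (sym l₁))))) (≤-reflexive (trans r₀ (sym l₀)))
        where
        r₀ : R y₀ ≡ suc i
        r₀ = trans (R-at m₀ l₀) (trans (cong (_∸ suc (suc i)) e) (count i))
        r₁ : R y₁ ≡ 2 * suc i ∸ suc i ∸ 1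
        r₁ = trans (R-at m₁ l₁) (trans (cong (_∸ suc (suc (suc i))) e) (sym (trans (∸-+-assoc (2 * suc i) (suc i) 1) (cong (2 * suc i ∸_) (+-comm (suc i) 1)))))

restrict-downFrom : ∀ s t → s ≤ t → (f : ℕ → ℕ) → ∑ (downFrom s) f ≤ ∑ (downFrom t) f
restrict-downFrom s zero z≤n f = ≤-refl
restrict-downFrom s (suc t) h f with m≤n⇒m<n∨m≡n h
... | inj₁ lt = ≤-trans (restrict-downFrom s t (≤-pred lt) f) (m≤n+m _ (f t))
... | inj₂ refl = ≤-refl

∑-filter : ∀ {X : Set} {q} {Q : X → Set q} (Q? : ∀ x → Dec (Q x)) xs (f : X → ℕ) → ∑ (filter Q? xs) f ≡ ∑ xs (λ x → ⟦ does (Q? x) ⟧ * f x)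
∑-filter Q? [] f = refl
∑-filter Q? (x ∷ xs) f with does (Q? x)
... | true = cong₂ _+_ (sym (*-identityˡ (f x))) (∑-filter Q? xs f)
... | false = ∑-filter Q? xs f

∑-cartesianProduct : ∀ {X Y : Set} (xs : List X) (ys : List Y) (f : X × Y → ℕ) → ∑ (cartesianProduct xs ys) f ≡ ∑ xs (λ x → ∑ ys (λ y → f (x , y)))
∑-cartesianProduct [] ys f = refl
∑-cartesianProduct (x ∷ xs) ys f = trans (∑-++ (map (x ,_) ys) (cartesianProduct xs ys) f) (cong₂ _+_ (∑-map (x ,_) ys f) (∑-cartesianProduct xs ys f))

-- Intervals attain the maximum over the integers

module Interval (n : ℕ) where
  interval : List ℤ
  interval = map pos (downFrom n)

  interval! : Unique interval
  interval! = map⁺! ℤP.+-injective (downFrom! n)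

  interval-length : length interval ≡ n
  interval-length = trans (length-map pos (downFrom n)) (length-downFrom n)

  open Line interval interval! using (mem; ∈-mem; mirror; gt; gt-true; r; l≡r; c; c≡)

  count-above : ∀ j m → m ≤ ∑ (downFrom (suc (j + m))) (λ i → ⟦ suc j ≤ᵈ i ⟧)
  count-above j zero = z≤n
  count-above j (suc m) = subst (λ s → suc m ≤ ∑ (downFrom (suc s)) (λ i → ⟦ suc j ≤ᵈ i ⟧)) (sym (+-suc j m))
    (+-mono-≤ (≤-reflexive (sym (cong ⟦_⟧ (≤ᵈ-intro (s≤s (m≤m+n j m)))))) (count-above j m))

  -- With m the size of the shorter side of j, the reflections of j + 1, ..., j + m stay in the
  -- interval; by `l≡r` the other side contributes as many.
  peak≤c : ∀ j → j < n → peak n j ≤ c (pos j)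
  peak≤c j j<n = ≤-trans (s≤s (*-monoʳ-≤ 2 (≤-trans enough (≤-reflexive (sym (l≡r (pos j))))))) (≤-reflexive (sym (c≡ (∈-map⁺ pos (∈-downFrom⁺ j<n)))))
    where
    open ≤-Reasoning
    m = j ⊓ (n ∸ suc j)
    fits : suc (j + m) ≤ n
    fits = ≤-trans (+-monoʳ-≤ (suc j) (m⊓n≤n j (n ∸ suc j))) (≤-reflexive (m+[n∸m]≡n j<n))
    reflected : ∀ {i} → j < i → i < suc (j + m) → mem (mirror (pos j) (pos i)) ≡ true
    reflected {i} j<i i≤ = ∈-mem (subst (_∈ interval) (sym eq) (∈-map⁺ pos (∈-downFrom⁺ (≤-<-trans (m∸n≤m j (i ∸ j)) j<n))))
      where
      d≤j : i ∸ j ≤ j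
      d≤j = ≤-trans (m≤n+o⇒m∸n≤o i j (≤-pred i≤)) (m⊓n≤m j (n ∸ suc j))
      lem : ∀ j d → pos 2 ℤ.* j ℤ.- (j ℤ.+ d) ≡ j ℤ.- d
      lem = ℤR.solve-∀
      eq : mirror (pos j) (pos i) ≡ pos (j ∸ (i ∸ j))
      eq = trans (cong (λ w → pos 2 ℤ.* pos j ℤ.- pos w) (sym (m+[n∸m]≡n (<⇒≤ j<i)))) (trans (lem (pos j) (pos (i ∸ j))) (trans (ℤP.m-n≡m⊖n j (i ∸ j)) (ℤP.⊖-≥ d≤j)))
    enough : m ≤ r (pos j)
    enough = begin
      m  ≤⟨ count-above j m ⟩
      ∑ (downFrom (suc (j + m))) (λ i → ⟦ suc j ≤ᵈ i ⟧)  ≤⟨ ∑-mono-∈ (downFrom (suc (j + m))) (λ i mi → pt i (∈-downFrom⁻ mi)) ⟩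
      ∑ (downFrom (suc (j + m))) (λ i → ⟦ gt (pos j) (pos i) ⟧ * ⟦ mem (mirror (pos j) (pos i)) ⟧)  ≤⟨ restrict-downFrom _ n fits (λ i → ⟦ gt (pos j) (pos i) ⟧ * ⟦ mem (mirror (pos j) (pos i)) ⟧) ⟩
      ∑ (downFrom n) (λ i → ⟦ gt (pos j) (pos i) ⟧ * ⟦ mem (mirror (pos j) (pos i)) ⟧)  ≡⟨ sym (∑-map pos (downFrom n) _) ⟩
      r (pos j)  ∎
      where
      pt : ∀ i → i < suc (j + m) → ⟦ suc j ≤ᵈ i ⟧ ≤ ⟦ gt (pos j) (pos i) ⟧ * ⟦ mem (mirror (pos j) (pos i)) ⟧
      pt i lt with suc j ≤ᵈ i in e
      ... | false = z≤n
      ... | true = ≤-reflexive (sym (cong₂ (λ a b → ⟦ a ⟧ * ⟦ b ⟧) (gt-true {pos j} {pos i} (ℤ.+<+ (≤ᵈ-elim e))) (reflected (≤ᵈ-elim e) lt)))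

  interval-extremal : half-square n ≤ Line.T interval interval!
  interval-extremal = ≤-trans (≤-reflexive (sym (∑-peak n))) (≤-trans (∑-mono-∈ (downFrom n) (λ j m → peak≤c j (∈-downFrom⁻ m))) (≤-reflexive (sym (∑-map pos (downFrom n) c))))

  interval-T : Line.T interval interval! ≡ half-square n
  interval-T = ≤-antisym (≤-trans (Line.T≤ interval interval!) (≤-reflexive (cong half-square interval-length))) interval-extremal

M3Z : ∀ n → M3ZIs n (half-square n)
M3Z n = (interval , interval! , interval-length , trans (Line.T3Z≡T interval interval!) interval-T) ,
  λ { A A! refl → ≤-trans (≤-reflexive (Line.T3Z≡T A A!)) (Line.T≤ A A!) }
  where open Interval n

-- Residues modulo a prime

module PrimeField (p : ℕ) .{{nz : NonZero p}} (pr : Prime p) where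

  G : Set
  G = Fin p

  P : ℤ
  P = pos p

  remainder-unique : ∀ r s k → r < p → s < p → pos r ≡ pos s ℤ.+ k ℤ.* P → r ≡ s
  remainder-unique r s (pos zero) r<p s<p e = ℤP.+-injective (trans e (trans (cong (λ z → pos s ℤ.+ z) (ℤP.*-zeroˡ P)) (ℤP.+-identityʳ _)))
  remainder-unique r s (pos (suc k)) r<p s<p e = ⊥-elim (<-irrefl refl (<-≤-trans r<p
    (subst (p ≤_) (sym (ℤP.+-injective (trans e (cong (λ z → pos s ℤ.+ z) (sym (ℤP.pos-* (suc k) p))))))
      (≤-trans (m≤m+n p (k * p)) (m≤n+m _ s)))))
  remainder-unique r s ℤ.-[1+ k ] r<p s<p e = ⊥-elim (<-irrefl refl (<-≤-trans s<p
    (subst (p ≤_) (ℤP.+-injective (trans (ℤP.pos-+ r _) (trans (cong (λ z → z ℤ.+ pos (suc k * p)) e) back)))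
      (≤-trans (m≤m+n p (k * p)) (m≤n+m _ r)))))
    where
    cancel : ∀ a b c → (a ℤ.+ (ℤ.- b) ℤ.* c) ℤ.+ b ℤ.* c ≡ a
    cancel = ℤR.solve-∀
    back : pos s ℤ.+ ℤ.-[1+ k ] ℤ.* P ℤ.+ pos (suc k * p) ≡ pos s
    back = trans (cong (λ z → pos s ℤ.+ ℤ.-[1+ k ] ℤ.* P ℤ.+ z) (ℤP.pos-* (suc k) p)) (cancel (pos s) (pos (suc k)) P)

  opaque
    -- Sealed, like the ring operations below, so that identities modulo p go through the ring laws
    -- instead of unfolding remainders.
    ι : ℤ → G
    ι = red p

    ι-red : ∀ z → ι z ≡ red p z
    ι-red z = refl

    toℕ-ι : ∀ z → toℕ (ι z) ≡ z ℤ.%ℕ p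
    toℕ-ι z = trans (toℕ-fromℕ< _) (DM.m<n⇒m%n≡m (ℤD.n%ℕd<d z p))

  toℤ-ι : ∀ z → ∃ λ k → z ≡ toℤ (ι z) ℤ.+ k ℤ.* P
  toℤ-ι z = z ℤ./ℕ p , trans (ℤD.a≡a%ℕn+[a/ℕn]*n z p) (cong (λ r → pos r ℤ.+ (z ℤ./ℕ p) ℤ.* P) (sym (toℕ-ι z)))

  ι-cong : ∀ {a b} k → a ≡ b ℤ.+ k ℤ.* P → ι a ≡ ι b
  ι-cong {a} {b} k e with toℤ-ι a | toℤ-ι b
  ... | m , ea | l , eb = toℕ-injective (remainder-unique _ _ (l ℤ.+ k ℤ.- m) (toℕ<n _) (toℕ<n _) (begin
      toℤ (ι a)  ≡⟨ lem₁ (toℤ (ι a)) m P ⟩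
      (toℤ (ι a) ℤ.+ m ℤ.* P) ℤ.- m ℤ.* P  ≡⟨ cong (λ z → z ℤ.- m ℤ.* P) (sym ea) ⟩
      a ℤ.- m ℤ.* P  ≡⟨ cong (λ z → z ℤ.- m ℤ.* P) e ⟩
      b ℤ.+ k ℤ.* P ℤ.- m ℤ.* P  ≡⟨ cong (λ z → z ℤ.+ k ℤ.* P ℤ.- m ℤ.* P) eb ⟩
      toℤ (ι b) ℤ.+ l ℤ.* P ℤ.+ k ℤ.* P ℤ.- m ℤ.* P  ≡⟨ lem₂ (toℤ (ι b)) l k m P ⟩
      toℤ (ι b) ℤ.+ (l ℤ.+ k ℤ.- m) ℤ.* P  ∎))
    where
    open ≡-Reasoning
    lem₁ : ∀ a m P → a ≡ (a ℤ.+ m ℤ.* P) ℤ.- m ℤ.* P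
    lem₁ = ℤR.solve-∀
    lem₂ : ∀ b l k m P → b ℤ.+ l ℤ.* P ℤ.+ k ℤ.* P ℤ.- m ℤ.* P ≡ b ℤ.+ (l ℤ.+ k ℤ.- m) ℤ.* P
    lem₂ = ℤR.solve-∀

  ι-inj : ∀ {a b} → ι a ≡ ι b → ∃ λ k → a ≡ b ℤ.+ k ℤ.* P
  ι-inj {a} {b} e with toℤ-ι a | toℤ-ι b
  ... | m , ea | l , eb = m ℤ.- l , trans ea (trans (cong (λ z → toℤ z ℤ.+ m ℤ.* P) e) (trans (lem (toℤ (ι b)) m l P) (cong (λ z → z ℤ.+ (m ℤ.- l) ℤ.* P) (sym eb))))
    where
    lem : ∀ b m l P → b ℤ.+ m ℤ.* P ≡ b ℤ.+ l ℤ.* P ℤ.+ (m ℤ.- l) ℤ.* P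
    lem = ℤR.solve-∀

  ι-toℤ : ∀ x → ι (toℤ x) ≡ x
  ι-toℤ x with toℤ-ι (toℤ x)
  ... | k , e = toℕ-injective (sym (remainder-unique _ _ k (toℕ<n x) (toℕ<n _) e))

  infixl 6 _⊕_ _⊝_
  infixl 7 _⊗_
  infix 8 ⊖_

  opaque
    _⊕_ _⊗_ : G → G → G
    x ⊕ y = ι (toℤ x ℤ.+ toℤ y)
    x ⊗ y = ι (toℤ x ℤ.* toℤ y)

    ⊖_ : G → G
    ⊖ x = ι (ℤ.- toℤ x)

    ι-+ : ∀ a b → ι (a ℤ.+ b) ≡ ι a ⊕ ι b
    ι-+ a b with toℤ-ι a | toℤ-ι b
    ... | k , ea | l , eb = ι-cong {a ℤ.+ b} {toℤ (ι a) ℤ.+ toℤ (ι b)} (k ℤ.+ l) (trans (cong₂ ℤ._+_ ea eb) (lem (toℤ (ι a)) (toℤ (ι b)) k l P))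
      where
      lem : ∀ a b k l P → a ℤ.+ k ℤ.* P ℤ.+ (b ℤ.+ l ℤ.* P) ≡ a ℤ.+ b ℤ.+ (k ℤ.+ l) ℤ.* P
      lem = ℤR.solve-∀

    ι-* : ∀ a b → ι (a ℤ.* b) ≡ ι a ⊗ ι b
    ι-* a b with toℤ-ι a | toℤ-ι b
    ... | k , ea | l , eb = ι-cong {a ℤ.* b} {toℤ (ι a) ℤ.* toℤ (ι b)} (k ℤ.* toℤ (ι b) ℤ.+ l ℤ.* toℤ (ι a) ℤ.+ k ℤ.* l ℤ.* P) (trans (cong₂ ℤ._*_ ea eb) (lem (toℤ (ι a)) (toℤ (ι b)) k l P))
      where
      lem : ∀ a b k l P → (a ℤ.+ k ℤ.* P) ℤ.* (b ℤ.+ l ℤ.* P) ≡ a ℤ.* b ℤ.+ (k ℤ.* b ℤ.+ l ℤ.* a ℤ.+ k ℤ.* l ℤ.* P) ℤ.* P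
      lem = ℤR.solve-∀

    ι-neg : ∀ a → ι (ℤ.- a) ≡ ⊖ ι a
    ι-neg a with toℤ-ι a
    ... | k , ea = ι-cong {ℤ.- a} {ℤ.- toℤ (ι a)} (ℤ.- k) (trans (cong ℤ.-_ ea) (lem (toℤ (ι a)) k P))
      where
      lem : ∀ a k P → ℤ.- (a ℤ.+ k ℤ.* P) ≡ ℤ.- a ℤ.+ (ℤ.- k) ℤ.* P
      lem = ℤR.solve-∀

  _⊝_ : G → G → G
  x ⊝ y = x ⊕ (⊖ y)

  ⊕-ι : ∀ x y → x ⊕ y ≡ ι (toℤ x ℤ.+ toℤ y)
  ⊕-ι x y = trans (cong₂ _⊕_ (sym (ι-toℤ x)) (sym (ι-toℤ y))) (sym (ι-+ _ _))

  ⊗-ι : ∀ x y → x ⊗ y ≡ ι (toℤ x ℤ.* toℤ y)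
  ⊗-ι x y = trans (cong₂ _⊗_ (sym (ι-toℤ x)) (sym (ι-toℤ y))) (sym (ι-* _ _))

  𝟎 𝟏 𝟐 : G
  𝟎 = ι (pos 0)
  𝟏 = ι (pos 1)
  𝟐 = ι (pos 2)

  -- Every element is the class of an integer, so an identity on classes of integers is an identity of the ring.
  lift₁ : ∀ {f g : G → G} → (∀ a → f (ι a) ≡ g (ι a)) → ∀ x → f x ≡ g x
  lift₁ {f} {g} h x = subst (λ z → f z ≡ g z) (ι-toℤ x) (h (toℤ x))

  private
    assoc⊕ : ∀ x y z → x ⊕ y ⊕ z ≡ x ⊕ (y ⊕ z)
    assoc⊕ x y z = lift₁ {λ x → x ⊕ y ⊕ z} (λ a → lift₁ {λ y → ι a ⊕ y ⊕ z} (λ b → lift₁ {λ z → ι a ⊕ ι b ⊕ z} (λ c →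
      trans (cong (_⊕ ι c) (sym (ι-+ a b))) (trans (sym (ι-+ _ c)) (trans (cong ι (ℤP.+-assoc a b c)) (trans (ι-+ a _) (cong (ι a ⊕_) (ι-+ b c)))))) z) y) x

    assoc⊗ : ∀ x y z → x ⊗ y ⊗ z ≡ x ⊗ (y ⊗ z)
    assoc⊗ x y z = lift₁ {λ x → x ⊗ y ⊗ z} (λ a → lift₁ {λ y → ι a ⊗ y ⊗ z} (λ b → lift₁ {λ z → ι a ⊗ ι b ⊗ z} (λ c →
      trans (cong (_⊗ ι c) (sym (ι-* a b))) (trans (sym (ι-* _ c)) (trans (cong ι (ℤP.*-assoc a b c)) (trans (ι-* a _) (cong (ι a ⊗_) (ι-* b c)))))) z) y) x

    comm⊕ : ∀ x y → x ⊕ y ≡ y ⊕ x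
    comm⊕ x y = trans (⊕-ι x y) (trans (cong ι (ℤP.+-comm (toℤ x) (toℤ y))) (sym (⊕-ι y x)))

    comm⊗ : ∀ x y → x ⊗ y ≡ y ⊗ x
    comm⊗ x y = trans (⊗-ι x y) (trans (cong ι (ℤP.*-comm (toℤ x) (toℤ y))) (sym (⊗-ι y x)))

    id⊕ : ∀ x → 𝟎 ⊕ x ≡ x
    id⊕ = lift₁ (λ a → trans (sym (ι-+ _ a)) (cong ι (ℤP.+-identityˡ a)))

    id⊗ : ∀ x → 𝟏 ⊗ x ≡ x
    id⊗ = lift₁ (λ a → trans (sym (ι-* _ a)) (cong ι (ℤP.*-identityˡ a)))

    inv⊕ : ∀ x → ⊖ x ⊕ x ≡ 𝟎
    inv⊕ = lift₁ (λ a → trans (cong (_⊕ ι a) (sym (ι-neg a))) (trans (sym (ι-+ _ a)) (cong ι (ℤP.+-inverseˡ a))))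

    dist : ∀ x y z → x ⊗ (y ⊕ z) ≡ x ⊗ y ⊕ x ⊗ z
    dist x y z = lift₁ {λ x → x ⊗ (y ⊕ z)} (λ a → lift₁ {λ y → ι a ⊗ (y ⊕ z)} (λ b → lift₁ {λ z → ι a ⊗ (ι b ⊕ z)} (λ c →
      trans (cong (ι a ⊗_) (sym (ι-+ b c))) (trans (sym (ι-* a _)) (trans (cong ι (ℤP.*-distribˡ-+ a b c)) (trans (ι-+ _ _) (cong₂ _⊕_ (ι-* a b) (ι-* a c)))))) z) y) x

  G-ring : CommutativeRing _ _
  G-ring = record
    { Carrier = G ; _≈_ = _≡_ ; _+_ = _⊕_ ; _*_ = _⊗_ ; -_ = ⊖_ ; 0# = 𝟎 ; 1# = 𝟏
    ; isCommutativeRing = record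
      { isRing = record
        { +-isAbelianGroup = record
          { isGroup = record
            { isMonoid = record
              { isSemigroup = record { isMagma = record { isEquivalence = isEquivalence ; ∙-cong = cong₂ _⊕_ } ; assoc = assoc⊕ }
              ; identity = id⊕ , λ x → trans (comm⊕ x _) (id⊕ x) }
            ; inverse = inv⊕ , (λ x → trans (comm⊕ x _) (inv⊕ x))
            ; ⁻¹-cong = cong ⊖_ }
          ; comm = comm⊕ }
        ; *-cong = cong₂ _⊗_
        ; *-assoc = assoc⊗
        ; *-identity = id⊗ , λ x → trans (comm⊗ x _) (id⊗ x)
        ; distrib = dist , (λ x y z → trans (comm⊗ _ x) (trans (dist x y z) (cong₂ _⊕_ (comm⊗ x y) (comm⊗ x z)))) }
      ; *-comm = comm⊗ } }

  private
    ℤ-raw = CommutativeRing.rawRing ℤP.+-*-commutativeRing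

    -- Gives the ring solver over `G` integer coefficients, which is how 0, 1 and 2 enter its
    -- equations.
    ι-morphism : ℤ-raw ACR.-Raw-AlmostCommutative⟶ ACR.fromCommutativeRing G-ring
    ι-morphism = record { ⟦_⟧ = ι ; +-homo = ι-+ ; *-homo = ι-* ; -‿homo = ι-neg ; 0-homo = refl ; 1-homo = refl }

    weak : ∀ a b → Maybe (ι a ≡ ι b)
    weak a b with a ℤP.≟ b
    ... | yes e = just (cong ι e)
    ... | no _ = nothing

    module Solver = Algebra.Solver.Ring ℤ-raw (ACR.fromCommutativeRing G-ring) ι-morphism weak

  module G-Solver where
    open Solver public using (solve; con; _:+_; _:*_; _:-_; :-_; _:=_)

  opaque
    elems : List G
    elems = allFin p

    elems-allFin : elems ≡ allFin p
    elems-allFin = refl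

    elems-unique : Unique elems
    elems-unique = allFin⁺ p

    elems-all : ∀ x → x ∈ elems
    elems-all = ∈-allFin

    elems-length : length elems ≡ p
    elems-length = length-tabulate id

  ∑G : (G → ℕ) → ℕ
  ∑G = ∑ elems

  ∑Z : (G → ℤ) → ℤ
  ∑Z = Σℤ.∑ elems

  infixr 6.5 ∑G ∑Z

  syntax ∑G (λ x → e) = ∑[ x ] e
  syntax ∑Z (λ x → e) = ∑ᶻ[ x ] e

  private
    module Dℕ = Σℕ.Delta (_≟F_ {p})
    module Dℤ = Σℤ.Delta (_≟F_ {p})

    unshift : ∀ t x → x ⊝ t ⊕ t ≡ x
    unshift = solve 2 (λ t x → x :- t :+ t := x) refl
      where open G-Solver
    shift : ∀ t x → x ⊕ t ⊝ t ≡ x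
    shift = solve 2 (λ t x → x :+ t :- t := x) refl
      where open G-Solver
    reflect : ∀ t x → t ⊝ (t ⊝ x) ≡ x
    reflect = solve 2 (λ t x → t :- (t :- x) := x) refl
      where open G-Solver
    undilate : ∀ u v → u ⊗ v ≡ 𝟏 → ∀ x → u ⊗ (v ⊗ x) ≡ x
    undilate u v e x = trans (sym (assoc⊗ u v x)) (trans (cong (_⊗ x) e) (id⊗ x))

  ∑-shift : ∀ t (f : G → ℕ) → ∑[ x ] f (x ⊕ t) ≡ ∑G f
  ∑-shift t = Dℕ.∑-bij elems-unique elems-all (_⊕ t) (_⊝ t) (unshift t) (shift t)

  ∑-reflect : ∀ t (f : G → ℕ) → ∑[ x ] f (t ⊝ x) ≡ ∑G f
  ∑-reflect t = Dℕ.∑-bij elems-unique elems-all (t ⊝_) (t ⊝_) (reflect t) (reflect t)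

  ∑-dilate : ∀ {u v} → u ⊗ v ≡ 𝟏 → (f : G → ℕ) → ∑[ x ] f (u ⊗ x) ≡ ∑G f
  ∑-dilate {u} {v} e = Dℕ.∑-bij elems-unique elems-all (u ⊗_) (v ⊗_) (undilate u v e) (undilate v u (trans (comm⊗ v u) e))

  ∑ᶻ-shift : ∀ t (f : G → ℤ) → ∑ᶻ[ x ] f (x ⊕ t) ≡ ∑Z f
  ∑ᶻ-shift t = Dℤ.∑-bij elems-unique elems-all (_⊕ t) (_⊝ t) (unshift t) (shift t)

  ∑ᶻ-dilate : ∀ {u v} → u ⊗ v ≡ 𝟏 → (f : G → ℤ) → ∑ᶻ[ x ] f (u ⊗ x) ≡ ∑Z f
  ∑ᶻ-dilate {u} {v} e = Dℤ.∑-bij elems-unique elems-all (u ⊗_) (v ⊗_) (undilate u v e) (undilate v u (trans (comm⊗ v u) e))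

  ∑ᶻ-δ : ∀ a (f : G → ℤ) → ∑ᶻ[ y ] (Σℤ.⟦ does (a ≟F y) ⟧ ℤ.* f y) ≡ f a
  ∑ᶻ-δ a = Dℤ.∑-δ elems-unique (elems-all a)

  ∑G-δ : ∀ a (f : G → ℕ) → ∑[ y ] ⟦ does (a ≟F y) ⟧ * f y ≡ f a
  ∑G-δ a = Dℕ.∑-δ elems-unique (elems-all a)

  ∑G-swap : (f : G → G → ℕ) → ∑[ x ] ∑[ y ] f x y ≡ ∑[ y ] ∑[ x ] f x y
  ∑G-swap = ∑-swap elems elems

  ∑G-const : ∀ k → ∑[ x ] k ≡ p * k
  ∑G-const k = trans (∑-const elems k) (cong (_* k) elems-length)

  card : (G → Bool) → ℕ
  card A = ∑[ x ] ⟦ A x ⟧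

  Unit : G → Set
  Unit u = ∃ λ v → u ⊗ v ≡ 𝟏

  Unit-* : ∀ {u v} → Unit u → Unit v → Unit (u ⊗ v)
  Unit-* {u} {v} (u' , e) (v' , f) = u' ⊗ v' , trans (lem u v u' v') (trans (cong₂ _⊗_ e f) (id⊗ 𝟏))
    where
    open G-Solver
    lem : ∀ u v u' v' → u ⊗ v ⊗ (u' ⊗ v') ≡ u ⊗ u' ⊗ (v ⊗ v')
    lem = solve 4 (λ u v u' v' → u :* v :* (u' :* v') := u :* u' :* (v :* v')) refl

  unit : ∀ u → u ≢ 𝟎 → Unit u
  unit u u≢0 = inv (toℕ u) refl
    where
    inv : ∀ k → toℕ u ≡ k → Unit u
    inv zero e = ⊥-elim (u≢0 (trans (sym (ι-toℤ u)) (cong (ι ∘ pos) e)))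
    inv (suc k) e with Cop.coprime-Bézout (Cop.prime⇒coprime pr {{_}} (subst (_< p) e (toℕ<n u)))
    ... | GCD.Bézout.+- x y eq = ι (ℤ.- pos y) , trans (cong (_⊗ ι (ℤ.- pos y)) u≡) (trans (sym (ι-* _ _)) (ι-cong (ℤ.- pos x)
            (trans (lem (pos (suc k)) (pos y)) (trans (cong (λ z → pos 1 ℤ.- z) E) (lem' (pos x) P)))))
      where
      u≡ = trans (sym (ι-toℤ u)) (cong (ι ∘ pos) e)
      E : pos 1 ℤ.+ pos y ℤ.* pos (suc k) ≡ pos x ℤ.* P
      E = trans (cong (λ z → pos 1 ℤ.+ z) (sym (ℤP.pos-* y (suc k)))) (trans (cong pos eq) (ℤP.pos-* x p))
      lem : ∀ s y → s ℤ.* (ℤ.- y) ≡ pos 1 ℤ.- (pos 1 ℤ.+ y ℤ.* s)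
      lem = ℤR.solve-∀
      lem' : ∀ x P → pos 1 ℤ.- x ℤ.* P ≡ pos 1 ℤ.+ (ℤ.- x) ℤ.* P
      lem' = ℤR.solve-∀
    ... | GCD.Bézout.-+ x y eq = ι (pos y) , trans (cong (_⊗ ι (pos y)) u≡) (trans (sym (ι-* _ _)) (ι-cong (pos x)
            (trans (ℤP.*-comm (pos (suc k)) (pos y)) (sym E))))
      where
      u≡ = trans (sym (ι-toℤ u)) (cong (ι ∘ pos) e)
      E : pos 1 ℤ.+ pos x ℤ.* P ≡ pos y ℤ.* pos (suc k)
      E = trans (cong (λ z → pos 1 ℤ.+ z) (sym (ℤP.pos-* x p))) (trans (cong pos eq) (ℤP.pos-* y (suc k)))

  -- The Balog-Szemerédi-Gowers argument

  BSet : Set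
  BSet = G → Bool

  _⊑_ : BSet → BSet → Set
  A ⊑ B = ∀ x → A x ≡ true → B x ≡ true

  card-mono : ∀ {A B} → A ⊑ B → card A ≤ card B
  card-mono h = ∑-mono elems (λ x → ⟦⟧-mono (h x))

  ∑-∃ : ∀ {f : G → ℕ} → 1 ≤ ∑G f → ∃ λ x → 1 ≤ f x
  ∑-∃ {f} h with ∑-<-pick elems {λ _ → 0} {f} (≤-trans (s≤s (≤-reflexive (∑-zero elems))) h)
  ... | x , _ , lt = x , lt

  ⟦⟧-pos : ∀ {a b} → 1 ≤ ⟦ a ⟧ * ⟦ b ⟧ → a ≡ true × b ≡ true
  ⟦⟧-pos {true} {true} _ = refl , refl
  ⟦⟧-pos {true} {false} ()
  ⟦⟧-pos {false} ()

  ∑-shiftˡ : ∀ t (f : G → ℕ) → ∑[ x ] f (t ⊕ x) ≡ ∑G f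
  ∑-shiftˡ t f = trans (∑-cong elems (λ x → cong f (solve 2 (λ t x → t :+ x := x :+ t) refl t x))) (∑-shift t f)
    where open G-Solver

  r : BSet → G → ℕ
  r A d = ∑[ z ] ⟦ A z ⟧ * ⟦ A (z ⊕ d) ⟧

  ∑-r : ∀ A → ∑G (r A) ≡ card A * card A
  ∑-r A = begin
    ∑[ d ] ∑[ z ] ⟦ A z ⟧ * ⟦ A (z ⊕ d) ⟧  ≡⟨ ∑G-swap _ ⟩
    ∑[ z ] ∑[ d ] ⟦ A z ⟧ * ⟦ A (z ⊕ d) ⟧  ≡⟨ ∑-cong elems (λ z → trans (∑-*ˡ elems ⟦ A z ⟧ _) (cong (⟦ A z ⟧ *_) (∑-shiftˡ z _))) ⟩
    ∑[ z ] ⟦ A z ⟧ * card A  ≡⟨ ∑-*ʳ elems (card A) _ ⟩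
    card A * card A  ∎
    where open ≡-Reasoning

  r-sym : ∀ A d → r A (⊖ d) ≡ r A d
  r-sym A d = trans (sym (∑-shift d _)) (∑-cong elems (λ z → trans (*-comm ⟦ A (z ⊕ d) ⟧ _) (cong (λ w → ⟦ A w ⟧ * ⟦ A (z ⊕ d) ⟧) (solve 2 (λ z d → z :+ d :+ (:- d) := z) refl z d))))
    where open G-Solver

  r≤card : ∀ A d → r A d ≤ card A
  r≤card A d = ∑-mono elems (λ z → *⟦⟧≤ ⟦ A z ⟧ (A (z ⊕ d)))

  popular : BSet → ℕ → ℕ → BSet
  popular A k n d = n ≤ᵈ (k * r A d)

  popular-sym : ∀ A k n d → popular A k n (⊖ d) ≡ popular A k n d
  popular-sym A k n d = cong (λ m → n ≤ᵈ (k * m)) (r-sym A d)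

  popular-card : ∀ A k n → n * card (popular A k n) ≤ k * (card A * card A)
  popular-card A k n = begin
    n * card (popular A k n)  ≡⟨ sym (∑-*ˡ elems n _) ⟩
    ∑[ d ] n * ⟦ popular A k n d ⟧  ≤⟨ ∑-mono elems (λ d → subst (_≤ k * r A d) (*-comm ⟦ popular A k n d ⟧ n) (⟦⟧-guard₀ (popular A k n d) ≤ᵈ-elim)) ⟩
    ∑[ d ] k * r A d  ≡⟨ ∑-*ˡ elems k _ ⟩
    k * ∑G (r A)  ≡⟨ cong (k *_) (∑-r A) ⟩
    k * (card A * card A)  ∎
    where open ≤-Reasoning

  -- The difference set Y - Y, as the differences with at least one representation.
  differences : BSet → BSet
  differences Y = popular Y 1 1

  differences-intro : ∀ Y {a b} → Y a ≡ true → Y b ≡ true → differences Y (b ⊝ a) ≡ true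
  differences-intro Y {a} {b} ea eb = ≤ᵈ-intro (≤-trans (subst (1 ≤_) refl one) (≤-reflexive (sym (*-identityˡ _))))
    where
    open G-Solver
    one : 1 ≤ r Y (b ⊝ a)
    one = ≤-trans (≤-reflexive (sym (cong₂ (λ u v → ⟦ u ⟧ * ⟦ v ⟧) ea (trans (cong Y (solve 2 (λ a b → a :+ (b :- a) := b) refl a b)) eb)))) (∑-term (elems-all a) (λ z → ⟦ Y z ⟧ * ⟦ Y (z ⊕ (b ⊝ a)) ⟧))

  differences-elim : ∀ Y {d} → differences Y d ≡ true → ∃ λ a → Y a ≡ true × Y (a ⊕ d) ≡ true
  differences-elim Y {d} e with ∑-∃ {λ z → ⟦ Y z ⟧ * ⟦ Y (z ⊕ d) ⟧} (≤-trans (≤ᵈ-elim e) (≤-reflexive (*-identityˡ _)))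
  ... | a , h = a , ⟦⟧-pos {Y a} h

  -- Summed over the midpoint y and one end x instead of x and d, to match the reflections over the
  -- integers and to split progressions by the kind of each of their three points.
  T₃ : BSet → BSet → BSet → ℕ
  T₃ X Y Z = ∑[ y ] ∑[ x ] ⟦ Y y ⟧ * (⟦ X x ⟧ * ⟦ Z (𝟐 ⊗ y ⊝ x) ⟧)

  badPairs : BSet → BSet → ℕ
  badPairs R Y = ∑[ x ] ∑[ x' ] ⟦ Y x ⟧ * (⟦ Y x' ⟧ * ⟦ not (R (x ⊝ x')) ⟧)

  -- A random neighbourhood in the graph {(x , y) : 2y - x ∈ A} contains few pairs with few common neighbours.
  module Neighbourhood (two : Unit 𝟐) (A : BSet) (ne : 1 ≤ card A) (T≥ : card A * card A ≤ 2 * T₃ A A A) where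
    n = card A
    R = popular A 64 n

    N : G → BSet
    N y x = A x ∧ A (𝟐 ⊗ y ⊝ x)

    -- The sum runs over the whole group, where 2y takes every value once because 2 is invertible;
    -- so it depends on x - x' alone.
    codegree : ∀ x x' → ∑[ y ] ⟦ A (𝟐 ⊗ y ⊝ x) ⟧ * ⟦ A (𝟐 ⊗ y ⊝ x') ⟧ ≡ r A (x ⊝ x')
    codegree x x' = begin
      ∑[ y ] ⟦ A (𝟐 ⊗ y ⊝ x) ⟧ * ⟦ A (𝟐 ⊗ y ⊝ x') ⟧  ≡⟨ ∑-cong elems (λ y → cong (λ w → ⟦ A (𝟐 ⊗ y ⊝ x) ⟧ * ⟦ A w ⟧) (solve 3 (λ y x x' → y :- x' := y :- x :+ (x :- x')) refl (𝟐 ⊗ y) x x')) ⟩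
      ∑[ y ] ⟦ A (𝟐 ⊗ y ⊝ x) ⟧ * ⟦ A (𝟐 ⊗ y ⊝ x ⊕ (x ⊝ x')) ⟧  ≡⟨ ∑-dilate (proj₂ two) (λ z → ⟦ A (z ⊝ x) ⟧ * ⟦ A (z ⊝ x ⊕ (x ⊝ x')) ⟧) ⟩
      ∑[ z ] ⟦ A (z ⊝ x) ⟧ * ⟦ A (z ⊝ x ⊕ (x ⊝ x')) ⟧  ≡⟨ ∑-shift (⊖ x) _ ⟩
      r A (x ⊝ x')  ∎
      where
      open ≡-Reasoning
      open G-Solver

    bound : ∀ x x' → 64 * (∑[ y ] ⟦ A y ⟧ * (⟦ N y x ⟧ * (⟦ N y x' ⟧ * ⟦ not (R (x ⊝ x')) ⟧))) ≤ ⟦ A x ⟧ * (⟦ A x' ⟧ * n)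
    bound x x' = begin
      64 * (∑[ y ] ⟦ A y ⟧ * (⟦ N y x ⟧ * (⟦ N y x' ⟧ * ⟦ not (R (x ⊝ x')) ⟧)))
        ≤⟨ *-monoʳ-≤ 64 (∑-mono elems (λ y → split (A y) (A x) (A (𝟐 ⊗ y ⊝ x)) (A x') (A (𝟐 ⊗ y ⊝ x')) (not (R (x ⊝ x'))))) ⟩
      64 * (∑[ y ] (⟦ A x ⟧ * (⟦ A x' ⟧ * ⟦ not (R (x ⊝ x')) ⟧)) * (⟦ A (𝟐 ⊗ y ⊝ x) ⟧ * ⟦ A (𝟐 ⊗ y ⊝ x') ⟧))
        ≡⟨ cong (64 *_) (trans (∑-*ˡ elems (⟦ A x ⟧ * (⟦ A x' ⟧ * ⟦ not (R (x ⊝ x')) ⟧)) _) (cong ((⟦ A x ⟧ * (⟦ A x' ⟧ * ⟦ not (R (x ⊝ x')) ⟧)) *_) (codegree x x'))) ⟩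
      64 * ((⟦ A x ⟧ * (⟦ A x' ⟧ * ⟦ not (R (x ⊝ x')) ⟧)) * r A (x ⊝ x'))
        ≡⟨ rearrange ⟦ A x ⟧ ⟦ A x' ⟧ ⟦ not (R (x ⊝ x')) ⟧ (r A (x ⊝ x')) ⟩
      ⟦ A x ⟧ * (⟦ A x' ⟧ * (⟦ not (R (x ⊝ x')) ⟧ * (64 * r A (x ⊝ x'))))
        ≤⟨ *-monoʳ-≤ ⟦ A x ⟧ (*-monoʳ-≤ ⟦ A x' ⟧ (⟦⟧-guard₀ (not (R (x ⊝ x'))) (λ e → <⇒≤ (≤ᵈ-false (not-true e))))) ⟩
      ⟦ A x ⟧ * (⟦ A x' ⟧ * n) ∎
      where
      open ≤-Reasoning
      rearrange : ∀ a b c s → 64 * ((a * (b * c)) * s) ≡ a * (b * (c * (64 * s)))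
      rearrange = solve-∀
      split : ∀ y a b a' b' c → ⟦ y ⟧ * (⟦ a ∧ b ⟧ * (⟦ a' ∧ b' ⟧ * ⟦ c ⟧)) ≤ (⟦ a ⟧ * (⟦ a' ⟧ * ⟦ c ⟧)) * (⟦ b ⟧ * ⟦ b' ⟧)
      split false a b a' b' c = z≤n
      split true false b a' b' c = z≤n
      split true true false a' b' c = z≤n
      split true true true false b' c = z≤n
      split true true true true false c = z≤n
      split true true true true true false = z≤n
      split true true true true true true = ≤-refl

    -- A bad pair has fewer than n/64 common neighbours, and there are at most n² pairs.
    total : ∑[ y ] ⟦ A y ⟧ * (64 * badPairs R (N y)) ≤ n * (n * n)
    total = begin
      ∑[ y ] ⟦ A y ⟧ * (64 * badPairs R (N y))
        ≡⟨ ∑-cong elems (λ y → expand y) ⟩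
      ∑[ y ] ∑[ x ] ∑[ x' ] 64 * (⟦ A y ⟧ * (⟦ N y x ⟧ * (⟦ N y x' ⟧ * ⟦ not (R (x ⊝ x')) ⟧)))
        ≡⟨ trans (∑G-swap _) (∑-cong elems (λ x → ∑G-swap _)) ⟩
      ∑[ x ] ∑[ x' ] ∑[ y ] 64 * (⟦ A y ⟧ * (⟦ N y x ⟧ * (⟦ N y x' ⟧ * ⟦ not (R (x ⊝ x')) ⟧)))
        ≤⟨ ∑-mono elems (λ x → ∑-mono elems (λ x' → ≤-trans (≤-reflexive (∑-*ˡ elems 64 _)) (bound x x'))) ⟩
      ∑[ x ] ∑[ x' ] ⟦ A x ⟧ * (⟦ A x' ⟧ * n)
        ≡⟨ ∑-cong elems (λ x → trans (∑-*ˡ elems ⟦ A x ⟧ _) (cong (⟦ A x ⟧ *_) (∑-*ʳ elems n _))) ⟩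
      ∑[ x ] ⟦ A x ⟧ * (n * n)
        ≡⟨ ∑-*ʳ elems (n * n) _ ⟩
      n * (n * n) ∎
      where
      open ≤-Reasoning
      swap* : ∀ a b s → a * (b * s) ≡ b * (a * s)
      swap* = solve-∀
      expand : ∀ y → ⟦ A y ⟧ * (64 * badPairs R (N y)) ≡ ∑[ x ] ∑[ x' ] 64 * (⟦ A y ⟧ * (⟦ N y x ⟧ * (⟦ N y x' ⟧ * ⟦ not (R (x ⊝ x')) ⟧)))
      expand y = trans (swap* ⟦ A y ⟧ 64 _) (sym (trans (∑-cong elems (λ x → trans (∑-*ˡ elems 64 _) (cong (64 *_) (∑-*ˡ elems ⟦ A y ⟧ _)))) (trans (∑-*ˡ elems 64 _) (cong (64 *_) (∑-*ˡ elems ⟦ A y ⟧ _)))))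

    T-degree : ∑[ y ] ⟦ A y ⟧ * card (N y) ≡ T₃ A A A
    T-degree = ∑-cong elems (λ y → trans (cong (⟦ A y ⟧ *_) (∑-cong elems (λ x → ⟦∧⟧ (A x) _))) (sym (∑-*ˡ elems ⟦ A y ⟧ _)))

    -- Cauchy-Schwarz in the form 8nd ≤ 8d² + 2n² at each vertex, combined with `T≥` for the sum of
    -- the degrees d.
    degree² : 4 * (n * (n * n)) ≤ ∑[ y ] ⟦ A y ⟧ * (8 * (card (N y) * card (N y))) + n * (2 * (n * n))
    degree² = begin
      4 * (n * (n * n))  ≡⟨ e₁ n ⟩
      4 * n * (n * n)  ≤⟨ *-monoʳ-≤ (4 * n) T≥ ⟩
      4 * n * (2 * T₃ A A A)  ≡⟨ trans (e₂ n _) (cong (8 * n *_) (sym T-degree)) ⟩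
      8 * n * (∑[ y ] ⟦ A y ⟧ * card (N y))  ≡⟨ sym (∑-*ˡ elems (8 * n) _) ⟩
      ∑[ y ] 8 * n * (⟦ A y ⟧ * card (N y))  ≤⟨ ∑-mono elems (λ y → ≤-trans (≤-reflexive (e₃ n ⟦ A y ⟧ (card (N y)))) (≤-trans (*-monoʳ-≤ ⟦ A y ⟧ (≤-trans (*-monoʳ-≤ 2 (2ab≤a²+b² (2 * card (N y)) n)) (≤-reflexive (e₄ n (card (N y)))))) (≤-reflexive (*-distribˡ-+ ⟦ A y ⟧ _ _)))) ⟩
      ∑[ y ] (⟦ A y ⟧ * (8 * (card (N y) * card (N y))) + ⟦ A y ⟧ * (2 * (n * n)))
                                               ≡⟨ trans (∑-+ elems _ _) (cong (∑[ y ] ⟦ A y ⟧ * (8 * (card (N y) * card (N y))) +_) (∑-*ʳ elems (2 * (n * n)) _)) ⟩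
      ∑[ y ] ⟦ A y ⟧ * (8 * (card (N y) * card (N y))) + n * (2 * (n * n)) ∎
      where
      open ≤-Reasoning
      e₁ : ∀ n → 4 * (n * (n * n)) ≡ 4 * n * (n * n)
      e₁ = solve-∀
      e₂ : ∀ n t → 4 * n * (2 * t) ≡ 8 * n * t
      e₂ = solve-∀
      e₃ : ∀ n a d → 8 * n * (a * d) ≡ a * (2 * (2 * ((2 * d) * n)))
      e₃ = solve-∀
      e₄ : ∀ n d → 2 * ((2 * d) * (2 * d) + n * n) ≡ 8 * (d * d) + 2 * (n * n)
      e₄ = solve-∀

    opaque
     -- The sum of 8d² over A is at least n³ plus 64 times the number of bad pairs, so averaging
     -- finds a single y for both purposes: its neighbourhood has at least n/3 elements, and at most
     -- an eighth of the pairs in it are bad.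
     good-vertex : ∃ λ y → A y ≡ true × n * n + 64 * badPairs R (N y) ≤ 8 * (card (N y) * card (N y))
     good-vertex = ∑-≤-pick elems A ne (begin
       ∑[ y ] ⟦ A y ⟧ * (n * n + 64 * badPairs R (N y))
         ≡⟨ trans (∑-cong elems (λ y → *-distribˡ-+ ⟦ A y ⟧ _ _)) (trans (∑-+ elems _ _) (cong (_+ ∑[ y ] ⟦ A y ⟧ * (64 * badPairs R (N y))) (∑-*ʳ elems (n * n) _))) ⟩
       n * (n * n) + ∑[ y ] ⟦ A y ⟧ * (64 * badPairs R (N y))
         ≤⟨ +-monoʳ-≤ (n * (n * n)) total ⟩
       n * (n * n) + n * (n * n)
         ≤⟨ +-cancelʳ-≤ (n * (2 * (n * n))) _ _ (≤-trans (≤-reflexive (e n)) degree²) ⟩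
       ∑[ y ] ⟦ A y ⟧ * (8 * (card (N y) * card (N y))) ∎)
       where
       open ≤-Reasoning
       e : ∀ n → n * (n * n) + n * (n * n) + n * (2 * (n * n)) ≡ 4 * (n * (n * n))
       e = solve-∀

  module Refine (Y R : BSet) (R-sym : ∀ d → R (⊖ d) ≡ R d) (few : 8 * badPairs R Y ≤ card Y * card Y) where
    y = card Y

    badAt : G → ℕ
    badAt x = ∑[ x' ] ⟦ Y x' ⟧ * ⟦ not (R (x ⊝ x')) ⟧

    Y' : BSet
    Y' x = Y x ∧ (4 * badAt x) ≤ᵈ y

    Y'⊑Y : Y' ⊑ Y
    Y'⊑Y x e = proj₁ (∧-true e)

    -- Markov's inequality: a discarded point has more than y/4 bad partners, and there are at most
    -- y²/8 bad pairs.
    large : y ≤ 2 * card Y'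
    large = cancel-sq (+-cancelʳ-≤ (y * y) _ _ (begin
      y * y + y * y  ≡⟨ sym (e₁ (y * y)) ⟩
      2 * (y * y)  ≤⟨ *-monoʳ-≤ 2 step ⟩
      2 * (y * card Y' + 4 * badPairs R Y)  ≡⟨ e₂ y (card Y') (badPairs R Y) ⟩
      y * (2 * card Y') + 8 * badPairs R Y  ≤⟨ +-monoʳ-≤ _ few ⟩
      y * (2 * card Y') + y * y  ∎))
      where
      open ≤-Reasoning
      e₁ : ∀ a → 2 * a ≡ a + a
      e₁ = solve-∀
      e₂ : ∀ y z b → 2 * (y * z + 4 * b) ≡ y * (2 * z) + 8 * b
      e₂ = solve-∀
      pt : ∀ x → y * ⟦ Y x ⟧ ≤ y * ⟦ Y' x ⟧ + 4 * (⟦ Y x ⟧ * badAt x)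
      pt x with Y x
      ... | false = ≤-trans (≤-reflexive (*-zeroʳ y)) z≤n
      ... | true with (4 * badAt x) ≤ᵈ y in q
      ...   | true = m≤m+n _ _
      ...   | false = ≤-trans (≤-reflexive (*-identityʳ y)) (≤-trans (<⇒≤ (≤ᵈ-false q)) (≤-trans (≤-reflexive (cong (4 *_) (sym (*-identityˡ (badAt x))))) (m≤n+m _ (y * 0))))
      step : y * y ≤ y * card Y' + 4 * badPairs R Y
      step = begin
        y * y  ≡⟨ sym (∑-*ˡ elems y _) ⟩
        ∑[ x ] y * ⟦ Y x ⟧  ≤⟨ ∑-mono elems pt ⟩
        ∑[ x ] (y * ⟦ Y' x ⟧ + 4 * (⟦ Y x ⟧ * badAt x))  ≡⟨ trans (∑-+ elems _ _) (cong₂ _+_ (∑-*ˡ elems y _) (∑-*ˡ elems 4 _)) ⟩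
        y * card Y' + 4 * (∑[ x ] ⟦ Y x ⟧ * badAt x)  ≡⟨ cong (λ w → y * card Y' + 4 * w) (∑-cong elems (λ x → sym (∑-*ˡ elems ⟦ Y x ⟧ _))) ⟩
        y * card Y' + 4 * badPairs R Y  ∎

    -- Write d = b - a with a, b in `Y'`. Each of them has at most y/4 bad partners, so for at least
    -- half of the z in `Y` both b - z and a - z lie in `R`. Then e = b - z and d - e = z - a lie in
    -- `R`, the latter by symmetry.
    middle : ∀ {d} → differences Y' d ≡ true → y ≤ 2 * (∑[ e ] ⟦ R e ⟧ * ⟦ R (d ⊝ e) ⟧)
    middle {d} h with differences-elim Y' h
    ... | a , ha , hb = *-cancelˡ-≤ 2 (+-cancelʳ-≤ (2 * y) _ _ (begin
      2 * y + 2 * y  ≡⟨ e₁ y ⟩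
      4 * y  ≤⟨ *-monoʳ-≤ 4 step ⟩
      4 * (S + (badAt b + badAt a))  ≡⟨ e₂ S (badAt b) (badAt a) ⟩
      2 * (2 * S) + (4 * badAt b + 4 * badAt a)  ≤⟨ +-monoʳ-≤ (2 * (2 * S)) (+-mono-≤ (≤ᵈ-elim (proj₂ (∧-true hb))) (≤ᵈ-elim (proj₂ (∧-true ha)))) ⟩
      2 * (2 * S) + (y + y)  ≡⟨ cong (2 * (2 * S) +_) (e₃ y) ⟩
      2 * (2 * S) + 2 * y  ∎))
      where
      open ≤-Reasoning
      b = a ⊕ d
      S = ∑[ e ] ⟦ R e ⟧ * ⟦ R (d ⊝ e) ⟧
      e₁ : ∀ y → 2 * y + 2 * y ≡ 4 * y
      e₁ = solve-∀
      e₂ : ∀ s u v → 4 * (s + (u + v)) ≡ 2 * (2 * s) + (4 * u + 4 * v)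
      e₂ = solve-∀
      e₃ : ∀ y → y + y ≡ 2 * y
      e₃ = solve-∀
      bool : ∀ u v w → ⟦ u ⟧ ≤ ⟦ v ⟧ * ⟦ w ⟧ + (⟦ u ⟧ * ⟦ not v ⟧ + ⟦ u ⟧ * ⟦ not w ⟧)
      bool false v w = z≤n
      bool true true true = s≤s z≤n
      bool true true false = s≤s z≤n
      bool true false true = s≤s z≤n
      bool true false false = s≤s z≤n
      S≡ : ∑[ z ] ⟦ R (b ⊝ z) ⟧ * ⟦ R (a ⊝ z) ⟧ ≡ S
      S≡ = trans (∑-cong elems (λ z → cong (λ w → ⟦ R (b ⊝ z) ⟧ * ⟦ w ⟧) (trans (sym (R-sym (a ⊝ z))) (cong R (solve 3 (λ a d z → :- (a :- z) := d :- (a :+ d :- z)) refl a d z)))))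
             (∑-reflect b (λ e → ⟦ R e ⟧ * ⟦ R (d ⊝ e) ⟧))
        where open G-Solver
      step : y ≤ S + (badAt b + badAt a)
      step = begin
        y ≤⟨ ∑-mono elems (λ z → bool (Y z) (R (b ⊝ z)) (R (a ⊝ z))) ⟩
        ∑[ z ] (⟦ R (b ⊝ z) ⟧ * ⟦ R (a ⊝ z) ⟧ + (⟦ Y z ⟧ * ⟦ not (R (b ⊝ z)) ⟧ + ⟦ Y z ⟧ * ⟦ not (R (a ⊝ z)) ⟧))
          ≡⟨ trans (∑-+ elems _ _) (cong₂ _+_ S≡ (∑-+ elems _ _)) ⟩
        S + (badAt b + badAt a) ∎

    small-differences : y * card (differences Y') ≤ 2 * (card R * card R)
    small-differences = begin
      y * card (differences Y')  ≡⟨ sym (∑-*ˡ elems y _) ⟩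
      ∑[ d ] y * ⟦ differences Y' d ⟧  ≤⟨ ∑-mono elems (λ d → ≤-trans (≤-reflexive (*-comm y ⟦ differences Y' d ⟧)) (⟦⟧-guard₀ (differences Y' d) (middle {d}))) ⟩
      ∑[ d ] 2 * (∑[ e ] ⟦ R e ⟧ * ⟦ R (d ⊝ e) ⟧)  ≡⟨ trans (∑-*ˡ elems 2 _) (cong (2 *_) (∑G-swap _)) ⟩
      2 * (∑[ e ] ∑[ d ] ⟦ R e ⟧ * ⟦ R (d ⊝ e) ⟧)  ≡⟨ cong (2 *_) (∑-cong elems (λ e → trans (∑-*ˡ elems ⟦ R e ⟧ _) (cong (⟦ R e ⟧ *_) (∑-shift (⊖ e) _)))) ⟩
      2 * (∑[ e ] ⟦ R e ⟧ * card R)  ≡⟨ cong (2 *_) (∑-*ʳ elems (card R) _) ⟩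
      2 * (card R * card R)  ∎
      where open ≤-Reasoning

  -- Passing to a neighbourhood costs a factor 3 and the refinement a factor 2. As `R` has at most
  -- 64n elements, the difference set is bounded by 3 · 2 · 64² · n = 24576n.
  balog-szemeredi : Unit 𝟐 → ∀ A → 1 ≤ card A → card A * card A ≤ 2 * T₃ A A A →
    ∃ λ Y → Y ⊑ A × card A ≤ 6 * card Y × card (differences Y) ≤ 24576 * card A
  balog-szemeredi two A ne T≥ = Y' , (λ x e → proj₁ (∧-true (Y'⊑Y x e))) , large-Y' , small
    where
    open Neighbourhood two A ne T≥
    y₀ = proj₁ good-vertex
    Y = N y₀
    ineq = proj₂ (proj₂ good-vertex)
    y≢0 : card A ≤ 3 * card Y
    y≢0 = ≮⇒≥ (λ q → <-irrefl refl (begin-strict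
        n * n  ≤⟨ m≤m+n _ _ ⟩
        n * n + 64 * badPairs R Y  ≤⟨ ineq ⟩
        8 * (card Y * card Y)  ≤⟨ m≤m+n _ _ ⟩
        8 * (card Y * card Y) + card Y * card Y  ≡⟨ e (card Y) ⟩
        3 * card Y * (3 * card Y)  <⟨ *-mono-< q q ⟩
        n * n  ∎))
      where
      open ≤-Reasoning
      e : ∀ y → 8 * (y * y) + y * y ≡ 3 * y * (3 * y)
      e = solve-∀
    few : 8 * badPairs R Y ≤ card Y * card Y
    few = *-cancelˡ-≤ 8 (≤-trans (≤-reflexive (sym (*-assoc 8 8 (badPairs R Y)))) (≤-trans (m≤n+m _ (n * n)) ineq))
    open Refine Y R (popular-sym A 64 n) few
    large-Y' : n ≤ 6 * card Y'
    large-Y' = ≤-trans y≢0 (≤-trans (*-monoʳ-≤ 3 large) (≤-reflexive (sym (*-assoc 3 2 (card Y')))))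
    R≤ : card R ≤ 64 * n
    R≤ = *-cancelˡ-≤ n {{>-nonZero ne}} (≤-trans (popular-card A 64 n) (≤-reflexive (e n)))
      where
      e : ∀ n → 64 * (n * n) ≡ n * (64 * n)
      e = solve-∀
    small : card (differences Y') ≤ 24576 * n
    small = *-cancelˡ-≤ n {{>-nonZero ne}} (begin
      n * card (differences Y')  ≤⟨ *-monoˡ-≤ _ y≢0 ⟩
      3 * card Y * card (differences Y')  ≡⟨ *-assoc 3 (card Y) _ ⟩
      3 * (card Y * card (differences Y'))  ≤⟨ *-monoʳ-≤ 3 small-differences ⟩
      3 * (2 * (card R * card R))  ≤⟨ *-monoʳ-≤ 3 (*-monoʳ-≤ 2 (*-mono-≤ R≤ R≤)) ⟩
      3 * (2 * (64 * n * (64 * n)))  ≡⟨ e n ⟩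
      n * (24576 * n)  ∎)
      where
      open ≤-Reasoning
      e : ∀ n → 3 * (2 * (64 * n * (64 * n))) ≡ n * (24576 * n)
      e = solve-∀

  -- Growth of popular differences

  hits : ∀ {a} {X : Set a} → List X → (X → ℕ) → Bool
  hits xs f = 1 ≤ᵈ ∑ xs f

  hits-intro : ∀ {a} {X : Set a} {xs : List X} {f x} → x ∈ xs → 1 ≤ f x → hits xs f ≡ true
  hits-intro m h = ≤ᵈ-intro (≤-trans h (∑-term m _))

  hits-elim : ∀ {a} {X : Set a} {xs : List X} {f} → hits xs f ≡ true → ∃ λ x → x ∈ xs × 1 ≤ f x
  hits-elim {xs = xs} {f} h = ∑-<-pick xs {λ _ → 0} {f} (≤-trans (s≤s (≤-reflexive (∑-zero xs))) (≤ᵈ-elim h))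

  both : ∀ {a b} → a ≡ true → b ≡ true → 1 ≤ ⟦ a ⟧ * ⟦ b ⟧
  both refl refl = ≤-refl

  one : ∀ {a} → a ≡ true → 1 ≤ ⟦ a ⟧
  one refl = ≤-refl

  one⁻ : ∀ {a} → 1 ≤ ⟦ a ⟧ → a ≡ true
  one⁻ {true} _ = refl

  hits-card : ∀ {a} {X : Set a} (xs : List X) (f : G → X → ℕ) → card (λ v → hits xs (f v)) ≤ ∑ xs (λ x → ∑[ v ] f v x)
  hits-card xs f = ≤-trans (∑-mono elems (λ v → pt (∑ xs (f v)))) (≤-reflexive (∑-swap elems xs f))
    where
    pt : ∀ k → ⟦ 1 ≤ᵈ k ⟧ ≤ k
    pt k with 1 ≤ᵈ k in e
    ... | true = ≤ᵈ-elim e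
    ... | false = z≤n

  sumset : BSet → BSet → BSet
  sumset U S v = hits elems (λ s → ⟦ S s ⟧ * ⟦ U (v ⊝ s) ⟧)

  sumset-intro : ∀ U S {v s} → S s ≡ true → U (v ⊝ s) ≡ true → sumset U S v ≡ true
  sumset-intro U S {v} {s} hs hu = hits-intro {f = λ s → ⟦ S s ⟧ * ⟦ U (v ⊝ s) ⟧} (elems-all s) (both hs hu)

  sumset-elim : ∀ U S {v} → sumset U S v ≡ true → ∃ λ s → S s ≡ true × U (v ⊝ s) ≡ true
  sumset-elim U S {v} h with hits-elim {xs = elems} h
  ... | s , _ , q = s , ⟦⟧-pos {S s} q

  diffset : BSet → BSet → BSet
  diffset U Y v = hits elems (λ a → ⟦ Y a ⟧ * ⟦ U (a ⊕ v) ⟧)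

  diffset-intro : ∀ U Y {v a} → Y a ≡ true → U (a ⊕ v) ≡ true → diffset U Y v ≡ true
  diffset-intro U Y {v} {a} hs hu = hits-intro {f = λ a → ⟦ Y a ⟧ * ⟦ U (a ⊕ v) ⟧} (elems-all a) (both hs hu)

  diffset-elim : ∀ U Y {v} → diffset U Y v ≡ true → ∃ λ a → Y a ≡ true × U (a ⊕ v) ≡ true
  diffset-elim U Y {v} h with hits-elim {xs = elems} h
  ... | a , _ , q = a , ⟦⟧-pos {Y a} q

  module Popular (Y : BSet) (κ n : ℕ) where
    S D : BSet
    S = popular Y κ n
    D = differences Y

    -- With w = u + s - a' and s = x - y in at least n/κ ways, w = (u - y) + (x - a').
    popular-growth : ∀ U → n * card (diffset (sumset U S) Y) ≤ κ * (card (diffset U Y) * card D)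
    popular-growth U = begin
      n * card VS  ≡⟨ sym (∑-*ˡ elems n _) ⟩
      ∑[ w ] n * ⟦ VS w ⟧  ≤⟨ ∑-mono elems (λ w → ≤-trans (≤-reflexive (*-comm n ⟦ VS w ⟧)) (⟦⟧-guard₀ (VS w) (pt w))) ⟩
      ∑[ w ] κ * (∑[ e ] ⟦ V e ⟧ * ⟦ D (w ⊝ e) ⟧)  ≡⟨ trans (∑-*ˡ elems κ _) (cong (κ *_) (∑G-swap _)) ⟩
      κ * (∑[ e ] ∑[ w ] ⟦ V e ⟧ * ⟦ D (w ⊝ e) ⟧)  ≡⟨ cong (κ *_) (∑-cong elems (λ e → trans (∑-*ˡ elems ⟦ V e ⟧ _) (cong (⟦ V e ⟧ *_) (∑-shift (⊖ e) _)))) ⟩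
      κ * (∑[ e ] ⟦ V e ⟧ * card D)  ≡⟨ cong (κ *_) (∑-*ʳ elems (card D) _) ⟩
      κ * (card V * card D)  ∎
      where
      open ≤-Reasoning
      V VS : BSet
      V = diffset U Y
      VS = diffset (sumset U S) Y
      pt : ∀ w → VS w ≡ true → n ≤ κ * (∑[ e ] ⟦ V e ⟧ * ⟦ D (w ⊝ e) ⟧)
      pt w h with diffset-elim (sumset U S) Y h
      ... | a , ha , h' with sumset-elim U S h'
      ...   | s , hs , hu = ≤-trans (≤ᵈ-elim hs) (*-monoʳ-≤ κ (≤-trans (∑-mono elems rep) (≤-reflexive (∑-reflect u (λ e → ⟦ V e ⟧ * ⟦ D (w ⊝ e) ⟧)))))
        where
        open G-Solver
        u = a ⊕ w ⊝ s
        rep : ∀ y → ⟦ Y y ⟧ * ⟦ Y (y ⊕ s) ⟧ ≤ ⟦ V (u ⊝ y) ⟧ * ⟦ D (w ⊝ (u ⊝ y)) ⟧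
        rep y with Y y in ey | Y (y ⊕ s) in ex
        ... | false | _ = z≤n
        ... | true | false = z≤n
        ... | true | true = both
          (diffset-intro U Y ey (subst (λ z → U z ≡ true) (solve 2 (λ y u → u := y :+ (u :- y)) refl y u) hu))
          (subst (λ z → D z ≡ true) (solve 4 (λ y s a w → y :+ s :- a := w :- (a :+ w :- s :- y)) refl y s a w) (differences-intro Y ha ex))

    -- `U k` is Y + kS and `Z k` is kS. Growth is controlled for Y + kS - Y, because a popular
    -- difference has to be split inside Y; it contains kS since a + kS lies in Y + kS for each a in
    -- Y.
    U Z : ℕ → BSet
    U zero = Y
    U (suc k) = sumset (U k) S
    Z zero v = does (v ≟F 𝟎)
    Z (suc k) = sumset (Z k) S

    module _ (K : ℕ) (n≥1 : 1 ≤ n) (D≤ : card D ≤ K * n) where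

      V-card : ∀ k → card (diffset (U k) Y) ≤ (κ * K) ^ k * (K * n)
      V-card zero = ≤-trans (card-mono V₀⊑D) (≤-trans D≤ (≤-reflexive (sym (*-identityˡ _))))
        where
        open G-Solver
        V₀⊑D : diffset Y Y ⊑ D
        V₀⊑D v h with diffset-elim Y Y h
        ... | a , ha , hb = subst (λ z → D z ≡ true) (solve 2 (λ a v → a :+ v :- a := v) refl a v) (differences-intro Y ha hb)
      V-card (suc k) = *-cancelˡ-≤ n {{>-nonZero n≥1}} (begin
        n * card (diffset (U (suc k)) Y)  ≤⟨ popular-growth (U k) ⟩
        κ * (card (diffset (U k) Y) * card D)  ≤⟨ *-monoʳ-≤ κ (*-mono-≤ (V-card k) D≤) ⟩
        κ * ((κ * K) ^ k * (K * n) * (K * n))  ≡⟨ lem κ K n ((κ * K) ^ k) ⟩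
        n * (κ * K * (κ * K) ^ k * (K * n))  ∎)
        where
        open ≤-Reasoning
        lem : ∀ κ K n q → κ * (q * (K * n) * (K * n)) ≡ n * (κ * K * q * (K * n))
        lem = solve-∀

      Z-card : ∃ (λ a → Y a ≡ true) → ∀ k → card (Z k) ≤ (κ * K) ^ k * (K * n)
      Z-card (a , ha) k = ≤-trans (card-mono (λ v h → diffset-intro (U k) Y ha (Z⊑U k v h))) (V-card k)
        where
        open G-Solver
        Z⊑U : ∀ k v → Z k v ≡ true → U k (a ⊕ v) ≡ true
        Z⊑U zero v h = subst (λ z → Y z ≡ true) (trans (solve 1 (λ a → a := a :+ con (pos 0)) refl a) (cong (a ⊕_) (sym (does⇒ (v ≟F 𝟎) h)))) ha
        Z⊑U (suc k) v h with sumset-elim (Z k) S h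
        ... | s , hs , hz = sumset-intro (U k) S hs (subst (λ z → U k z ≡ true) (solve 3 (λ a v s → a :+ (v :- s) := a :+ v :- s) refl a v s) (Z⊑U k (v ⊝ s) hz))

  -- Ruzsa covering and almost invariant sets

  module Covering (S Z₂ Z₃ Z₄ : BSet)
    (D⊑Z₂ : ∀ {a b} → S a ≡ true → S b ≡ true → Z₂ (b ⊝ a) ≡ true)
    (Z₃⊑ : ∀ {v s} → S s ≡ true → Z₂ v ≡ true → Z₃ (v ⊕ s) ≡ true)
    (Z₄⊑ : ∀ {v s} → S s ≡ true → Z₃ (v ⊝ s) ≡ true → Z₄ v ≡ true)
    (s₀ : G) (s₀∈ : S s₀ ≡ true) where

    meets : List G → G → Bool
    meets X z = hits X (λ x → ⟦ differences S (z ⊝ x) ⟧)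

    -- A maximal family of points of `Z₃` with pairwise disjoint translates of `S`. If z is
    -- rejected, z + S meets some x + S, and so z - x lies in S - S.
    greedy : List G → List G
    greedy [] = []
    greedy (z ∷ zs) = if Z₃ z ∧ not (meets (greedy zs) z) then z ∷ greedy zs else greedy zs

    greedy-covers : ∀ zs {z} → z ∈ zs → Z₃ z ≡ true → ∃ λ x → x ∈ greedy zs × Z₂ (z ⊝ x) ≡ true
    greedy-covers (z ∷ zs) (here refl) hz rewrite hz with meets (greedy zs) z in e
    ... | false = z , here refl , subst (λ w → Z₂ w ≡ true) (solve 2 (λ s z → s :- s := z :- z) refl s₀ z) (D⊑Z₂ s₀∈ s₀∈)
      where open G-Solver
    ... | true with hits-elim {xs = greedy zs} e
    ...   | x , m , q with differences-elim S (one⁻ q)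
    ...     | a , ha , hb = x , m , subst (λ w → Z₂ w ≡ true) (solve 2 (λ a v → a :+ v :- a := v) refl a (z ⊝ x)) (D⊑Z₂ ha hb)
      where open G-Solver
    greedy-covers (z' ∷ zs) (there m) hz with Z₃ z' ∧ not (meets (greedy zs) z') | greedy-covers zs m hz
    ... | true  | x , mx , q = x , there mx , q
    ... | false | r = r

    -- Disjointness stated pointwise: v lies in at most one translate, and then in `Z₄`. Summed over
    -- v it bounds the number of translates.
    packed : ∀ zs v → ∑ (greedy zs) (λ x → ⟦ S (v ⊝ x) ⟧) ≤ ⟦ Z₄ v ⟧
    packed [] v = z≤n
    packed (z ∷ zs) v with Z₃ z in ez | meets (greedy zs) z in em
    ... | false | _     = packed zs v
    ... | true  | true  = packed zs v
    ... | true  | false with S (v ⊝ z) in es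
    ...   | false = packed zs v
    ...   | true  = ≤-trans (s≤s (≤-reflexive rest)) (one (Z₄⊑ es (subst (λ w → Z₃ w ≡ true) (solve 2 (λ z v → z := v :- (v :- z)) refl z v) ez)))
      where
      open G-Solver
      none : ∀ x → x ∈ greedy zs → ⟦ S (v ⊝ x) ⟧ ≡ 0
      none x m with S (v ⊝ x) in ex
      ... | false = refl
      ... | true = true≢false (hits-intro {f = λ x → ⟦ differences S (z ⊝ x) ⟧} m (one (subst (λ w → differences S w ≡ true) (solve 3 (λ v x z → v :- x :- (v :- z) := z :- x) refl v x z) (differences-intro S es ex)))) em
      rest : ∑ (greedy zs) (λ x → ⟦ S (v ⊝ x) ⟧) ≡ 0
      rest = trans (∑-cong-∈ (greedy zs) none) (∑-zero (greedy zs))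

    X : List G
    X = greedy elems

    X-covers : ∀ z → Z₃ z ≡ true → ∃ λ x → x ∈ X × Z₂ (z ⊝ x) ≡ true
    X-covers z = greedy-covers elems (elems-all z)

    X-length : length X * card S ≤ card Z₄
    X-length = begin
      length X * card S  ≡⟨ sym (∑-const X (card S)) ⟩
      ∑ X (λ _ → card S)  ≡⟨ ∑-cong X (λ x → sym (∑-shift (⊖ x) _)) ⟩
      ∑ X (λ x → ∑[ v ] ⟦ S (v ⊝ x) ⟧)  ≡⟨ ∑-swap X elems _ ⟩
      ∑[ v ] ∑ X (λ x → ⟦ S (v ⊝ x) ⟧)  ≤⟨ ∑-mono elems (packed elems) ⟩
      card Z₄  ∎
      where open ≤-Reasoning

  module Box where
    multiples : G → ℕ → List G → List G
    multiples x zero L = L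
    multiples x (suc m) L = L ++ map (x ⊕_) (multiples x m L)

    -- All combinations of the generators with coefficients from 0 to k, listed with repetitions so
    -- that the length is exactly a power.
    box : List G → ℕ → List G
    box [] k = 𝟎 ∷ []
    box (x ∷ X) k = multiples x k (box X k)

    length-multiples : ∀ x m L → length (multiples x m L) ≡ (m + 1) * length L
    length-multiples x zero L = sym (*-identityˡ _)
    length-multiples x (suc m) L = trans (length-++ L) (cong (length L +_) (trans (length-map (x ⊕_) (multiples x m L)) (length-multiples x m L)))

    length-box : ∀ X k → length (box X k) ≡ (k + 1) ^ length X
    length-box [] k = refl
    length-box (x ∷ X) k = trans (length-multiples x k _) (cong ((k + 1) *_) (length-box X k))

    multiples-map : ∀ x m {L L'} t → (∀ {l} → l ∈ L → l ⊕ t ∈ L') → ∀ {q} → q ∈ multiples x m L → q ⊕ t ∈ multiples x m L'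
    multiples-map x zero t h m = h m
    multiples-map x (suc k) {L} t h m with ∈-++⁻ L m
    ... | inj₁ m' = ∈-++⁺ˡ (h m')
    ... | inj₂ m' with ∈-map⁻ (x ⊕_) m'
    ...   | q , mq , refl = ∈-++⁺ʳ _ (subst (_∈ _) (solve 3 (λ x q t → x :+ (q :+ t) := x :+ q :+ t) refl x q t) (∈-map⁺ (x ⊕_) (multiples-map x k t h mq)))
      where open G-Solver

    multiples-suc : ∀ x m {L q} → q ∈ multiples x m L → q ∈ multiples x (suc m) L
    multiples-suc x zero m = ∈-++⁺ˡ m
    multiples-suc x (suc k) {L} m with ∈-++⁻ L m
    ... | inj₁ m' = ∈-++⁺ˡ m'
    ... | inj₂ m' with ∈-map⁻ (x ⊕_) m'
    ...   | q , mq , refl = ∈-++⁺ʳ L (∈-map⁺ (x ⊕_) (multiples-suc x k mq))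

    -- The alternative t = 0 serves the coordinates that are not raised; it also shows that boxes
    -- increase with k.
    box-+ : ∀ X k t → t ∈ X ⊎ t ≡ 𝟎 → ∀ {q} → q ∈ box X k → q ⊕ t ∈ box X (suc k)
    box-+ [] k t (inj₂ refl) (here refl) = here (solve 0 (con (pos 0) :+ con (pos 0) := con (pos 0)) refl)
      where open G-Solver
    box-+ (x ∷ X) k t (inj₁ (here refl)) {q} m = ∈-++⁺ʳ _ (subst (_∈ _) (solve 2 (λ x q → x :+ (q :+ con (pos 0)) := q :+ x) refl x q)
        (∈-map⁺ (x ⊕_) (multiples-map x k 𝟎 (box-+ X k 𝟎 (inj₂ refl)) m)))
      where open G-Solver
    box-+ (x ∷ X) k t (inj₁ (there mt)) m = multiples-suc x k (multiples-map x k t (box-+ X k t (inj₁ mt)) m)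
    box-+ (x ∷ X) k t (inj₂ e) m = multiples-suc x k (multiples-map x k t (box-+ X k t (inj₂ e)) m)

    box-zero : ∀ X → box X 0 ≡ 𝟎 ∷ []
    box-zero [] = refl
    box-zero (x ∷ X) = box-zero X

  -- One common superset `B⁺` controls the symmetric difference of `B` with each of its translates
  -- by `S`.
  record Følner (S : BSet) (e M : ℕ) : Set where
    field
      B B⁺ : BSet
      B⊑ : B ⊑ B⁺
      B+S : ∀ {v s} → S s ≡ true → B v ≡ true → B⁺ (v ⊕ s) ≡ true
      slow : e * card B⁺ ≤ (e + 1) * card B
      B-pos : 1 ≤ card B
      B-card : card B ≤ M

  module _ (S Z₂ Z₃ : BSet) (X : List G) (covers : ∀ z → Z₃ z ≡ true → ∃ λ x → x ∈ X × Z₂ (z ⊝ x) ≡ true)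
           (Z₃⊑ : ∀ {v s} → S s ≡ true → Z₂ v ≡ true → Z₃ (v ⊕ s) ≡ true) (Z₂-pos : 1 ≤ card Z₂)
           (d : ℕ) (X≤ : length X ≤ d) (e : ℕ) (k₀ : ℕ) (k₀-large : e ^ k₀ * (k₀ + 1) ^ d < (e + 1) ^ k₀) where
    open Box
    open G-Solver

    private
      -- `Z₂` plus the box of side k. Adding `S` leads into `Z₃` plus this box, hence by the
      -- covering into `Z₂` plus the next box, while the cardinality grows only polynomially in k.
      B : ℕ → BSet
      B k v = hits (box X k) (λ q → ⟦ Z₂ (v ⊝ q) ⟧)

      B-intro : ∀ {k v q} → q ∈ box X k → Z₂ (v ⊝ q) ≡ true → B k v ≡ true
      B-intro {k} {v} m h = hits-intro {f = λ q → ⟦ Z₂ (v ⊝ q) ⟧} m (one h)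

      B-mono : ∀ k → B k ⊑ B (suc k)
      B-mono k v h with hits-elim {xs = box X k} h
      ... | q , m , z = B-intro {suc k} {v} (box-+ X k 𝟎 (inj₂ refl) m) (subst (λ w → Z₂ w ≡ true) (solve 2 (λ v q → v :- q := v :- (q :+ con (pos 0))) refl v q) (one⁻ z))

      B-+ : ∀ k {v s} → S s ≡ true → B k v ≡ true → B (suc k) (v ⊕ s) ≡ true
      B-+ k {v} {s} hs h with hits-elim {xs = box X k} h
      ... | q , m , z with covers (v ⊝ q ⊕ s) (Z₃⊑ hs (one⁻ z))
      ...   | x , mx , hx = B-intro {suc k} {v ⊕ s} (box-+ X k x (inj₁ mx) m) (subst (λ w → Z₂ w ≡ true) (solve 4 (λ v q s x → v :- q :+ s :- x := v :+ s :- (q :+ x)) refl v q s x) hx)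

      B≤ : ∀ k → card (B k) ≤ (k + 1) ^ d * card Z₂
      B≤ k = begin
        card (B k)  ≤⟨ hits-card (box X k) _ ⟩
        ∑ (box X k) (λ q → ∑[ v ] ⟦ Z₂ (v ⊝ q) ⟧)  ≡⟨ ∑-cong (box X k) (λ q → ∑-shift (⊖ q) _) ⟩
        ∑ (box X k) (λ q → card Z₂)  ≡⟨ ∑-const (box X k) _ ⟩
        length (box X k) * card Z₂  ≡⟨ cong (_* card Z₂) (length-box X k) ⟩
        (k + 1) ^ length X * card Z₂  ≤⟨ *-monoˡ-≤ (card Z₂) (^-monoʳ-≤ (k + 1) {{>-nonZero (m≤n+m 1 k)}} X≤) ⟩
        (k + 1) ^ d * card Z₂  ∎
        where open ≤-Reasoning

      Z₂≤B : ∀ k → card Z₂ ≤ card (B k)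
      Z₂≤B zero = card-mono (λ v h → B-intro {0} {v} (subst (𝟎 ∈_) (sym (box-zero X)) (here refl)) (subst (λ w → Z₂ w ≡ true) (solve 1 (λ v → v := v :- con (pos 0)) refl v) h))
      Z₂≤B (suc k) = ≤-trans (Z₂≤B k) (card-mono (B-mono k))

    følner : Følner S e ((k₀ + 1) ^ d * card Z₂)
    følner with slow-step e (λ k → card (B k)) k₀
    ... | inj₁ (j , j<k , h) = record
      { B = B j ; B⁺ = B (suc j) ; B⊑ = B-mono j ; B+S = B-+ j ; slow = h
      ; B-pos = ≤-trans Z₂-pos (Z₂≤B j)
      ; B-card = ≤-trans (B≤ j) (*-monoˡ-≤ (card Z₂) (^-monoˡ-≤ d (+-monoˡ-≤ 1 (<⇒≤ j<k)))) }
    ... | inj₂ h = ⊥-elim (<-irrefl refl (begin-strict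
        (e + 1) ^ k₀ * card Z₂  ≤⟨ *-monoʳ-≤ ((e + 1) ^ k₀) (Z₂≤B 0) ⟩
        (e + 1) ^ k₀ * card (B 0)  ≤⟨ h ⟩
        e ^ k₀ * card (B k₀)  ≤⟨ *-monoʳ-≤ (e ^ k₀) (B≤ k₀) ⟩
        e ^ k₀ * ((k₀ + 1) ^ d * card Z₂)  ≡⟨ sym (*-assoc (e ^ k₀) _ _) ⟩
        e ^ k₀ * (k₀ + 1) ^ d * card Z₂  <⟨ *-monoˡ-< (card Z₂) {{>-nonZero Z₂-pos}} k₀-large ⟩
        (e + 1) ^ k₀ * card Z₂  ∎))
      where open ≤-Reasoning

  module _ (Y : BSet) (n K : ℕ) (n≥1 : 1 ≤ n) (K≥1 : 1 ≤ K) (n≤ : n ≤ 6 * card Y) (Y≤n : card Y ≤ n) (D≤ : card (differences Y) ≤ K * n) where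
    open Popular Y (72 * K) n

    -- An unpopular difference has fewer than n/(72K) representations and there are at most Kn
    -- differences, so together they account for at most n²/72. By n ≤ 6|Y| this is at most half of
    -- all pairs, whence 72 = 2 · 6².
    popular-mass : card Y * card Y ≤ 2 * (∑[ d ] ⟦ S d ⟧ * r Y d)
    popular-mass = *-cancelˡ-≤ (36 * K) {{>-nonZero (≤-trans K≥1 (m≤n*m K 36))}} (+-cancelʳ-≤ (36 * K * (card Y * card Y)) _ _ (begin
      36 * K * (card Y * card Y) + 36 * K * (card Y * card Y)  ≡⟨ e₁ K (card Y * card Y) ⟩
      72 * K * (card Y * card Y)  ≡⟨ cong (72 * K *_) (sym (∑-r Y)) ⟩
      72 * K * ∑G (r Y)  ≡⟨ sym (∑-*ˡ elems (72 * K) _) ⟩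
      ∑[ d ] 72 * K * r Y d  ≤⟨ ∑-mono elems pt ⟩
      ∑[ d ] (72 * K * (⟦ S d ⟧ * r Y d) + n * ⟦ D d ⟧)  ≡⟨ trans (∑-+ elems _ _) (cong₂ _+_ (∑-*ˡ elems (72 * K) _) (∑-*ˡ elems n _)) ⟩
      72 * K * W + n * card D  ≤⟨ +-monoʳ-≤ (72 * K * W) (*-monoʳ-≤ n D≤) ⟩
      72 * K * W + n * (K * n)  ≤⟨ +-monoʳ-≤ (72 * K * W) (*-mono-≤ n≤ (*-monoʳ-≤ K n≤)) ⟩
      72 * K * W + 6 * card Y * (K * (6 * card Y))  ≡⟨ e₂ K W (card Y) ⟩
      36 * K * (2 * W) + 36 * K * (card Y * card Y)  ∎))
      where
      open ≤-Reasoning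
      W = ∑[ d ] ⟦ S d ⟧ * r Y d
      e₁ : ∀ K q → 36 * K * q + 36 * K * q ≡ 72 * K * q
      e₁ = solve-∀
      e₂ : ∀ K W y → 72 * K * W + 6 * y * (K * (6 * y)) ≡ 36 * K * (2 * W) + 36 * K * (y * y)
      e₂ = solve-∀
      pt : ∀ d → 72 * K * r Y d ≤ 72 * K * (⟦ S d ⟧ * r Y d) + n * ⟦ D d ⟧
      pt d with S d in es
      ... | true = ≤-trans (≤-reflexive (cong (72 * K *_) (sym (*-identityˡ (r Y d))))) (m≤m+n _ _)
      ... | false with D d in ed
      ...   | true = ≤-trans (<⇒≤ (≤ᵈ-false es)) (≤-trans (≤-reflexive (sym (*-identityʳ n))) (m≤n+m (n * 1) (72 * K * 0)))
      ...   | false = ≤-trans (*-monoʳ-≤ (72 * K) (≤-trans (≤-reflexive (sym (*-identityˡ (r Y d)))) (≤-pred (≤ᵈ-false ed)))) (m≤m+n _ _)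

    private
      κ = 72 * K

      y≥1 : 1 ≤ card Y
      y≥1 = *-cancelˡ-< 6 0 (card Y) (≤-trans n≥1 n≤)

      S-large : n ≤ 72 * card S
      S-large = *-cancelˡ-≤ n {{>-nonZero n≥1}} (begin
        n * n  ≤⟨ *-mono-≤ n≤ n≤ ⟩
        6 * card Y * (6 * card Y)  ≡⟨ e₁ (card Y) ⟩
        36 * (card Y * card Y)  ≤⟨ *-monoʳ-≤ 36 popular-mass ⟩
        36 * (2 * (∑[ d ] ⟦ S d ⟧ * r Y d))  ≤⟨ *-monoʳ-≤ 36 (*-monoʳ-≤ 2 (≤-trans (∑-mono elems (λ d → *-monoʳ-≤ ⟦ S d ⟧ (≤-trans (r≤card Y d) Y≤n))) (≤-reflexive (∑-*ʳ elems n _)))) ⟩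
        36 * (2 * (card S * n))  ≡⟨ e₂ (card S) n ⟩
        n * (72 * card S)  ∎)
        where
        open ≤-Reasoning
        e₁ : ∀ y → 6 * y * (6 * y) ≡ 36 * (y * y)
        e₁ = solve-∀
        e₂ : ∀ s n → 36 * (2 * (s * n)) ≡ n * (72 * s)
        e₂ = solve-∀

      S-pos : ∃ λ s → S s ≡ true
      S-pos = _ , one⁻ (proj₂ (∑-∃ {λ s → ⟦ S s ⟧} (*-cancelˡ-< 72 0 (card S) (≤-trans n≥1 S-large))))

      Y-pos : ∃ λ a → Y a ≡ true
      Y-pos = _ , one⁻ (proj₂ (∑-∃ {λ s → ⟦ Y s ⟧} y≥1))

      Z≤ : ∀ k → card (Z k) ≤ (κ * K) ^ k * (K * n)
      Z≤ = Z-card K n≥1 D≤ Y-pos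

      S-neg : ∀ {s} → S s ≡ true → S (⊖ s) ≡ true
      S-neg {s} h = trans (popular-sym Y κ n s) h

      Z-+ : ∀ k {v s} → S s ≡ true → Z k v ≡ true → Z (suc k) (v ⊕ s) ≡ true
      Z-+ k {v} {s} hs hv = sumset-intro (Z k) S hs (subst (λ w → Z k w ≡ true) (solve 2 (λ v s → v := v :+ s :- s) refl v s) hv)
        where open G-Solver

      Z₀ : Z 0 𝟎 ≡ true
      Z₀ = ⇒does (𝟎 ≟F 𝟎) refl

      S-S : ∀ {a b} → S a ≡ true → S b ≡ true → Z 2 (b ⊝ a) ≡ true
      S-S {a} {b} ha hb = subst (λ w → Z 2 w ≡ true) (solve 2 (λ a b → con (pos 0) :+ b :+ (:- a) := b :- a) refl a b) (Z-+ 1 (S-neg ha) (Z-+ 0 hb Z₀))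
        where open G-Solver

      module C = Covering S (Z 2) (Z 3) (Z 4) S-S (Z-+ 2) (λ hs hz → sumset-intro (Z 3) S hs hz) (proj₁ S-pos) (proj₂ S-pos)

      X≤ : length C.X ≤ følner-rank K
      X≤ = *-cancelʳ-≤ (length C.X) (følner-rank K) n {{>-nonZero n≥1}} (begin
        length C.X * n  ≤⟨ *-monoʳ-≤ (length C.X) S-large ⟩
        length C.X * (72 * card S)  ≡⟨ e₁ (length C.X) (card S) ⟩
        72 * (length C.X * card S)  ≤⟨ *-monoʳ-≤ 72 (≤-trans C.X-length (Z≤ 4)) ⟩
        72 * ((κ * K) ^ 4 * (K * n))  ≡⟨ e₂ ((κ * K) ^ 4) K n ⟩
        følner-rank K * n  ∎)
        where
        open ≤-Reasoning
        e₁ : ∀ x s → x * (72 * s) ≡ 72 * (x * s)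
        e₁ = solve-∀
        e₂ : ∀ q K n → 72 * (q * (K * n)) ≡ 72 * (q * K) * n
        e₂ = solve-∀

      Z₂-pos : 1 ≤ card (Z 2)
      Z₂-pos = ≤-trans (one (S-S (proj₂ S-pos) (proj₂ S-pos))) (∑-term (elems-all _) (λ x → ⟦ Z 2 x ⟧))

    popular-følner : ∀ e (e≥1 : 1 ≤ e) → Følner S e (følner-size K e e≥1 * n)
    popular-følner e e≥1 = record { Følner F ; B-card = ≤-trans (Følner.B-card F) (≤-trans (*-monoʳ-≤ ((k + 1) ^ følner-rank K) (Z≤ 2)) (≤-reflexive (lem ((k + 1) ^ følner-rank K) ((κ * K) ^ 2) K n))) }
      where
      k = proj₁ (ExponentialGrowth.exponential-beats-polynomial e (følner-rank K) e≥1)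
      F = følner S (Z 2) (Z 3) C.X C.X-covers (Z-+ 2) Z₂-pos (følner-rank K) X≤ e k (proj₂ (ExponentialGrowth.exponential-beats-polynomial e (følner-rank K) e≥1))
      lem : ∀ a b K n → a * (b * (K * n)) ≡ a * (b * K) * n
      lem = solve-∀

  -- The second moment over all dilations

  zcong : {f g : G → ℤ} → (∀ x → f x ≡ g x) → ∑Z f ≡ ∑Z g
  zcong = Σℤ.∑-cong elems

  z+ : (f g : G → ℤ) → ∑ᶻ[ x ] (f x ℤ.+ g x) ≡ ∑Z f ℤ.+ ∑Z g
  z+ = Σℤ.∑-+ elems

  z*ˡ : ∀ k (f : G → ℤ) → ∑ᶻ[ x ] k ℤ.* f x ≡ k ℤ.* ∑Z f
  z*ˡ = Σℤ.∑-*ˡ elems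

  z*ʳ : ∀ k (f : G → ℤ) → ∑ᶻ[ x ] f x ℤ.* k ≡ ∑Z f ℤ.* k
  z*ʳ = Σℤ.∑-*ʳ elems

  zswap : (f : G → G → ℤ) → ∑ᶻ[ x ] ∑ᶻ[ y ] f x y ≡ ∑ᶻ[ y ] ∑ᶻ[ x ] f x y
  zswap = Σℤ.∑-swap elems elems

  z- : (f g : G → ℤ) → ∑ᶻ[ x ] (f x ℤ.- g x) ≡ ∑Z f ℤ.- ∑Z g
  z- f g = trans (z+ f (λ x → ℤ.- g x)) (cong (λ z → ∑Z f ℤ.+ z) (trans (zcong (λ x → sym (ℤP.-1*i≡-i (g x)))) (trans (z*ˡ ℤ.-1ℤ g) (ℤP.-1*i≡-i _))))

  pos-∑ : ∀ {a} {X : Set a} (xs : List X) (f : X → ℕ) → pos (∑ xs f) ≡ Σℤ.∑ xs (λ x → pos (f x))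
  pos-∑ [] f = refl
  pos-∑ (x ∷ xs) f = trans (ℤP.pos-+ (f x) _) (cong (λ z → pos (f x) ℤ.+ z) (pos-∑ xs f))

  z-const : ∀ k → ∑ᶻ[ x ] k ≡ P ℤ.* k
  z-const k = trans (const elems) (cong (λ l → pos l ℤ.* k) elems-length)
    where
    const : (xs : List G) → Σℤ.∑ xs (λ _ → k) ≡ pos (length xs) ℤ.* k
    const [] = refl
    const (x ∷ xs) = trans (cong (λ z → k ℤ.+ z) (const xs)) (lem k (pos (length xs)))
      where
      lem : ∀ k l → k ℤ.+ l ℤ.* k ≡ (pos 1 ℤ.+ l) ℤ.* k
      lem = ℤR.solve-∀

  -- For indicator functions of sets B and I this counts the points of ξB + β in I: the profile of
  -- the dilate ξB seen through a moving window.
  transform : (f g : G → ℤ) → G → G → ℤ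
  transform f g ξ β = ∑ᶻ[ x ] f x ℤ.* g (ξ ⊗ x ⊕ β)

  sqz : ℤ → ℤ
  sqz z = z ℤ.* z

  private
    z*z : (f g : G → ℤ) → ∑Z f ℤ.* ∑Z g ≡ ∑ᶻ[ x ] ∑ᶻ[ y ] f x ℤ.* g y
    z*z f g = trans (sym (z*ʳ (∑Z g) f)) (zcong (λ x → sym (z*ˡ (f x) g)))

    z-shiftˡ : ∀ t (f : G → ℤ) → ∑ᶻ[ x ] f (t ⊕ x) ≡ ∑Z f
    z-shiftˡ t f = trans (zcong (λ x → cong f (solve 2 (λ t x → t :+ x := x :+ t) refl t x))) (∑ᶻ-shift t f)
      where open G-Solver

  -- For x ≢ x′ the pair (ξ x + β , ξ x′ + β) is equidistributed over G × G.
  correlation : ∀ (g : G → ℤ) x x' → ∑ᶻ[ ξ ] ∑ᶻ[ β ] g (ξ ⊗ x ⊕ β) ℤ.* g (ξ ⊗ x' ⊕ β)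
                ≡ sqz (∑Z g) ℤ.+ Σℤ.⟦ does (x ≟F x') ⟧ ℤ.* (P ℤ.* (∑ᶻ[ β ] sqz (g β)) ℤ.- sqz (∑Z g))
  correlation g x x' = trans step (last (x ≟F x'))
    where
    open G-Solver
    step : ∑ᶻ[ ξ ] ∑ᶻ[ β ] g (ξ ⊗ x ⊕ β) ℤ.* g (ξ ⊗ x' ⊕ β) ≡ ∑ᶻ[ β ] g β ℤ.* (∑ᶻ[ ξ ] g (β ⊕ (x' ⊝ x) ⊗ ξ))
    step = begin
      ∑ᶻ[ ξ ] ∑ᶻ[ β ] g (ξ ⊗ x ⊕ β) ℤ.* g (ξ ⊗ x' ⊕ β)
        ≡⟨ zcong (λ ξ → zcong (λ β → cong (λ w → g (ξ ⊗ x ⊕ β) ℤ.* g w) (solve 4 (λ ξ x x' β → ξ :* x' :+ β := ξ :* x :+ β :+ (x' :- x) :* ξ) refl ξ x x' β))) ⟩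
      ∑ᶻ[ ξ ] ∑ᶻ[ β ] g (ξ ⊗ x ⊕ β) ℤ.* g (ξ ⊗ x ⊕ β ⊕ (x' ⊝ x) ⊗ ξ)
        ≡⟨ zcong (λ ξ → z-shiftˡ (ξ ⊗ x) (λ β → g β ℤ.* g (β ⊕ (x' ⊝ x) ⊗ ξ))) ⟩
      ∑ᶻ[ ξ ] ∑ᶻ[ β ] g β ℤ.* g (β ⊕ (x' ⊝ x) ⊗ ξ)
        ≡⟨ zswap (λ ξ β → g β ℤ.* g (β ⊕ (x' ⊝ x) ⊗ ξ)) ⟩
      ∑ᶻ[ β ] ∑ᶻ[ ξ ] g β ℤ.* g (β ⊕ (x' ⊝ x) ⊗ ξ)
        ≡⟨ zcong (λ β → z*ˡ (g β) (λ ξ → g (β ⊕ (x' ⊝ x) ⊗ ξ))) ⟩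
      ∑ᶻ[ β ] g β ℤ.* (∑ᶻ[ ξ ] g (β ⊕ (x' ⊝ x) ⊗ ξ)) ∎
      where open ≡-Reasoning
    last : (d : Dec (x ≡ x')) → ∑ᶻ[ β ] g β ℤ.* (∑ᶻ[ ξ ] g (β ⊕ (x' ⊝ x) ⊗ ξ)) ≡ sqz (∑Z g) ℤ.+ Σℤ.⟦ does d ⟧ ℤ.* (P ℤ.* (∑ᶻ[ β ] sqz (g β)) ℤ.- sqz (∑Z g))
    last (yes refl) = begin
      ∑ᶻ[ β ] g β ℤ.* (∑ᶻ[ ξ ] g (β ⊕ (x ⊝ x) ⊗ ξ))
        ≡⟨ zcong (λ β → cong (λ z → g β ℤ.* z) (trans (zcong (λ ξ → cong g (solve 3 (λ β x ξ → β :+ (x :- x) :* ξ := β) refl β x ξ))) (z-const (g β)))) ⟩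
      ∑ᶻ[ β ] g β ℤ.* (P ℤ.* g β)
        ≡⟨ trans (zcong (λ β → e₁ (g β) P)) (z*ˡ P (λ β → sqz (g β))) ⟩
      P ℤ.* (∑ᶻ[ β ] sqz (g β))
        ≡⟨ e₂ (P ℤ.* (∑ᶻ[ β ] sqz (g β))) (sqz (∑Z g)) ⟩
      sqz (∑Z g) ℤ.+ pos 1 ℤ.* (P ℤ.* (∑ᶻ[ β ] sqz (g β)) ℤ.- sqz (∑Z g)) ∎
      where
      open ≡-Reasoning
      e₁ : ∀ a P → a ℤ.* (P ℤ.* a) ≡ P ℤ.* (a ℤ.* a)
      e₁ = ℤR.solve-∀
      e₂ : ∀ a b → a ≡ b ℤ.+ pos 1 ℤ.* (a ℤ.- b)
      e₂ = ℤR.solve-∀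
    last (no x≢) = begin
      ∑ᶻ[ β ] g β ℤ.* (∑ᶻ[ ξ ] g (β ⊕ (x' ⊝ x) ⊗ ξ))
        ≡⟨ zcong (λ β → cong (λ z → g β ℤ.* z) (trans (∑ᶻ-dilate (proj₂ inv) (λ z → g (β ⊕ z))) (z-shiftˡ β g))) ⟩
      ∑ᶻ[ β ] g β ℤ.* ∑Z g  ≡⟨ z*ʳ (∑Z g) g ⟩
      sqz (∑Z g)  ≡⟨ e₁ (sqz (∑Z g)) (P ℤ.* (∑ᶻ[ β ] sqz (g β)) ℤ.- sqz (∑Z g)) ⟩
      sqz (∑Z g) ℤ.+ pos 0 ℤ.* (P ℤ.* (∑ᶻ[ β ] sqz (g β)) ℤ.- sqz (∑Z g)) ∎
      where
      open ≡-Reasoning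
      e₁ : ∀ a b → a ≡ a ℤ.+ pos 0 ℤ.* b
      e₁ = ℤR.solve-∀
      inv : Unit (x' ⊝ x)
      inv = unit (x' ⊝ x) (λ e → x≢ (sym (trans (solve 2 (λ x x' → x' := x' :- x :+ x) refl x x') (trans (cong (_⊕ x) e) (solve 1 (λ x → con (pos 0) :+ x := x) refl x)))))

  -- Takes the part of Parseval's identity. After the square is expanded, `correlation` leaves a
  -- main term, which vanishes when f or g has sum zero, and a diagonal term.
  second-moment : ∀ f g → ∑ᶻ[ ξ ] ∑ᶻ[ β ] sqz (transform f g ξ β)
                ≡ sqz (∑Z f) ℤ.* sqz (∑Z g) ℤ.+ (∑ᶻ[ x ] sqz (f x)) ℤ.* (P ℤ.* (∑ᶻ[ β ] sqz (g β)) ℤ.- sqz (∑Z g))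
  second-moment f g = begin
    ∑ᶻ[ ξ ] ∑ᶻ[ β ] sqz (transform f g ξ β)
      ≡⟨ zcong (λ ξ → zcong (λ β → z*z (λ x → f x ℤ.* g (ξ ⊗ x ⊕ β)) (λ x → f x ℤ.* g (ξ ⊗ x ⊕ β)))) ⟩
    ∑ᶻ[ ξ ] ∑ᶻ[ β ] ∑ᶻ[ x ] ∑ᶻ[ y ] f x ℤ.* g (ξ ⊗ x ⊕ β) ℤ.* (f y ℤ.* g (ξ ⊗ y ⊕ β))
      ≡⟨ zcong (λ ξ → trans (zswap (λ β x → ∑ᶻ[ y ] f x ℤ.* g (ξ ⊗ x ⊕ β) ℤ.* (f y ℤ.* g (ξ ⊗ y ⊕ β)))) (zcong (λ x → zswap (λ β y → f x ℤ.* g (ξ ⊗ x ⊕ β) ℤ.* (f y ℤ.* g (ξ ⊗ y ⊕ β)))))) ⟩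
    ∑ᶻ[ ξ ] ∑ᶻ[ x ] ∑ᶻ[ y ] ∑ᶻ[ β ] f x ℤ.* g (ξ ⊗ x ⊕ β) ℤ.* (f y ℤ.* g (ξ ⊗ y ⊕ β))
      ≡⟨ trans (zswap (λ ξ x → ∑ᶻ[ y ] ∑ᶻ[ β ] f x ℤ.* g (ξ ⊗ x ⊕ β) ℤ.* (f y ℤ.* g (ξ ⊗ y ⊕ β)))) (zcong (λ x → zswap (λ ξ y → ∑ᶻ[ β ] f x ℤ.* g (ξ ⊗ x ⊕ β) ℤ.* (f y ℤ.* g (ξ ⊗ y ⊕ β))))) ⟩
    ∑ᶻ[ x ] ∑ᶻ[ y ] ∑ᶻ[ ξ ] ∑ᶻ[ β ] f x ℤ.* g (ξ ⊗ x ⊕ β) ℤ.* (f y ℤ.* g (ξ ⊗ y ⊕ β))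
      ≡⟨ zcong (λ x → zcong (λ y → pull x y)) ⟩
    ∑ᶻ[ x ] ∑ᶻ[ y ] (a ℤ.* (f x ℤ.* f y) ℤ.+ Σℤ.⟦ does (x ≟F y) ⟧ ℤ.* (f x ℤ.* f y ℤ.* b))
      ≡⟨ zcong (λ x → trans (z+ (λ y → a ℤ.* (f x ℤ.* f y)) (λ y → Σℤ.⟦ does (x ≟F y) ⟧ ℤ.* (f x ℤ.* f y ℤ.* b))) (cong₂ ℤ._+_ (trans (z*ˡ a (λ y → f x ℤ.* f y)) (cong (λ z → a ℤ.* z) (z*ˡ (f x) f))) (∑ᶻ-δ x (λ y → f x ℤ.* f y ℤ.* b)))) ⟩
    ∑ᶻ[ x ] (a ℤ.* (f x ℤ.* ∑Z f) ℤ.+ sqz (f x) ℤ.* b)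
      ≡⟨ trans (z+ (λ x → a ℤ.* (f x ℤ.* ∑Z f)) (λ x → sqz (f x) ℤ.* b)) (cong₂ ℤ._+_ (trans (z*ˡ a (λ x → f x ℤ.* ∑Z f)) (trans (cong (λ z → a ℤ.* z) (z*ʳ (∑Z f) f)) (ℤP.*-comm a (sqz (∑Z f))))) (z*ʳ b (λ x → sqz (f x)))) ⟩
    sqz (∑Z f) ℤ.* a ℤ.+ (∑ᶻ[ x ] sqz (f x)) ℤ.* b ∎
    where
    open ≡-Reasoning
    a = sqz (∑Z g)
    b = P ℤ.* (∑ᶻ[ β ] sqz (g β)) ℤ.- sqz (∑Z g)
    pull : ∀ x y → ∑ᶻ[ ξ ] ∑ᶻ[ β ] f x ℤ.* g (ξ ⊗ x ⊕ β) ℤ.* (f y ℤ.* g (ξ ⊗ y ⊕ β)) ≡ a ℤ.* (f x ℤ.* f y) ℤ.+ Σℤ.⟦ does (x ≟F y) ⟧ ℤ.* (f x ℤ.* f y ℤ.* b)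
    pull x y = begin
      ∑ᶻ[ ξ ] ∑ᶻ[ β ] f x ℤ.* g (ξ ⊗ x ⊕ β) ℤ.* (f y ℤ.* g (ξ ⊗ y ⊕ β))
        ≡⟨ zcong (λ ξ → trans (zcong (λ β → e₁ (f x) (g (ξ ⊗ x ⊕ β)) (f y) (g (ξ ⊗ y ⊕ β)))) (z*ˡ (f x ℤ.* f y) (λ β → g (ξ ⊗ x ⊕ β) ℤ.* g (ξ ⊗ y ⊕ β)))) ⟩
      ∑ᶻ[ ξ ] f x ℤ.* f y ℤ.* (∑ᶻ[ β ] g (ξ ⊗ x ⊕ β) ℤ.* g (ξ ⊗ y ⊕ β))
        ≡⟨ trans (z*ˡ (f x ℤ.* f y) (λ ξ → ∑ᶻ[ β ] g (ξ ⊗ x ⊕ β) ℤ.* g (ξ ⊗ y ⊕ β))) (cong (λ z → f x ℤ.* f y ℤ.* z) (correlation g x y)) ⟩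
      f x ℤ.* f y ℤ.* (a ℤ.+ Σℤ.⟦ does (x ≟F y) ⟧ ℤ.* b)
        ≡⟨ e₂ (f x ℤ.* f y) a Σℤ.⟦ does (x ≟F y) ⟧ b ⟩
      a ℤ.* (f x ℤ.* f y) ℤ.+ Σℤ.⟦ does (x ≟F y) ⟧ ℤ.* (f x ℤ.* f y ℤ.* b) ∎
      where
      e₁ : ∀ a b c d → a ℤ.* b ℤ.* (c ℤ.* d) ≡ a ℤ.* c ℤ.* (b ℤ.* d)
      e₁ = ℤR.solve-∀
      e₂ : ∀ f a s b → f ℤ.* (a ℤ.+ s ℤ.* b) ≡ a ℤ.* f ℤ.+ s ℤ.* (f ℤ.* b)
      e₂ = ℤR.solve-∀

  indicator : BSet → G → ℤ
  indicator B x = pos ⟦ B x ⟧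

  sq-difference : Bool → Bool → ℕ
  sq-difference a b = sq (pos ⟦ a ⟧ ℤ.- pos ⟦ b ⟧)

  module Window (B I : BSet) where
    b = card B
    m = card I

    F : G → G → ℤ
    F = transform (indicator B) (indicator I)

    -- Squared change of the profile of ξB under a shift by u. `Γ` and `Δ` below are the sizes of
    -- the symmetric differences of I and of B with a translate.
    V : G → G → ℕ
    V u ξ = ∑[ β ] sq (F ξ (β ⊕ u) ℤ.- F ξ β)

    Γ : G → ℕ
    Γ u = ∑[ β ] sq-difference (I (β ⊕ u)) (I β)

    Δ : G → ℕ
    Δ s = ∑[ x ] sq-difference (B (x ⊝ s)) (B x)

    private
      pos-sum-sq : (f : G → ℤ) → pos (∑[ x ] sq (f x)) ≡ ∑ᶻ[ x ] sqz (f x)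
      pos-sum-sq f = trans (pos-∑ elems _) (zcong (λ x → sq-pos (f x)))

      sqz-⟦⟧ : ∀ a → sqz (pos ⟦ a ⟧) ≡ pos ⟦ a ⟧
      sqz-⟦⟧ true = refl
      sqz-⟦⟧ false = refl

      ∑-sqz-indicator : ∀ A → ∑ᶻ[ x ] sqz (indicator A x) ≡ pos (card A)
      ∑-sqz-indicator A = trans (zcong (λ x → sqz-⟦⟧ (A x))) (sym (pos-∑ elems _))

      zero-sum : ∀ {f g : G → ℤ} → ∑Z f ≡ ∑Z g → ∑ᶻ[ x ] (f x ℤ.- g x) ≡ pos 0
      zero-sum {f} {g} e = trans (z- f g) (trans (cong (ℤ._- ∑Z g) e) (ℤP.+-inverseʳ (∑Z g)))

      pos-V : ∀ (u : G → G) (f g : G → ℤ) → (∀ ξ β → F ξ (β ⊕ u ξ) ℤ.- F ξ β ≡ transform f g ξ β) → pos (∑[ ξ ] V (u ξ) ξ) ≡ ∑ᶻ[ ξ ] ∑ᶻ[ β ] sqz (transform f g ξ β)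
      pos-V u f g e = trans (pos-∑ elems _) (zcong (λ ξ → trans (pos-sum-sq (λ β → F ξ (β ⊕ u ξ) ℤ.- F ξ β)) (zcong (λ β → cong sqz (e ξ β)))))

    -- The change of the profile is the transform of B against the difference of two windows; this
    -- difference has sum zero, so only the diagonal term of `second-moment` is left.
    ∑-V-shift : ∀ u → ∑[ ξ ] V u ξ ≡ b * (p * Γ u)
    ∑-V-shift u = ℤP.+-injective (begin
      pos (∑[ ξ ] V u ξ)  ≡⟨ pos-V (λ _ → u) (indicator B) g diff ⟩
      ∑ᶻ[ ξ ] ∑ᶻ[ β ] sqz (transform (indicator B) g ξ β)  ≡⟨ second-moment (indicator B) g ⟩
      sqz (∑Z (indicator B)) ℤ.* sqz (∑Z g) ℤ.+ (∑ᶻ[ x ] sqz (indicator B x)) ℤ.* (P ℤ.* (∑ᶻ[ β ] sqz (g β)) ℤ.- sqz (∑Z g))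
        ≡⟨ cong₂ (λ w v → sqz (∑Z (indicator B)) ℤ.* sqz w ℤ.+ v ℤ.* (P ℤ.* (∑ᶻ[ β ] sqz (g β)) ℤ.- sqz w)) (zero-sum (∑ᶻ-shift u (indicator I))) (∑-sqz-indicator B) ⟩
      sqz (∑Z (indicator B)) ℤ.* pos 0 ℤ.+ pos b ℤ.* (P ℤ.* (∑ᶻ[ β ] sqz (g β)) ℤ.- pos 0)
        ≡⟨ e₁ (sqz (∑Z (indicator B))) (pos b) (P ℤ.* (∑ᶻ[ β ] sqz (g β))) ⟩
      pos b ℤ.* (P ℤ.* (∑ᶻ[ β ] sqz (g β)))  ≡⟨ cong (λ z → pos b ℤ.* (P ℤ.* z)) (sym (pos-sum-sq g)) ⟩
      pos b ℤ.* (P ℤ.* pos (Γ u))  ≡⟨ trans (cong (λ z → pos b ℤ.* z) (sym (ℤP.pos-* p (Γ u)))) (sym (ℤP.pos-* b _)) ⟩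
      pos (b * (p * Γ u))  ∎)
      where
      open ≡-Reasoning
      g : G → ℤ
      g z = indicator I (z ⊕ u) ℤ.- indicator I z
      e₁ : ∀ s b q → s ℤ.* pos 0 ℤ.+ b ℤ.* (q ℤ.- pos 0) ≡ b ℤ.* q
      e₁ = ℤR.solve-∀
      e₂ : ∀ b x y → b ℤ.* x ℤ.- b ℤ.* y ≡ b ℤ.* (x ℤ.- y)
      e₂ = ℤR.solve-∀
      diff : ∀ ξ β → F ξ (β ⊕ u) ℤ.- F ξ β ≡ transform (indicator B) g ξ β
      diff ξ β = trans (sym (z- _ _)) (zcong (λ x → trans (cong (λ w → indicator B x ℤ.* indicator I w ℤ.- indicator B x ℤ.* indicator I (ξ ⊗ x ⊕ β)) (solve 3 (λ a β u → a :+ (β :+ u) := a :+ β :+ u) refl (ξ ⊗ x) β u)) (e₂ (indicator B x) (indicator I (ξ ⊗ x ⊕ β ⊕ u)) (indicator I (ξ ⊗ x ⊕ β)))))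
        where open G-Solver

    -- For every ξ at once, shifting the profile by ξs amounts to translating B by s, and the
    -- difference of the indicators of B + s and B has sum zero.
    ∑-V-period : ∀ s → ∑[ ξ ] V (ξ ⊗ s) ξ ≤ Δ s * (p * m)
    ∑-V-period s = ℤP.drop‿+≤+ (ℤP.≤-trans (ℤP.≤-reflexive eq) (ℤP.≤-trans (ℤP.i≤i+j _ (pos (Δ s * (m * m)))) (ℤP.≤-reflexive eq'')))
      where
      f : G → ℤ
      f x = indicator B (x ⊝ s) ℤ.- indicator B x
      e₂ : ∀ b c x → b ℤ.* x ℤ.- c ℤ.* x ≡ (b ℤ.- c) ℤ.* x
      e₂ = ℤR.solve-∀
      diff : ∀ ξ β → F ξ (β ⊕ ξ ⊗ s) ℤ.- F ξ β ≡ transform f (indicator I) ξ β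
      diff ξ β = trans (cong (ℤ._- F ξ β) (trans (sym (∑ᶻ-shift (⊖ s) _)) (zcong (λ x → cong (λ w → indicator B (x ⊝ s) ℤ.* indicator I w) (solve 4 (λ ξ x s β → ξ :* (x :- s) :+ (β :+ ξ :* s) := ξ :* x :+ β) refl ξ x s β)))))
        (trans (sym (z- _ _)) (zcong (λ x → e₂ (indicator B (x ⊝ s)) (indicator B x) (indicator I (ξ ⊗ x ⊕ β)))))
        where open G-Solver
      D' = ∑ᶻ[ x ] sqz (f x)
      e₃ : ∀ D P m s → pos 0 ℤ.* s ℤ.+ D ℤ.* (P ℤ.* m ℤ.- m ℤ.* m) ≡ D ℤ.* (P ℤ.* m) ℤ.- D ℤ.* (m ℤ.* m)
      e₃ = ℤR.solve-∀
      eq : pos (∑[ ξ ] V (ξ ⊗ s) ξ) ≡ pos (Δ s * (p * m)) ℤ.- pos (Δ s * (m * m))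
      eq = begin
        pos (∑[ ξ ] V (ξ ⊗ s) ξ)  ≡⟨ pos-V (_⊗ s) f (indicator I) diff ⟩
        ∑ᶻ[ ξ ] ∑ᶻ[ β ] sqz (transform f (indicator I) ξ β)  ≡⟨ second-moment f (indicator I) ⟩
        sqz (∑Z f) ℤ.* sqz (∑Z (indicator I)) ℤ.+ D' ℤ.* (P ℤ.* (∑ᶻ[ β ] sqz (indicator I β)) ℤ.- sqz (∑Z (indicator I)))
          ≡⟨ cong₂ (λ w v → sqz w ℤ.* sqz (∑Z (indicator I)) ℤ.+ D' ℤ.* (P ℤ.* v ℤ.- sqz (∑Z (indicator I)))) (zero-sum (∑ᶻ-shift (⊖ s) (indicator B))) (∑-sqz-indicator I) ⟩
        pos 0 ℤ.* sqz (∑Z (indicator I)) ℤ.+ D' ℤ.* (P ℤ.* pos m ℤ.- sqz (∑Z (indicator I)))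
          ≡⟨ cong₂ (λ w v → pos 0 ℤ.* sqz w ℤ.+ v ℤ.* (P ℤ.* pos m ℤ.- sqz w)) (sym (pos-∑ elems _)) (sym (pos-sum-sq f)) ⟩
        pos 0 ℤ.* sqz (pos m) ℤ.+ pos (Δ s) ℤ.* (P ℤ.* pos m ℤ.- pos m ℤ.* pos m)
          ≡⟨ e₃ (pos (Δ s)) P (pos m) (sqz (pos m)) ⟩
        pos (Δ s) ℤ.* (P ℤ.* pos m) ℤ.- pos (Δ s) ℤ.* (pos m ℤ.* pos m)
          ≡⟨ cong₂ ℤ._-_ (trans (cong (λ z → pos (Δ s) ℤ.* z) (sym (ℤP.pos-* p m))) (sym (ℤP.pos-* (Δ s) _))) (trans (cong (λ z → pos (Δ s) ℤ.* z) (sym (ℤP.pos-* m m))) (sym (ℤP.pos-* (Δ s) _))) ⟩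
        pos (Δ s * (p * m)) ℤ.- pos (Δ s * (m * m)) ∎
        where open ≡-Reasoning
      e₄ : ∀ a c → a ℤ.- c ℤ.+ c ≡ a
      e₄ = ℤR.solve-∀
      eq'' = e₄ (pos (Δ s * (p * m))) (pos (Δ s * (m * m)))

    -- At ξ = 0 the profile is b times the window, whatever B is. This degenerate frequency has to
    -- be excluded when ξ is chosen.
    V-zero : ∀ u → V u 𝟎 ≡ b * b * Γ u
    V-zero u = trans (∑-cong elems (λ β → trans (cong sq (diff β)) (sq-scale _))) (∑-*ˡ elems (b * b) _)
      where
      open G-Solver
      F₀ : ∀ β → F 𝟎 β ≡ pos b ℤ.* indicator I β
      F₀ β = trans (zcong (λ x → cong (λ w → indicator B x ℤ.* indicator I w) (solve 2 (λ x β → con (pos 0) :* x :+ β := β) refl x β))) (trans (z*ʳ (indicator I β) (indicator B)) (cong (ℤ._* indicator I β) (sym (pos-∑ elems _))))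
      e₂ : ∀ b x y → b ℤ.* x ℤ.- b ℤ.* y ≡ b ℤ.* (x ℤ.- y)
      e₂ = ℤR.solve-∀
      diff : ∀ β → F 𝟎 (β ⊕ u) ℤ.- F 𝟎 β ≡ pos b ℤ.* (indicator I (β ⊕ u) ℤ.- indicator I β)
      diff β = trans (cong₂ ℤ._-_ (F₀ (β ⊕ u)) (F₀ β)) (e₂ (pos b) (indicator I (β ⊕ u)) (indicator I β))
      sq-scale : ∀ z → sq (pos b ℤ.* z) ≡ b * b * sq z
      sq-scale z = trans (cong₂ _*_ (ℤP.abs-* (pos b) z) (ℤP.abs-* (pos b) z)) (e₃ b ⌊ z ⌋)
        where
        e₃ : ∀ b z → (b * z) * (b * z) ≡ b * b * (z * z)
        e₃ = solve-∀

    Γ+2r : ∀ u → Γ u + 2 * r I u ≡ 2 * m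
    Γ+2r u = begin
      Γ u + 2 * r I u  ≡⟨ cong (Γ u +_) (sym (∑-*ˡ elems 2 _)) ⟩
      Γ u + ∑[ z ] 2 * (⟦ I z ⟧ * ⟦ I (z ⊕ u) ⟧)  ≡⟨ sym (∑-+ elems _ _) ⟩
      ∑[ z ] (sq-difference (I (z ⊕ u)) (I z) + 2 * (⟦ I z ⟧ * ⟦ I (z ⊕ u) ⟧))  ≡⟨ ∑-cong elems (λ z → pt (I (z ⊕ u)) (I z)) ⟩
      ∑[ z ] (⟦ I (z ⊕ u) ⟧ + ⟦ I z ⟧)  ≡⟨ ∑-+ elems _ _ ⟩
      (∑[ z ] ⟦ I (z ⊕ u) ⟧) + m  ≡⟨ cong (_+ m) (∑-shift u _) ⟩
      m + m  ≡⟨ cong (m +_) (sym (+-identityʳ m)) ⟩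
      2 * m  ∎
      where
      open ≡-Reasoning
      pt : ∀ a c → sq-difference a c + 2 * (⟦ c ⟧ * ⟦ a ⟧) ≡ ⟦ a ⟧ + ⟦ c ⟧
      pt true true = refl
      pt true false = refl
      pt false true = refl
      pt false false = refl

    ∑-Γ : ∑G Γ + 2 * (m * m) ≡ p * (2 * m)
    ∑-Γ = begin
      ∑G Γ + 2 * (m * m)  ≡⟨ cong (∑G Γ +_) (trans (cong (2 *_) (sym (∑-r I))) (sym (∑-*ˡ elems 2 _))) ⟩
      ∑G Γ + ∑[ u ] 2 * r I u  ≡⟨ sym (∑-+ elems _ _) ⟩
      ∑[ u ] (Γ u + 2 * r I u)  ≡⟨ trans (∑-cong elems Γ+2r) (∑G-const (2 * m)) ⟩
      p * (2 * m)  ∎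
      where open ≡-Reasoning

    V-+ : ∀ u v ξ → V (u ⊕ v) ξ ≤ 2 * V u ξ + 2 * V v ξ
    V-+ u v ξ = begin
      V (u ⊕ v) ξ  ≤⟨ ∑-mono elems (λ β → ≤-trans (≤-reflexive (cong sq (split β))) (sq-+ (F ξ (β ⊕ u ⊕ v) ℤ.- F ξ (β ⊕ u)) (F ξ (β ⊕ u) ℤ.- F ξ β))) ⟩
      ∑[ β ] (2 * sq (F ξ (β ⊕ u ⊕ v) ℤ.- F ξ (β ⊕ u)) + 2 * sq (F ξ (β ⊕ u) ℤ.- F ξ β)) ≡⟨ trans (∑-+ elems _ _) (cong₂ _+_ (trans (∑-*ˡ elems 2 _) (cong (2 *_) (∑-shift u (λ β → sq (F ξ (β ⊕ v) ℤ.- F ξ β))))) (∑-*ˡ elems 2 _)) ⟩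
      2 * V v ξ + 2 * V u ξ  ≡⟨ +-comm (2 * V v ξ) _ ⟩
      2 * V u ξ + 2 * V v ξ  ∎
      where
      open ≤-Reasoning
      open G-Solver
      e₁ : ∀ a b c → a ℤ.- c ≡ (a ℤ.- b) ℤ.+ (b ℤ.- c)
      e₁ = ℤR.solve-∀
      split : ∀ β → F ξ (β ⊕ (u ⊕ v)) ℤ.- F ξ β ≡ (F ξ (β ⊕ u ⊕ v) ℤ.- F ξ (β ⊕ u)) ℤ.+ (F ξ (β ⊕ u) ℤ.- F ξ β)
      split β = trans (cong (λ w → F ξ w ℤ.- F ξ β) (solve 3 (λ β u v → β :+ (u :+ v) := β :+ u :+ v) refl β u v)) (e₁ (F ξ (β ⊕ u ⊕ v)) (F ξ (β ⊕ u)) (F ξ β))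

    V-neg : ∀ u ξ → V (⊖ u) ξ ≡ V u ξ
    V-neg u ξ = trans (sym (∑-shift u _)) (∑-cong elems (λ β → trans (cong (λ w → sq (F ξ w ℤ.- F ξ (β ⊕ u))) (solve 2 (λ β u → β :+ u :+ (:- u) := β) refl β u)) (trans (cong sq (e₁ (F ξ β) (F ξ (β ⊕ u)))) (sq-neg (F ξ (β ⊕ u) ℤ.- F ξ β)))))
      where
      open G-Solver
      e₁ : ∀ a b → a ℤ.- b ≡ ℤ.- (b ℤ.- a)
      e₁ = ℤR.solve-∀

    V-multiple : ∀ j t ξ → V (ι (pos j) ⊗ t) ξ ≤ 4 ^ j * V t ξ
    V-multiple zero t ξ = ≤-trans (≤-reflexive (trans (∑-cong elems (λ β → sq-0 (trans (cong (λ w → F ξ w ℤ.- F ξ β) (solve 2 (λ β t → β :+ con (pos 0) :* t := β) refl β t)) (ℤP.+-inverseʳ (F ξ β))))) (∑-zero elems))) z≤n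
      where open G-Solver
    V-multiple (suc j) t ξ = begin
      V (ι (pos (suc j)) ⊗ t) ξ  ≡⟨ cong (λ w → V w ξ) (trans (cong (_⊗ t) (ι-+ (pos 1) (pos j))) (solve 2 (λ j t → (con (pos 1) :+ j) :* t := j :* t :+ t) refl (ι (pos j)) t)) ⟩
      V (ι (pos j) ⊗ t ⊕ t) ξ  ≤⟨ V-+ (ι (pos j) ⊗ t) t ξ ⟩
      2 * V (ι (pos j) ⊗ t) ξ + 2 * V t ξ  ≤⟨ +-mono-≤ (*-monoʳ-≤ 2 (V-multiple j t ξ)) (*-monoʳ-≤ 2 (m≤n*m (V t ξ) (4 ^ j) {{m^n≢0 4 j}})) ⟩
      2 * (4 ^ j * V t ξ) + 2 * (4 ^ j * V t ξ)  ≡⟨ e₁ (4 ^ j) (V t ξ) ⟩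
      4 * 4 ^ j * V t ξ  ∎
      where
      open ≤-Reasoning
      open G-Solver
      e₁ : ∀ q v → 2 * (q * v) + 2 * (q * v) ≡ 4 * q * v
      e₁ = solve-∀

  -- Distance to zero modulo p, Dirichlet approximation and arcs

  ≤ᵈ-no : ∀ {m n} → n < m → m ≤ᵈ n ≡ false
  ≤ᵈ-no {m} {n} lt with m ≤ᵈ n in e
  ... | true = ⊥-elim (<⇒≱ lt (≤ᵈ-elim e))
  ... | false = refl

  toℕ-ι-pos : ∀ {k} → k < p → toℕ (ι (pos k)) ≡ k
  toℕ-ι-pos {k} lt = trans (toℕ-ι (pos k)) (DM.m<n⇒m%n≡m lt)

  ι-small : ∀ {a b} → ι a ≡ ι b → ⌊ a ℤ.- b ⌋ < p → a ≡ b
  ι-small {a} {b} e lt with ι-inj {a} {b} e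
  ... | k , eq = trans eq (trans (cong (λ k → b ℤ.+ k ℤ.* P) k≡0) (ℤP.+-identityʳ b))
    where
    lem : ∀ b k P → (b ℤ.+ k ℤ.* P) ℤ.- b ≡ k ℤ.* P
    lem = ℤR.solve-∀
    size : ⌊ k ⌋ * p < 1 * p
    size = subst₂ _<_ (trans (cong ⌊_⌋ (trans (cong (ℤ._- b) eq) (lem b k P))) (ℤP.abs-* k P)) (sym (*-identityˡ p)) lt
    k≡0 : k ≡ pos 0
    k≡0 = ℤP.∣i∣≡0⇒i≡0 (n<1⇒n≡0 (*-cancelʳ-< p ⌊ k ⌋ 1 size))

  ‖_‖ : G → ℕ
  ‖ x ‖ = toℕ x ⊓ (p ∸ toℕ x)

  norm-rep : ∀ x → ∃ λ z → x ≡ ι z × ⌊ z ⌋ ≡ ‖ x ‖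
  norm-rep x with ≤-total (toℕ x) (p ∸ toℕ x)
  ... | inj₁ h = toℤ x , sym (ι-toℤ x) , sym (m≤n⇒m⊓n≡m h)
  ... | inj₂ h = toℤ x ℤ.- P , trans (sym (ι-toℤ x)) (ι-cong (pos 1) (lem (toℤ x) P)) ,
                 trans (cong ⌊_⌋ (ℤP.m-n≡m⊖n (toℕ x) p)) (trans (ℤP.∣⊖∣-≤ (<⇒≤ (toℕ<n x))) (sym (m≥n⇒m⊓n≡n h)))
    where
    lem : ∀ x P → x ≡ (x ℤ.- P) ℤ.+ pos 1 ℤ.* P
    lem = ℤR.solve-∀

  norm-min : ∀ z → ‖ ι z ‖ ≤ ⌊ z ⌋
  norm-min z with toℤ-ι z
  ... | pos k , e = ≤-trans (m⊓n≤m _ _) (≤-trans (m≤m+n _ (k * p)) (≤-reflexive (sym (cong ⌊_⌋ (trans e (trans (cong (λ w → toℤ (ι z) ℤ.+ w) (sym (ℤP.pos-* k p))) (sym (ℤP.pos-+ (toℕ (ι z)) (k * p)))))))))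
  ... | ℤ.-[1+ k ] , e = ≤-trans (m⊓n≤n _ _) (m≤n+o⇒m∸n≤o p (toℕ (ι z)) (begin
      p  ≤⟨ m≤m+n p (k * p) ⟩
      suc k * p  ≡⟨ cong ⌊_⌋ (trans (ℤP.pos-* (suc k) p) (trans (lem (toℤ (ι z)) (pos (suc k)) P) (cong (λ w → toℤ (ι z) ℤ.- w) (sym e)))) ⟩
      ⌊ toℤ (ι z) ℤ.- z ⌋  ≤⟨ ℤP.∣i-j∣≤∣i∣+∣j∣ (toℤ (ι z)) z ⟩
      toℕ (ι z) + ⌊ z ⌋  ∎))
    where
    open ≤-Reasoning
    lem : ∀ x k P → k ℤ.* P ≡ x ℤ.- (x ℤ.+ (ℤ.- k) ℤ.* P)
    lem = ℤR.solve-∀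

  private
    via : ∀ {x z} → x ≡ ι z → ‖ x ‖ ≤ ⌊ z ⌋
    via refl = norm-min _

  norm-+ : ∀ x y → ‖ x ⊕ y ‖ ≤ ‖ x ‖ + ‖ y ‖
  norm-+ x y with norm-rep x | norm-rep y
  ... | a , refl , ea | b , refl , eb = ≤-trans (via (sym (ι-+ a b))) (≤-trans (ℤP.∣i+j∣≤∣i∣+∣j∣ a b) (≤-reflexive (cong₂ _+_ ea eb)))

  norm-neg : ∀ x → ‖ ⊖ x ‖ ≤ ‖ x ‖
  norm-neg x with norm-rep x
  ... | a , refl , ea = ≤-trans (via (sym (ι-neg a))) (≤-trans (≤-reflexive (ℤP.∣-i∣≡∣i∣ a)) (≤-reflexive ea))

  norm-- : ∀ x y → ‖ x ⊝ y ‖ ≤ ‖ x ‖ + ‖ y ‖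
  norm-- x y = ≤-trans (norm-+ x (⊖ y)) (+-monoʳ-≤ ‖ x ‖ (norm-neg y))

  norm-* : ∀ k x → ‖ ι (pos k) ⊗ x ‖ ≤ k * ‖ x ‖
  norm-* k x with norm-rep x
  ... | a , refl , ea = ≤-trans (via (sym (ι-* (pos k) a))) (≤-trans (≤-reflexive (ℤP.abs-* (pos k) a)) (≤-reflexive (cong (k *_) ea)))

  -- Two of the K + 1 multiples of t by 0, ..., K have residues in the same of K bins of length p/K;
  -- their difference is the required multiple.
  dirichlet : ∀ K → 1 ≤ K → ∀ t → ∃ λ k → 1 ≤ k × k ≤ K × K * ‖ ι (pos k) ⊗ t ‖ < p
  dirichlet K K≥1 t = finish (pigeonhole (n<1+n K) bin)
    where
    val : ℕ → ℕ
    val i = toℕ (ι (pos i) ⊗ t)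
    bin : Fin (suc K) → Fin K
    bin i = fromℕ< (DM.m<n*o⇒m/o<n {K * val (toℕ i)} {K} {p} (*-monoʳ-< K {{>-nonZero K≥1}} (toℕ<n _)))
    close : ∀ {a b} → a / p ≡ b / p → a ≤ b → b ∸ a < p
    close {a} {b} e le = m<n+o⇒m∸n<o b a (begin-strict
      b  ≡⟨ DM.m≡m%n+[m/n]*n b p ⟩
      b % p + b / p * p  <⟨ +-monoˡ-< _ (DM.m%n<n b p) ⟩
      p + b / p * p  ≡⟨ cong (λ w → p + w * p) (sym e) ⟩
      p + a / p * p  ≤⟨ +-monoʳ-≤ p (DM.m/n*n≤m a p) ⟩
      p + a  ≡⟨ +-comm p a ⟩
      a + p  ∎)
      where open ≤-Reasoning
    finish : (∃ λ i → ∃ λ j → i Data.Fin.< j × bin i ≡ bin j) → ∃ λ k → 1 ≤ k × k ≤ K × K * ‖ ι (pos k) ⊗ t ‖ < p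
    finish (i , j , i<j , e) = toℕ j ∸ toℕ i , m<n⇒0<n∸m i<j , ≤-trans (m∸n≤m (toℕ j) (toℕ i)) (≤-pred (toℕ<n j)) , small
      where
      a = val (toℕ i)
      c = val (toℕ j)
      bins : K * a / p ≡ K * c / p
      bins = trans (sym (toℕ-fromℕ< _)) (trans (cong toℕ e) (toℕ-fromℕ< _))
      diff : ι (pos (toℕ j ∸ toℕ i)) ⊗ t ≡ ι (pos c) ⊝ ι (pos a)
      diff = begin
        ι (pos (toℕ j ∸ toℕ i)) ⊗ t  ≡⟨ cong (λ w → ι w ⊗ t) (sym (ℤP.⊖-≥ (<⇒≤ i<j))) ⟩
        ι (toℕ j ℤ.⊖ toℕ i) ⊗ t  ≡⟨ cong (λ w → ι w ⊗ t) (sym (ℤP.m-n≡m⊖n (toℕ j) (toℕ i))) ⟩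
        ι (pos (toℕ j) ℤ.- pos (toℕ i)) ⊗ t  ≡⟨ cong (_⊗ t) (trans (ι-+ _ _) (cong (ι (pos (toℕ j)) ⊕_) (ι-neg _))) ⟩
        (ι (pos (toℕ j)) ⊝ ι (pos (toℕ i))) ⊗ t  ≡⟨ solve 3 (λ u v t → (u :- v) :* t := u :* t :- v :* t) refl _ _ t ⟩
        ι (pos (toℕ j)) ⊗ t ⊝ ι (pos (toℕ i)) ⊗ t  ≡⟨ cong₂ _⊝_ (sym (ι-toℤ _)) (sym (ι-toℤ _)) ⟩
        ι (pos c) ⊝ ι (pos a)  ∎
        where
        open ≡-Reasoning
        open G-Solver
      difference-norm : ∀ a c → ‖ ι (pos c) ⊝ ι (pos a) ‖ ≤ ⌊ c ℤ.⊖ a ⌋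
      difference-norm a c = via (trans (cong (ι (pos c) ⊕_) (sym (ι-neg (pos a)))) (trans (sym (ι-+ _ _)) (cong ι (ℤP.m-n≡m⊖n c a))))
      small : K * ‖ ι (pos (toℕ j ∸ toℕ i)) ⊗ t ‖ < p
      small with ≤-total a c
      ... | inj₁ h = ≤-<-trans (*-monoʳ-≤ K (≤-trans (≤-reflexive (cong ‖_‖ diff)) (≤-trans (difference-norm a c) (≤-reflexive (trans (cong ⌊_⌋ (ℤP.⊖-≥ h)) refl)))))
                       (≤-<-trans (≤-reflexive (*-distribˡ-∸ K c a)) (close bins (*-monoʳ-≤ K h)))
      ... | inj₂ h = ≤-<-trans (*-monoʳ-≤ K (≤-trans (≤-reflexive (cong ‖_‖ diff)) (≤-trans (difference-norm a c) (≤-reflexive (ℤP.∣⊖∣-≤ h)))))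
                       (≤-<-trans (≤-reflexive (*-distribˡ-∸ K a c)) (close (sym bins) (*-monoʳ-≤ K h)))

  ∑-cover : ∀ {X Y : Set} (xs : List X) (ys : List Y) (φ : X → Y → G) → (∀ u → ∃ λ x → ∃ λ y → x ∈ xs × y ∈ ys × φ x y ≡ u) →
            (f : G → ℕ) → ∑G f ≤ ∑ xs (λ x → ∑ ys (λ y → f (φ x y)))
  ∑-cover xs ys φ cov f = begin
    ∑[ u ] f u  ≤⟨ ∑-mono elems pt ⟩
    ∑[ u ] ∑ xs (λ x → ∑ ys (λ y → ⟦ does (φ x y ≟F u) ⟧ * f u))  ≡⟨ trans (∑-swap elems xs _) (∑-cong xs (λ x → ∑-swap elems ys _)) ⟩
    ∑ xs (λ x → ∑ ys (λ y → ∑[ u ] ⟦ does (φ x y ≟F u) ⟧ * f u))  ≡⟨ ∑-cong xs (λ x → ∑-cong ys (λ y → ∑G-δ (φ x y) f)) ⟩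
    ∑ xs (λ x → ∑ ys (λ y → f (φ x y)))  ∎
    where
    open ≤-Reasoning
    pt : ∀ u → f u ≤ ∑ xs (λ x → ∑ ys (λ y → ⟦ does (φ x y ≟F u) ⟧ * f u))
    pt u with cov u
    ... | x , y , mx , my , e = ≤-trans (≤-reflexive (sym (trans (cong (λ b → ⟦ b ⟧ * f u) (⇒does (φ x y ≟F u) e)) (*-identityˡ (f u)))))
                                  (≤-trans (∑-term my (λ y → ⟦ does (φ x y ≟F u) ⟧ * f u)) (∑-term mx (λ x → ∑ ys (λ y → ⟦ does (φ x y ≟F u) ⟧ * f u))))

  initial : ℕ → BSet
  initial m x = suc (toℕ x) ≤ᵈ m

  initial-card : ∀ m → m ≤ p → card (initial m) ≡ m
  initial-card zero h = trans (∑-cong elems (λ x → cong ⟦_⟧ (≤ᵈ-no (s≤s z≤n)))) (∑-zero elems)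
  initial-card (suc m) h = begin
    card (initial (suc m))  ≡⟨ ∑-cong elems pt ⟩
    ∑[ x ] (⟦ does (fromℕ< h ≟F x) ⟧ * 1 + ⟦ initial m x ⟧)  ≡⟨ ∑-+ elems _ _ ⟩
    (∑[ x ] ⟦ does (fromℕ< h ≟F x) ⟧ * 1) + card (initial m)  ≡⟨ cong₂ _+_ (∑G-δ (fromℕ< h) (λ _ → 1)) (initial-card m (<⇒≤ h)) ⟩
    suc m  ∎
    where
    open ≡-Reasoning
    pt : ∀ x → ⟦ initial (suc m) x ⟧ ≡ ⟦ does (fromℕ< h ≟F x) ⟧ * 1 + ⟦ initial m x ⟧
    pt x with fromℕ< h ≟F x
    ... | yes refl = trans (cong ⟦_⟧ (≤ᵈ-intro (s≤s (≤-reflexive (toℕ-fromℕ< h))))) (cong (λ b → 1 + ⟦ b ⟧) (sym (≤ᵈ-no (s≤s (≤-reflexive (sym (toℕ-fromℕ< h)))))))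
    ... | no ne with initial m x in e
    ...   | true = cong ⟦_⟧ (≤ᵈ-intro (m≤n⇒m≤1+n (≤ᵈ-elim e)))
    ...   | false = cong ⟦_⟧ (≤ᵈ-no (s≤s (≤∧≢⇒< (≤-pred (≤ᵈ-false e)) (λ eq → ne (toℕ-injective (trans (toℕ-fromℕ< h) eq))))))

  initial-overlap : ∀ m h → m ≤ p → m ∸ h ≤ r (initial m) (ι (pos h))
  initial-overlap m h m≤p = ≤-trans (≤-reflexive (sym (initial-card (m ∸ h) (≤-trans (m∸n≤m m h) m≤p)))) (∑-mono elems pt)
    where
    pt : ∀ z → ⟦ initial (m ∸ h) z ⟧ ≤ ⟦ initial m z ⟧ * ⟦ initial m (z ⊕ ι (pos h)) ⟧
    pt z with initial (m ∸ h) z in e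
    ... | false = z≤n
    ... | true = ≤-reflexive (sym (cong₂ (λ a b → ⟦ a ⟧ * ⟦ b ⟧) (≤ᵈ-intro (≤-trans (≤ᵈ-elim e) (m∸n≤m m h))) (≤ᵈ-intro (subst (_< m) (sym val) lt))))
      where
      lt : toℕ z + h < m
      lt = m≤o∸n⇒m+n≤o (suc (toℕ z)) (<⇒≤ (m<n∸o⇒o<n' (≤ᵈ-elim e))) (≤ᵈ-elim e)
        where
        m<n∸o⇒o<n' : suc (toℕ z) ≤ m ∸ h → h < m
        m<n∸o⇒o<n' q = m∸n≢0⇒n<m (λ z → <⇒≢ (≤-trans (s≤s z≤n) q) (sym z))
      val : toℕ (z ⊕ ι (pos h)) ≡ toℕ z + h
      val = trans (cong toℕ (trans (cong (_⊕ ι (pos h)) (sym (ι-toℤ z))) (trans (sym (ι-+ (toℤ z) (pos h))) (cong ι (sym (ℤP.pos-+ (toℕ z) h)))))) (toℕ-ι-pos (<-≤-trans lt m≤p))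

  factorial-unit : ∀ K → K < p → Unit (ι (pos (K !)))
  factorial-unit zero lt = 𝟏 , solve 0 (con (pos 1) :* con (pos 1) := con (pos 1)) refl
    where open G-Solver
  factorial-unit (suc K) lt = subst Unit (trans (sym (ι-* (pos (suc K)) (pos (K !)))) (cong ι (sym (ℤP.pos-* (suc K) (K !)))))
    (Unit-* (unit (ι (pos (suc K))) (λ e → 1+n≢0 (trans (sym (toℕ-ι-pos lt)) (trans (cong toℕ e) (toℕ-ι-pos (≤-<-trans z≤n lt)))))) (factorial-unit K (<-trans (n<1+n K) lt)))

  -- A dilation that moves most of S close to zero

  module _ (K q M : ℕ) (S : BSet) (weight : G → ℕ) (supp : ∀ s → S s ≡ false → weight s ≡ 0)
           (F : Følner S (invariance K q) M) (weight-pos : 1 ≤ ∑G weight) (K≥ : 128 ≤ K) (K<p : K < p) (M≤ : 8 * M ≤ p) where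

    open Følner F
    private
      e = invariance K q
      L = 2 * period-constant K q
      J = period-exponent K q
      b = card B
      W = ∑G weight
      -- A window of half the group makes the total variation `Q` of order p²; shifts below H count
      -- as small.
      m = p / 2
      H = p / K
        where instance _ = >-nonZero (≤-trans (s≤s z≤n) K≥)
      I = initial m

      m≤p : m ≤ p
      m≤p = DM.m/n≤m p 2

      m-card : card I ≡ m
      m-card = initial-card m m≤p

      2m≤p : 2 * m ≤ p
      2m≤p = ≤-trans (≤-reflexive (*-comm 2 m)) (DM.m/n*n≤m p 2)

      p≤4m : p ≤ 4 * m
      p≤4m = begin
        p  ≡⟨ DM.m≡m%n+[m/n]*n p 2 ⟩
        p % 2 + m * 2  ≤⟨ +-monoˡ-≤ (m * 2) (≤-trans (<⇒≤ (DM.m%n<n p 2)) (*-monoʳ-≤ 2 m≥1)) ⟩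
        2 * m + m * 2  ≡⟨ lem m ⟩
        4 * m  ∎
        where
        open ≤-Reasoning
        lem : ∀ m → 2 * m + m * 2 ≡ 4 * m
        lem = solve-∀
        m≥1 : 1 ≤ m
        m≥1 = DM.m≥n⇒m/n>0 (≤-trans (≤-trans (s≤s (s≤s z≤n)) K≥) (<⇒≤ K<p))

      instance
        K≢0 : NonZero K
        K≢0 = >-nonZero (≤-trans (s≤s z≤n) K≥)

      KH≤p : K * H ≤ p
      KH≤p = ≤-trans (≤-reflexive (*-comm K H)) (DM.m/n*n≤m p K)

      p<KH : p < K * suc H
      p<KH = begin-strict
        p  ≡⟨ DM.m≡m%n+[m/n]*n p K ⟩
        p % K + H * K  <⟨ +-monoˡ-< (H * K) (DM.m%n<n p K) ⟩
        K + H * K  ≡⟨ *-comm (suc H) K ⟩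
        K * suc H  ∎
        where open ≤-Reasoning

    open Window B I using (V; Γ; Δ; ∑-V-shift; ∑-V-period; V-zero; Γ+2r; ∑-Γ; V-+; V-neg; V-multiple)

    private
      Q = ∑G Γ

      Q-large : p * m ≤ Q
      Q-large = +-cancelʳ-≤ (2 * (m * m)) _ _ (begin
        p * m + 2 * (m * m)  ≡⟨ cong (p * m +_) (sym (*-assoc 2 m m)) ⟩
        p * m + 2 * m * m  ≤⟨ +-monoʳ-≤ (p * m) (*-monoˡ-≤ m 2m≤p) ⟩
        p * m + p * m  ≡⟨ lem p m ⟩
        p * (2 * m)  ≡⟨ sym (trans (cong (λ m → Q + 2 * (m * m)) (sym m-card)) (trans ∑-Γ (cong (λ m → p * (2 * m)) m-card))) ⟩
        Q + 2 * (m * m)  ∎)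
        where
        open ≤-Reasoning
        lem : ∀ p m → p * m + p * m ≡ p * (2 * m)
        lem = solve-∀

      Γ-small : ∀ h → Γ (ι (pos h)) ≤ 2 * h
      Γ-small h = +-cancelʳ-≤ (2 * r I (ι (pos h))) _ _ (begin
        Γ (ι (pos h)) + 2 * r I (ι (pos h))  ≡⟨ trans (Γ+2r (ι (pos h))) (cong (2 *_) m-card) ⟩
        2 * m  ≤⟨ *-monoʳ-≤ 2 (m≤n+m∸n m h) ⟩
        2 * (h + (m ∸ h))  ≡⟨ *-distribˡ-+ 2 h (m ∸ h) ⟩
        2 * h + 2 * (m ∸ h)  ≤⟨ +-monoʳ-≤ (2 * h) (*-monoʳ-≤ 2 (initial-overlap m h m≤p)) ⟩
        2 * h + 2 * r I (ι (pos h))  ∎)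
        where open ≤-Reasoning

      -- `B` and its translate by s both lie in `B⁺`, which has at most b/e elements more than each
      -- of them.
      Δ-small : ∀ s → S s ≡ true → e * Δ s ≤ 2 * b
      Δ-small s hs = +-cancelʳ-≤ (e * (2 * b)) _ _ (begin
        e * Δ s + e * (2 * b)  ≡⟨ sym (*-distribˡ-+ e _ _) ⟩
        e * (Δ s + 2 * b)  ≤⟨ *-monoʳ-≤ e step ⟩
        e * (2 * card B⁺)  ≡⟨ l₁ e (card B⁺) ⟩
        2 * (e * card B⁺)  ≤⟨ *-monoʳ-≤ 2 slow ⟩
        2 * ((e + 1) * b)  ≡⟨ l₂ e b ⟩
        2 * b + e * (2 * b)  ∎)
        where
        open ≤-Reasoning
        l₁ : ∀ e c → e * (2 * c) ≡ 2 * (e * c)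
        l₁ = solve-∀
        l₂ : ∀ e b → 2 * ((e + 1) * b) ≡ 2 * b + e * (2 * b)
        l₂ = solve-∀
        l₃ : ∀ b → b + b ≡ 2 * b
        l₃ = solve-∀
        pt : ∀ x y z → (x ≡ true → z ≡ true) → (y ≡ true → z ≡ true) → sq-difference x y + (⟦ x ⟧ + ⟦ y ⟧) ≤ 2 * ⟦ z ⟧
        pt true y z f g rewrite f refl with y
        ... | true = ≤-refl
        ... | false = ≤-refl
        pt false true z f g rewrite g refl = ≤-refl
        pt false false z f g = z≤n
        step : Δ s + 2 * b ≤ 2 * card B⁺
        step = begin
          Δ s + 2 * b  ≡⟨ cong (Δ s +_) (sym (trans (cong (_+ b) (∑-shift (⊖ s) _)) (l₃ b))) ⟩
          Δ s + ((∑[ x ] ⟦ B (x ⊝ s) ⟧) + b)  ≡⟨ trans (cong (Δ s +_) (sym (∑-+ elems _ _))) (sym (∑-+ elems _ _)) ⟩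
          ∑[ x ] (sq-difference (B (x ⊝ s)) (B x) + (⟦ B (x ⊝ s) ⟧ + ⟦ B x ⟧)) ≤⟨ ∑-mono elems (λ x → pt (B (x ⊝ s)) (B x) (B⁺ x) (λ h → subst (λ w → B⁺ w ≡ true) (solve 2 (λ x s → x :- s :+ s := x) refl x s) (B+S hs h)) (B⊑ x)) ⟩
          ∑[ x ] 2 * ⟦ B⁺ x ⟧  ≡⟨ ∑-*ˡ elems 2 _ ⟩
          2 * card B⁺  ∎
          where open G-Solver

      V̂ C₁ C₂ : G → ℕ
      V̂ ξ = ∑[ u ] V u ξ
      C₁ ξ = ∑ (downFrom H) (λ h → V (ι (pos h)) ξ)
      C₂ ξ = ∑[ s ] weight s * V (ξ ⊗ s) ξ

      ∑-V̂ : ∑G V̂ ≡ b * (p * Q)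
      ∑-V̂ = trans (∑G-swap _) (trans (∑-cong elems ∑-V-shift) (trans (∑-*ˡ elems b _) (cong (b *_) (∑-*ˡ elems p _))))

      V̂-zero : V̂ 𝟎 ≡ b * b * Q
      V̂-zero = trans (∑-cong elems V-zero) (∑-*ˡ elems (b * b) _)

      ∑-C₁ : ∑G C₁ ≤ H * (b * (p * (2 * H)))
      ∑-C₁ = begin
        ∑G C₁  ≡⟨ ∑-swap elems (downFrom H) _ ⟩
        ∑ (downFrom H) (λ h → ∑[ ξ ] V (ι (pos h)) ξ)  ≤⟨ ∑-mono-∈ (downFrom H) (λ h mem → ≤-trans (≤-reflexive (∑-V-shift (ι (pos h)))) (*-monoʳ-≤ b (*-monoʳ-≤ p (≤-trans (Γ-small h) (*-monoʳ-≤ 2 (<⇒≤ (∈-downFrom⁻ mem))))))) ⟩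
        ∑ (downFrom H) (λ h → b * (p * (2 * H)))  ≡⟨ trans (∑-const (downFrom H) _) (cong (_* (b * (p * (2 * H)))) (length-downFrom H)) ⟩
        H * (b * (p * (2 * H)))  ∎
        where open ≤-Reasoning

      ∑-C₂ : e * ∑G C₂ ≤ W * (2 * b * (p * m))
      ∑-C₂ = begin
        e * ∑G C₂  ≡⟨ cong (e *_) (trans (∑G-swap _) (∑-cong elems (λ s → ∑-*ˡ elems (weight s) _))) ⟩
        e * (∑[ s ] weight s * (∑[ ξ ] V (ξ ⊗ s) ξ))  ≡⟨ sym (∑-*ˡ elems e _) ⟩
        ∑[ s ] e * (weight s * (∑[ ξ ] V (ξ ⊗ s) ξ))  ≤⟨ ∑-mono elems pt ⟩
        ∑[ s ] weight s * (2 * b * (p * m))  ≡⟨ ∑-*ʳ elems _ _ ⟩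
        W * (2 * b * (p * m))  ∎
        where
        open ≤-Reasoning
        l₁ : ∀ e w v → e * (w * v) ≡ w * (e * v)
        l₁ = solve-∀
        pt : ∀ s → e * (weight s * (∑[ ξ ] V (ξ ⊗ s) ξ)) ≤ weight s * (2 * b * (p * m))
        pt s with S s in es
        ... | false = ≤-trans (≤-reflexive (trans (cong (λ w → e * (w * (∑[ ξ ] V (ξ ⊗ s) ξ))) (supp s es)) (*-zeroʳ e))) z≤n
        ... | true = ≤-trans (≤-reflexive (l₁ e (weight s) _)) (*-monoʳ-≤ (weight s) (begin
          e * (∑[ ξ ] V (ξ ⊗ s) ξ)  ≤⟨ *-monoʳ-≤ e (∑-V-period s) ⟩
          e * (Δ s * (p * card I))  ≡⟨ trans (cong (λ m → e * (Δ s * (p * m))) m-card) (sym (*-assoc e (Δ s) _)) ⟩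
          e * Δ s * (p * m)  ≤⟨ *-monoˡ-≤ (p * m) (Δ-small s es) ⟩
          2 * b * (p * m)  ∎))

      -- A single inequality cost ξ < W V̂ ξ gives three facts: short shifts change the profile
      -- little, most shifts from ξS do so too, and ξ is not 0, because at 0 the last term alone is
      -- W V̂ ξ.
      cost : G → ℕ
      cost ξ = W * (8 * K * C₁ ξ) + p * L * C₂ ξ + ⟦ does (𝟎 ≟F ξ) ⟧ * (W * V̂ ξ)

      ∑-cost : ∑G cost ≡ W * (8 * K * ∑G C₁) + p * L * ∑G C₂ + W * (b * b * Q)
      ∑-cost = trans (∑-+ elems _ _) (cong₂ _+_ (trans (∑-+ elems _ _) (cong₂ _+_ (trans (∑-*ˡ elems W _) (cong (W *_) (∑-*ˡ elems (8 * K) _))) (∑-*ˡ elems (p * L) _))) (trans (∑G-δ 𝟎 (λ ξ → W * V̂ ξ)) (cong (W *_) V̂-zero)))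

      p≥1 : 1 ≤ p
      p≥1 = ≤-trans (s≤s z≤n) K<p

      -- Of 16 parts Q, the short shifts and the shifts ξs together take fewer than 14; the
      -- remaining 2 are for the frequency 0. The bound K ≥ 128 makes the short shifts cheap enough.
      budget : 256 * K * (H * H) + 2 * (p * m) < 14 * Q
      budget = begin-strict
        256 * K * (H * H) + 2 * (p * m)  ≤⟨ +-mono-≤ first (*-monoʳ-≤ 2 Q-large) ⟩
        2 * (p * p) + 2 * Q  <⟨ +-monoˡ-< (2 * Q) second ⟩
        12 * Q + 2 * Q  ≡⟨ sym (*-distribʳ-+ Q 12 2) ⟩
        14 * Q  ∎
        where
        open ≤-Reasoning
        l₂ : ∀ K H → 256 * K * (H * H) ≡ 2 * (128 * H * (K * H))
        l₂ = solve-∀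
        l₃ : ∀ p m → 3 * (p * (4 * m)) ≡ 12 * (p * m)
        l₃ = solve-∀
        first : 256 * K * (H * H) ≤ 2 * (p * p)
        first = ≤-trans (≤-reflexive (l₂ K H)) (*-monoʳ-≤ 2 (*-mono-≤ (≤-trans (*-monoˡ-≤ H K≥) KH≤p) KH≤p))
        second : 2 * (p * p) < 12 * Q
        second = begin-strict
          2 * (p * p)  <⟨ *-monoˡ-< (p * p) {{m*n≢0 p p}} (≤-refl {3}) ⟩
          3 * (p * p)  ≤⟨ *-monoʳ-≤ 3 (*-monoʳ-≤ p p≤4m) ⟩
          3 * (p * (4 * m))  ≡⟨ l₃ p m ⟩
          12 * (p * m)  ≤⟨ *-monoʳ-≤ 12 Q-large ⟩
          12 * Q  ∎

      cost<V̂ : ∑G cost < ∑[ ξ ] W * V̂ ξ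
      cost<V̂ = *-cancelˡ-< 16 _ _ (begin-strict
        16 * ∑G cost  ≡⟨ trans (cong (16 *_) ∑-cost) (l₁ W (8 * K * ∑G C₁) p L (∑G C₂) (b * b * Q)) ⟩
        W * (16 * (8 * K * ∑G C₁)) + p * (e * ∑G C₂) + W * (16 * (b * b * Q))  ≤⟨ +-monoˡ-≤ _ (+-mono-≤ (*-monoʳ-≤ W (*-monoʳ-≤ 16 (*-monoʳ-≤ (8 * K) ∑-C₁))) (*-monoʳ-≤ p ∑-C₂)) ⟩
        W * (16 * (8 * K * (H * (b * (p * (2 * H)))))) + p * (W * (2 * b * (p * m))) + W * (16 * (b * b * Q))
                                                                                   ≡⟨ l₂ W K H b p m Q ⟩
        W * b * (p * (256 * K * (H * H) + 2 * (p * m)) + 16 * b * Q)  ≤⟨ *-monoʳ-≤ (W * b) (+-monoʳ-≤ (p * (256 * K * (H * H) + 2 * (p * m))) third) ⟩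
        W * b * (p * (256 * K * (H * H) + 2 * (p * m)) + p * (2 * Q))  <⟨ *-monoʳ-< (W * b) {{>-nonZero (*-mono-≤ weight-pos B-pos)}} (+-monoˡ-< (p * (2 * Q)) (*-monoʳ-< p {{>-nonZero p≥1}} budget)) ⟩
        W * b * (p * (14 * Q) + p * (2 * Q))  ≡⟨ l₃ W b p Q ⟩
        16 * (W * (b * (p * Q)))  ≡⟨ cong (16 *_) (sym (trans (∑-*ˡ elems W _) (cong (W *_) ∑-V̂))) ⟩
        16 * (∑[ ξ ] W * V̂ ξ)  ∎)
        where
        open ≤-Reasoning
        l₁ : ∀ W c p L d v → 16 * (W * c + p * L * d + W * v) ≡ W * (16 * c) + p * (16 * L * d) + W * (16 * v)
        l₁ = solve-∀
        l₂ : ∀ W K H b p m Q → W * (16 * (8 * K * (H * (b * (p * (2 * H)))))) + p * (W * (2 * b * (p * m))) + W * (16 * (b * b * Q)) ≡ W * b * (p * (256 * K * (H * H) + 2 * (p * m)) + 16 * b * Q)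
        l₂ = solve-∀
        l₃ : ∀ W b p Q → W * b * (p * (14 * Q) + p * (2 * Q)) ≡ 16 * (W * (b * (p * Q)))
        l₃ = solve-∀
        l₄ : ∀ b Q → 16 * b * Q ≡ 8 * b * (2 * Q)
        l₄ = solve-∀
        third : 16 * b * Q ≤ p * (2 * Q)
        third = ≤-trans (≤-reflexive (l₄ b Q)) (*-monoˡ-≤ (2 * Q) (≤-trans (*-monoʳ-≤ 8 B-card) M≤))

      module Frequency (ξ : G) (cheap : cost ξ < W * V̂ ξ) where

        ξ≢0 : ξ ≢ 𝟎
        ξ≢0 refl = <⇒≱ cheap (≤-trans (≤-reflexive (sym (trans (cong (λ a → ⟦ a ⟧ * (W * V̂ 𝟎)) (⇒does (𝟎 ≟F 𝟎) refl)) (*-identityˡ _)))) (m≤n+m _ (W * (8 * K * C₁ 𝟎) + p * L * C₂ 𝟎)))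

        cheap₁ : 8 * K * C₁ ξ < V̂ ξ
        cheap₁ = *-cancelˡ-< W _ _ (≤-<-trans (≤-trans (m≤m+n _ _) (m≤m+n _ _)) cheap)

        cheap₂ : p * L * C₂ ξ < W * V̂ ξ
        cheap₂ = ≤-<-trans (≤-trans (m≤n+m _ (W * (8 * K * C₁ ξ))) (m≤m+n _ _)) cheap

        good : G → Bool
        good s = suc (period-constant K q * (p * V (ξ ⊗ s) ξ)) ≤ᵈ V̂ ξ

        -- Markov's inequality for the weighted sum `C₂`; the factor 2 in `L` is what saves half of
        -- the weight.
        half-good : W ≤ 2 * (∑[ s ] weight s * ⟦ good s ⟧)
        half-good = +-cancelʳ-≤ W _ _ (begin
          W + W  ≡⟨ l₀ W ⟩
          2 * W  ≤⟨ *-monoʳ-≤ 2 (≤-trans (∑-mono elems (λ s → ≤-reflexive (pt (weight s) (good s)))) (≤-reflexive (∑-+ elems _ _))) ⟩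
          2 * ((∑[ s ] weight s * ⟦ good s ⟧) + bad)  ≡⟨ *-distribˡ-+ 2 (∑[ s ] weight s * ⟦ good s ⟧) bad ⟩
          2 * (∑[ s ] weight s * ⟦ good s ⟧) + 2 * bad  ≤⟨ +-monoʳ-≤ (2 * (∑[ s ] weight s * ⟦ good s ⟧)) (<⇒≤ bad-small) ⟩
          2 * (∑[ s ] weight s * ⟦ good s ⟧) + W  ∎)
          where
          open ≤-Reasoning
          bad = ∑[ s ] weight s * ⟦ not (good s) ⟧
          l₀ : ∀ w → w + w ≡ 2 * w
          l₀ = solve-∀
          pt : ∀ w g → w ≡ w * ⟦ g ⟧ + w * ⟦ not g ⟧
          pt w true = trans (sym (+-identityʳ w)) (cong₂ _+_ (sym (*-identityʳ w)) (sym (*-zeroʳ w)))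
          pt w false = cong₂ _+_ (sym (*-zeroʳ w)) (sym (*-identityʳ w))
          l₁ : ∀ v w g → w * g * v ≡ w * (g * v)
          l₁ = λ v w g → *-assoc w g v
          l₂ : ∀ w c p v → w * (c * (p * v)) ≡ c * p * (w * v)
          l₂ = solve-∀
          l₃ : ∀ c p d → 2 * (c * p * d) ≡ p * (2 * c) * d
          l₃ = solve-∀
          bad-small : 2 * bad < W
          bad-small = *-cancelʳ-< (V̂ ξ) (2 * bad) W (begin-strict
            2 * bad * V̂ ξ  ≡⟨ trans (*-assoc 2 bad _) (cong (2 *_) (sym (∑-*ʳ elems (V̂ ξ) _))) ⟩
            2 * (∑[ s ] weight s * ⟦ not (good s) ⟧ * V̂ ξ)  ≤⟨ *-monoʳ-≤ 2 (∑-mono elems (λ s → ≤-trans (≤-reflexive (l₁ (V̂ ξ) (weight s) ⟦ not (good s) ⟧)) (*-monoʳ-≤ (weight s) (⟦⟧-guard₀ (not (good s)) (λ h → ≤-pred (≤ᵈ-false (not-true h))))))) ⟩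
            2 * (∑[ s ] weight s * (period-constant K q * (p * V (ξ ⊗ s) ξ)))  ≡⟨ cong (2 *_) (trans (∑-cong elems (λ s → l₂ (weight s) (period-constant K q) p (V (ξ ⊗ s) ξ))) (∑-*ˡ elems (period-constant K q * p) _)) ⟩
            2 * (period-constant K q * p * C₂ ξ)  ≡⟨ l₃ (period-constant K q) p (C₂ ξ) ⟩
            p * L * C₂ ξ  <⟨ cheap₂ ⟩
            W * V̂ ξ  ∎)

        -- If K! t were not small, then the shifts j k g t + h would cover G, with k, g, j bounded and h < H.
        periods-near : ∀ t → period-constant K q * (p * V t ξ) < V̂ ξ → q * ‖ ι (pos (K !)) ⊗ t ‖ ≤ p
        periods-near t cheap-t = finish (dirichlet K (≤-trans (s≤s z≤n) K≥) t)
          where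
          finish : (∃ λ k → 1 ≤ k × k ≤ K × K * ‖ ι (pos k) ⊗ t ‖ < p) → q * ‖ ι (pos (K !)) ⊗ t ‖ ≤ p
          finish (k , k≥1 , k≤K , close) = ≮⇒≥ λ far → <-irrefl refl (contra far)
            where
            open ≤-Reasoning
            ρ = ‖ ι (pos k) ⊗ t ‖
            f = proj₁ (divides-factorial k≥1 k≤K)
            K!t : ‖ ι (pos (K !)) ⊗ t ‖ ≤ K ! * ρ
            K!t = begin
              ‖ ι (pos (K !)) ⊗ t ‖  ≡⟨ cong (λ w → ‖ w ⊗ t ‖) (trans (cong (ι ∘ pos) (sym (proj₁ (proj₂ (divides-factorial k≥1 k≤K))))) (trans (cong ι (ℤP.pos-* f k)) (ι-* (pos f) (pos k)))) ⟩
              ‖ ι (pos f) ⊗ ι (pos k) ⊗ t ‖  ≡⟨ cong ‖_‖ (solve 3 (λ f k t → f :* k :* t := f :* (k :* t)) refl (ι (pos f)) (ι (pos k)) t) ⟩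
              ‖ ι (pos f) ⊗ (ι (pos k) ⊗ t) ‖  ≤⟨ norm-* f (ι (pos k) ⊗ t) ⟩
              f * ρ  ≤⟨ *-monoˡ-≤ ρ (proj₂ (proj₂ (divides-factorial k≥1 k≤K))) ⟩
              K ! * ρ  ∎
              where open G-Solver
            -- ρ is kt up to sign, and V does not change when the shift is negated.
            V-ρ : V (ι (pos ρ)) ξ ≤ 4 ^ k * V t ξ
            V-ρ = ≤-trans (≤-reflexive (sign (norm-rep (ι (pos k) ⊗ t)))) (V-multiple k t ξ)
              where
              sign : (∃ λ z → ι (pos k) ⊗ t ≡ ι z × ⌊ z ⌋ ≡ ρ) → V (ι (pos ρ)) ξ ≡ V (ι (pos k) ⊗ t) ξ
              sign (pos z , e , e') = cong (λ w → V w ξ) (trans (cong (ι ∘ pos) (sym e')) (sym e))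
              sign (ℤ.-[1+ z ] , e , e') = trans (sym (V-neg (ι (pos ρ)) ξ)) (cong (λ w → V w ξ) (trans (sym (ι-neg (pos ρ))) (trans (cong (λ w → ι (ℤ.- pos w)) (sym e')) (sym e))))

            module _ (far : p < q * ‖ ι (pos (K !)) ⊗ t ‖) where
              p<qK!ρ : p < q * K ! * ρ
              p<qK!ρ = <-≤-trans far (≤-trans (*-monoʳ-≤ q K!t) (≤-reflexive (sym (*-assoc q (K !) ρ))))
              ρ≥1 : 1 ≤ ρ
              ρ≥1 = n≢0⇒n>0 (λ z → n≮0 (subst (p <_) (trans (cong (q * K ! *_) z) (*-zeroʳ (q * K !))) p<qK!ρ))
              instance
                ρ≢0 : NonZero ρ
                ρ≢0 = >-nonZero ρ≥1
              ρ≤H : ρ ≤ H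
              ρ≤H = ≤-pred (*-cancelˡ-< K ρ (suc H) (<-trans close p<KH))
              -- s is the largest multiple of ρ up to H, hence more than H/2, so that 2K steps of
              -- length s go around the whole group.
              g = H / ρ
              s = g * ρ
              g≥1 : 1 ≤ g
              g≥1 = DM.m≥n⇒m/n>0 ρ≤H
              s≤H : s ≤ H
              s≤H = DM.m/n*n≤m H ρ
              H<2s : suc H ≤ 2 * s
              H<2s = begin
                suc H  ≡⟨ cong suc (DM.m≡m%n+[m/n]*n H ρ) ⟩
                suc (H % ρ) + s  ≤⟨ +-monoˡ-≤ s (≤-trans (DM.m%n<n H ρ) (≤-trans (≤-reflexive (sym (*-identityˡ ρ))) (*-monoˡ-≤ ρ g≥1))) ⟩
                s + s  ≡⟨ cong (s +_) (sym (+-identityʳ s)) ⟩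
                2 * s  ∎
              instance
                s≢0 : NonZero s
                s≢0 = m*n≢0 g ρ {{>-nonZero g≥1}}
              p<2Ks : p < 2 * K * s
              p<2Ks = <-≤-trans p<KH (≤-trans (*-monoʳ-≤ K H<2s) (≤-reflexive (lem K s)))
                where
                lem : ∀ K s → K * (2 * s) ≡ 2 * K * s
                lem = solve-∀
              -- Here it matters that K!t is far from 0: this keeps ρ above p/(qK!) and thereby
              -- bounds the exponent of 4.
              g≤ : g ≤ q * K !
              g≤ = <⇒≤ (*-cancelʳ-< ρ g (q * K !) (≤-<-trans (≤-trans s≤H (≤-trans (m≤n*m H K) KH≤p)) p<qK!ρ))
              φ : ℕ → ℕ → G
              φ j h = ι (pos (j * s)) ⊕ ι (pos h)
              cover : ∀ u → ∃ λ j → ∃ λ h → j ∈ downFrom (2 * K) × h ∈ downFrom s × φ j h ≡ u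
              cover u = toℕ u / s , toℕ u % s , ∈-downFrom⁺ (DM.m<n*o⇒m/o<n (<-trans (toℕ<n u) p<2Ks)) , ∈-downFrom⁺ (DM.m%n<n (toℕ u) s) ,
                trans (sym (ι-+ (pos (toℕ u / s * s)) (pos (toℕ u % s)))) (trans (cong ι (trans (sym (ℤP.pos-+ (toℕ u / s * s) (toℕ u % s))) (cong pos (trans (+-comm (toℕ u / s * s) _) (sym (DM.m≡m%n+[m/n]*n (toℕ u) s)))))) (ι-toℤ u))
              each : ∀ j h → j < 2 * K → V (φ j h) ξ ≤ 2 * (4 ^ J * V t ξ) + 2 * V (ι (pos h)) ξ
              each j h j< = ≤-trans (V-+ (ι (pos (j * s))) (ι (pos h)) ξ) (+-monoˡ-≤ _ (*-monoʳ-≤ 2 (begin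
                V (ι (pos (j * s))) ξ  ≡⟨ cong (λ w → V w ξ) (trans (cong (ι ∘ pos) (sym (*-assoc j g ρ))) (trans (cong ι (ℤP.pos-* (j * g) ρ)) (ι-* _ _))) ⟩
                V (ι (pos (j * g)) ⊗ ι (pos ρ)) ξ  ≤⟨ V-multiple (j * g) (ι (pos ρ)) ξ ⟩
                4 ^ (j * g) * V (ι (pos ρ)) ξ  ≤⟨ *-monoʳ-≤ (4 ^ (j * g)) V-ρ ⟩
                4 ^ (j * g) * (4 ^ k * V t ξ)  ≡⟨ trans (sym (*-assoc (4 ^ (j * g)) (4 ^ k) _)) (cong (_* V t ξ) (sym (^-distribˡ-+-* 4 (j * g) k))) ⟩
                4 ^ (j * g + k) * V t ξ  ≤⟨ *-monoˡ-≤ (V t ξ) (^-monoʳ-≤ 4 (+-mono-≤ (*-mono-≤ (<⇒≤ j<) g≤) k≤K)) ⟩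
                4 ^ J * V t ξ  ∎)))
              shifts : V̂ ξ ≤ 2 * K * (s * (2 * (4 ^ J * V t ξ)) + 2 * C₁ ξ)
              shifts = begin
                V̂ ξ  ≤⟨ ∑-cover (downFrom (2 * K)) (downFrom s) φ cover (λ u → V u ξ) ⟩
                ∑ (downFrom (2 * K)) (λ j → ∑ (downFrom s) (λ h → V (φ j h) ξ))  ≤⟨ ∑-mono-∈ (downFrom (2 * K)) (λ j mj → ≤-trans (∑-mono (downFrom s) (λ h → each j h (∈-downFrom⁻ mj))) inner) ⟩
                ∑ (downFrom (2 * K)) (λ j → s * (2 * (4 ^ J * V t ξ)) + 2 * C₁ ξ)  ≡⟨ trans (∑-const (downFrom (2 * K)) _) (cong (_* (s * (2 * (4 ^ J * V t ξ)) + 2 * C₁ ξ)) (length-downFrom (2 * K))) ⟩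
                2 * K * (s * (2 * (4 ^ J * V t ξ)) + 2 * C₁ ξ)  ∎
                where
                inner : ∑ (downFrom s) (λ h → 2 * (4 ^ J * V t ξ) + 2 * V (ι (pos h)) ξ) ≤ s * (2 * (4 ^ J * V t ξ)) + 2 * C₁ ξ
                inner = begin
                  ∑ (downFrom s) (λ h → 2 * (4 ^ J * V t ξ) + 2 * V (ι (pos h)) ξ)  ≡⟨ trans (∑-+ (downFrom s) _ _) (cong₂ _+_ (trans (∑-const (downFrom s) _) (cong (_* (2 * (4 ^ J * V t ξ))) (length-downFrom s))) (∑-*ˡ (downFrom s) 2 _)) ⟩
                  s * (2 * (4 ^ J * V t ξ)) + 2 * ∑ (downFrom s) (λ h → V (ι (pos h)) ξ) ≤⟨ +-monoʳ-≤ (s * (2 * (4 ^ J * V t ξ))) (*-monoʳ-≤ 2 (restrict-downFrom s H s≤H (λ h → V (ι (pos h)) ξ))) ⟩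
                  s * (2 * (4 ^ J * V t ξ)) + 2 * C₁ ξ  ∎
              contra : V̂ ξ < V̂ ξ
              contra = *-cancelˡ-< 2 (V̂ ξ) (V̂ ξ) (begin-strict
                2 * V̂ ξ  ≤⟨ *-monoʳ-≤ 2 shifts ⟩
                2 * (2 * K * (s * (2 * (4 ^ J * V t ξ)) + 2 * C₁ ξ))  ≡⟨ lem₁ K s (4 ^ J) (V t ξ) (C₁ ξ) ⟩
                8 * 4 ^ J * (K * s * V t ξ) + 8 * K * C₁ ξ  <⟨ +-mono-≤-< (*-monoʳ-≤ (8 * 4 ^ J) (*-monoˡ-≤ (V t ξ) (≤-trans (*-monoʳ-≤ K s≤H) KH≤p))) cheap₁ ⟩
                8 * 4 ^ J * (p * V t ξ) + V̂ ξ  <⟨ +-monoˡ-< (V̂ ξ) cheap-t ⟩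
                V̂ ξ + V̂ ξ  ≡⟨ cong (V̂ ξ +_) (sym (+-identityʳ (V̂ ξ))) ⟩
                2 * V̂ ξ  ∎)
                where
                lem₁ : ∀ K s x v c → 2 * (2 * K * (s * (2 * (x * v)) + 2 * c)) ≡ 8 * x * (K * s * v) + 8 * K * c
                lem₁ = solve-∀

    near-dilation : ∃ λ u → Unit u × W ≤ 2 * (∑[ s ] weight s * ⟦ (q * ‖ u ⊗ s ‖) ≤ᵈ p ⟧)
    near-dilation = finish (∑-<-pick elems cost<V̂)
      where
      finish : (∃ λ ξ → ξ ∈ elems × cost ξ < W * V̂ ξ) → ∃ λ u → Unit u × W ≤ 2 * (∑[ s ] weight s * ⟦ (q * ‖ u ⊗ s ‖) ≤ᵈ p ⟧)
      -- The factor K! clears the multiplier k that Dirichlet's theorem chose for each s separately.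
      finish (ξ , _ , cheap) = ι (pos (K !)) ⊗ ξ , Unit-* (factorial-unit K K<p) (unit ξ ξ≢0) ,
        ≤-trans half-good (*-monoʳ-≤ 2 (∑-mono elems (λ s → *-monoʳ-≤ (weight s) (⟦⟧-mono (λ h → ≤ᵈ-intro (subst (λ w → q * ‖ w ‖ ≤ p) (solve 3 (λ k ξ s → k :* (ξ :* s) := k :* ξ :* s) refl (ι (pos (K !))) ξ s) (periods-near (ξ ⊗ s) (≤ᵈ-elim h))))))))
        where
        open Frequency ξ cheap
        open G-Solver

  -- Concentration in a short arc

  aff : G → G → BSet → BSet
  aff v b A x = A (v ⊗ x ⊕ b)

  ∑-affine : ∀ {v} → Unit v → ∀ b (f : G → ℕ) → ∑[ x ] f (v ⊗ x ⊕ b) ≡ ∑G f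
  ∑-affine (v' , e) b f = trans (∑-dilate e (λ x → f (x ⊕ b))) (∑-shift b f)

  card-aff : ∀ {v} → Unit v → ∀ b A → card (aff v b A) ≡ card A
  card-aff uv b A = ∑-affine uv b (λ x → ⟦ A x ⟧)

  T₃-aff : ∀ {v} → Unit v → ∀ b A → T₃ (aff v b A) (aff v b A) (aff v b A) ≡ T₃ A A A
  T₃-aff {v} uv b A = trans
    (∑-cong elems (λ y → trans (∑-cong elems (λ x → cong (λ w → ⟦ A (v ⊗ y ⊕ b) ⟧ * (⟦ A (v ⊗ x ⊕ b) ⟧ * ⟦ A w ⟧)) (solve 4 (λ v y x b → v :* (con (pos 2) :* y :- x) :+ b := con (pos 2) :* (v :* y :+ b) :- (v :* x :+ b)) refl v y x b)))
      (∑-affine uv b (λ x → ⟦ A (v ⊗ y ⊕ b) ⟧ * (⟦ A x ⟧ * ⟦ A (𝟐 ⊗ (v ⊗ y ⊕ b) ⊝ x) ⟧)))))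
    (∑-affine uv b (λ y → ∑[ x ] ⟦ A y ⟧ * (⟦ A x ⟧ * ⟦ A (𝟐 ⊗ y ⊝ x) ⟧)))
    where open G-Solver

  core : ℕ → BSet → ℕ
  core q A = ∑[ x ] ⟦ A x ⟧ * ⟦ (q * ‖ x ‖) ≤ᵈ p ⟧

  -- Most pairs (z , z + s) of Y have popular difference s, so after the dilation some z has many near neighbours.
  cluster : ∀ C K q → 24576 ≤ C → 128 ≤ K → K < p → Unit 𝟐 → ∀ A → 1 ≤ card A → card A * card A ≤ 2 * T₃ A A A →
            cluster-density C K q * card A ≤ p → ∃ λ v → ∃ λ b → Unit v × card A ≤ 144 * core q (aff v b A)
  cluster C K q C≥ K≥ K<p two A ne T≥ dense = from (balog-szemeredi two A ne T≥)
    where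
    n = card A
    from : (∃ λ Y → Y ⊑ A × n ≤ 6 * card Y × card (differences Y) ≤ 24576 * n) → ∃ λ v → ∃ λ b → Unit v × card A ≤ 144 * core q (aff v b A)
    from (Y , Y⊑A , n≤ , D≤) = finish near
      where
      open Popular Y (72 * C) n using (S)
      weight : G → ℕ
      weight s = ⟦ S s ⟧ * r Y s
      D≤' : card (differences Y) ≤ C * n
      D≤' = ≤-trans D≤ (*-monoˡ-≤ n C≥)
      C≥1 : 1 ≤ C
      C≥1 = ≤-trans (s≤s z≤n) C≥
      mass : card Y * card Y ≤ 2 * ∑G weight
      mass = popular-mass Y n C ne C≥1 n≤ (card-mono Y⊑A) D≤'
      y≥1 : 1 ≤ card Y
      y≥1 = *-cancelˡ-< 6 0 (card Y) (≤-trans ne n≤)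
      near : ∃ λ u → Unit u × ∑G weight ≤ 2 * (∑[ s ] weight s * ⟦ (q * ‖ u ⊗ s ‖) ≤ᵈ p ⟧)
      near = near-dilation K q (følner-size C (invariance K q) (invariance-pos K q) * n) S weight (λ s e → cong (λ b → ⟦ b ⟧ * r Y s) e)
        (popular-følner Y n C ne C≥1 n≤ (card-mono Y⊑A) D≤' (invariance K q) (invariance-pos K q))
        (*-cancelˡ-< 2 0 (∑G weight) (≤-trans (*-mono-≤ y≥1 y≥1) mass)) K≥ K<p
        (≤-trans (≤-reflexive (sym (*-assoc 8 (følner-size C (invariance K q) (invariance-pos K q)) n))) dense)
      finish : (∃ λ u → Unit u × ∑G weight ≤ 2 * (∑[ s ] weight s * ⟦ (q * ‖ u ⊗ s ‖) ≤ᵈ p ⟧)) → ∃ λ v → ∃ λ b → Unit v × card A ≤ 144 * core q (aff v b A)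
      finish (u , (v , uv) , half) = result (∑-≤-pick elems Y {λ _ → n} {λ z → 144 * c z} y≥1 total)
        where
        open ≤-Reasoning
        N : G → ℕ
        N s = ⟦ (q * ‖ u ⊗ s ‖) ≤ᵈ p ⟧
        c : G → ℕ
        c z = ∑[ x ] ⟦ Y x ⟧ * N (x ⊝ z)
        pairs : ∑[ s ] weight s * N s ≤ ∑[ z ] ⟦ Y z ⟧ * c z
        pairs = begin
          ∑[ s ] weight s * N s  ≤⟨ ∑-mono elems (λ s → *-monoˡ-≤ (N s) (⟦⟧*≤ (S s) (r Y s))) ⟩
          ∑[ s ] r Y s * N s  ≡⟨ ∑-cong elems (λ s → sym (∑-*ʳ elems (N s) _)) ⟩
          ∑[ s ] ∑[ z ] ⟦ Y z ⟧ * ⟦ Y (z ⊕ s) ⟧ * N s  ≡⟨ ∑G-swap _ ⟩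
          ∑[ z ] ∑[ s ] ⟦ Y z ⟧ * ⟦ Y (z ⊕ s) ⟧ * N s  ≡⟨ ∑-cong elems (λ z → trans (∑-cong elems (λ s → *-assoc ⟦ Y z ⟧ ⟦ Y (z ⊕ s) ⟧ (N s))) (∑-*ˡ elems ⟦ Y z ⟧ _)) ⟩
          ∑[ z ] ⟦ Y z ⟧ * (∑[ s ] ⟦ Y (z ⊕ s) ⟧ * N s)  ≡⟨ ∑-cong elems (λ z → cong (⟦ Y z ⟧ *_) (trans (∑-cong elems (λ s → cong (λ w → ⟦ Y (z ⊕ s) ⟧ * N w) (solve 2 (λ z s → s := z :+ s :- z) refl z s))) (∑-shiftˡ z (λ x → ⟦ Y x ⟧ * N (x ⊝ z))))) ⟩
          ∑[ z ] ⟦ Y z ⟧ * c z  ∎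
          where open G-Solver
        l₁ : ∀ y → 6 * y * (6 * y) ≡ 36 * (y * y)
        l₁ = solve-∀
        l₂ : ∀ s → 36 * (2 * (2 * s)) ≡ 144 * s
        l₂ = solve-∀
        l₃ : ∀ a b → 144 * (a * b) ≡ a * (144 * b)
        l₃ = solve-∀
        total : ∑[ z ] ⟦ Y z ⟧ * n ≤ ∑[ z ] ⟦ Y z ⟧ * (144 * c z)
        total = begin
          ∑[ z ] ⟦ Y z ⟧ * n  ≡⟨ ∑-*ʳ elems n _ ⟩
          card Y * n  ≤⟨ *-monoˡ-≤ n (card-mono Y⊑A) ⟩
          n * n  ≤⟨ *-mono-≤ n≤ n≤ ⟩
          6 * card Y * (6 * card Y)  ≡⟨ l₁ (card Y) ⟩
          36 * (card Y * card Y)  ≤⟨ *-monoʳ-≤ 36 mass ⟩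
          36 * (2 * ∑G weight)  ≤⟨ *-monoʳ-≤ 36 (*-monoʳ-≤ 2 half) ⟩
          36 * (2 * (2 * (∑[ s ] weight s * N s)))  ≡⟨ l₂ (∑[ s ] weight s * N s) ⟩
          144 * (∑[ s ] weight s * N s)  ≤⟨ *-monoʳ-≤ 144 pairs ⟩
          144 * (∑[ z ] ⟦ Y z ⟧ * c z)  ≡⟨ trans (sym (∑-*ˡ elems 144 _)) (∑-cong elems (λ z → l₃ ⟦ Y z ⟧ (c z))) ⟩
          ∑[ z ] ⟦ Y z ⟧ * (144 * c z)  ∎
        result : (∃ λ z → Y z ≡ true × n ≤ 144 * c z) → ∃ λ v → ∃ λ b → Unit v × card A ≤ 144 * core q (aff v b A)
        result (z , _ , h) = v , z , (u , vu) , ≤-trans h (*-monoʳ-≤ 144 (begin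
          c z  ≤⟨ ∑-mono elems (λ x → *-monoˡ-≤ (N (x ⊝ z)) (⟦⟧-mono (Y⊑A x))) ⟩
          ∑[ x ] ⟦ A x ⟧ * N (x ⊝ z)  ≡⟨ sym (∑-affine (u , vu) z (λ x → ⟦ A x ⟧ * N (x ⊝ z))) ⟩
          ∑[ x ] ⟦ A (v ⊗ x ⊕ z) ⟧ * N (v ⊗ x ⊕ z ⊝ z)  ≡⟨ ∑-cong elems (λ x → cong (λ w → ⟦ A (v ⊗ x ⊕ z) ⟧ * ⟦ (q * ‖ w ‖) ≤ᵈ p ⟧) (back x)) ⟩
          core q (aff v z A)  ∎))
          where
          open G-Solver
          vu : v ⊗ u ≡ 𝟏
          vu = trans (solve 2 (λ v u → v :* u := u :* v) refl v u) uv
          back : ∀ x → u ⊗ (v ⊗ x ⊕ z ⊝ z) ≡ x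
          back x = trans (solve 4 (λ u v x z → u :* (v :* x :+ z :- z) := u :* v :* x) refl u v x z) (trans (cong (_⊗ x) uv) (solve 1 (λ x → con (pos 1) :* x := x) refl x))

  -- 0 is outside A, 1 the core, 2 the middle zone, 3 far. The type is finite so that `split₁` and
  -- `split₂` are verified by evaluation over all 64 triples.
  Label : Set
  Label = Fin 4

  label : Bool → Bool → Bool → Label
  label false c m = zero
  label true true m = suc zero
  label true false true = suc (suc zero)
  label true false false = suc (suc (suc zero))

  inA isC isM isF isMF isCM : Label → Bool
  inA zero = false
  inA (suc _) = true
  isC (suc zero) = true
  isC _ = false
  isM (suc (suc zero)) = true
  isM _ = false
  isF (suc (suc (suc zero))) = true
  isF _ = false
  isMF (suc (suc _)) = true
  isMF _ = false
  isCM (suc zero) = true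
  isCM (suc (suc zero)) = true
  isCM _ = false

  label-A : ∀ a c m → inA (label a c m) ≡ a
  label-A false c m = refl
  label-A true true m = refl
  label-A true false true = refl
  label-A true false false = refl

  label-C : ∀ {a c m} → isC (label a c m) ≡ true → a ≡ true × c ≡ true
  label-C {true} {true} _ = refl , refl
  label-C {true} {false} {true} ()
  label-C {true} {false} {false} ()

  label-F : ∀ {a c m} → isF (label a c m) ≡ true → a ≡ true × m ≡ false
  label-F {true} {true} ()
  label-F {true} {false} {true} ()
  label-F {true} {false} {false} _ = refl , refl

  label-M : ∀ {a c m} → isM (label a c m) ≡ true → a ≡ true × m ≡ true
  label-M {true} {true} ()
  label-M {true} {false} {true} _ = refl , refl
  label-M {true} {false} {false} ()

  label-C-count : ∀ a c m → ⟦ isC (label a c m) ⟧ ≡ ⟦ a ⟧ * ⟦ c ⟧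
  label-C-count false c m = refl
  label-C-count true true m = refl
  label-C-count true false true = refl
  label-C-count true false false = refl

  isMF-split : ∀ l → ⟦ isMF l ⟧ ≡ ⟦ isM l ⟧ + ⟦ isF l ⟧
  isMF-split zero = refl
  isMF-split (suc zero) = refl
  isMF-split (suc (suc zero)) = refl
  isMF-split (suc (suc (suc zero))) = refl

  inA-split : ∀ l → ⟦ inA l ⟧ ≡ ⟦ isC l ⟧ + ⟦ isMF l ⟧
  inA-split zero = refl
  inA-split (suc zero) = refl
  inA-split (suc (suc zero)) = refl
  inA-split (suc (suc (suc zero))) = refl

  inA-split' : ∀ l → ⟦ inA l ⟧ ≡ ⟦ isCM l ⟧ + ⟦ isF l ⟧
  inA-split' zero = refl
  inA-split' (suc zero) = refl
  inA-split' (suc (suc zero)) = refl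
  inA-split' (suc (suc (suc zero))) = refl

  prod : (Label → Bool) → (Label → Bool) → (Label → Bool) → Label → Label → Label → ℕ
  prod χ ψ ω x y z = ⟦ ψ y ⟧ * (⟦ χ x ⟧ * ⟦ ω z ⟧)

  -- A triple of A that is neither all core nor free of core points contains a middle point, or else
  -- shows one of the six mixed patterns of core and far points in the last group.
  split₁ : ∀ x y z → prod inA inA inA x y z ≤ prod isC isC isC x y z + prod isMF isMF isMF x y z
    + (⟦ isM y ⟧ * ⟦ inA x ⟧ + ⟦ inA y ⟧ * ⟦ isM x ⟧ + ⟦ inA y ⟧ * ⟦ isM z ⟧)
    + ((prod isC isC isF x y z + prod isF isC isC x y z) + prod isC isF isC x y z
      + (prod isC isF isF x y z + prod isF isF isC x y z) + prod isF isC isF x y z)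
  split₁ = toWitness {a? = all? λ x → all? λ y → all? λ z → _ ≤? _} _

  -- The three patterns with two core points and one far point are kept apart, since the endgame
  -- excludes them; every other triple mixing far points with the rest has a far point and a second
  -- point outside the core.
  split₂ : ∀ x y z → prod inA inA inA x y z ≤ prod isCM isCM isCM x y z + prod isF isF isF x y z
    + (prod isC isC isF x y z + prod isF isC isC x y z + prod isC isF isC x y z)
    + (⟦ isF y ⟧ * ⟦ isMF x ⟧ + ⟦ isF y ⟧ * ⟦ isMF z ⟧ + ⟦ isF x ⟧ * ⟦ isMF z ⟧ + ⟦ isF x ⟧ * ⟦ isM y ⟧ + ⟦ isF z ⟧ * ⟦ isM y ⟧ + ⟦ isF z ⟧ * ⟦ isM x ⟧)
  split₂ = toWitness {a? = all? λ x → all? λ y → all? λ z → _ ≤? _} _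

  norm-2y-x : ∀ y x → ‖ 𝟐 ⊗ y ⊝ x ‖ ≤ 2 * ‖ y ‖ + ‖ x ‖
  norm-2y-x y x = ≤-trans (norm-- (𝟐 ⊗ y) x) (+-monoˡ-≤ ‖ x ‖ (norm-* 2 y))

  ∑-yx : ∀ (f g : G → ℕ) → ∑[ y ] ∑[ x ] f y * g x ≡ ∑G f * ∑G g
  ∑-yx f g = trans (∑-cong elems (λ y → ∑-*ˡ elems (f y) g)) (∑-*ʳ elems (∑G g) f)

  ∑-yz : ∀ (f g : G → ℕ) → ∑[ y ] ∑[ x ] f y * g (𝟐 ⊗ y ⊝ x) ≡ ∑G f * ∑G g
  ∑-yz f g = trans (∑-cong elems (λ y → trans (∑-*ˡ elems (f y) _) (cong (f y *_) (∑-reflect (𝟐 ⊗ y) g)))) (∑-*ʳ elems (∑G g) f)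

  ∑-z : Unit 𝟐 → ∀ x (g : G → ℕ) → ∑[ y ] g (𝟐 ⊗ y ⊝ x) ≡ ∑G g
  ∑-z two x g = ∑-affine two (⊖ x) g

  ∑-xz : Unit 𝟐 → ∀ (f g : G → ℕ) → ∑[ y ] ∑[ x ] f x * g (𝟐 ⊗ y ⊝ x) ≡ ∑G f * ∑G g
  ∑-xz two f g = trans (∑G-swap _) (trans (∑-cong elems (λ x → trans (∑-*ˡ elems (f x) _) (cong (f x *_) (∑-z two x g)))) (∑-*ʳ elems (∑G g) f))

  ∑∑-mono : {f g : G → G → ℕ} → (∀ y x → f y x ≤ g y x) → ∑[ y ] ∑[ x ] f y x ≤ ∑[ y ] ∑[ x ] g y x
  ∑∑-mono h = ∑-mono elems (λ y → ∑-mono elems (h y))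

  ∑∑-+ : (f g : G → G → ℕ) → ∑[ y ] ∑[ x ] (f y x + g y x) ≡ (∑[ y ] ∑[ x ] f y x) + (∑[ y ] ∑[ x ] g y x)
  ∑∑-+ f g = trans (∑-cong elems (λ y → ∑-+ elems (f y) (g y))) (∑-+ elems _ _)

  core-grow : ∀ q A (X : BSet) {u} → Unit u → (∀ x → X x ≡ true → A x ≡ true × q * ‖ u ⊗ x ‖ ≤ p) → ∃ λ v → Unit v × card X ≤ core q (aff v 𝟎 A)
  core-grow q A X {u} (v , uv) h = v , (u , trans (solve 2 (λ u v → v :* u := u :* v) refl u v) uv) , (begin
    card X  ≤⟨ ∑-mono elems (λ x → pt x) ⟩
    ∑[ x ] ⟦ A x ⟧ * ⟦ (q * ‖ u ⊗ x ‖) ≤ᵈ p ⟧  ≡⟨ ∑-cong elems (λ x → cong₂ (λ w w' → ⟦ A w ⟧ * ⟦ (q * ‖ w' ‖) ≤ᵈ p ⟧) (back x) (solve 2 (λ u x → u :* x := u :* x :+ con (pos 0)) refl u x)) ⟩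
    ∑[ x ] ⟦ A (v ⊗ (u ⊗ x ⊕ 𝟎) ⊕ 𝟎) ⟧ * ⟦ (q * ‖ u ⊗ x ⊕ 𝟎 ‖) ≤ᵈ p ⟧  ≡⟨ ∑-affine (v , uv) 𝟎 (λ x → ⟦ A (v ⊗ x ⊕ 𝟎) ⟧ * ⟦ (q * ‖ x ‖) ≤ᵈ p ⟧) ⟩
    core q (aff v 𝟎 A)  ∎)
    where
    open ≤-Reasoning
    open G-Solver
    pt : ∀ x → ⟦ X x ⟧ ≤ ⟦ A x ⟧ * ⟦ (q * ‖ u ⊗ x ‖) ≤ᵈ p ⟧
    pt x with X x in e
    ... | false = z≤n
    ... | true = both (proj₁ (h x e)) (≤ᵈ-intro (proj₂ (h x e)))
    back : ∀ x → x ≡ v ⊗ (u ⊗ x ⊕ 𝟎) ⊕ 𝟎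
    back x = trans (solve 1 (λ x → x := con (pos 1) :* x) refl x) (trans (cong (_⊗ x) (sym uv)) (solve 3 (λ u v x → u :* v :* x := v :* (u :* x :+ con (pos 0)) :+ con (pos 0)) refl u v x))

  InductionHypothesis : ℕ → Set
  InductionHypothesis n = ∀ B → card B < n → 2 * T₃ B B B ≤ card B * card B + 1

  -- One round: either all but n/40 of A lies in the core at sharpness 6R, or a dilation gives a
  -- core at the coarser sharpness `Q'` with n/E more points. The thresholds fit together: for core
  -- points 2y - x stays within p/(2R), sums of two and doubles within p/(3R).
  module Step (Q' E : ℕ) (Q'≥1 : 1 ≤ Q') (two : Unit 𝟐) (A : BSet) (E≥ : 80640 ≤ E)
              (IH : InductionHypothesis (card A)) (T≥ : card A * card A ≤ 2 * T₃ A A A)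
              (core-large : card A ≤ 144 * core (6 * (2 * (Q' * Q'))) A) (ne : 1 ≤ card A) (Q'<p : 2 * Q' < p) where
    n = card A
    R = 2 * (Q' * Q')

    lab : G → Label
    lab x = label (A x) ((6 * R * ‖ x ‖) ≤ᵈ p) ((2 * R * ‖ x ‖) ≤ᵈ p)

    C M F MF : BSet
    C = isC ∘ lab
    M = isM ∘ lab
    F = isF ∘ lab
    MF = isMF ∘ lab

    C-near : ∀ x → C x ≡ true → A x ≡ true × 6 * R * ‖ x ‖ ≤ p
    C-near x h = proj₁ (label-C h) , ≤ᵈ-elim (proj₂ (label-C {A x} h))

    M-near : ∀ x → M x ≡ true → A x ≡ true × 2 * R * ‖ x ‖ ≤ p
    M-near x h = proj₁ (label-M {A x} h) , ≤ᵈ-elim (proj₂ (label-M {A x} h))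

    F-far : ∀ x → F x ≡ true → A x ≡ true × p < 2 * R * ‖ x ‖
    F-far x h = proj₁ (label-F {A x} h) , ≤ᵈ-false (proj₂ (label-F {A x} h))

    A-lab : ∀ x → ⟦ A x ⟧ ≡ ⟦ inA (lab x) ⟧
    A-lab x = cong ⟦_⟧ (sym (label-A (A x) _ _))

    card-C : card C ≡ core (6 * R) A
    card-C = ∑-cong elems (λ x → label-C-count (A x) _ _)

    n-split : n ≡ card C + card MF
    n-split = trans (∑-cong elems (λ x → trans (A-lab x) (inA-split (lab x)))) (∑-+ elems _ _)

    card-M+F : card MF ≡ card M + card F
    card-M+F = trans (∑-cong elems (λ x → isMF-split (lab x))) (∑-+ elems _ _)

    arc : G → ℕ
    arc c = ∑[ x ] ⟦ F x ⟧ * ⟦ (3 * R * ‖ x ⊝ c ‖) ≤ᵈ p ⟧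

    -- Far points whose double is near 0, such as those near p/2. A far midpoint of two core points
    -- is of this kind.
    dbl : ℕ
    dbl = ∑[ x ] ⟦ F x ⟧ * ⟦ (3 * R * ‖ 𝟐 ⊗ x ‖) ≤ᵈ p ⟧

    Progress : Set
    Progress = ∃ λ v → Unit v × E * core (6 * R) A + n ≤ E * core Q' (aff v 𝟎 A)

    Q'≤R : Q' ≤ R
    Q'≤R = ≤-trans (m≤m*n Q' Q' {{>-nonZero Q'≥1}}) (m≤n*m _ 2)

    unit-small : ∀ {k} → 1 ≤ k → k < p → Unit (ι (pos k))
    unit-small {k} k≥1 k<p = unit (ι (pos k)) (λ e → <⇒≢ k≥1 (sym (trans (sym (toℕ-ι-pos k<p)) (trans (cong toℕ e) (toℕ-ι-pos (≤-<-trans z≤n k<p))))))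

    progress : ∀ (X : BSet) {u} k → Unit u → n ≤ E * k → card C + k ≤ card X → (∀ x → X x ≡ true → A x ≡ true × Q' * ‖ u ⊗ x ‖ ≤ p) → Progress
    progress X k uu heavy size h = let (v , uv , le) = core-grow Q' A X uu h in v , uv , (begin
      E * core (6 * R) A + n  ≤⟨ +-mono-≤ (≤-reflexive (cong (E *_) (sym card-C))) heavy ⟩
      E * card C + E * k  ≡⟨ sym (*-distribˡ-+ E (card C) k) ⟩
      E * (card C + k)  ≤⟨ *-monoʳ-≤ E (≤-trans size le) ⟩
      E * core Q' (aff v 𝟎 A)  ∎)
      where open ≤-Reasoning

    size-∨ : ∀ (f : G → Bool) → card C + (∑[ x ] ⟦ F x ⟧ * ⟦ f x ⟧) ≤ card (λ x → C x ∨ (F x ∧ f x))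
    size-∨ f = ≤-reflexive (trans (sym (∑-+ elems _ _)) (∑-cong elems (λ x → pt (lab x) (f x))))
      where
      pt : ∀ l b → ⟦ isC l ⟧ + ⟦ isF l ⟧ * ⟦ b ⟧ ≡ ⟦ isC l ∨ (isF l ∧ b) ⟧
      pt zero b = refl
      pt (suc zero) b = refl
      pt (suc (suc zero)) b = refl
      pt (suc (suc (suc zero))) true = refl
      pt (suc (suc (suc zero))) false = refl

    ∨-cases : ∀ x (f : G → Bool) → (C x ∨ (F x ∧ f x)) ≡ true → C x ≡ true ⊎ (F x ≡ true × f x ≡ true)
    ∨-cases x f h with C x | F x | f x
    ... | true | _ | _ = inj₁ refl
    ... | false | true | true = inj₂ (refl , refl)

    progress-mid : n ≤ E * card M → Progress
    progress-mid heavy = progress (isCM ∘ lab) (card M) (𝟏 , solve 0 (con (pos 1) :* con (pos 1) := con (pos 1)) refl) heavy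
      (≤-reflexive (trans (sym (∑-+ elems _ _)) (∑-cong elems (λ x → pt (lab x)))))
      (λ x h → near x (cases (lab x) h))
      where
      open G-Solver
      pt : ∀ l → ⟦ isC l ⟧ + ⟦ isM l ⟧ ≡ ⟦ isCM l ⟧
      pt zero = refl
      pt (suc zero) = refl
      pt (suc (suc zero)) = refl
      pt (suc (suc (suc zero))) = refl
      cases : ∀ l → isCM l ≡ true → isC l ≡ true ⊎ isM l ≡ true
      cases (suc zero) _ = inj₁ refl
      cases (suc (suc zero)) _ = inj₂ refl
      one* : ∀ x → ‖ 𝟏 ⊗ x ‖ ≡ ‖ x ‖
      one* x = cong ‖_‖ (solve 1 (λ x → con (pos 1) :* x := x) refl x)
      near : ∀ x → C x ≡ true ⊎ M x ≡ true → A x ≡ true × Q' * ‖ 𝟏 ⊗ x ‖ ≤ p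
      near x (inj₁ h) = proj₁ (C-near x h) , ≤-trans (*-mono-≤ (≤-trans Q'≤R (m≤n*m R 6)) (≤-reflexive (one* x))) (proj₂ (C-near x h))
      near x (inj₂ h) = proj₁ (M-near x h) , ≤-trans (*-mono-≤ (≤-trans Q'≤R (m≤n*m R 2)) (≤-reflexive (one* x))) (proj₂ (M-near x h))

    progress-double : n ≤ E * dbl → Progress
    progress-double heavy = progress (λ x → C x ∨ (F x ∧ f x)) dbl two heavy (size-∨ f) (λ x h → near x (∨-cases x f h))
      where
      f : G → Bool
      f x = (3 * R * ‖ 𝟐 ⊗ x ‖) ≤ᵈ p
      l : ∀ R x → R * (2 * x) ≡ 2 * R * x
      l = solve-∀
      near : ∀ x → C x ≡ true ⊎ (F x ≡ true × f x ≡ true) → A x ≡ true × Q' * ‖ 𝟐 ⊗ x ‖ ≤ p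
      near x (inj₁ h) = proj₁ (C-near x h) , ≤-trans (*-mono-≤ Q'≤R (norm-* 2 x)) (≤-trans (≤-reflexive (l R ‖ x ‖)) (≤-trans (*-monoˡ-≤ ‖ x ‖ (*-monoˡ-≤ R {2} {6} (s≤s (s≤s z≤n)))) (proj₂ (C-near x h))))
      near x (inj₂ (h , h')) = proj₁ (F-far x h) , ≤-trans (*-monoˡ-≤ ‖ 𝟐 ⊗ x ‖ (≤-trans Q'≤R (m≤n*m R 3))) (≤ᵈ-elim h')

    -- Dirichlet: some k ≤ 2Q′ brings the centre c close to 0.
    progress-arc : ∀ c → n ≤ E * arc c → Progress
    progress-arc c heavy = go (dirichlet (2 * Q') (*-mono-≤ {1} {2} (s≤s z≤n) Q'≥1) c)
      where
      f : G → Bool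
      f x = (3 * R * ‖ x ⊝ c ‖) ≤ᵈ p
      go : (∃ λ k → 1 ≤ k × k ≤ 2 * Q' × 2 * Q' * ‖ ι (pos k) ⊗ c ‖ < p) → Progress
      go (k , k≥1 , k≤ , close) = progress (λ x → C x ∨ (F x ∧ f x)) (arc c) (unit-small k≥1 (≤-<-trans k≤ Q'<p)) heavy (size-∨ f) (λ x h → near x (∨-cases x f h))
        where
        open ≤-Reasoning
        l₁ : ∀ q k x → q * (k * x) ≡ q * k * x
        l₁ = solve-∀
        l₂ : ∀ q → q * (2 * q) ≡ 2 * (q * q)
        l₂ = solve-∀
        Q'k : Q' * k ≤ R
        Q'k = ≤-trans (*-monoʳ-≤ Q' k≤) (≤-reflexive (l₂ Q'))
        near : ∀ x → C x ≡ true ⊎ (F x ≡ true × f x ≡ true) → A x ≡ true × Q' * ‖ ι (pos k) ⊗ x ‖ ≤ p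
        near x (inj₁ h) = proj₁ (C-near x h) , (begin
          Q' * ‖ ι (pos k) ⊗ x ‖  ≤⟨ *-monoʳ-≤ Q' (norm-* k x) ⟩
          Q' * (k * ‖ x ‖)  ≡⟨ l₁ Q' k ‖ x ‖ ⟩
          Q' * k * ‖ x ‖  ≤⟨ *-monoˡ-≤ ‖ x ‖ (≤-trans Q'k (m≤n*m R 6)) ⟩
          6 * R * ‖ x ‖  ≤⟨ proj₂ (C-near x h) ⟩
          p  ∎)
        near x (inj₂ (h , h')) = proj₁ (F-far x h) , *-cancelˡ-≤ 2 (begin
          2 * (Q' * ‖ ι (pos k) ⊗ x ‖)  ≡⟨ cong (λ w → 2 * (Q' * ‖ w ‖)) (solve 3 (λ k x c → k :* x := k :* c :+ k :* (x :- c)) refl (ι (pos k)) x c) ⟩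
          2 * (Q' * ‖ ι (pos k) ⊗ c ⊕ ι (pos k) ⊗ (x ⊝ c) ‖)  ≤⟨ *-monoʳ-≤ 2 (*-monoʳ-≤ Q' (≤-trans (norm-+ _ _) (+-monoʳ-≤ ‖ ι (pos k) ⊗ c ‖ (norm-* k (x ⊝ c))))) ⟩
          2 * (Q' * (‖ ι (pos k) ⊗ c ‖ + k * ‖ x ⊝ c ‖))  ≡⟨ l₃ Q' (‖ ι (pos k) ⊗ c ‖) k (‖ x ⊝ c ‖) ⟩
          2 * Q' * ‖ ι (pos k) ⊗ c ‖ + 2 * (Q' * k) * ‖ x ⊝ c ‖  ≤⟨ +-mono-≤ (<⇒≤ close) (≤-trans (*-monoˡ-≤ ‖ x ⊝ c ‖ (≤-trans (*-monoʳ-≤ 2 Q'k) (*-monoˡ-≤ R {2} {3} (s≤s (s≤s z≤n))))) (≤ᵈ-elim h')) ⟩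
          p + p  ≡⟨ cong (p +_) (sym (+-identityʳ p)) ⟩
          2 * p  ∎)
          where
          open G-Solver
          l₃ : ∀ q a k b → 2 * (q * (a + k * b)) ≡ 2 * q * a + 2 * (q * k) * b
          l₃ = solve-∀

    module Light (M-light : E * card M < n) (dbl-light : E * dbl < n) (arc-light : ∀ c → E * arc c < n) where

      -- Dominates the progressions that meet both the core and its complement. The two zeros are
      -- the patterns core-core-far and far-core-core, excluded by distance. A far midpoint of two
      -- core points falls under `dbl`; in the other patterns another point of the progression
      -- prescribes an arc for a far point.
      cross : G → G → ℕ
      cross y x = ⟦ M y ⟧ * ⟦ inA (lab x) ⟧ + ⟦ inA (lab y) ⟧ * ⟦ M x ⟧ + ⟦ inA (lab y) ⟧ * ⟦ M (𝟐 ⊗ y ⊝ x) ⟧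
        + (0 + 0 + ⟦ F y ⟧ * ⟦ (3 * R * ‖ 𝟐 ⊗ y ‖) ≤ᵈ p ⟧ * ⟦ A x ⟧
          + (⟦ A y ⟧ * (⟦ F (𝟐 ⊗ y ⊝ x) ⟧ * ⟦ (3 * R * ‖ 𝟐 ⊗ y ⊝ x ⊝ 𝟐 ⊗ y ‖) ≤ᵈ p ⟧) + ⟦ A y ⟧ * (⟦ F x ⟧ * ⟦ (3 * R * ‖ x ⊝ 𝟐 ⊗ y ‖) ≤ᵈ p ⟧))
          + ⟦ A x ⟧ * (⟦ F (𝟐 ⊗ y ⊝ x) ⟧ * ⟦ (3 * R * ‖ 𝟐 ⊗ y ⊝ x ⊝ (⊖ x) ‖) ≤ᵈ p ⟧))

      half-R : ∀ a → 6 * R * a ≡ 3 * R * (2 * a)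
      half-R a = l R a
        where
        l : ∀ R a → 6 * R * a ≡ 3 * R * (2 * a)
        l = solve-∀

      too-far : ∀ {x y z} → C x ≡ true → C y ≡ true → F z ≡ true → ‖ z ‖ ≤ 2 * ‖ y ‖ + ‖ x ‖ → ⊥
      too-far {x} {y} {z} hx hy hz le = <-irrefl refl (begin-strict
        3 * p  <⟨ *-monoʳ-< 3 (proj₂ (F-far z hz)) ⟩
        3 * (2 * R * ‖ z ‖)  ≤⟨ *-monoʳ-≤ 3 (*-monoʳ-≤ (2 * R) le) ⟩
        3 * (2 * R * (2 * ‖ y ‖ + ‖ x ‖))  ≡⟨ l R (‖ y ‖) (‖ x ‖) ⟩
        2 * (6 * R * ‖ y ‖) + 6 * R * ‖ x ‖  ≤⟨ +-mono-≤ (*-monoʳ-≤ 2 (proj₂ (C-near y hy))) (proj₂ (C-near x hx)) ⟩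
        2 * p + p  ≡⟨ l' p ⟩
        3 * p  ∎)
        where
        open ≤-Reasoning
        l : ∀ R y x → 3 * (2 * R * (2 * y + x)) ≡ 2 * (6 * R * y) + 6 * R * x
        l = solve-∀
        l' : ∀ p → 2 * p + p ≡ 3 * p
        l' = solve-∀

      near₃ : ∀ {x w} → C x ≡ true → ‖ w ‖ ≤ 2 * ‖ x ‖ → (3 * R * ‖ w ‖) ≤ᵈ p ≡ true
      near₃ {x} hx le = ≤ᵈ-intro (≤-trans (*-monoʳ-≤ (3 * R) le) (≤-trans (≤-reflexive (sym (half-R ‖ x ‖))) (proj₂ (C-near x hx))))

      near₂ : ∀ {x z w} → C x ≡ true → C z ≡ true → ‖ w ‖ ≤ ‖ x ‖ + ‖ z ‖ → (3 * R * ‖ w ‖) ≤ᵈ p ≡ true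
      near₂ {x} {z} {w} hx hz le = ≤ᵈ-intro (*-cancelˡ-≤ 2 (begin
        2 * (3 * R * ‖ w ‖)  ≤⟨ *-monoʳ-≤ 2 (*-monoʳ-≤ (3 * R) le) ⟩
        2 * (3 * R * (‖ x ‖ + ‖ z ‖))  ≡⟨ l R (‖ x ‖) (‖ z ‖) ⟩
        6 * R * ‖ x ‖ + 6 * R * ‖ z ‖  ≤⟨ +-mono-≤ (proj₂ (C-near x hx)) (proj₂ (C-near z hz)) ⟩
        p + p  ≡⟨ cong (p +_) (sym (+-identityʳ p)) ⟩
        2 * p  ∎))
        where
        open ≤-Reasoning
        l : ∀ R x z → 2 * (3 * R * (x + z)) ≡ 6 * R * x + 6 * R * z
        l = solve-∀

      pointwise : ∀ y x → ⟦ A y ⟧ * (⟦ A x ⟧ * ⟦ A (𝟐 ⊗ y ⊝ x) ⟧)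
        ≤ ⟦ C y ⟧ * (⟦ C x ⟧ * ⟦ C (𝟐 ⊗ y ⊝ x) ⟧) + ⟦ MF y ⟧ * (⟦ MF x ⟧ * ⟦ MF (𝟐 ⊗ y ⊝ x) ⟧) + cross y x
      pointwise y x = begin
        ⟦ A y ⟧ * (⟦ A x ⟧ * ⟦ A z ⟧)  ≡⟨ cong₂ _*_ (A-lab y) (cong₂ _*_ (A-lab x) (A-lab z)) ⟩
        prod inA inA inA (lab x) (lab y) (lab z)  ≤⟨ split₁ (lab x) (lab y) (lab z) ⟩
        _  ≤⟨ +-mono-≤ (≤-refl {s + t}) (+-mono-≤ (+-mono-≤ (+-mono-≤ (+-mono-≤ CCF FCC) CFC) (+-mono-≤ CFF FFC)) FCF) ⟩
        _  ≡⟨ +-assoc s t _ ⟩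
        s + cross y x  ∎
        where
        open ≤-Reasoning
        open G-Solver
        z = 𝟐 ⊗ y ⊝ x
        s = prod isC isC isC (lab x) (lab y) (lab z) + prod isMF isMF isMF (lab x) (lab y) (lab z)
        t = ⟦ M y ⟧ * ⟦ inA (lab x) ⟧ + ⟦ inA (lab y) ⟧ * ⟦ M x ⟧ + ⟦ inA (lab y) ⟧ * ⟦ M z ⟧
        x≡ : x ≡ 𝟐 ⊗ y ⊝ z
        x≡ = solve 2 (λ x y → x := con (pos 2) :* y :- (con (pos 2) :* y :- x)) refl x y
        CCF : prod isC isC isF (lab x) (lab y) (lab z) ≤ 0
        CCF = guard₃ (C x) (C y) (F z) (λ hx hy hz → ⊥-elim (too-far hx hy hz (norm-2y-x y x)))
        FCC : prod isF isC isC (lab x) (lab y) (lab z) ≤ 0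
        FCC = guard₃ (F x) (C y) (C z) (λ hx hy hz → ⊥-elim (too-far hz hy hx (≤-trans (≤-reflexive (cong ‖_‖ x≡)) (norm-2y-x y z))))
        CFC : prod isC isF isC (lab x) (lab y) (lab z) ≤ ⟦ F y ⟧ * ⟦ (3 * R * ‖ 𝟐 ⊗ y ‖) ≤ᵈ p ⟧ * ⟦ A x ⟧
        CFC = guard₃ (C x) (F y) (C z) (λ hx hy hz → *-mono-≤ (both hy (near₂ hx hz (≤-trans (≤-reflexive (cong ‖_‖ (solve 2 (λ x y → con (pos 2) :* y := x :+ (con (pos 2) :* y :- x)) refl x y))) (norm-+ x z)))) (one (proj₁ (C-near x hx))))
        CFF : prod isC isF isF (lab x) (lab y) (lab z) ≤ ⟦ A y ⟧ * (⟦ F z ⟧ * ⟦ (3 * R * ‖ z ⊝ 𝟐 ⊗ y ‖) ≤ᵈ p ⟧)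
        CFF = guard₃ (C x) (F y) (F z) (λ hx hy hz → *-mono-≤ (one (proj₁ (F-far y hy))) (both hz (near₃ hx (≤-trans (≤-reflexive (cong ‖_‖ (solve 2 (λ x y → con (pos 2) :* y :- x :- con (pos 2) :* y := :- x) refl x y))) (≤-trans (norm-neg x) (m≤n*m ‖ x ‖ 2))))))
        FFC : prod isF isF isC (lab x) (lab y) (lab z) ≤ ⟦ A y ⟧ * (⟦ F x ⟧ * ⟦ (3 * R * ‖ x ⊝ 𝟐 ⊗ y ‖) ≤ᵈ p ⟧)
        FFC = guard₃ (F x) (F y) (C z) (λ hx hy hz → *-mono-≤ (one (proj₁ (F-far y hy))) (both hx (near₃ hz (≤-trans (≤-reflexive (cong ‖_‖ (solve 2 (λ x y → x :- con (pos 2) :* y := :- (con (pos 2) :* y :- x)) refl x y))) (≤-trans (norm-neg z) (m≤n*m ‖ z ‖ 2))))))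
        FCF : prod isF isC isF (lab x) (lab y) (lab z) ≤ ⟦ A x ⟧ * (⟦ F z ⟧ * ⟦ (3 * R * ‖ z ⊝ (⊖ x) ‖) ≤ᵈ p ⟧)
        FCF = guard₃ (F x) (C y) (F z) (λ hx hy hz → *-mono-≤ (one (proj₁ (F-far x hx))) (both hz (near₃ hy (≤-trans (≤-reflexive (cong ‖_‖ (solve 2 (λ x y → con (pos 2) :* y :- x :- (:- x) := con (pos 2) :* y) refl x y))) (norm-* 2 y)))))

      -- Seven terms of at most n²/E each: three with a middle point, one with a double near 0,
      -- three with an arc.
      cross-bound : E * (∑[ y ] ∑[ x ] cross y x) ≤ 7 * (n * n)
      cross-bound = begin
        E * (∑[ y ] ∑[ x ] cross y x)  ≡⟨ cong (E *_) expand ⟩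
        E * (m * n + n * m + n * m + (dbl * n + (a₁ + a₂) + a₃))  ≡⟨ l₁ E m n dbl a₁ a₂ a₃ ⟩
        3 * (E * m * n) + (E * dbl * n + (E * a₁ + E * a₂) + E * a₃)  ≤⟨ +-mono-≤ (*-monoʳ-≤ 3 (*-monoˡ-≤ n (<⇒≤ M-light))) (+-mono-≤ (+-mono-≤ (*-monoˡ-≤ n (<⇒≤ dbl-light)) (+-mono-≤ (light (𝟐 ⊗_)) (light (𝟐 ⊗_)))) (light ⊖_)) ⟩
        3 * (n * n) + (n * n + (n * n + n * n) + n * n)  ≡⟨ l₂ (n * n) ⟩
        7 * (n * n)  ∎
        where
        open ≤-Reasoning
        m = card M
        a₁ = ∑[ y ] ⟦ A y ⟧ * arc (𝟐 ⊗ y)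
        a₂ = ∑[ y ] ⟦ A y ⟧ * arc (𝟐 ⊗ y)
        a₃ = ∑[ x ] ⟦ A x ⟧ * arc (⊖ x)
        nA : card (inA ∘ lab) ≡ n
        nA = ∑-cong elems (λ x → sym (A-lab x))
        l₁ : ∀ E m n d a b c → E * (m * n + n * m + n * m + (d * n + (a + b) + c)) ≡ 3 * (E * m * n) + (E * d * n + (E * a + E * b) + E * c)
        l₁ = solve-∀
        l₂ : ∀ q → 3 * q + (q + (q + q) + q) ≡ 7 * q
        l₂ = solve-∀
        light : ∀ (φ : G → G) → E * (∑[ y ] ⟦ A y ⟧ * arc (φ y)) ≤ n * n
        light φ = begin
          E * (∑[ y ] ⟦ A y ⟧ * arc (φ y))  ≡⟨ sym (∑-*ˡ elems E _) ⟩
          ∑[ y ] E * (⟦ A y ⟧ * arc (φ y))  ≤⟨ ∑-mono elems (λ y → ≤-trans (≤-reflexive (l₃ E ⟦ A y ⟧ (arc (φ y)))) (*-monoʳ-≤ ⟦ A y ⟧ (<⇒≤ (arc-light (φ y))))) ⟩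
          ∑[ y ] ⟦ A y ⟧ * n  ≡⟨ ∑-*ʳ elems n _ ⟩
          n * n  ∎
          where
          l₃ : ∀ E a b → E * (a * b) ≡ a * (E * b)
          l₃ = solve-∀
        expand : ∑[ y ] ∑[ x ] cross y x ≡ m * n + n * m + n * m + (dbl * n + (a₁ + a₂) + a₃)
        f₁ f₂ f₃ f₄ f₅ f₆ f₇ : G → G → ℕ
        f₁ y x = ⟦ M y ⟧ * ⟦ inA (lab x) ⟧
        f₂ y x = ⟦ inA (lab y) ⟧ * ⟦ M x ⟧
        f₃ y x = ⟦ inA (lab y) ⟧ * ⟦ M (𝟐 ⊗ y ⊝ x) ⟧
        f₄ y x = ⟦ F y ⟧ * ⟦ (3 * R * ‖ 𝟐 ⊗ y ‖) ≤ᵈ p ⟧ * ⟦ A x ⟧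
        f₅ y x = ⟦ A y ⟧ * (⟦ F (𝟐 ⊗ y ⊝ x) ⟧ * ⟦ (3 * R * ‖ 𝟐 ⊗ y ⊝ x ⊝ 𝟐 ⊗ y ‖) ≤ᵈ p ⟧)
        f₆ y x = ⟦ A y ⟧ * (⟦ F x ⟧ * ⟦ (3 * R * ‖ x ⊝ 𝟐 ⊗ y ‖) ≤ᵈ p ⟧)
        f₇ y x = ⟦ A x ⟧ * (⟦ F (𝟐 ⊗ y ⊝ x) ⟧ * ⟦ (3 * R * ‖ 𝟐 ⊗ y ⊝ x ⊝ (⊖ x) ‖) ≤ᵈ p ⟧)
        s₅ : ∑[ y ] ∑[ x ] f₅ y x ≡ a₁
        s₅ = ∑-cong elems (λ y → trans (∑-*ˡ elems ⟦ A y ⟧ _) (cong (⟦ A y ⟧ *_) (∑-reflect (𝟐 ⊗ y) (λ z → ⟦ F z ⟧ * ⟦ (3 * R * ‖ z ⊝ 𝟐 ⊗ y ‖) ≤ᵈ p ⟧))))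
        s₆ : ∑[ y ] ∑[ x ] f₆ y x ≡ a₂
        s₆ = ∑-cong elems (λ y → ∑-*ˡ elems ⟦ A y ⟧ _)
        s₇ : ∑[ y ] ∑[ x ] f₇ y x ≡ a₃
        s₇ = trans (∑G-swap f₇) (∑-cong elems (λ x → trans (∑-*ˡ elems ⟦ A x ⟧ _) (cong (⟦ A x ⟧ *_) (∑-z two x (λ z → ⟦ F z ⟧ * ⟦ (3 * R * ‖ z ⊝ (⊖ x) ‖) ≤ᵈ p ⟧)))))
        infixl 6 _⊹_
        _⊹_ : (G → G → ℕ) → (G → G → ℕ) → G → G → ℕ
        (f ⊹ g) y x = f y x + g y x
        both-sums : ∀ {f g a b} → ∑[ y ] ∑[ x ] f y x ≡ a → ∑[ y ] ∑[ x ] g y x ≡ b → ∑[ y ] ∑[ x ] (f ⊹ g) y x ≡ a + b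
        both-sums {f} {g} e e' = trans (∑∑-+ f g) (cong₂ _+_ e e')
        expand = both-sums {f₁ ⊹ f₂ ⊹ f₃} {f₄ ⊹ (f₅ ⊹ f₆) ⊹ f₇}
          (both-sums {f₁ ⊹ f₂} {f₃} (both-sums {f₁} {f₂} (trans (∑-yx (λ y → ⟦ M y ⟧) (λ x → ⟦ inA (lab x) ⟧)) (cong (m *_) nA)) (trans (∑-yx (λ y → ⟦ inA (lab y) ⟧) (λ x → ⟦ M x ⟧)) (cong (_* m) nA)))
            (trans (∑-yz (λ y → ⟦ inA (lab y) ⟧) (λ z → ⟦ M z ⟧)) (cong (_* m) nA)))
          (both-sums {f₄ ⊹ (f₅ ⊹ f₆)} {f₇} (both-sums {f₄} {f₅ ⊹ f₆} (∑-yx (λ y → ⟦ F y ⟧ * ⟦ (3 * R * ‖ 𝟐 ⊗ y ‖) ≤ᵈ p ⟧) (λ x → ⟦ A x ⟧)) (both-sums {f₅} {f₆} s₅ s₆)) s₇)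

      T-split : T₃ A A A ≤ T₃ C C C + T₃ MF MF MF + (∑[ y ] ∑[ x ] cross y x)
      T-split = ≤-trans (∑∑-mono pointwise) (≤-reflexive (trans (∑∑-+ (λ y x → ⟦ C y ⟧ * (⟦ C x ⟧ * ⟦ C (𝟐 ⊗ y ⊝ x) ⟧) + ⟦ MF y ⟧ * (⟦ MF x ⟧ * ⟦ MF (𝟐 ⊗ y ⊝ x) ⟧)) cross) (cong (_+ (∑[ y ] ∑[ x ] cross y x)) (∑∑-+ (λ y x → ⟦ C y ⟧ * (⟦ C x ⟧ * ⟦ C (𝟐 ⊗ y ⊝ x) ⟧)) (λ y x → ⟦ MF y ⟧ * (⟦ MF x ⟧ * ⟦ MF (𝟐 ⊗ y ⊝ x) ⟧))))))

      c≥1 : 1 ≤ card C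
      c≥1 = *-cancelˡ-< 144 0 (card C) (≤-trans ne (≤-trans core-large (≤-reflexive (cong (144 *_) (sym card-C)))))

      mostly-core : 40 * card MF ≤ n
      mostly-core = go (card F) refl
        where
        open ≤-Reasoning
        M-small : 40 * card M ≤ n
        M-small = ≤-trans (*-monoˡ-≤ (card M) (≤-trans (≤ᵇ⇒≤ 40 80640 _) E≥)) (<⇒≤ M-light)
        go : ∀ f → card F ≡ f → 40 * card MF ≤ n
        go zero e = ≤-trans (≤-reflexive (cong (40 *_) (trans card-M+F (trans (cong (card M +_) e) (+-identityʳ (card M)))))) M-small
        go (suc f) e = merge-arithmetic {n} {card C} {card MF} {T₃ A A A} {T₃ C C C} {T₃ MF MF MF} {E * (∑[ y ] ∑[ x ] cross y x)} E E≥ E<n n-split T≥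
          (≤-trans (*-monoʳ-≤ E T-split) (≤-reflexive (*-distribˡ-+ E _ (∑[ y ] ∑[ x ] cross y x))))
          cross-bound
          (IH C (subst (card C <_) (sym n-split) (m<m+n (card C) mf≥1)))
          (IH MF (subst (card MF <_) (sym n-split) (m<n+m (card MF) c≥1)))
          (≤-trans core-large (≤-reflexive (cong (144 *_) (sym card-C))))
          where
          mf≥1 : 1 ≤ card MF
          mf≥1 = ≤-trans (s≤s z≤n) (≤-trans (≤-reflexive (sym e)) (≤-trans (m≤n+m (card F) (card M)) (≤-reflexive (sym card-M+F))))
          -- An arc centred at a far point contains that point, so a light arc with a far centre
          -- exists only if n > E.
          E<n : E < n
          E<n = point (∑-∃ {λ x → ⟦ F x ⟧} (≤-trans (s≤s z≤n) (≤-reflexive (sym e))))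
            where
            point : (∃ λ x → 1 ≤ ⟦ F x ⟧) → E < n
            point (x , h) = ≤-<-trans (≤-trans (≤-reflexive (sym (*-identityʳ E))) (*-monoʳ-≤ E (≤-trans self (∑-term (elems-all x) (λ y → ⟦ F y ⟧ * ⟦ (3 * R * ‖ y ⊝ x ‖) ≤ᵈ p ⟧))))) (arc-light x)
              where
              open G-Solver
              self : 1 ≤ ⟦ F x ⟧ * ⟦ (3 * R * ‖ x ⊝ x ‖) ≤ᵈ p ⟧
              self = both {F x} {(3 * R * ‖ x ⊝ x ‖) ≤ᵈ p} (one⁻ h) (≤ᵈ-intro (≤-trans (*-monoʳ-≤ (3 * R) (≤-trans (≤-reflexive (cong ‖_‖ (solve 1 (λ x → x :- x := con (pos 0)) refl x))) (norm-min (pos 0)))) (≤-trans (≤-reflexive (*-zeroʳ (3 * R))) z≤n)))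

    step : 40 * n ≤ 40 * core (6 * R) A + n ⊎ Progress
    step with n ≤? E * card M
    ... | yes h = inj₂ (progress-mid h)
    ... | no h₁ with n ≤? E * dbl
    ...   | yes h = inj₂ (progress-double h)
    ...   | no h₂ with any? (λ c → n ≤? E * arc c)
    ...     | yes (c , h) = inj₂ (progress-arc c h)
    ...     | no h₃ = inj₁ (begin
              40 * n  ≡⟨ cong (40 *_) n-split ⟩
              40 * (card C + card MF)  ≡⟨ *-distribˡ-+ 40 (card C) (card MF) ⟩
              40 * card C + 40 * card MF  ≤⟨ +-mono-≤ (≤-reflexive (cong (40 *_) card-C)) (Light.mostly-core (≰⇒> h₁) (≰⇒> h₂) (λ c → ≰⇒> (λ q → h₃ (c , q)))) ⟩
              40 * core (6 * R) A + n  ∎)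
      where open ≤-Reasoning

  core-anti : ∀ {q q'} A → q ≤ q' → core q' A ≤ core q A
  core-anti A h = ∑-mono elems (λ x → *-monoʳ-≤ ⟦ A x ⟧ (⟦⟧-mono (λ e → ≤ᵈ-intro (≤-trans (*-monoˡ-≤ ‖ x ‖ h) (≤ᵈ-elim e)))))

  core-ext : ∀ q {A B} → (∀ x → A x ≡ B x) → core q A ≡ core q B
  core-ext q h = ∑-cong elems (λ x → cong (λ b → ⟦ b ⟧ * ⟦ (q * ‖ x ‖) ≤ᵈ p ⟧) (h x))

  aff-id : ∀ A x → A x ≡ aff 𝟏 𝟎 A x
  aff-id A x = cong A (solve 1 (λ x → x := con (pos 1) :* x :+ con (pos 0)) refl x)
    where open G-Solver

  aff-aff : ∀ v b v' b' A x → aff v' b' (aff v b A) x ≡ aff (v ⊗ v') (v ⊗ b' ⊕ b) A x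
  aff-aff v b v' b' A x = cong A (solve 5 (λ v b v' b' x → v :* (v' :* x :+ b') :+ b := v :* v' :* x :+ (v :* b' :+ b)) refl v b v' b' x)
    where open G-Solver

  Unit-𝟏 : Unit 𝟏
  Unit-𝟏 = 𝟏 , solve 0 (con (pos 1) :* con (pos 1) := con (pos 1)) refl
    where open G-Solver

  module _ (n q E : ℕ) (n≥1 : 1 ≤ n) (q≥1 : 1 ≤ q) (E≥ : 80640 ≤ E) (two : Unit 𝟐) (IH : InductionHypothesis n) where

    -- f counts the rounds left. A gain of n/E preserves the inequality En ≤ E core + fn with f
    -- lowered by one, and at f = 0 all of A is in the core. At the start f = E holds for free.
    concentrate : ∀ f A → card A ≡ n → n * n ≤ 2 * T₃ A A A → n ≤ 144 * core (scale q f) A → E * n ≤ E * core (scale q f) A + f * n →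
                  2 * scale q f < p → ∃ λ v → ∃ λ b → Unit v × 40 * n ≤ 40 * core q (aff v b A) + n
    concentrate zero A eq T≥ big total Q<p = 𝟏 , 𝟎 , Unit-𝟏 , ≤-trans (*-monoʳ-≤ 40 (*-cancelˡ-≤ E {{>-nonZero (≤-trans (s≤s z≤n) E≥)}} (≤-trans total (≤-reflexive (trans (+-identityʳ _) (cong (E *_) (core-ext q (aff-id A)))))))) (m≤m+n _ n)
    concentrate (suc f) A refl T≥ big total Q<p = go step
      where
      Q' = scale q f
      Q'≥1 = ≤-trans q≥1 (scale-≥ q f q≥1)
      Q'<p = ≤-<-trans (*-monoʳ-≤ 2 (scale-step Q' Q'≥1)) Q<p
      open Step Q' E Q'≥1 two A E≥ IH T≥ big n≥1 Q'<p using (step; Progress; R)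
      go : 40 * n ≤ 40 * core (6 * R) A + n ⊎ Progress → ∃ λ v → ∃ λ b → Unit v × 40 * n ≤ 40 * core q (aff v b A) + n
      go (inj₁ h) = 𝟏 , 𝟎 , Unit-𝟏 , ≤-trans h (+-monoˡ-≤ n (*-monoʳ-≤ 40 (≤-trans (core-anti A (scale-≥ q (suc f) q≥1)) (≤-reflexive (core-ext q (aff-id A))))))
      go (inj₂ (v , uv , le)) = compose (concentrate f (aff v 𝟎 A) (card-aff uv 𝟎 A) (≤-trans T≥ (≤-reflexive (cong (2 *_) (sym (T₃-aff uv 𝟎 A)))))
          (≤-trans big (*-monoʳ-≤ 144 (*-cancelˡ-≤ E {{>-nonZero (≤-trans (s≤s z≤n) E≥)}} (≤-trans (m≤m+n _ n) le))))
          (≤-trans total (≤-trans (≤-reflexive (sym (+-assoc (E * core (6 * R) A) n (f * n)))) (+-monoˡ-≤ (f * n) le))) Q'<p)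
        where
        compose : (∃ λ v' → ∃ λ b' → Unit v' × 40 * n ≤ 40 * core q (aff v' b' (aff v 𝟎 A)) + n) → ∃ λ v → ∃ λ b → Unit v × 40 * n ≤ 40 * core q (aff v b A) + n
        compose (v' , b' , uv' , h) = v ⊗ v' , v ⊗ b' ⊕ 𝟎 , Unit-* uv uv' , ≤-trans h (≤-reflexive (cong (λ c → 40 * c + n) (core-ext q (aff-aff v 𝟎 v' b' A))))

  -- Dilating by 2 first makes the midpoint of two core points a core point again, so no far point is such a midpoint.
  module Endgame (two : Unit 𝟐) (A : BSet) (ne : 1 ≤ card A) (IH : InductionHypothesis (card A)) (T≥ : card A * card A ≤ 2 * T₃ A A A)
                 (concentrated : 40 * card A ≤ 40 * core 96 A + card A) where
    h : G
    h = proj₁ two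

    unit-h : Unit h
    unit-h = 𝟐 , trans (solve 1 (λ h → h :* con (pos 2) := con (pos 2) :* h) refl h) (proj₂ two)
      where open G-Solver

    -- The dilate 2A: x belongs to it when its half, `h ⊗ x`, belongs to `A`.
    A' : BSet
    A' = aff h 𝟎 A

    n = card A'

    n≡ : n ≡ card A
    n≡ = card-aff unit-h 𝟎 A

    hx : G → G
    hx x = h ⊗ x ⊕ 𝟎

    lab : G → Label
    lab x = label (A' x) ((96 * ‖ hx x ‖) ≤ᵈ p) ((16 * ‖ x ‖) ≤ᵈ p)

    C M F MF CM : BSet
    C = isC ∘ lab
    M = isM ∘ lab
    F = isF ∘ lab
    MF = isMF ∘ lab
    CM = isCM ∘ lab

    A-lab : ∀ x → ⟦ A' x ⟧ ≡ ⟦ inA (lab x) ⟧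
    A-lab x = cong ⟦_⟧ (sym (label-A (A' x) _ _))

    C-near : ∀ x → C x ≡ true → 96 * ‖ hx x ‖ ≤ p
    C-near x e = ≤ᵈ-elim (proj₂ (label-C {A' x} e))

    F-far : ∀ x → F x ≡ true → p < 16 * ‖ x ‖
    F-far x e = ≤ᵈ-false (proj₂ (label-F {A' x} e))

    card-C : card C ≡ core 96 A
    card-C = trans (∑-cong elems (λ x → label-C-count (A' x) _ _)) (∑-affine unit-h 𝟎 (λ x → ⟦ A x ⟧ * ⟦ (96 * ‖ x ‖) ≤ᵈ p ⟧))

    n-split : n ≡ card C + card MF
    n-split = trans (∑-cong elems (λ x → trans (A-lab x) (inA-split (lab x)))) (∑-+ elems _ _)

    n-split' : n ≡ card CM + card F
    n-split' = trans (∑-cong elems (λ x → trans (A-lab x) (inA-split' (lab x)))) (∑-+ elems _ _)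

    few : 40 * card MF ≤ n
    few = +-cancelˡ-≤ (40 * card C) _ _ (≤-trans (≤-reflexive (trans (sym (*-distribˡ-+ 40 (card C) (card MF))) (cong (40 *_) (trans (sym n-split) n≡)))) (≤-trans concentrated (≤-reflexive (cong₂ (λ c n → 40 * c + n) (sym card-C) (sym n≡)))))

    double : ∀ x → ‖ x ‖ ≤ 2 * ‖ hx x ‖
    double x = ≤-trans (≤-reflexive (cong ‖_‖ (trans (solve 1 (λ x → x := con (pos 1) :* x) refl x) (trans (cong (_⊗ x) (sym (proj₂ two))) (solve 2 (λ h x → con (pos 2) :* h :* x := con (pos 2) :* (h :* x :+ con (pos 0))) refl h x))))) (norm-* 2 (hx x))
      where open G-Solver

    -- After doubling, core points lie within p/48 of 0, so 2y - x stays within p/16. This is the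
    -- origin of 96 = 2 · 3 · 16.
    too-far : ∀ {x y z} → C x ≡ true → C y ≡ true → F z ≡ true → ‖ z ‖ ≤ 2 * ‖ y ‖ + ‖ x ‖ → ⊥
    too-far {x} {y} {z} ex ey ez le = <-irrefl refl (begin-strict
      3 * p  <⟨ *-monoʳ-< 3 (F-far z ez) ⟩
      3 * (16 * ‖ z ‖)  ≤⟨ *-monoʳ-≤ 3 (*-monoʳ-≤ 16 (≤-trans le (+-mono-≤ (*-monoʳ-≤ 2 (double y)) (double x)))) ⟩
      3 * (16 * (2 * (2 * ‖ hx y ‖) + 2 * ‖ hx x ‖))  ≡⟨ l (‖ hx y ‖) (‖ hx x ‖) ⟩
      2 * (96 * ‖ hx y ‖) + 96 * ‖ hx x ‖  ≤⟨ +-mono-≤ (*-monoʳ-≤ 2 (C-near y ey)) (C-near x ex) ⟩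
      2 * p + p  ≡⟨ l' p ⟩
      3 * p  ∎)
      where
      open ≤-Reasoning
      l : ∀ y x → 3 * (16 * (2 * (2 * y) + 2 * x)) ≡ 2 * (96 * y) + 96 * x
      l = solve-∀
      l' : ∀ p → 2 * p + p ≡ 3 * p
      l' = solve-∀

    -- y is the sum of the halves of x and z, and the core of `A'` was defined by the smallness of
    -- these halves.
    far-midpoint : ∀ {x y} → C x ≡ true → F y ≡ true → C (𝟐 ⊗ y ⊝ x) ≡ true → ⊥
    far-midpoint {x} {y} ex ey ez = <-irrefl refl (begin-strict
      2 * p  ≤⟨ *-monoˡ-≤ p {2} {6} (s≤s (s≤s z≤n)) ⟩
      6 * p  <⟨ *-monoʳ-< 6 (F-far y ey) ⟩
      6 * (16 * ‖ y ‖)  ≡⟨ sym (*-assoc 6 16 (‖ y ‖)) ⟩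
      96 * ‖ y ‖  ≤⟨ *-monoʳ-≤ 96 (≤-trans (≤-reflexive (cong ‖_‖ y≡)) (norm-+ (hx x) (hx z))) ⟩
      96 * (‖ hx x ‖ + ‖ hx z ‖)  ≡⟨ *-distribˡ-+ 96 (‖ hx x ‖) (‖ hx z ‖) ⟩
      96 * ‖ hx x ‖ + 96 * ‖ hx z ‖  ≤⟨ +-mono-≤ (C-near x ex) (C-near z ez) ⟩
      p + p  ≡⟨ cong (p +_) (sym (+-identityʳ p)) ⟩
      2 * p  ∎)
      where
      open ≤-Reasoning
      open G-Solver
      z = 𝟐 ⊗ y ⊝ x
      y≡ : y ≡ hx x ⊕ hx z
      y≡ = trans (solve 1 (λ x → x := con (pos 1) :* x) refl y) (trans (cong (_⊗ y) (sym (proj₂ two))) (solve 3 (λ h x y → con (pos 2) :* h :* y := h :* x :+ con (pos 0) :+ (h :* (con (pos 2) :* y :- x) :+ con (pos 0))) refl h x y))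

    f₁ f₂ f₃ f₄ f₅ f₆ cross : G → G → ℕ
    f₁ y x = ⟦ F y ⟧ * ⟦ MF x ⟧
    f₂ y x = ⟦ F y ⟧ * ⟦ MF (𝟐 ⊗ y ⊝ x) ⟧
    f₃ y x = ⟦ F x ⟧ * ⟦ MF (𝟐 ⊗ y ⊝ x) ⟧
    f₄ y x = ⟦ F x ⟧ * ⟦ M y ⟧
    f₅ y x = ⟦ F (𝟐 ⊗ y ⊝ x) ⟧ * ⟦ M y ⟧
    f₆ y x = ⟦ F (𝟐 ⊗ y ⊝ x) ⟧ * ⟦ M x ⟧
    cross y x = f₁ y x + f₂ y x + f₃ y x + f₄ y x + f₅ y x + f₆ y x

    tri : BSet → G → G → ℕ
    tri X y x = ⟦ X y ⟧ * (⟦ X x ⟧ * ⟦ X (𝟐 ⊗ y ⊝ x) ⟧)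

    pointwise : ∀ y x → tri A' y x ≤ tri CM y x + tri F y x + cross y x
    pointwise y x = begin
      tri A' y x  ≡⟨ cong₂ _*_ (A-lab y) (cong₂ _*_ (A-lab x) (A-lab z)) ⟩
      prod inA inA inA (lab x) (lab y) (lab z)  ≤⟨ split₂ (lab x) (lab y) (lab z) ⟩
      _  ≤⟨ +-monoˡ-≤ (cross y x) (+-monoʳ-≤ (tri CM y x + tri F y x) (+-mono-≤ (+-mono-≤ CCF FCC) CFC)) ⟩
      tri CM y x + tri F y x + 0 + cross y x  ≡⟨ cong (_+ cross y x) (+-identityʳ (tri CM y x + tri F y x)) ⟩
      tri CM y x + tri F y x + cross y x  ∎
      where
      open ≤-Reasoning
      open G-Solver
      z = 𝟐 ⊗ y ⊝ x
      CCF : prod isC isC isF (lab x) (lab y) (lab z) ≤ 0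
      CCF = guard₃ (C x) (C y) (F z) (λ ex ey ez → ⊥-elim (too-far ex ey ez (norm-2y-x y x)))
      FCC : prod isF isC isC (lab x) (lab y) (lab z) ≤ 0
      FCC = guard₃ (F x) (C y) (C z) (λ ex ey ez → ⊥-elim (too-far ez ey ex (≤-trans (≤-reflexive (cong ‖_‖ (solve 2 (λ x y → x := con (pos 2) :* y :- (con (pos 2) :* y :- x)) refl x y))) (norm-2y-x y z))))
      CFC : prod isC isF isC (lab x) (lab y) (lab z) ≤ 0
      CFC = guard₃ (C x) (F y) (C z) (λ ex ey ez → ⊥-elim (far-midpoint ex ey ez))

    T-split : T₃ A' A' A' ≤ T₃ CM CM CM + T₃ F F F + 6 * (card F * card MF)
    T-split = begin
      T₃ A' A' A'  ≤⟨ ∑∑-mono pointwise ⟩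
      ∑[ y ] ∑[ x ] (tri CM y x + tri F y x + cross y x)  ≡⟨ trans (∑∑-+ (λ y x → tri CM y x + tri F y x) cross) (cong (_+ (∑[ y ] ∑[ x ] cross y x)) (∑∑-+ (tri CM) (tri F))) ⟩
      T₃ CM CM CM + T₃ F F F + (∑[ y ] ∑[ x ] cross y x)  ≤⟨ +-monoʳ-≤ (T₃ CM CM CM + T₃ F F F) cross≤ ⟩
      T₃ CM CM CM + T₃ F F F + 6 * (card F * card MF)  ∎
      where
      open ≤-Reasoning
      w = card F * card MF
      M≤MF : card M ≤ card MF
      M≤MF = card-mono {M} {MF} (λ x → cases (lab x))
        where
        cases : ∀ l → isM l ≡ true → isMF l ≡ true
        cases (suc (suc zero)) _ = refl
      FM : card F * card M ≤ w
      FM = *-monoʳ-≤ (card F) M≤MF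
      plus : ∀ {f g : G → G → ℕ} {a b} → ∑[ y ] ∑[ x ] f y x ≤ a → ∑[ y ] ∑[ x ] g y x ≤ b → ∑[ y ] ∑[ x ] (f y x + g y x) ≤ a + b
      plus {f} {g} e e' = ≤-trans (≤-reflexive (∑∑-+ f g)) (+-mono-≤ e e')
      six : ∀ w → w + w + w + w + w + w ≡ 6 * w
      six = solve-∀
      χF χM χMF : G → ℕ
      χF x = ⟦ F x ⟧
      χM x = ⟦ M x ⟧
      χMF x = ⟦ MF x ⟧
      s₄ : ∑[ y ] ∑[ x ] f₄ y x ≤ w
      s₄ = ≤-trans (≤-reflexive (trans (∑G-swap f₄) (∑-yx χF χM))) FM
      s₅ : ∑[ y ] ∑[ x ] f₅ y x ≤ w
      s₅ = ≤-trans (≤-reflexive (trans (∑-cong elems (λ y → ∑-cong elems (λ x → *-comm ⟦ F (𝟐 ⊗ y ⊝ x) ⟧ ⟦ M y ⟧))) (trans (∑-yz χM χF) (*-comm (∑G χM) (∑G χF))))) FM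
      s₆ : ∑[ y ] ∑[ x ] f₆ y x ≤ w
      s₆ = ≤-trans (≤-reflexive (trans (∑-cong elems (λ y → ∑-cong elems (λ x → *-comm ⟦ F (𝟐 ⊗ y ⊝ x) ⟧ ⟦ M x ⟧))) (trans (∑-xz two χM χF) (*-comm (∑G χM) (∑G χF))))) FM
      cross≤ : ∑[ y ] ∑[ x ] cross y x ≤ 6 * w
      cross≤ = ≤-trans (plus (plus (plus (plus (plus (≤-reflexive (∑-yx χF χMF)) (≤-reflexive (∑-yz χF χMF))) (≤-reflexive (∑-xz two χF χMF))) s₄) s₅) s₆) (≤-reflexive (six w))

    n≥1 : 1 ≤ n
    n≥1 = subst (1 ≤_) (sym n≡) ne

    F≤MF : card F ≤ card MF
    F≤MF = card-mono {F} {MF} (λ x → cases (lab x))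
      where
      cases : ∀ l → isF l ≡ true → isMF l ≡ true
      cases (suc (suc (suc zero))) _ = refl

    no-far : card F ≡ 0
    no-far = go (card F) refl
      where
      go : ∀ f → card F ≡ f → f ≡ 0
      go zero e = refl
      go (suc f) e = ⊥-elim (1+n≢0 (trans (sym e) (endgame-arithmetic {n} {card CM} {card F} {card MF} {T₃ A' A' A'} {T₃ CM CM CM} {T₃ F F F} n-split' F≤MF few
        (≤-trans (≤-reflexive (cong₂ _*_ n≡ n≡)) (≤-trans T≥ (≤-reflexive (cong (2 *_) (sym (T₃-aff unit-h 𝟎 A)))))) T-split
        (IH CM (subst (card CM <_) (trans (sym n-split') n≡) (m<m+n (card CM) (subst (1 ≤_) (sym e) (s≤s z≤n)))))
        (IH F (subst (card F <_) n≡ (≤-<-trans F≤MF MF<n))))))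
        where
        MF<n : card MF < n
        MF<n = ≤-trans (≤-trans (s≤s (m≤n+m (card MF) 0)) big) few
          where
          big : suc (card MF) ≤ 40 * card MF
          big = ≤-trans (+-monoˡ-≤ (card MF) (≤-trans (subst (1 ≤_) (sym e) (s≤s z≤n)) F≤MF)) (≤-trans (≤-reflexive (cong (card MF +_) (sym (+-identityʳ _)))) (*-monoˡ-≤ (card MF) {2} {40} (s≤s (s≤s z≤n))))

    short : ∀ x → A' x ≡ true → 16 * ‖ x ‖ ≤ p
    short x ex = ≮⇒≥ (λ lt → <⇒≢ (≤-trans (one (far lt)) (∑-term (elems-all x) (λ y → ⟦ F y ⟧))) (sym no-far))
      where
      open ≤-Reasoning
      far : p < 16 * ‖ x ‖ → F x ≡ true
      far lt = cong₂ (λ (a b : Bool) → isF (label a b _)) ex core-no ∙ cong (λ b → isF (label true false b)) (≤ᵈ-no lt)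
        where
        infixr 5 _∙_
        _∙_ = trans
        core-no : (96 * ‖ hx x ‖) ≤ᵈ p ≡ false
        core-no = ≤ᵈ-no (begin-strict
          p  <⟨ lt ⟩
          16 * ‖ x ‖  ≤⟨ *-monoʳ-≤ 16 (double x) ⟩
          16 * (2 * ‖ hx x ‖)  ≡⟨ sym (*-assoc 16 2 (‖ hx x ‖)) ⟩
          32 * ‖ hx x ‖  ≤⟨ *-monoˡ-≤ (‖ hx x ‖) (≤ᵇ⇒≤ 32 96 _) ⟩
          96 * ‖ hx x ‖  ∎)

  rectification : ∀ C K E → 24576 ≤ C → 128 ≤ K → 80640 ≤ E → ∀ A → 1 ≤ card A → rectification-density C K E * card A ≤ p →
    InductionHypothesis (card A) → card A * card A ≤ 2 * T₃ A A A →
    ∃ λ v → ∃ λ b → Unit v × (∀ x → aff v b A x ≡ true → 16 * ‖ x ‖ ≤ p)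
  rectification C K E C≥ K≥ E≥ A ne dense IH T≥ = from-cluster (cluster C K Q C≥ K≥ K<p two A ne T≥ (≤-trans (*-monoˡ-≤ n (cluster-density-≤ C K E)) dense))
    where
    n = card A
    Q = scale 96 E
    2Q+K≤p : 2 * Q + K ≤ p
    2Q+K≤p = ≤-trans (scale-≤-density C K E) (≤-trans (m≤m*n (rectification-density C K E) n {{>-nonZero ne}}) dense)
    Q≥1 : 1 ≤ 2 * Q
    Q≥1 = *-mono-≤ {1} {2} (s≤s z≤n) (≤-trans (s≤s z≤n) (scale-≥ 96 E (s≤s z≤n)))
    K<p : K < p
    K<p = ≤-trans (+-monoˡ-≤ K Q≥1) 2Q+K≤p
    Q<p : 2 * Q < p
    Q<p = ≤-trans (≤-trans (≤-reflexive (+-comm 1 (2 * Q))) (+-monoʳ-≤ (2 * Q) (≤-trans (s≤s z≤n) K≥))) 2Q+K≤p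
    2<p : 2 < p
    2<p = ≤-<-trans (≤-trans (s≤s (s≤s z≤n)) K≥) K<p
    two : Unit 𝟐
    two = unit 𝟐 (λ e → 1+n≢0 (trans (sym (toℕ-ι-pos 2<p)) (trans (cong toℕ e) (toℕ-ι-pos (≤-<-trans z≤n 2<p)))))
    Goal : Set
    Goal = ∃ λ v → ∃ λ b → Unit v × (∀ x → aff v b A x ≡ true → 16 * ‖ x ‖ ≤ p)
    from-core : ∀ v b → Unit v → 40 * n ≤ 40 * core 96 (aff v b A) + n → Goal
    from-core v b uv conc = v ⊗ End.h , v ⊗ 𝟎 ⊕ b , Unit-* uv End.unit-h , λ x e → End.short x (trans (aff-aff v b End.h 𝟎 A x) e)
      where
      n≡ = card-aff uv b A
      module End = Endgame two (aff v b A) (subst (1 ≤_) (sym n≡) ne) (subst InductionHypothesis (sym n≡) IH)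
        (subst₂ (λ n t → n * n ≤ 2 * t) (sym n≡) (sym (T₃-aff uv b A)) T≥) (subst (λ n → 40 * n ≤ 40 * core 96 (aff v b A) + n) (sym n≡) conc)
    from-cluster : (∃ λ v → ∃ λ b → Unit v × n ≤ 144 * core Q (aff v b A)) → Goal
    from-cluster (v , b , uv , big) = finish (concentrate n 96 E ne (s≤s z≤n) E≥ two IH E (aff v b A) (card-aff uv b A)
        (≤-trans T≥ (≤-reflexive (cong (2 *_) (sym (T₃-aff uv b A))))) big (m≤n+m (E * n) (E * core Q (aff v b A))) Q<p)
      where
      finish : (∃ λ v' → ∃ λ b' → Unit v' × 40 * n ≤ 40 * core 96 (aff v' b' (aff v b A)) + n) → Goal
      finish (v' , b' , uv' , h) = from-core (v ⊗ v') (v ⊗ b' ⊕ b) (Unit-* uv uv') (≤-trans h (≤-reflexive (cong (λ c → 40 * c + n) (core-ext 96 (aff-aff v b v' b' A)))))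

  -- Transfer to the integers

  module Lift (χ : BSet) (Z : List ℤ) (Z! : Unique Z) (small : ∀ {z} → z ∈ Z → 16 * ⌊ z ⌋ ≤ p)
              (image : ∀ {x} → χ x ≡ true → ∃ λ z → z ∈ Z × x ≡ ι z) (preimage : ∀ {z} → z ∈ Z → χ (ι z) ≡ true) where
    open Line Z Z! using (mem; ∈-mem; mem-∈; mirror; T)

    private
      four-small : ∀ {a b c d} → a ∈ Z → b ∈ Z → c ∈ Z → d ∈ Z → 16 * (⌊ a ⌋ + ⌊ b ⌋ + ⌊ c ⌋ + ⌊ d ⌋) ≤ 4 * p
      four-small {a} {b} {c} {d} ma mb mc md = ≤-trans (≤-reflexive (l (⌊ a ⌋) (⌊ b ⌋) (⌊ c ⌋) (⌊ d ⌋))) (≤-trans (+-mono-≤ (+-mono-≤ (+-mono-≤ (small ma) (small mb)) (small mc)) (small md)) (≤-reflexive (l' p)))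
        where
        l : ∀ a b c d → 16 * (a + b + c + d) ≡ 16 * a + 16 * b + 16 * c + 16 * d
        l = solve-∀
        l' : ∀ p → p + p + p + p ≡ 4 * p
        l' = solve-∀

      p>0 : 0 < p
      p>0 = ≤-<-trans z≤n (toℕ<n 𝟎)

      below-p : ∀ {t} → 16 * t ≤ 4 * p → t < p
      below-p {t} h = *-cancelˡ-< 16 t p (≤-<-trans h (*-monoˡ-< p {{>-nonZero p>0}} (≤ᵇ⇒≤ 5 16 _)))

    ι-injective : ∀ {a b} → a ∈ Z → b ∈ Z → ι a ≡ ι b → a ≡ b
    ι-injective {a} {b} ma mb e = ι-small e (≤-<-trans (≤-trans (ℤP.∣i-j∣≤∣i∣+∣j∣ a b) (≤-trans (m≤m+n (⌊ a ⌋ + ⌊ b ⌋) (⌊ a ⌋)) (m≤m+n _ (⌊ a ⌋)))) (below-p (four-small ma mb ma ma)))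

    χ-∑ : ∀ x → ⟦ χ x ⟧ ≡ ∑ Z (λ z → ⟦ does (ι z ≟F x) ⟧)
    χ-∑ x with χ x in e
    ... | false = sym (trans (∑-cong-∈ Z (λ z mz → cong ⟦_⟧ (dec-false (ι z ≟F x) (λ eq → true≢false (trans (cong χ (sym eq)) (preimage mz)) e)))) (∑-zero Z))
    ... | true = let (z , mz , eq) = image {x} e in ≤-antisym
          (≤-trans (≤-reflexive (sym (cong ⟦_⟧ (⇒does (ι z ≟F x) (sym eq))))) (∑-term mz (λ z → ⟦ does (ι z ≟F x) ⟧)))
          (∑-at-most-one Z! (λ z → does (ι z ≟F x)) (λ {a} {b} ma mb ea eb → ι-injective ma mb (trans (does⇒ (ι a ≟F x) ea) (sym (does⇒ (ι b ≟F x) eb)))))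

    ∑-lift : ∀ (f : G → ℕ) → ∑[ x ] ⟦ χ x ⟧ * f x ≡ ∑ Z (λ z → f (ι z))
    ∑-lift f = begin
      ∑[ x ] ⟦ χ x ⟧ * f x  ≡⟨ ∑-cong elems (λ x → trans (cong (_* f x) (χ-∑ x)) (sym (∑-*ʳ Z (f x) _))) ⟩
      ∑[ x ] ∑ Z (λ z → ⟦ does (ι z ≟F x) ⟧ * f x)  ≡⟨ ∑-swap elems Z _ ⟩
      ∑ Z (λ z → ∑[ x ] ⟦ does (ι z ≟F x) ⟧ * f x)  ≡⟨ ∑-cong Z (λ z → ∑G-δ (ι z) f) ⟩
      ∑ Z (λ z → f (ι z))  ∎
      where open ≡-Reasoning

    card-lift : card χ ≡ length Z
    card-lift = trans (∑-cong elems (λ x → sym (*-identityʳ ⟦ χ x ⟧))) (trans (∑-lift (λ _ → 1)) (trans (∑-const Z 1) (*-identityʳ _)))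

    -- For x, y, z in `Z` the integer 2y - x - z has absolute value at most 4p/16, so p divides it
    -- only when it is 0: reduction respects progressions in both directions.
    T-lift : T₃ χ χ χ ≡ T
    T-lift = begin
      T₃ χ χ χ  ≡⟨ ∑-cong elems (λ y → ∑-*ˡ elems ⟦ χ y ⟧ _) ⟩
      ∑[ y ] ⟦ χ y ⟧ * (∑[ x ] ⟦ χ x ⟧ * ⟦ χ (𝟐 ⊗ y ⊝ x) ⟧)  ≡⟨ ∑-lift (λ y → ∑[ x ] ⟦ χ x ⟧ * ⟦ χ (𝟐 ⊗ y ⊝ x) ⟧) ⟩
      ∑ Z (λ y → ∑[ x ] ⟦ χ x ⟧ * ⟦ χ (𝟐 ⊗ ι y ⊝ x) ⟧)  ≡⟨ ∑-cong Z (λ y → ∑-lift (λ x → ⟦ χ (𝟐 ⊗ ι y ⊝ x) ⟧)) ⟩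
      ∑ Z (λ y → ∑ Z (λ x → ⟦ χ (𝟐 ⊗ ι y ⊝ ι x) ⟧))  ≡⟨ ∑-cong-∈ Z (λ y my → ∑-cong-∈ Z (λ x mx → cong ⟦_⟧ (agree my mx))) ⟩
      T  ∎
      where
      open ≡-Reasoning
      ι-mirror : ∀ y x → ι (mirror y x) ≡ 𝟐 ⊗ ι y ⊝ ι x
      ι-mirror y x = trans (ι-+ (pos 2 ℤ.* y) (ℤ.- x)) (cong₂ _⊕_ (ι-* (pos 2) y) (ι-neg x))
      agree : ∀ {y x} → y ∈ Z → x ∈ Z → χ (𝟐 ⊗ ι y ⊝ ι x) ≡ mem (mirror y x)
      agree {y} {x} my mx = iff (χ (𝟐 ⊗ ι y ⊝ ι x)) (mem (mirror y x)) refl refl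
        where
        iff : ∀ a b → χ (𝟐 ⊗ ι y ⊝ ι x) ≡ a → mem (mirror y x) ≡ b → χ (𝟐 ⊗ ι y ⊝ ι x) ≡ mem (mirror y x)
        iff true _ ea _ = trans ea (sym (∈-mem (near (image ea))))
          where
          near : (∃ λ z → z ∈ Z × 𝟐 ⊗ ι y ⊝ ι x ≡ ι z) → mirror y x ∈ Z
          near (z , mz , e) = subst (_∈ Z) (sym (ι-small (trans (ι-mirror y x) e) (≤-<-trans size (below-p (four-small my my mx mz))))) mz
            where
            lem : ∀ y → pos 2 ℤ.* y ≡ y ℤ.+ y
            lem = ℤR.solve-∀
            size : ⌊ mirror y x ℤ.- z ⌋ ≤ ⌊ y ⌋ + ⌊ y ⌋ + ⌊ x ⌋ + ⌊ z ⌋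
            size = ≤-trans (ℤP.∣i-j∣≤∣i∣+∣j∣ (mirror y x) z) (+-monoˡ-≤ (⌊ z ⌋) (≤-trans (ℤP.∣i-j∣≤∣i∣+∣j∣ (pos 2 ℤ.* y) x) (+-monoˡ-≤ (⌊ x ⌋) (≤-trans (≤-reflexive (cong ⌊_⌋ (lem y))) (ℤP.∣i+j∣≤∣i∣+∣j∣ y y)))))
        iff false true ea eb = ⊥-elim (true≢false (trans (cong χ (sym (ι-mirror y x))) (preimage (mem-∈ eb))) ea)
        iff false false ea eb = trans ea (sym eb)

  representative : G → ℤ
  representative x = proj₁ (norm-rep x)

  module Representatives (χ : BSet) (short : ∀ x → χ x ≡ true → 16 * ‖ x ‖ ≤ p) where
    Z : List ℤ
    Z = map representative (filter (λ x → χ x ≟B true) elems)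

    Z! : Unique Z
    Z! = map⁺! (λ {x} {y} e → trans (proj₁ (proj₂ (norm-rep x))) (trans (cong ι e) (sym (proj₁ (proj₂ (norm-rep y)))))) (filter⁺! (λ x → χ x ≟B true) elems-unique)

    member : ∀ {z} → z ∈ Z → ∃ λ x → χ x ≡ true × z ≡ representative x
    member m with ∈-map⁻ representative m
    ... | x , mx , e = x , proj₂ (∈-filter⁻ (λ x → χ x ≟B true) {xs = elems} mx) , e

    small : ∀ {z} → z ∈ Z → 16 * ⌊ z ⌋ ≤ p
    small m with member m
    ... | x , hx , refl = ≤-trans (≤-reflexive (cong (16 *_) (proj₂ (proj₂ (norm-rep x))))) (short x hx)

    image : ∀ {x} → χ x ≡ true → ∃ λ z → z ∈ Z × x ≡ ι z
    image {x} h = representative x , ∈-map⁺ representative (∈-filter⁺ (λ x → χ x ≟B true) (elems-all x) h) , proj₁ (proj₂ (norm-rep x))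

    preimage : ∀ {z} → z ∈ Z → χ (ι z) ≡ true
    preimage m with member m
    ... | x , hx , refl = trans (cong χ (sym (proj₁ (proj₂ (norm-rep x))))) hx

    open Lift χ Z Z! small image preimage public

  short-bound : ∀ χ → (∀ x → χ x ≡ true → 16 * ‖ x ‖ ≤ p) → 2 * T₃ χ χ χ ≤ card χ * card χ + 1
  short-bound χ short = ≤-trans (*-monoʳ-≤ 2 (≤-trans (≤-reflexive T-lift) (≤-trans (Line.T≤ Z Z!) (≤-reflexive (cong half-square (sym card-lift)))))) (half-square-≤ (card χ))
    where open Representatives χ short

  -- The upper bound modulo p by induction on the size

  module _ (C K E : ℕ) (C≥ : 24576 ≤ C) (K≥ : 128 ≤ K) (E≥ : 80640 ≤ E) where

    Bound : ℕ → Set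
    Bound n = ∀ χ → card χ ≡ n → rectification-density C K E * n ≤ p → 2 * T₃ χ χ χ ≤ n * n + 1

    -- Smaller sets satisfy the same density condition. If 2T < n² the claim is immediate; otherwise
    -- A can be moved into a short arc, where the bound for integers applies.
    upper-bound : ∀ n → Bound n
    upper-bound = <-rec Bound λ n → step n
      where
      step : ∀ n → (∀ {m} → m < n → Bound m) → Bound n
      step n rec χ refl dense = by-size n refl
        where
        n² : 2 * T₃ χ χ χ ≤ 2 * (n * n)
        n² = *-monoʳ-≤ 2 (≤-trans (∑∑-mono {λ y x → ⟦ χ y ⟧ * (⟦ χ x ⟧ * ⟦ χ (𝟐 ⊗ y ⊝ x) ⟧)} {λ y x → ⟦ χ y ⟧ * ⟦ χ x ⟧} (λ y x → *-monoʳ-≤ ⟦ χ y ⟧ (*⟦⟧≤ ⟦ χ x ⟧ (χ (𝟐 ⊗ y ⊝ x))))) (≤-reflexive (∑-yx (λ y → ⟦ χ y ⟧) (λ x → ⟦ χ x ⟧))))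
        by-size : ∀ k → n ≡ k → 2 * T₃ χ χ χ ≤ n * n + 1
        by-size zero e = ≤-trans n² (≤-trans (≤-reflexive (cong (λ k → 2 * (k * k)) e)) z≤n)
        by-size (suc k) e = decide (n * n ≤? 2 * T₃ χ χ χ)
          where
          bounded : (∃ λ v → ∃ λ b → Unit v × (∀ x → aff v b χ x ≡ true → 16 * ‖ x ‖ ≤ p)) → 2 * T₃ χ χ χ ≤ n * n + 1
          bounded (v , b , uv , short) = subst₂ (λ t n → 2 * t ≤ n * n + 1) (T₃-aff uv b χ) (card-aff uv b χ) (short-bound (aff v b χ) short)
          decide : Dec (n * n ≤ 2 * T₃ χ χ χ) → 2 * T₃ χ χ χ ≤ n * n + 1
          decide (no small-T) = ≤-trans (<⇒≤ (≰⇒> small-T)) (m≤m+n _ 1)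
          decide (yes T≥) = bounded (rectification C K E C≥ K≥ E≥ χ (subst (1 ≤_) (sym e) (s≤s z≤n)) dense (λ B lt → rec lt B refl (≤-trans (*-monoʳ-≤ (rectification-density C K E) (<⇒≤ lt)) dense)) T≥)

  -- Subsets of Z/N and the extremal sets

  indicatorOf : Subset p → BSet
  indicatorOf A x = Vec.lookup A x

  does-∈ : ∀ {n} (A : Subset n) x → does (x ∈S? A) ≡ Vec.lookup A x
  does-∈ (true Vec.∷ A) zero = refl
  does-∈ (false Vec.∷ A) zero = refl
  does-∈ (b Vec.∷ A) (suc x) = does-∈ A x

  ∑-allFin-suc : ∀ n (f : Fin (suc n) → ℕ) → ∑ (allFin (suc n)) f ≡ f zero + ∑ (allFin n) (λ i → f (suc i))
  ∑-allFin-suc n f = cong (f zero +_) (trans (cong (λ xs → ∑ xs f) (sym (map-tabulate id suc))) (∑-map suc (allFin n) f))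

  size : ∀ {n} (A : Subset n) → ∣ A ∣ ≡ ∑ (allFin n) (λ x → ⟦ Vec.lookup A x ⟧)
  size Vec.[] = refl
  size (true Vec.∷ A) = trans (cong suc (size A)) (sym (∑-allFin-suc _ (λ x → ⟦ Vec.lookup (true Vec.∷ A) x ⟧)))
  size (false Vec.∷ A) = trans (size A) (sym (∑-allFin-suc _ (λ x → ⟦ Vec.lookup (false Vec.∷ A) x ⟧)))

  card-indicator : ∀ A → card (indicatorOf A) ≡ ∣ A ∣
  card-indicator A = trans (cong (λ xs → ∑ xs (λ x → ⟦ Vec.lookup A x ⟧)) elems-allFin) (sym (size A))

  red-affine : ∀ x d k → red p (toℤ x ℤ.+ pos k ℤ.* toℤ d) ≡ x ⊕ ι (pos k) ⊗ d
  red-affine x d k = trans (sym (ι-red _)) (trans (ι-+ _ _) (cong₂ _⊕_ (ι-toℤ x) (trans (ι-* _ _) (cong (ι (pos k) ⊗_) (ι-toℤ d)))))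

  -- Substitute y = x + d, so that x + 2d becomes 2y - x.
  T3N≡T₃ : ∀ A → T3N p A ≡ T₃ (indicatorOf A) (indicatorOf A) (indicatorOf A)
  T3N≡T₃ A = begin
    T3N p A  ≡⟨ length-filter-∑ _ (cartesianProduct (allFin p) (allFin p)) ⟩
    ∑ (cartesianProduct (allFin p) (allFin p)) _  ≡⟨ ∑-cartesianProduct (allFin p) (allFin p) _ ⟩
    ∑ (allFin p) (λ x → ∑ (allFin p) (λ d → ⟦ does (x ∈S? A) ∧ (does (red p (toℤ x ℤ.+ toℤ d) ∈S? A) ∧ does (red p (toℤ x ℤ.+ pos 2 ℤ.* toℤ d) ∈S? A)) ⟧))
                                                                                   ≡⟨ cong (λ xs → ∑ xs (λ x → ∑ xs (λ d → ⟦ does (x ∈S? A) ∧ (does (red p (toℤ x ℤ.+ toℤ d) ∈S? A) ∧ does (red p (toℤ x ℤ.+ pos 2 ℤ.* toℤ d) ∈S? A)) ⟧))) (sym elems-allFin) ⟩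
    ∑[ x ] ∑[ d ] ⟦ does (x ∈S? A) ∧ (does (red p (toℤ x ℤ.+ toℤ d) ∈S? A) ∧ does (red p (toℤ x ℤ.+ pos 2 ℤ.* toℤ d) ∈S? A)) ⟧
                                                                                   ≡⟨ ∑-cong elems (λ x → ∑-cong elems (λ d → pt x d)) ⟩
    ∑[ x ] ∑[ d ] ⟦ χ x ⟧ * (⟦ χ (x ⊕ d) ⟧ * ⟦ χ (𝟐 ⊗ (x ⊕ d) ⊝ x) ⟧)  ≡⟨ ∑-cong elems (λ x → ∑-shiftˡ x (λ y → ⟦ χ x ⟧ * (⟦ χ y ⟧ * ⟦ χ (𝟐 ⊗ y ⊝ x) ⟧))) ⟩
    ∑[ x ] ∑[ y ] ⟦ χ x ⟧ * (⟦ χ y ⟧ * ⟦ χ (𝟐 ⊗ y ⊝ x) ⟧)  ≡⟨ ∑G-swap _ ⟩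
    ∑[ y ] ∑[ x ] ⟦ χ x ⟧ * (⟦ χ y ⟧ * ⟦ χ (𝟐 ⊗ y ⊝ x) ⟧)  ≡⟨ ∑-cong elems (λ y → ∑-cong elems (λ x → swap* ⟦ χ x ⟧ ⟦ χ y ⟧ ⟦ χ (𝟐 ⊗ y ⊝ x) ⟧)) ⟩
    T₃ χ χ χ  ∎
    where
    open ≡-Reasoning
    χ = indicatorOf A
    swap* : ∀ a b c → a * (b * c) ≡ b * (a * c)
    swap* = solve-∀
    first : ∀ x d → red p (toℤ x ℤ.+ toℤ d) ≡ x ⊕ d
    first x d = trans (sym (ι-red _)) (sym (⊕-ι x d))
    second : ∀ x d → red p (toℤ x ℤ.+ pos 2 ℤ.* toℤ d) ≡ 𝟐 ⊗ (x ⊕ d) ⊝ x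
    second x d = trans (red-affine x d 2) (solve 2 (λ x d → x :+ con (pos 2) :* d := con (pos 2) :* (x :+ d) :- x) refl x d)
      where open G-Solver
    pt : ∀ x d → ⟦ does (x ∈S? A) ∧ (does (red p (toℤ x ℤ.+ toℤ d) ∈S? A) ∧ does (red p (toℤ x ℤ.+ pos 2 ℤ.* toℤ d) ∈S? A)) ⟧ ≡ ⟦ χ x ⟧ * (⟦ χ (x ⊕ d) ⟧ * ⟦ χ (𝟐 ⊗ (x ⊕ d) ⊝ x) ⟧)
    pt x d = trans (cong ⟦_⟧ (cong₂ _∧_ (does-∈ A x) (cong₂ _∧_ (trans (does-∈ A _) (cong χ (first x d))) (trans (does-∈ A _) (cong χ (second x d))))))
      (trans (⟦∧⟧ (χ x) _) (cong (⟦ χ x ⟧ *_) (⟦∧⟧ (χ (x ⊕ d)) _)))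

  red-⊗ : ∀ a c x → red p (toℤ a ℤ.* x ℤ.+ toℤ c) ≡ a ⊗ ι x ⊕ c
  red-⊗ a c x = trans (sym (ι-red _)) (trans (ι-+ _ _) (cong₂ _⊕_ (trans (ι-* _ _) (cong (_⊗ ι x) (ι-toℤ a))) (ι-toℤ c)))

  Unit⇒IsUnit : ∀ {a} → Unit a → IsUnit p a
  Unit⇒IsUnit {a} (a' , e) = a' , trans (sym (ι-red _)) (trans (sym (⊗-ι a a')) (trans e (ι-red (pos 1))))

  module _ (two : Unit 𝟐) (A : Subset p) (v b : G) (uv : Unit v) (short : ∀ x → aff v b (indicatorOf A) x ≡ true → 16 * ‖ x ‖ ≤ p) where
    private
      χ' = aff v b (indicatorOf A)
    open Representatives χ' short
    open Classification Z Z! using (AffineImage)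

    -- The division by s in `AffineImage` is carried out modulo p, where 1 and 2 are invertible; the
    -- resulting slope is vh/s.
    transfer : ∀ {S} → AffineImage S → IsAffineImage p A S
    transfer {S} image' = a , Unit⇒IsUnit unit-a , c , λ u → mk⇔ (to u) (from u)
      where
      open AffineImage image'
      scale-unit : Unit (ι (pos s))
      scale-unit with s≡
      ... | inj₁ refl = Unit-𝟏
      ... | inj₂ refl = two
      σ = proj₁ scale-unit
      unit-σ : Unit σ
      unit-σ = ι (pos s) , trans (solve 2 (λ x y → x :* y := y :* x) refl σ (ι (pos s))) (proj₂ scale-unit)
        where open G-Solver
      unit-h : Unit (ι h)
      unit-h with scale-h
      ... | inj₁ refl = Unit-𝟏
      ... | inj₂ (z₁ , z₂ , m₁ , m₂ , ne , refl) = unit (ι (z₁ ℤ.- z₂)) (λ e → ne (ι-injective m₁ m₂ (begin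
          ι z₁  ≡⟨ cong ι (lem z₁ z₂) ⟩
          ι (z₁ ℤ.- z₂ ℤ.+ z₂)  ≡⟨ ι-+ (z₁ ℤ.- z₂) z₂ ⟩
          ι (z₁ ℤ.- z₂) ⊕ ι z₂  ≡⟨ cong (_⊕ ι z₂) e ⟩
          𝟎 ⊕ ι z₂  ≡⟨ solve 1 (λ x → con (pos 0) :+ x := x) refl (ι z₂) ⟩
          ι z₂  ∎)))
        where
        open ≡-Reasoning
        open G-Solver
        lem : ∀ a b → a ≡ a ℤ.- b ℤ.+ b
        lem = ℤR.solve-∀
      a c : G
      a = v ⊗ (σ ⊗ ι h)
      c = v ⊗ ι y ⊕ b
      unit-a : Unit a
      unit-a = Unit-* uv (Unit-* unit-σ unit-h)
      relation : ∀ {z x} → pos s ℤ.* z ≡ pos s ℤ.* y ℤ.+ h ℤ.* x → v ⊗ ι z ⊕ b ≡ a ⊗ ι x ⊕ c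
      relation {z} {x} e = begin
        v ⊗ ι z ⊕ b  ≡⟨ cong (λ w → v ⊗ w ⊕ b) (trans (solve 1 (λ z → z := con (pos 1) :* z) refl (ι z)) (cong (_⊗ ι z) (sym (proj₂ scale-unit)))) ⟩
        v ⊗ (ι (pos s) ⊗ σ ⊗ ι z) ⊕ b  ≡⟨ solve 5 (λ v s σ z b → v :* (s :* σ :* z) :+ b := v :* (σ :* (s :* z)) :+ b) refl v (ι (pos s)) σ (ι z) b ⟩
        v ⊗ (σ ⊗ (ι (pos s) ⊗ ι z)) ⊕ b  ≡⟨ cong (λ w → v ⊗ (σ ⊗ w) ⊕ b) (trans (sym (ι-* (pos s) z)) (trans (cong ι e) (trans (ι-+ _ _) (cong₂ _⊕_ (ι-* (pos s) y) (ι-* h x))))) ⟩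
        v ⊗ (σ ⊗ (ι (pos s) ⊗ ι y ⊕ ι h ⊗ ι x)) ⊕ b  ≡⟨ solve 7 (λ v σ s y h x b → v :* (σ :* (s :* y :+ h :* x)) :+ b := v :* (σ :* h) :* x :+ (v :* (s :* σ :* y) :+ b)) refl v σ (ι (pos s)) (ι y) (ι h) (ι x) b ⟩
        a ⊗ ι x ⊕ (v ⊗ (ι (pos s) ⊗ σ ⊗ ι y) ⊕ b)  ≡⟨ cong (λ w → a ⊗ ι x ⊕ (v ⊗ (w ⊗ ι y) ⊕ b)) (proj₂ scale-unit) ⟩
        a ⊗ ι x ⊕ (v ⊗ (𝟏 ⊗ ι y) ⊕ b)  ≡⟨ cong (λ w → a ⊗ ι x ⊕ (v ⊗ w ⊕ b)) (solve 1 (λ z → con (pos 1) :* z := z) refl (ι y)) ⟩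
        a ⊗ ι x ⊕ c  ∎
        where
        open ≡-Reasoning
        open G-Solver
      to : ∀ u → u FS.∈ A → Σ ℤ (λ x → S x × u ≡ red p (toℤ a ℤ.* x ℤ.+ toℤ c))
      to u u∈ = let (z , mz , w≡) = image {w} (trans (cong (Vec.lookup A) (sym u≡)) ([]=⇒lookup u∈))
                    (x , sx , e) = into mz
                in x , sx , trans u≡ (trans (cong (λ w → v ⊗ w ⊕ b) w≡) (trans (relation e) (sym (red-⊗ a c x))))
        where
        open G-Solver
        v' = proj₁ uv
        w = v' ⊗ (u ⊝ b)
        u≡ : u ≡ v ⊗ w ⊕ b
        u≡ = trans (solve 2 (λ u b → u := con (pos 1) :* (u :- b) :+ b) refl u b) (trans (cong (λ t → t ⊗ (u ⊝ b) ⊕ b) (sym (proj₂ uv))) (solve 4 (λ v v' u b → v :* v' :* (u :- b) :+ b := v :* (v' :* (u :- b)) :+ b) refl v v' u b))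
      from : ∀ u → Σ ℤ (λ x → S x × u ≡ red p (toℤ a ℤ.* x ℤ.+ toℤ c)) → u FS.∈ A
      from u (x , sx , u≡) = let (z , mz , e) = onto sx in
        lookup⇒[]= u A (trans (cong (Vec.lookup A) (trans u≡ (trans (red-⊗ a c x) (sym (relation e))))) (preimage mz))

    extremal-image : 1 ≤ length Z → half-square (length Z) ≤ Line.T Z Z! → AffineImageOfEF p A
    extremal-image ne ext = go (Extremizers.classified Z Z! ext ne)
      where
      go : Classification.Classified Z Z! → AffineImageOfEF p A
      go (k , m , inj₁ e) = k , m , inj₁ (transfer e)
      go (k , m , inj₂ f) = k , m , inj₂ (transfer f)

  module Conclusion (C K E : ℕ) (C≥ : 24576 ≤ C) (K≥ : 128 ≤ K) (E≥ : 80640 ≤ E) (n : ℕ) (n≥1 : 1 ≤ n)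
                    (dense : rectification-density C K E * n ≤ p) (16n≤p : 16 * n ≤ p) where

    2<p : 2 < p
    2<p = ≤-trans (≤ᵇ⇒≤ 3 16 _) (≤-trans (m≤m*n 16 n {{>-nonZero n≥1}}) 16n≤p)

    two : Unit 𝟐
    two = unit 𝟐 (λ e → 1+n≢0 (trans (sym (toℕ-ι-pos 2<p)) (trans (cong toℕ e) (toℕ-ι-pos (≤-<-trans z≤n 2<p)))))

    upper : ∀ (A : Subset p) → ∣ A ∣ ≡ n → T3N p A ≤ half-square n
    upper A e = ≤half-square n (T3N p A) (subst (λ t → 2 * t ≤ n * n + 1) (sym (T3N≡T₃ A)) (upper-bound C K E C≥ K≥ E≥ n (indicatorOf A) (trans (card-indicator A) e) dense))

    extremal : ∀ (A : Subset p) → ∣ A ∣ ≡ n → T3N p A ≡ half-square n → AffineImageOfEF p A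
    extremal A e T≡ = go (rectification C K E C≥ K≥ E≥ χ (subst (1 ≤_) (sym n≡) n≥1) (subst (λ n → rectification-density C K E * n ≤ p) (sym n≡) dense)
        (λ B lt → upper-bound C K E C≥ K≥ E≥ (card B) B refl (≤-trans (*-monoʳ-≤ (rectification-density C K E) (<⇒≤ (subst (card B <_) n≡ lt))) dense))
        (subst₂ (λ n t → n * n ≤ 2 * t) (sym n≡) (sym T₃≡) (half-square-≥ n)))
      where
      χ = indicatorOf A
      n≡ : card χ ≡ n
      n≡ = trans (card-indicator A) e
      T₃≡ : T₃ χ χ χ ≡ half-square n
      T₃≡ = trans (sym (T3N≡T₃ A)) T≡
      go : (∃ λ v → ∃ λ b → Unit v × (∀ x → aff v b χ x ≡ true → 16 * ‖ x ‖ ≤ p)) → AffineImageOfEF p A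
      go (v , b , uv , short) = extremal-image two A v b uv short (subst (1 ≤_) (sym Z≡) n≥1)
          (≤-reflexive (trans (cong half-square Z≡) (trans (sym T₃≡) (trans (sym (T₃-aff uv b χ)) T-lift))))
        where
        open Representatives (aff v b χ) short
        Z≡ : length Z ≡ n
        Z≡ = trans (sym card-lift) (trans (card-aff uv b χ) n≡)

    -- The residues 0, ..., n - 1: by 16n ≤ p they lie in a short arc, so their progressions are
    -- those of the interval over the integers.
    attained : Σ (Subset p) λ A → ∣ A ∣ ≡ n × T3N p A ≡ half-square n
    attained = A , trans (sym (card-indicator A)) (trans (∑-cong elems (λ x → cong ⟦_⟧ (ind x))) (initial-card n n≤p)) ,
        trans (T3N≡T₃ A) (trans (∑-cong elems (λ y → ∑-cong elems (λ x → cong₂ (λ a b → ⟦ a ⟧ * b) (ind y) (cong₂ (λ a b → ⟦ a ⟧ * ⟦ b ⟧) (ind x) (ind _))))) (trans T-lift (Interval.interval-T n)))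
      where
      A : Subset p
      A = Vec.tabulate (initial n)
      n≤p : n ≤ p
      n≤p = ≤-trans (m≤n*m n 16) 16n≤p
      ind : ∀ x → indicatorOf A x ≡ initial n x
      ind x = lookup∘tabulate (initial n) x
      small : ∀ {z} → z ∈ Interval.interval n → 16 * ⌊ z ⌋ ≤ p
      small m with ∈-map⁻ pos m
      ... | i , mi , refl = ≤-trans (*-monoʳ-≤ 16 (<⇒≤ (∈-downFrom⁻ mi))) 16n≤p
      image : ∀ {x} → initial n x ≡ true → ∃ λ z → z ∈ Interval.interval n × x ≡ ι z
      image {x} h = toℤ x , ∈-map⁺ pos (∈-downFrom⁺ (≤ᵈ-elim h)) , sym (ι-toℤ x)
      preimage : ∀ {z} → z ∈ Interval.interval n → initial n (ι z) ≡ true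
      preimage m with ∈-map⁻ pos m
      ... | i , mi , refl = ≤ᵈ-intro (subst (_< n) (sym (toℕ-ι-pos (<-≤-trans (∈-downFrom⁻ mi) n≤p))) (∈-downFrom⁻ mi))
      open Lift (initial n) (Interval.interval n) (Interval.interval! n) small image preimage

-- Sealed for the same reason as rectification-density.
opaque
  density : ℕ
  density = rectification-density 24576 128 80640 + 16

  density-suffices : ∀ n N .{{_ : NonZero N}} → Prime N → 1 ≤ n → density * n ≤ N →
    M3NIs N n (half-square n) × ((A : Subset N) → ∣ A ∣ ≡ n → T3N N A ≡ half-square n → AffineImageOfEF N A)
  density-suffices n N pr n≥1 dense = (attained , upper) , extremal
    where
    -- 24576 comes from `balog-szemeredi`, 128 from `budget`, 80640 from `merge-arithmetic`. The
    -- concentration argument treats them as variables with lower bounds, which keeps the tower of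
    -- constants unevaluated.
    open PrimeField.Conclusion N pr 24576 128 80640 ≤-refl ≤-refl ≤-refl n n≥1
      (≤-trans (*-monoˡ-≤ n (m≤m+n (rectification-density 24576 128 80640) 16)) dense)
      (≤-trans (*-monoˡ-≤ n (m≤n+m 16 (rectification-density 24576 128 80640))) dense)

theorem1p5 : Σ ℕ λ C → 1 ≤ C ×
    ((n N : ℕ) → .{{_ : NonZero N}} → Prime N → 1 ≤ n → C * n ≤ N →
    M3NIs N n ((n * n + 1) / 2) × M3ZIs n ((n * n + 1) / 2) ×
    ((A : Subset N) → ∣ A ∣ ≡ n → T3N N A ≡ (n * n + 1) / 2 → AffineImageOfEF N A))
-- The successor makes the constant visibly positive while `density` stays sealed; c is its
-- reciprocal.
theorem1p5 = suc density , s≤s z≤n , λ n N pr n≥1 dense →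
  let (maximum , extremal) = density-suffices n N pr n≥1 (≤-trans (m≤n+m (density * n) n) dense)
  in subst (λ v → M3NIs N n v × M3ZIs n v × ((A : Subset N) → ∣ A ∣ ≡ n → T3N N A ≡ v → AffineImageOfEF N A)) (sym (half-square-/ n)) (maximum , M3Z n , extremal)
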